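{- Let $s,t$ be coprime integers greater than $1$, let $\sigma$ be an $s$-core, $\tau$ a $t$-core, and $n\ge0$ an integer. Then the set of partitions of $n$ with $s$-core $\sigma$ and $t$-core $\tau$ contains exactly one self-conjugate partition if and only if $\sigma=\sigma'$, $\tau=\tau'$ and one of the following holds: (1) $\mathrm{cor}_t(\sigma)=\mathrm{cor}_s(\tau)$ and $n=|\sigma|+|\tau|-|\mathrm{cor}_t(\sigma)|$; (2) $t$ is odd, $\mathrm{cor}_t(\sigma)\rightharpoondown_{s,t}\mathrm{cor}_s(\tau)$, and $n=|\tau|+t(\mathrm{wei}_t(\sigma)+1)$; (3) $s$ is odd, $\mathrm{cor}_s(\tau)\rightharpoondown_{t,s}\mathrm{cor}_t(\sigma)$, and $n=|\sigma|+s(\mathrm{wei}_s(\tau)+1)$; (4) $s$ and $t$ are both odd, $\mathrm{cor}_t(\sigma)\leftrightharpoons_{s,t}\mathrm{cor}_s(\tau)$, and $n=|\mathrm{cor}_t(\sigma)\star\mathrm{cor}_s(\tau)|+s(\mathrm{wei}_s(\tau)+1)+t(\mathrm{wei}_t(\sigma)+1)$; (5) $s$ and $t$ are both odd, $\mathrm{cor}_t(\sigma)=\mathrm{cor}_s(\tau)=\kappa_{s,t}$, and $n=|\sigma|+|\tau|-|\kappa_{s,t}|+st$.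
   Context: Partitions, size $|\lambda|$; beta-set $\mathcal B(\lambda)=\{\lambda_r-r:r\ge1\}$. The conjugate $\lambda'$ is given by $\lambda'_r=|\{c:\lambda_c\ge r\}|$; $\lambda$ is self-conjugate if $\lambda'=\lambda$. A rim $s$-hook is a connected set of $s$ nodes of the rim of the Young diagram (nodes $(r,c)$ with $(r+1,c+1)$ not a node) whose removal leaves a partition's diagram; $\lambda$ is an $s$-core if it has no rim $s$-hook. The $s$-core $\mathrm{cor}_s(\lambda)$ is obtained by repeatedly removing rim $s$-hooks, and the $s$-weight $\mathrm{wei}_s(\lambda)$ is the number of hooks removed, so $|\lambda|=|\mathrm{cor}_s(\lambda)|+s\,\mathrm{wei}_s(\lambda)$. An $(s,t)$-core is both an $s$-core and a $t$-core; $\kappa_{s,t}$ denotes the unique $(s,t)$-core of largest size. For $b\in\mathbb Z$ write $\bar b=-1-b$. For partitions $\alpha,\beta$ and positive integers $p,q$, write $\alpha\rightharpoondown_{p,q}\beta$ if there is an integer $b\in\mathcal B(\beta)\setminus\mathcal B(\alpha)$ with $\bar b-b\equiv q\pmod{2p}$ and $\mathcal B(\alpha)=(\mathcal B(\beta)\setminus\{b\})\cup\{\bar b\}$. For partitions $\alpha,\beta$ write $\alpha\leftrightharpoons_{s,t}\beta$ if there are distinct integers $b,c\in\mathcal B(\beta)\setminus\mathcal B(\alpha)$ with $\bar b-b\equiv t\pmod{2s}$, $\bar c-c\equiv -s\pmod{2t}$ and $\mathcal B(\alpha)=(\mathcal B(\beta)\setminus\{b,c\})\cup\{\bar b,\bar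 c\}$; in that case $\alpha\star\beta$ denotes the partition with beta-set $(\mathcal B(\beta)\setminus\{c\})\cup\{\bar c\}$. -}

module Defs where

open import Data.Bool using (Bool; true; false; _∧_; T)
open import Data.Nat as ℕ using (ℕ; zero; suc; _≤_; _<_; _≤ᵇ_; _≤?_)
open import Data.Nat.Divisibility as ℕD using ()
open import Data.Integer as ℤ using (ℤ; +_; _-_)
open import Data.Integer.Divisibility as ℤD using ()
open import Data.List using (List; []; _∷_; length; filter)
open import Data.Nat.ListAction using (sum)
open import Data.Product using (Σ; Σ-syntax; _×_; _,_)
open import Data.Sum using (_⊎_)
open import Relation.Nullary using (¬_)
open import Relation.Binary.PropositionalEquality using (_≡_; _≢_)

isPartition : List ℕ → Bool
isPartition []           = true
isPartition (x ∷ [])     = 1 ≤ᵇ x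
isPartition (x ∷ y ∷ xs) = (y ≤ᵇ x) ∧ isPartition (y ∷ xs)

record Partition : Set where
  constructor mkPartition
  field
    parts : List ℕ
    valid : T (isPartition parts)
open Partition public

size : Partition → ℕ
size λ′ = sum (parts λ′)

-- λ_r for r ≥ 1 (1-indexed); 0 beyond the length (and 0 for r = 0, unused)
nthPart : List ℕ → ℕ → ℕ
nthPart []       _             = 0
nthPart (x ∷ xs) zero          = 0
nthPart (x ∷ xs) (suc zero)    = x
nthPart (x ∷ xs) (suc (suc r)) = nthPart xs (suc r)

part : Partition → ℕ → ℕ
part λ′ r = nthPart (parts λ′) r

conjPart : Partition → ℕ → ℕ
conjPart λ′ r = length (filter (λ x → r ≤? x) (parts λ′))

SelfConjugate : Partition → Set
SelfConjugate λ′ = ∀ r → 1 ≤ r → part λ′ r ≡ conjPart λ′ r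

_∈B_ : ℤ → Partition → Set
b ∈B λ′ = Σ[ r ∈ ℕ ] (1 ≤ r × b ≡ (+ part λ′ r) - (+ r))

bar : ℤ → ℤ
bar b = ℤ.-[1+ 0 ] - b

_≡_[mod_] : ℤ → ℤ → ℤ → Set
a ≡ b [mod m ] = m ℤD.∣ (a - b)

Node : Partition → ℕ → ℕ → Set
Node λ′ r c = 1 ≤ r × 1 ≤ c × c ≤ part λ′ r

Rim : Partition → ℕ → ℕ → Set
Rim λ′ r c = Node λ′ r c × ¬ Node λ′ (suc r) (suc c)

Adjacent : ℕ → ℕ → ℕ → ℕ → Set
Adjacent r c r′ c′ =
  (r ≡ r′ × (c′ ≡ suc c ⊎ c ≡ suc c′)) ⊎ (c ≡ c′ × (r′ ≡ suc r ⊎ r ≡ suc r′))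

data PathIn (D : ℕ → ℕ → Set) : ℕ → ℕ → ℕ → ℕ → Set where
  here : ∀ {r c} → PathIn D r c r c
  step : ∀ {r c r′ c′ r″ c″} → Adjacent r c r′ c′ → D r′ c′ →
         PathIn D r′ c′ r″ c″ → PathIn D r c r″ c″

Connected : (ℕ → ℕ → Set) → Set
Connected D = ∀ r c r′ c′ → D r c → D r′ c′ → PathIn D r c r′ c′

Skew : Partition → Partition → ℕ → ℕ → Set
Skew λ′ μ r c = Node λ′ r c × ¬ Node μ r c

RemovesRimHook : ℕ → Partition → Partition → Set
RemovesRimHook s λ′ μ =
  (∀ r c → Node μ r c → Node λ′ r c) ×
  size λ′ ≡ size μ ℕ.+ s ×
  (∀ r c → Skew λ′ μ r c → Rim λ′ r c) ×
  Connected (Skew λ′ μ)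

IsCore : ℕ → Partition → Set
IsCore s λ′ = ∀ μ → ¬ RemovesRimHook s λ′ μ

data Reduces (s : ℕ) : Partition → Partition → ℕ → Set where
  done : ∀ {λ′} → Reduces s λ′ λ′ 0
  next : ∀ {λ′ ν μ w} → RemovesRimHook s λ′ ν → Reduces s ν μ w →
         Reduces s λ′ μ (suc w)

CoreWeight : ℕ → Partition → Partition → ℕ → Set
CoreWeight s λ′ κ w = Reduces s λ′ κ w × IsCore s κ

HasCore : ℕ → Partition → Partition → Set
HasCore s λ′ κ = Σ[ w ∈ ℕ ] CoreWeight s λ′ κ w

IsKappa : ℕ → ℕ → Partition → Set
IsKappa s t κ = IsCore s κ × IsCore t κ ×
  (∀ μ → IsCore s μ → IsCore t μ → size μ ≤ size κ)

Harpoon : ℕ → ℕ → Partition → Partition → Set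
Harpoon p q α β = Σ[ b ∈ ℤ ]
  (b ∈B β × ¬ (b ∈B α) ×
   (bar b - b) ≡ + q [mod + (2 ℕ.* p) ] ×
   (∀ x → (x ∈B α → (x ∈B β × x ≢ b) ⊎ x ≡ bar b) ×
          ((x ∈B β × x ≢ b) ⊎ x ≡ bar b → x ∈B α)))

HarpoonsWith : ℕ → ℕ → Partition → Partition → ℤ → ℤ → Set
HarpoonsWith s t α β b c =
  b ≢ c × b ∈B β × ¬ (b ∈B α) × c ∈B β × ¬ (c ∈B α) ×
  (bar b - b) ≡ + t [mod + (2 ℕ.* s) ] ×
  (bar c - c) ≡ ℤ.- (+ s) [mod + (2 ℕ.* t) ] ×
  (∀ x → (x ∈B α → (x ∈B β × x ≢ b × x ≢ c) ⊎ (x ≡ bar b ⊎ x ≡ bar c)) ×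
         ((x ∈B β × x ≢ b × x ≢ c) ⊎ (x ≡ bar b ⊎ x ≡ bar c) → x ∈B α))

-- γ is the partition with beta-set (B(β) \ {c}) ∪ {c̄}
-- (so γ = α ⋆ β when α ⇌_{s,t} β is witnessed by b, c)
StarWith : Partition → ℤ → Partition → Set
StarWith β c γ =
  ∀ x → (x ∈B γ → (x ∈B β × x ≢ c) ⊎ x ≡ bar c) ×
        ((x ∈B β × x ≢ c) ⊎ x ≡ bar c → x ∈B γ)

Odd : ℕ → Set
Odd n = ¬ (2 ℕD.∣ n)

ExactlyOneSelfConjugate : ℕ → ℕ → Partition → Partition → ℕ → Set
ExactlyOneSelfConjugate s t σ τ n =
  Σ[ λ′ ∈ Partition ] (P λ′ × (∀ μ → P μ → μ ≡ λ′))
  where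
    P : Partition → Set
    P μ = size μ ≡ n × HasCore s μ σ × HasCore t μ τ × SelfConjugate μ

{-# OPTIONS --safe #-}
-- Work with Maya diagrams f : ℤ → Bool (indicators of beta-sets).  In the odd coordinate
-- w x = 2x + 1 conjugation is w ↦ - w, a self-conjugate diagram takes opposite values at x and x̄,
-- and its size is an energy E.  Two diagrams have the same s-core iff their difference is a
-- boundary V(· - s) - V, and then their energies differ by s ΣV, where V ≥ 0 over a core.
--
-- Exchanging residue classes modulo t in conjugate pairs preserves the s-core of every diagram
-- and makes τ an s-core as well, so σ and τ may be assumed to be (s,t)-cores.
--
-- If one of the five conditions holds, the solution is found by flipping (exchanging x and x̄)
-- at the points of odd coordinate - s, - t, - st.  When ΣV is odd, its symmetry forces a gap of
-- any solution in the self-conjugate class, and flipping there leads to an energy below that of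
-- a core unless the gap is the expected one.
--
-- Conversely, if f is the only solution, then no two beads p, q can be exchanged for two gaps
-- r, u with p + q = r + u and {p, q} ≡ {r, u} modulo s and modulo t, together with their
-- conjugates.  This forces f to be an (s,t)-core up to flips at ± s, ± t and ± st.
--
-- The largest (s,t)-core is recognised by its bead at st - s - t: by a sum-of-squares
-- computation with the column heights of an (s,t)-core, E falls short of the maximum by half of
-- a sum of terms D (s - D) with 0 ≤ D ≤ s.
module Submission where

-- A flip at x moves a bead between x and x̄, a distance w x, so the core modulo d is unchanged when
-- d divides w x. For odd d the innermost such points have odd coordinates ± d; for d = s, t, st
-- they give the cheapest self-conjugate changes that leave the s-core, the t-core or both alone. In
-- the other modulus such a flip acts like the flip of the top bead of a runner, and this is the
-- bead b of a harpoon.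
--
-- In a self-conjugate (s,t)-core no bead x has w x = i s + j t with i, j ≥ 0, as x̄ = x - w x would
-- then be a bead too. So st - s - t, the largest integer not of this form, bounds the beads.
--
-- The obstacle in the converse is that an exchange has to be made together with its conjugate and
-- breaks down when a bead of it is conjugate to a gap of it. A gap x below a bead x + s must be
-- compensated, as τ is an s-core, by a bead y below a gap y + s in the class of x modulo t; these
-- four points form an exchange. Only the blocked ones survive, and they sit at the few positions
-- named above.

module Proof where

  open import Defs using (bar; isPartition; Partition; mkPartition; parts; valid; size; nthPart; part; conjPart; SelfConjugate; _∈B_; _≡_[mod_]; Rim; Adjacent; PathIn; here; step; Connected; Skew; RemovesRimHook; IsCore; Reduces; done; next; CoreWeight; HasCore; IsKappa; Harpoon; HarpoonsWith; StarWith; Odd; ExactlyOneSelfConjugate)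
  open import Data.Bool using (Bool; true; false; not; if_then_else_; _∧_; _∨_; T)
  open import Data.Bool.Properties using (not-involutive; T-∧; T-irrelevant; ∨-zeroʳ)
  open import Data.Nat as ℕ using (ℕ; zero; suc; z≤n; s≤s)
  import Data.Nat.Properties as ℕP
  open import Data.Nat.Coprimality using (Coprime; coprime-Bézout)
  import Data.Nat.Divisibility as ℕD
  open import Data.Nat.GCD using (module Bézout)
  open import Data.Nat.ListAction using (sum)
  open import Data.Nat.Tactic.RingSolver using () renaming (solve-∀ to solveℕ-∀)
  open import Data.Integer using (ℤ; +_; -[1+_]; _+_; _*_; _-_; -_; 0ℤ; 1ℤ; -1ℤ; _≤_; _<_; +≤+; -≤+; +<+; ∣_∣)
  import Data.Integer.Properties as ℤP
  open import Data.Integer.Divisibility.Signed using (_∣_; divides; _∣?_; ∣m∣n⇒∣m+n; ∣m∣n⇒∣m-n; ∣m⇒∣-m; ∣m+n∣n⇒∣m; ∣n⇒∣m*n; ∣ᵤ⇒∣; ∣⇒∣ᵤ)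
  open import Data.Integer.DivMod using (_%ℕ_; _/ℕ_; n%ℕd<d; a≡a%ℕn+[a/ℕn]*n)
  open import Data.Integer.Tactic.RingSolver using (solve-∀)
  open import Data.List using (List; _∷_; []; length; filter)
  open import Data.List.Properties using (filter-accept; filter-reject)
  open import Data.Product using (Σ-syntax; _×_; _,_; proj₁; proj₂)
  open import Data.Sum using (_⊎_; inj₁; inj₂; [_,_]′)
  open import Data.Empty using (⊥; ⊥-elim)
  open import Data.Unit using (tt)
  open import Function using (_∘_)
  open import Function.Bundles using (Equivalence)
  open import Relation.Nullary using (¬_; Dec; yes; no; does)
  open import Relation.Binary using (tri<; tri≈; tri>)
  open import Relation.Binary.PropositionalEquality using (_≡_; _≢_; refl; sym; trans; cong; cong₂; subst)

  -- Ring identities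

  ring1 : ∀ a b c d e f → a + b + (c + d + (e + f)) ≡ a + (c + e) + (b + (d + f))
  ring1 = solve-∀
  ring2 : ∀ c a d e → c * a + (c * d + c * e) ≡ c * (a + (d + e))
  ring2 = solve-∀
  ring3 : ∀ a b → a - b ≡ a + -1ℤ * b
  ring3 = solve-∀
  ring4 : ∀ a b c d e → a + (c + d) + (b + e) ≡ a + (b + c) + (d + e)
  ring4 = solve-∀
  ring5 : ∀ x n → x - (1ℤ + n) ≡ x - 1ℤ - n
  ring5 = solve-∀
  ring6 : ∀ x d → x - d - (- d) ≡ x
  ring6 = solve-∀
  ring7 : ∀ a b c → a + c ≡ a + (b + c) - b
  ring7 = solve-∀
  ring8 : ∀ a b c → a + b ≡ a + (b + c) - c
  ring8 = solve-∀
  ring9 : ∀ a b → a - b + - a ≡ 0ℤ - b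
  ring9 = solve-∀
  ring10 : ∀ x → -[1+ 0 ] - (-[1+ 0 ] - x) ≡ x
  ring10 = solve-∀
  ring11 : ∀ x d → -[1+ 0 ] - (x + d) ≡ -[1+ 0 ] - x - d
  ring11 = solve-∀
  ring12 : ∀ x d → -[1+ 0 ] - (x - d) ≡ -[1+ 0 ] - x + d
  ring12 = solve-∀
  ring13 : ∀ x → -[1+ 0 ] - x + (-[1+ 0 ] - x) + 1ℤ ≡ - (x + x + 1ℤ)
  ring13 = solve-∀
  ring14 : ∀ x d → x + d + (x + d) + 1ℤ ≡ x + x + 1ℤ + (d + d)
  ring14 = solve-∀
  ring15 : ∀ x → -[1+ 0 ] - x ≡ x - (x + x + 1ℤ)
  ring15 = solve-∀
  ring16 : ∀ x → (+ 2) * x ≡ x + x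
  ring16 = solve-∀
  ring17 : ∀ x → x + x ≡ x + x + 1ℤ - 1ℤ
  ring17 = solve-∀
  ring18 : ∀ x y → (y - x) + (y - x) + 1ℤ ≡ y + y + 1ℤ - (x + x)
  ring18 = solve-∀
  ring19 : ∀ x a b c → x * (a - c) - x * (b - c) ≡ x * (a - b)
  ring19 = solve-∀
  ring20 : ∀ a b c → a - c - (b - c) ≡ a - b
  ring20 = solve-∀
  ring21 : ∀ a b c e → a - b + (c - e) ≡ a + c - (b + e)
  ring21 = solve-∀
  ring22 : ∀ c a b → c * (a - b) ≡ c * a - c * b
  ring22 = solve-∀
  ring23 : ∀ x d → x + d - d ≡ x
  ring23 = solve-∀
  ring24 : ∀ x d → x + 0ℤ * d ≡ x
  ring24 = solve-∀
  ring25 : ∀ x d k → x + (1ℤ + k) * d ≡ x + k * d + d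
  ring25 = solve-∀
  ring26 : ∀ a b → a - b ≡ -1ℤ * (b - a)
  ring26 = solve-∀
  ring27 : ∀ x k d → x ≡ x + (- k) * d + k * d
  ring27 = solve-∀
  ring28 : ∀ a b → b - a ≡ -1ℤ * (a - b)
  ring28 = solve-∀
  ring29 : ∀ a b c → a - c ≡ a - b + (b - c)
  ring29 = solve-∀
  ring30 : ∀ x d a b → x * (a - b) ≡ (x - d) * a + d * a - x * b
  ring30 = solve-∀
  ring31 : ∀ N a y e → (a + y) + (N + a) * e ≡ y + (N + a) * (1ℤ + e) - N
  ring31 = solve-∀
  ring32 : ∀ y k d → y - k * d ≡ -[1+ 0 ] - (-[1+ 0 ] - y + k * d)
  ring32 = solve-∀
  ring33 : ∀ x i k d → x + (i - k) * d ≡ x - k * d + i * d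
  ring33 = solve-∀
  ring34 : ∀ y k d → y - (1ℤ + k) * d ≡ y - k * d - d
  ring34 = solve-∀
  ring35 : ∀ y k d → y ≡ y - k * d + k * d
  ring35 = solve-∀
  ring36 : ∀ x → 1ℤ - x ≡ - (x - 1ℤ)
  ring36 = solve-∀
  ring37 : ∀ a → 0ℤ - a ≡ - a
  ring37 = solve-∀
  ring38 : ∀ a → -1ℤ * a ≡ - a
  ring38 = solve-∀
  ring39 : ∀ a b c → a - (b - c) ≡ a - b + c
  ring39 = solve-∀
  ring40 : ∀ a x → a * (-[1+ 0 ] - x - x) + a * (x + x + 1ℤ) ≡ 0ℤ
  ring40 = solve-∀
  ring41 : ∀ x a b c → x * (a * (b - c)) ≡ a * (x * b - x * c)
  ring41 = solve-∀
  ring42 : ∀ a b → a - -1ℤ * b ≡ a + b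
  ring42 = solve-∀
  ring43 : ∀ f g a X X′ Y Y′ → f - g + (a * (X′ - X) - a * (Y′ - Y)) ≡ f - g + a * ((Y - X) - (Y′ - X′))
  ring43 = solve-∀
  ring44 : ∀ x d → d ≡ x + d - x
  ring44 = solve-∀
  ring45 : ∀ b → b + b + 1ℤ ≡ b - (-[1+ 0 ] - b)
  ring45 = solve-∀
  ring46 : ∀ b d → b - (b + d) ≡ -1ℤ * d
  ring46 = solve-∀
  ring47 : ∀ b d → -[1+ 0 ] - b - d ≡ -[1+ 0 ] - (b + d)
  ring47 = solve-∀
  ring48 : ∀ a b c d → a + b - d ≡ a + (b - c) + (c - d)
  ring48 = solve-∀
  ring49 : ∀ y a b c → y * (a + b - c) ≡ y * a + ((y - -1ℤ) * b - b) - y * c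
  ring49 = solve-∀
  ring50 : ∀ x s → (x - 1ℤ) + (s - 0ℤ) - -1ℤ ≡ x + s
  ring50 = solve-∀
  ring51 : ∀ n a k → n - a + (a - k) ≡ n - k
  ring51 = solve-∀
  ring52 : ∀ n a k → n - a + (a + k) ≡ -1ℤ - (- (1ℤ + n) - k)
  ring52 = solve-∀
  ring53 : ∀ a n → a + n + 1ℤ ≡ a + (1ℤ + n)
  ring53 = solve-∀
  ring54 : ∀ z p c → z - (p + 1ℤ) + (1ℤ + c) ≡ z - p + c
  ring54 = solve-∀
  ring55 : ∀ p → -1ℤ + (p + 1ℤ) ≡ p
  ring55 = solve-∀
  ring56 : ∀ z p c → z - (p + 1ℤ) + c + 1ℤ ≡ z - p + c
  ring56 = solve-∀
  ring57 : ∀ z p c → z - p ≡ z - (p + 1ℤ) + c - (c - 1ℤ)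
  ring57 = solve-∀
  ring58 : ∀ z c → z - (z + 1ℤ) + c ≡ c - 1ℤ
  ring58 = solve-∀
  ring59 : ∀ z p → z - p ≡ z - p + 0ℤ
  ring59 = solve-∀
  ring60 : ∀ a n → - a + n + 1ℤ ≡ - a + (1ℤ + n)
  ring60 = solve-∀
  ring61 : ∀ n → - n + (n + n) ≡ n
  ring61 = solve-∀
  ring62 : ∀ a r → a - (1ℤ + r) + 1ℤ ≡ a - r
  ring62 = solve-∀
  ring63 : ∀ a r → a - r - 1ℤ ≡ a - (1ℤ + r)
  ring63 = solve-∀
  ring64 : ∀ j c x → (x - (1ℤ + j)) + c + (j - (1ℤ + c) - (x - 1ℤ)) ≡ -1ℤ
  ring64 = solve-∀
  ring65 : ∀ a r → -[1+ 0 ] - (a - (1ℤ + r)) ≡ r - a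
  ring65 = solve-∀
  ring66 : ∀ a j → -[1+ 0 ] - (j - a) ≡ a - (1ℤ + j)
  ring66 = solve-∀
  ring67 : ∀ a r → a - (1ℤ + r) ≡ -[1+ 0 ] - (r - a)
  ring67 = solve-∀
  ring68 : ∀ p q s → p - (q + s) ≡ p - q - s
  ring68 = solve-∀
  ring69 : ∀ m s → m + s - m - s ≡ 0ℤ
  ring69 = solve-∀
  ring70 : ∀ a b r → a - b ≡ a - r - (b - r)
  ring70 = solve-∀
  ring71 : ∀ x r → (1ℤ + x) - (1ℤ + r) ≡ x - r
  ring71 = solve-∀
  ring72 : ∀ x a → a * (x + x + 1ℤ) - x * (a + a) ≡ a
  ring72 = solve-∀
  ring73 : ∀ z e d → z - e - d ≡ z - d - e
  ring73 = solve-∀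
  ring74 : ∀ z k d → z - (1ℤ + k) * d ≡ z - d - k * d
  ring74 = solve-∀
  ring75 : ∀ a b c → a - c ≡ (a - b) + (b - c)
  ring75 = solve-∀
  ring76 : ∀ z c δ → z - c - (z - (c + δ)) ≡ δ
  ring76 = solve-∀
  ring77 : ∀ z c δ → z - c ≡ z + δ - (c + δ)
  ring77 = solve-∀
  ring78 : ∀ z c δ → z - (c + δ) ≡ z - δ - c
  ring78 = solve-∀
  ring79 : ∀ z a t → z - a + t ≡ z + t - a
  ring79 = solve-∀
  ring80 : ∀ z a t → z + t - a - t ≡ z - a
  ring80 = solve-∀
  ring81 : ∀ z t δ → z + t - δ ≡ z - δ + t
  ring81 = solve-∀
  ring82 : ∀ z c δ → z - δ - c ≡ z - (c + δ)
  ring82 = solve-∀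
  ring83 : ∀ a b X → a - b ≡ 0ℤ * X - 1ℤ * (b - a)
  ring83 = solve-∀
  ring84 : ∀ a b X → a - b ≡ 1ℤ * (a - b) - 0ℤ * X
  ring84 = solve-∀
  ring85 : ∀ a X Y → a - a ≡ 0ℤ * X - 0ℤ * Y
  ring85 = solve-∀
  ring86 : ∀ z δ → z + δ ≡ z - (- δ)
  ring86 = solve-∀
  ring87 : ∀ a b → a - b ≡ - (b - a)
  ring87 = solve-∀
  ring88 : ∀ a b → - (a * b) ≡ a * (- b)
  ring88 = solve-∀
  ring89 : ∀ d a → d * (- a - 1ℤ) + (d - 1ℤ) ≡ d * (- a) - 1ℤ
  ring89 = solve-∀
  ring90 : ∀ z c δ → - (z - c) - (c + c + 1ℤ + δ) ≡ -[1+ 0 ] - z - (c + δ)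
  ring90 = solve-∀
  ring91 : ∀ z c δ → - (z - (c + δ)) - (c + c + 1ℤ + δ) ≡ -[1+ 0 ] - z - c
  ring91 = solve-∀
  ring92 : ∀ z c δ → - (-[1+ 0 ] - z - (c + δ)) - (c + c + 1ℤ + δ) ≡ z - c
  ring92 = solve-∀
  ring93 : ∀ z c δ → - (-[1+ 0 ] - z - c) - (c + c + 1ℤ + δ) ≡ z - (c + δ)
  ring93 = solve-∀
  ring94 : ∀ n a b → n - a + b ≡ n - (a - b)
  ring94 = solve-∀
  ring95 : ∀ n a b → n - (a - b) - (b - a) ≡ n
  ring95 = solve-∀
  ring96 : ∀ z x δ → x + δ ≡ z + δ - (z - x)
  ring96 = solve-∀
  ring97 : ∀ z k t → z - (- k) * t ≡ z + k * t
  ring97 = solve-∀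
  ring98 : ∀ x s → x + x + 1ℤ ≡ (x - s) + (x - s) + 1ℤ + (s + s)
  ring98 = solve-∀
  ring99 : ∀ x s → x - s + (s + s) ≡ x + s
  ring99 = solve-∀
  ring100 : ∀ x s w → x - s ≡ x - w - s + w
  ring100 = solve-∀
  ring101 : ∀ a b c → a - b - 1ℤ + (b - c) ≡ a - c - 1ℤ
  ring101 = solve-∀
  ring102 : ∀ x s → -[1+ 0 ] - (x + s) + s ≡ -[1+ 0 ] - x
  ring102 = solve-∀
  ring103 : ∀ z x s → z - (-[1+ 0 ] - (x + s)) - (z - x) ≡ x + x + 1ℤ + s
  ring103 = solve-∀
  ring104 : ∀ z x s → z - (-[1+ 0 ] - (x + s) + s) - (z - x) ≡ x + x + 1ℤ
  ring104 = solve-∀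
  ring105 : ∀ z x s → z - (-[1+ 0 ] - (x + s)) - (z - (x + s)) ≡ x + x + 1ℤ + (s + s)
  ring105 = solve-∀
  ring106 : ∀ z x s → z - (-[1+ 0 ] - (x + s) + s) - (z - (x + s)) ≡ x + x + 1ℤ + s
  ring106 = solve-∀
  ring107 : ∀ z x s → - (z - x) ≡ -[1+ 0 ] - z - (-[1+ 0 ] - (x + s) + s)
  ring107 = solve-∀
  ring108 : ∀ z x s → - (z - (x + s)) ≡ -[1+ 0 ] - z - (-[1+ 0 ] - (x + s))
  ring108 = solve-∀
  ring109 : ∀ z x s → - (-[1+ 0 ] - z - (-[1+ 0 ] - (x + s) + s)) ≡ z - x
  ring109 = solve-∀
  ring110 : ∀ z x s → - (-[1+ 0 ] - z - (-[1+ 0 ] - (x + s))) ≡ z - (x + s)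
  ring110 = solve-∀
  ring111 : ∀ n a → n ≡ n - (a - a)
  ring111 = solve-∀
  ring112 : ∀ m a b → (1ℤ + m - a) + (a - b - 1ℤ) ≡ m - b
  ring112 = solve-∀
  ring113 : ∀ n a b c → n - (a - b) - (b - c) ≡ n - (a - c)
  ring113 = solve-∀
  ring114 : ∀ a b → (0ℤ - a) + (a - b - 1ℤ) + b ≡ -1ℤ
  ring114 = solve-∀
  ring115 : ∀ a y → a + 0ℤ + (y + y) ≡ a + (y + y)
  ring115 = solve-∀
  ring116 : ∀ a → 0ℤ ≡ a + a + (- a + - a)
  ring116 = solve-∀
  ring117 : ∀ a b c y → a + b + (y + y) + (b + c) ≡ a + c + (y + b + (y + b))
  ring117 = solve-∀
  ring118 : ∀ a b x y → y - a - (x - b) ≡ - ((x - y) + (a - b))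
  ring118 = solve-∀
  ring119 : ∀ F → - (- F + F) ≡ 0ℤ
  ring119 = solve-∀
  ring120 : ∀ c n d → - (1ℤ + n) - (- c) - (-[1+ 0 ] - (1ℤ + n + c + d)) ≡ c + c + 1ℤ + d
  ring120 = solve-∀
  ring121 : ∀ x d → x - d + (x - d) + 1ℤ ≡ x + x + 1ℤ - (d + d)
  ring121 = solve-∀
  ring122 : ∀ k d → (k + k) * d ≡ k * d + k * d
  ring122 = solve-∀
  ring123 : ∀ a t → a + t - a ≡ t * 1ℤ
  ring123 = solve-∀
  ring124 : ∀ j t → - t - (j * t + j * t) ≡ (-1ℤ - (j + j)) * t
  ring124 = solve-∀
  ring125 : ∀ a t u → a + t + (- t - (u + u)) ≡ a - (u + u)
  ring125 = solve-∀
  ring126 : ∀ a u → a - u - a ≡ - u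
  ring126 = solve-∀
  ring127 : ∀ u → u + - (u + u) ≡ - u
  ring127 = solve-∀
  ring128 : ∀ k t → k * t + k * t ≡ (k + k) * t
  ring128 = solve-∀
  ring129 : ∀ z k k′ t → z + k * t + k′ * t ≡ z + (k + k′) * t
  ring129 = solve-∀
  ring130 : ∀ z n t → z + - (1ℤ + n) * t + (z + - (1ℤ + n) * t) + 1ℤ ≡ z + z + 1ℤ - (1ℤ + n + (1ℤ + n)) * t
  ring130 = solve-∀
  ring131 : ∀ a b z n t → a - (b - (z - (1ℤ + n + (1ℤ + n)) * t)) + (n + n) * t ≡ a - b + z - (t + t)
  ring131 = solve-∀
  ring132 : ∀ x s t m → x + s - (-[1+ 0 ] - x + m * t) ≡ (x + x + 1ℤ - (s * t - s - t)) + ((s - 1ℤ - m) * t)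
  ring132 = solve-∀
  ring133 : ∀ n → 1ℤ + n - 1ℤ - n ≡ 0ℤ
  ring133 = solve-∀
  ring134 : ∀ s t h → - s + (h * t + h * t) - (s * t - s - t) ≡ t * (h + h + 1ℤ - s)
  ring134 = solve-∀
  ring135 : ∀ s t l h → - t + (l + l) * s - (s * t - s - t + (l - h + (l - h)) * s) ≡ s * (h + h + 1ℤ - t)
  ring135 = solve-∀
  ring136 : ∀ c h k t → c + k * t ≡ c + h * t + (k - h) * t
  ring136 = solve-∀
  ring137 : ∀ s t l q → t - ((l + l) - q) * s ≡ q * s - (- t + (l + l) * s)
  ring137 = solve-∀
  ring138 : ∀ b s → b + b + 1ℤ - -1ℤ * s ≡ b + s - (-[1+ 0 ] - b)
  ring138 = solve-∀
  ring139 : ∀ k h → (- (k - h) - 1ℤ) + (- (k - h) - 1ℤ) + 1ℤ ≡ (h + h + 1ℤ) - (k + k) - 1ℤ - 1ℤ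
  ring139 = solve-∀
  ring140 : ∀ x n t → x + (1ℤ + n) * t ≡ x + t + n * t
  ring140 = solve-∀
  ring141 : ∀ s t → s * t - s - t ≡ t * s - t - s
  ring141 = solve-∀
  ring142 : ∀ x b s n → x - (b + s + n * s) ≡ - (b - (x + - (1ℤ + n) * s))
  ring142 = solve-∀
  ring143 : ∀ s i → - (- s - (i * s + i * s)) ≡ (i + i + 1ℤ) * s
  ring143 = solve-∀
  ring144 : ∀ i m t → i + i + (- (m - 1ℤ) - 1ℤ) * t + - (i + i + 1ℤ - m * t) ≡ -1ℤ
  ring144 = solve-∀
  ring145 : ∀ a s t i k m → a + s + t + (- s - (i * s + i * s)) - (a - (- s + (k + k) * t)) + s * (i + i + 1ℤ - m * t) + t * (s - (k + k) - 1ℤ - 1ℤ) + s * ((m - 1ℤ) * t) + (t - 1ℤ) ≡ -1ℤ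
  ring145 = solve-∀
  ring146 : ∀ c i s k t → -[1+ 0 ] - (c - i * s) ≡ -[1+ 0 ] - (c + k * t) + i * s + k * t
  ring146 = solve-∀
  ring147 : ∀ a s t i v → a + s + t + (- s - (i * s + i * s)) - (a - v) + (- v + (i * s + i * s)) - (t + t) + (t - 1ℤ) ≡ -1ℤ
  ring147 = solve-∀
  ring148 : ∀ a s t l → a + s + t - (a - (- t + (l + l) * s)) ≡ s * (l + l + 1ℤ)
  ring148 = solve-∀
  ring149 : ∀ c s → c - 0ℤ * s ≡ c
  ring149 = solve-∀
  ring150 : ∀ s t → s - 1ℤ * t ≡ - (- s - (- t))
  ring150 = solve-∀
  ring151 : ∀ s t → s - 1ℤ + t + (- s - t) ≡ -1ℤ
  ring151 = solve-∀
  ring152 : ∀ a s t → a - (- s) - (- t) ≡ a + s + t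
  ring152 = solve-∀
  ring153 : ∀ a s t → a + s + t ≡ a + t + s
  ring153 = solve-∀
  ring154 : ∀ a s t → a + s + t + (- s) + (- t) ≡ a
  ring154 = solve-∀
  ring155 : ∀ a s t i m → a + s * t + (- s - (i * s + i * s)) - a + s * (i + i + 1ℤ - m * t) ≡ - (s * ((m - 1ℤ) * t))
  ring155 = solve-∀
  ring156 : ∀ a s t i m → a + s * t + (- s - (i * s + i * s)) ≡ a - s * ((m - 1ℤ) * t) - s * (i + i + 1ℤ - m * t)
  ring156 = solve-∀
  ring157 : ∀ s t i m → - s - (i * s + i * s) - (- (s * t)) ≡ - (s * ((m - 1ℤ) * t)) - s * (i + i + 1ℤ - m * t)
  ring157 = solve-∀
  ring158 : ∀ s → - 0ℤ - s * 0ℤ ≡ 0ℤ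
  ring158 = solve-∀
  ring159 : ∀ a s → a - 0ℤ - s * 0ℤ ≡ a
  ring159 = solve-∀
  ring160 : ∀ s t i h → s + (i * s + i * s) - (- (s * t - s - t) + (i * s + i * s) + (h + h) * t) ≡ - (t * (h + h + 1ℤ - s))
  ring160 = solve-∀
  ring161 : ∀ s i → - (- s - (i * s + i * s)) ≡ s + (i * s + i * s)
  ring161 = solve-∀
  ring162 : ∀ a s t i → a + s * t + (- s - (i * s + i * s)) - a + (- (s * t - s - t) + (i * s + i * s)) - (t + t) + (t - 1ℤ) ≡ -1ℤ
  ring162 = solve-∀
  ring163 : ∀ s t → - (s * t) ≡ - t * s
  ring163 = solve-∀
  ring164 : ∀ s t → - (s * t) ≡ - s * t
  ring164 = solve-∀
  ring165 : ∀ a s t → a + s * t - a ≡ s * t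
  ring165 = solve-∀
  ring166 : ∀ z x t → z - t - x + t ≡ z - x
  ring166 = solve-∀
  ring167 : ∀ z s → z - (- s) ≡ z + s
  ring167 = solve-∀
  ring168 : ∀ o a b A B C D → o * (a - b + ((A - B) - (C - D))) ≡ o * (a - b) + (o * (A - C) - o * (B - D))
  ring168 = solve-∀
  ring169 : ∀ F G a b → F - G ≡ a - b + (F - a - (G - b))
  ring169 = solve-∀
  ring170 : ∀ z s t → z + s - t ≡ z - t - (- s)
  ring170 = solve-∀
  ring171 : ∀ a → - a ≡ - (a + (1ℤ - 1ℤ))
  ring171 = solve-∀
  ring172 : ∀ x y → x + x + 1ℤ + (y - x + (y - x)) ≡ y + y + 1ℤ
  ring172 = solve-∀
  ring173 : ∀ x y → y + y + 1ℤ - (x + x + 1ℤ) ≡ (y - x) + (y - x)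
  ring173 = solve-∀
  ring174 : ∀ y s → y + y + 1ℤ - (- s) ≡ y + s - (-[1+ 0 ] - y)
  ring174 = solve-∀
  ring175 : ∀ y x → - (y - x) ≡ x - y
  ring175 = solve-∀
  ring176 : ∀ y s → - (y - (y + s)) ≡ s
  ring176 = solve-∀
  ring177 : ∀ x → - (-[1+ 0 ] - x - x) ≡ x + x + 1ℤ
  ring177 = solve-∀
  ring178 : ∀ x y s → - (y - x) ≡ - (y + s - s - x)
  ring178 = solve-∀
  ring179 : ∀ x s → - (-[1+ 0 ] - (x + s) - s - x) ≡ x + x + 1ℤ + (s + s)
  ring179 = solve-∀
  ring180 : ∀ x v s → x + x + 1ℤ + (s + s) + (v - x + (v - x)) ≡ v + v + 1ℤ + (s + s)
  ring180 = solve-∀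
  ring181 : ∀ a b c → a - b - (c - b) ≡ a - c
  ring181 = solve-∀
  ring182 : ∀ a b → - (b - a) ≡ a - b
  ring182 = solve-∀
  ring183 : ∀ x s → x + x + 1ℤ - (- s) ≡ x - (-[1+ 0 ] - (x + s))
  ring183 = solve-∀
  ring184 : ∀ x y s → (y + y + 1ℤ - (- s)) - (y - x + (y - x)) ≡ - (-[1+ 0 ] - (x + s) - x)
  ring184 = solve-∀
  ring185 : ∀ x a b t → (a - b) * t ≡ x + a * t - (x + b * t)
  ring185 = solve-∀
  ring186 : ∀ m i → m - (1ℤ + i) ≡ m - i - 1ℤ
  ring186 = solve-∀
  ring187 : ∀ x s → x - s ≡ -[1+ 0 ] - (-[1+ 0 ] - x + s)
  ring187 = solve-∀
  ring188 : ∀ x t s → x - t - s + t ≡ x - s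
  ring188 = solve-∀
  ring189 : ∀ x t s → x - t + s + t ≡ x + s
  ring189 = solve-∀
  ring190 : ∀ x t s → s + s ≡ x - t + s - (x - t - s)
  ring190 = solve-∀
  ring191 : ∀ x t s → x - t + s - (x - t - s) ≡ (+ 2) * s
  ring191 = solve-∀
  ring192 : ∀ z s → z + s - z ≡ 1ℤ * s
  ring192 = solve-∀
  ring193 : ∀ x u → x + u - x ≡ u
  ring193 = solve-∀
  ring194 : ∀ Y N t → Y + 1ℤ * t + (N - 1ℤ - 1ℤ) * t ≡ Y + (N - 1ℤ) * t
  ring194 = solve-∀
  ring195 : ∀ Y i t → Y + 1ℤ * t + i * t ≡ Y + (1ℤ + i) * t
  ring195 = solve-∀
  ring196 : ∀ Y i t → Y + 1ℤ * t + i * t + t ≡ Y + (1ℤ + 1ℤ + i) * t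
  ring196 = solve-∀
  ring197 : ∀ Y t → Y ≡ Y + 0ℤ * t
  ring197 = solve-∀
  ring198 : ∀ i → i + - (1ℤ + i - 0ℤ) ≡ -1ℤ
  ring198 = solve-∀
  ring199 : ∀ N i → N - 1ℤ - 1ℤ - i - 1ℤ + (1ℤ + i - N) ≡ -[1+ 1 ]
  ring199 = solve-∀
  ring200 : ∀ i → i + - (1ℤ + 1ℤ + i - 0ℤ) ≡ -[1+ 1 ]
  ring200 = solve-∀
  ring201 : ∀ N i → N - 1ℤ - 1ℤ - i - 1ℤ + (1ℤ + 1ℤ + i - N) ≡ -1ℤ
  ring201 = solve-∀
  ring202 : ∀ x t → x - t + t ≡ x
  ring202 = solve-∀
  ring203 : ∀ x t → x + -1ℤ * t ≡ x - t
  ring203 = solve-∀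
  ring204 : ∀ x o t → x - o * t ≡ x + (- o) * t
  ring204 = solve-∀
  ring205 : ∀ o → o - 1ℤ - 1ℤ + - (-1ℤ - (- o)) ≡ -1ℤ
  ring205 = solve-∀
  ring206 : ∀ x t → x - t - x ≡ -1ℤ * t
  ring206 = solve-∀
  ring207 : ∀ X t → X + 1ℤ * t ≡ X + t
  ring207 = solve-∀
  ring208 : ∀ X o t → X + (o - 1ℤ) * t ≡ X + o * t - t
  ring208 = solve-∀
  ring209 : ∀ x t → x - t ≡ x - 1ℤ * t
  ring209 = solve-∀
  ring210 : ∀ o t → o * t ≡ - (- o * t)
  ring210 = solve-∀
  ring211 : ∀ o m s → - o - 1ℤ - 1ℤ + m * s + (o - m * s) ≡ -[1+ 1 ]
  ring211 = solve-∀
  ring212 : ∀ m s t → - (m * s) * t ≡ (1ℤ + (- m - 1ℤ)) * (s * t)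
  ring212 = solve-∀
  ring213 : ∀ N t → - (- (N * t) + (t + t)) ≡ (N - 1ℤ - 1ℤ) * t
  ring213 = solve-∀
  ring214 : ∀ a m s → a + (- m - 1ℤ) * s + (s - 1ℤ) + - (a - m * s) ≡ -1ℤ
  ring214 = solve-∀
  ring215 : ∀ y → y ≡ -[1+ 0 ] - y + (y + y + 1ℤ)
  ring215 = solve-∀
  ring216 : ∀ Y m s t → Y + m * s * t + t ≡ Y + t + m * (s * t)
  ring216 = solve-∀
  ring217 : ∀ a → - (a - 1ℤ - 1ℤ) - 1ℤ ≡ - (a - 1ℤ)
  ring217 = solve-∀
  ring218 : ∀ t → - (1ℤ * t) ≡ - t
  ring218 = solve-∀
  ring219 : ∀ a s t → a - (t - (s + s)) ≡ - (- (a + (s + s)) - (- t))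
  ring219 = solve-∀
  ring220 : ∀ b → -[1+ 0 ] - b + (b + b + 1ℤ) ≡ b
  ring220 = solve-∀
  ring221 : ∀ s t → s - 1ℤ + t + - (t - (- s)) ≡ -1ℤ
  ring221 = solve-∀
  ring222 : ∀ t → t - 1ℤ + t + - (t - (- t)) ≡ -1ℤ
  ring222 = solve-∀
  ring223 : ∀ s t → s - 1ℤ + s + - (t - (t - (s + s))) ≡ -1ℤ
  ring223 = solve-∀
  ring224 : ∀ t → - t ≡ -1ℤ * t
  ring224 = solve-∀
  ring225 : ∀ s t → t - (+ 3) * s ≡ - (s - (t - (s + s)))
  ring225 = solve-∀
  ring226 : ∀ s → s + (s + s) ≡ (+ 3) * s
  ring226 = solve-∀
  ring227 : ∀ s → s - 1ℤ + s + s + s + - (s + (s + s) - (- s)) ≡ -1ℤ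
  ring227 = solve-∀
  ring228 : ∀ s t → s - 1ℤ + s + t + t + - (s + (t + t) - (- s)) ≡ -1ℤ
  ring228 = solve-∀
  ring229 : ∀ s t → s - 1ℤ + t + t + t + - (s + (t + t) - (- t)) ≡ -1ℤ
  ring229 = solve-∀
  ring230 : ∀ s t → s - 1ℤ + s + s + t + - (s + (t + t) - (t - (s + s))) ≡ -1ℤ
  ring230 = solve-∀
  ring231 : ∀ c s t → c + t + s ≡ c + s + t
  ring231 = solve-∀
  ring232 : ∀ s t I → s - (1ℤ + (I + I)) * t ≡ - (- s + (I * t + I * t) - (- t))
  ring232 = solve-∀
  ring233 : ∀ s t I → s + s - ((I + 1ℤ) * t + (I + 1ℤ) * t) ≡ - (- s + (I * t + I * t) - (s - (t + t)))
  ring233 = solve-∀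
  ring234 : ∀ c s k t → -[1+ 0 ] - (c + k * t + s) ≡ c + (- k) * t - (c + c + 1ℤ - (- s))
  ring234 = solve-∀
  ring235 : ∀ a → a - 0ℤ ≡ a
  ring235 = solve-∀
  ring236 : ∀ s → s - 1ℤ + s + - (s + (s + s) - s) ≡ -1ℤ
  ring236 = solve-∀
  ring237 : ∀ s t → s - 1ℤ + s + s + t + - (s + (s + s) - (- t)) ≡ -1ℤ
  ring237 = solve-∀
  ring238 : ∀ s t → s - 1ℤ + s + s + t + - (t + (s + s) - (- s)) ≡ -1ℤ
  ring238 = solve-∀
  ring239 : ∀ s t → s - 1ℤ + s + t + t + - (t + (s + s) - (- t)) ≡ -1ℤ
  ring239 = solve-∀
  ring240 : ∀ x s → -[1+ 0 ] - (-[1+ 0 ] - (x + s) + s) ≡ x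
  ring240 = solve-∀
  ring241 : ∀ t s → t - (s + s) + (s + s) ≡ t
  ring241 = solve-∀
  ring242 : ∀ a p q r u → a + (u + u + 1ℤ) - (q + q + 1ℤ) + (r + r + 1ℤ) - (p + p + 1ℤ) - a ≡ - ((p + q - (r + u)) + (p + q - (r + u)))
  ring242 = solve-∀
  ring243 : ∀ p r k d → r - (p + k * d) ≡ r - p - k * d
  ring243 = solve-∀
  ring244 : ∀ p q r u k d → u - (q + (- k) * d) ≡ - (p + q - (r + u)) + - (r - p - k * d)
  ring244 = solve-∀
  ring245 : ∀ D → D - (+ 6) + (+ 6) ≡ D
  ring245 = solve-∀
  ring246 : ∀ D c q → (+ 5) - c + (D - (+ 6)) + (q - 1ℤ) * D + (c - q * D) + 0ℤ ≡ -1ℤ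
  ring246 = solve-∀
  ring247 : ∀ D c q → c - 1ℤ + (- (q - 1ℤ) - 1ℤ) * D + - (c - q * D) ≡ -1ℤ
  ring247 = solve-∀
  ring248 : ∀ s t → (s - (+ 3)) * t + (+ 3) * (t - (+ 2)) ≡ s * t - (+ 6)
  ring248 = solve-∀
  ring249 : ∀ s t → (s - (+ 2)) * t + (+ 2) * (t - (+ 3)) ≡ s * t - (+ 6)
  ring249 = solve-∀
  ring250 : ∀ a → - (a - (+ 3)) - 1ℤ ≡ - (a - (+ 2))
  ring250 = solve-∀
  ring251 : ∀ a i j → a + j - (a + i) ≡ j - i
  ring251 = solve-∀
  ring252 : ∀ D → D - (+ 6) + (0ℤ - D) ≡ -[1+ 5 ]
  ring252 = solve-∀
  ring253 : ∀ a m D → a * (m * D) ≡ a * m * D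
  ring253 = solve-∀
  ring254 : ∀ z x M → z + (x + M) ≡ z + M + x
  ring254 = solve-∀
  ring255 : ∀ x i k M → x + x + 1ℤ + (i + i) - (- (k + k + 1ℤ)) * M ≡ x + i + k * M + M - (-[1+ 0 ] - (x + i + k * M))
  ring255 = solve-∀
  ring256 : ∀ x i k M → x + x + 1ℤ + i - (- k) * M ≡ x - (-[1+ 0 ] - (x + i + k * M))
  ring256 = solve-∀
  ring257 : ∀ x i k M → x + x + 1ℤ + i - (- (k + 1ℤ + 1ℤ)) * M ≡ x + i + k * M + M - (-[1+ 0 ] - (x + M))
  ring257 = solve-∀
  ring258 : ∀ m s t → m * (s * t) ≡ m * t * s
  ring258 = solve-∀
  ring259 : ∀ x i k M → i - (1ℤ - k) * M ≡ x + i + k * M - (x + M)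
  ring259 = solve-∀
  ring260 : ∀ x i k M → i - (- k - 1ℤ) * M ≡ x + i + k * M + M - x
  ring260 = solve-∀
  ring261 : ∀ D → D + D ≡ (+ 2) * D
  ring261 = solve-∀
  ring262 : ∀ e → e - 1ℤ + (e - 1ℤ) + 1ℤ ≡ e + e + 1ℤ - (+ 2)
  ring262 = solve-∀
  ring263 : ∀ n → - n - (+ 2) ≡ - (1ℤ + (1ℤ + n))
  ring263 = solve-∀
  ring264 : ∀ n → 1ℤ + (1ℤ + n) ≡ n + (+ 2)
  ring264 = solve-∀
  ring265 : ∀ k → k + k + (+ 2) ≡ k + 1ℤ + (k + 1ℤ)
  ring265 = solve-∀
  ring266 : ∀ k → - (k + k) ≡ - k + - k
  ring266 = solve-∀
  ring267 : ∀ s t → s - 1ℤ + t + - (s - (- t)) ≡ -1ℤ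
  ring267 = solve-∀
  ring268 : ∀ t I s → - t + (I * s + I * s) ≡ - t + (I + I) * s
  ring268 = solve-∀
  ring269 : ∀ t I s q → t - (I + I - q) * s ≡ q * s - (- t + (I + I) * s)
  ring269 = solve-∀
  ring270 : ∀ a s t → a - (- t) - (- s) ≡ a + s + t
  ring270 = solve-∀
  ring271 : ∀ s t l k → (l + l + 1ℤ) * s - (k + k + 1ℤ) * t ≡ - t + (l + l) * s - (- s + (k + k) * t)
  ring271 = solve-∀
  ring272 : ∀ c b₀ b → c + b₀ - b + (c + b₀ - b) + 1ℤ ≡ (c + c + 1ℤ) + (b₀ + b₀ + 1ℤ) - (b + b + 1ℤ)
  ring272 = solve-∀
  ring273 : ∀ s t l o → - s + - t - (- t + (l + l) * s) - (- (o * (s * t))) ≡ - (s * (l + l + 1ℤ - o * t))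
  ring273 = solve-∀
  ring274 : ∀ a s t l o → a + s + t - (a - (- t + (l + l) * s)) - o * (s * t) ≡ s * (l + l + 1ℤ - o * t)
  ring274 = solve-∀
  ring275 : ∀ o t → (o - 1ℤ) * t + t ≡ o * t
  ring275 = solve-∀
  ring276 : ∀ o → o - 1ℤ + 1ℤ ≡ o
  ring276 = solve-∀
  ring277 : ∀ s t o → (- (o - 1ℤ) - 1ℤ) * s * t ≡ - (o * (s * t))
  ring277 = solve-∀
  ring278 : ∀ s t o → o * (s * t) ≡ o * t * s
  ring278 = solve-∀
  ring279 : ∀ s t o → - (o * (s * t)) ≡ - (o * t) * s
  ring279 = solve-∀
  ring280 : ∀ s t o → - (o * (s * t)) ≡ - (o * s) * t
  ring280 = solve-∀
  ring281 : ∀ a n → a + (n - a) ≡ n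
  ring281 = solve-∀
  ring282 : ∀ s k → - (s * (k + k)) ≡ - (s * k) + - (s * k)
  ring282 = solve-∀
  ring283 : ∀ s t → s * (t - (+ 2)) + (s - 1ℤ) + (s - s * t) ≡ -1ℤ
  ring283 = solve-∀
  ring284 : ∀ h s → (- (h - 1ℤ) - 1ℤ) + (- (h - 1ℤ) - 1ℤ) + (s - (+ 2)) + (h + h + 1ℤ - s) ≡ -1ℤ
  ring284 = solve-∀
  ring285 : ∀ s t h → - (s * t) - (s + (- (h + 1ℤ) + - (h + 1ℤ)) * s) ≡ s * (h + h + 1ℤ - t)
  ring285 = solve-∀
  ring286 : ∀ s j t → s + (j * t + j * t) ≡ s + (j + j) * t
  ring286 = solve-∀
  ring287 : ∀ j t → (j - 1ℤ) * t ≡ j * t - t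
  ring287 = solve-∀
  ring288 : ∀ s j t a → j * t - t + (j * t - t) + t + t + (s - 1ℤ) + a + - (s + (j + j) * t - (- a)) ≡ -1ℤ
  ring288 = solve-∀
  ring289 : ∀ s j t → j * t - t + (j * t - t) + (t - 1ℤ) + t + - (s + (j + j) * t - s) ≡ -1ℤ
  ring289 = solve-∀
  ring290 : ∀ s j t → s - (1ℤ - (j + j)) * t ≡ s + (j + j) * t - t
  ring290 = solve-∀
  ring291 : ∀ s j t → s - (s - (j + j)) * t ≡ s + (j + j) * t - s * t
  ring291 = solve-∀
  ring292 : ∀ s j t → j * t - t + (j * t - t) + (t - 1ℤ) + t + - (- s + (j + j) * t - (- s)) ≡ -1ℤ
  ring292 = solve-∀
  ring293 : ∀ s j t → t * (s - j - 1ℤ) + t * (s - j - 1ℤ) + (t - 1ℤ) + t + (- (s * t) + (j + j) * t - s * t) ≡ -1ℤ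
  ring293 = solve-∀
  ring294 : ∀ s → s ≡ - (- s)
  ring294 = solve-∀
  ring295 : ∀ s j t → s - (s - (j + j) - (j + j)) * t ≡ s + (j + j) * t - (- (- (s * t) + (j + j) * t))
  ring295 = solve-∀
  ring296 : ∀ c e v → c + (e + v) ≡ e + (c + v)
  ring296 = solve-∀
  ring297 : ∀ s j t → s - (j + j - s) * t ≡ s - (- (s * t) + (j + j) * t)
  ring297 = solve-∀
  ring298 : ∀ s t h → - t - (- (s * t) + (h + h) * t) ≡ - (t * (h + h + 1ℤ - s))
  ring298 = solve-∀
  ring299 : ∀ s t h → t - (- (s * t) + (h + 1ℤ + (h + 1ℤ)) * t) ≡ - (t * (h + h + 1ℤ - s))
  ring299 = solve-∀
  ring300 : ∀ h → h + 1ℤ - 1ℤ ≡ h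
  ring300 = solve-∀
  ring301 : ∀ h → h ≡ h + h + 1ℤ - h - 1ℤ
  ring301 = solve-∀
  ring302 : ∀ h → h - 1ℤ ≡ h + h + 1ℤ - (h + 1ℤ) - 1ℤ
  ring302 = solve-∀
  ring303 : ∀ s t → s * (t - (+ 2)) + t * (s - (+ 2)) + (s - (+ 2)) + (t - (+ 2)) + - (s * t - s - t - (- (s * t))) ≡ -[1+ 3 ]
  ring303 = solve-∀
  ring304 : ∀ s t → s - 1ℤ + t + (s * t - s - t - s * t) ≡ -1ℤ
  ring304 = solve-∀
  ring305 : ∀ s t h → - (s * t) - (- s + (- h + - h) * s) ≡ s * (h + h + 1ℤ - t)
  ring305 = solve-∀
  ring306 : ∀ s t → t * (s - (+ 2)) + (t - 1ℤ) + (t - s * t) ≡ -1ℤ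
  ring306 = solve-∀
  ring307 : ∀ s D → D + (s - 1ℤ) + - (s - (- D)) ≡ -1ℤ
  ring307 = solve-∀
  ring308 : ∀ s t → t - (t - (+ 2)) * s ≡ - (s * t - s - t - s)
  ring308 = solve-∀
  ring309 : ∀ s t → s - (s - (+ 2)) * t ≡ - (s * t - s - t - t)
  ring309 = solve-∀
  ring310 : ∀ t → - (- t) ≡ 1ℤ * t
  ring310 = solve-∀
  ring311 : ∀ k D → 0ℤ + k * D + (0ℤ + k * D) + 1ℤ - (k + k) * D ≡ 1ℤ
  ring311 = solve-∀
  ring312 : ∀ z D → z + D + (z + D) + 1ℤ - (+ 2) * D ≡ z + z + 1ℤ
  ring312 = solve-∀
  ring313 : ∀ n z D → n - D - D + (z + D + (z + D) + 1ℤ) - (z + z + 1ℤ) ≡ n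
  ring313 = solve-∀
  ring314 : ∀ e D → e + D + D ≡ e + (D + D)
  ring314 = solve-∀
  ring315 : ∀ D → D - 1ℤ + (- (D + D) - (- D)) ≡ -1ℤ
  ring315 = solve-∀
  ring316 : ∀ e D → D + D ≡ e + D + D - e
  ring316 = solve-∀
  ring317 : ∀ n D → n ≡ n - D + D
  ring317 = solve-∀
  ring318 : ∀ a b c d → a + b + (c + d) ≡ a + c + (b + d)
  ring318 = solve-∀
  ring319 : ∀ c a b → c * a + c * b ≡ c * (a + b)
  ring319 = solve-∀
  ring320 : ∀ a b → 0ℤ - b ≡ a - (a + b)
  ring320 = solve-∀
  ring321 : ∀ k → - (1ℤ + k) - 1ℤ ≡ - (1ℤ + (1ℤ + k))
  ring321 = solve-∀
  ring322 : ∀ t a → 0ℤ ≡ 0ℤ * a + t * (0ℤ * 0ℤ - 0ℤ)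
  ring322 = solve-∀
  ring323 : ∀ k t z → k * (z + z + 1ℤ) + t * (k * k - k) + (z + k * t + (z + k * t) + 1ℤ) ≡ (1ℤ + k) * (z + z + 1ℤ) + t * ((1ℤ + k) * (1ℤ + k) - (1ℤ + k))
  ring323 = solve-∀
  ring324 : ∀ t z → 0ℤ - (z + -1ℤ * t + (z + -1ℤ * t) + 1ℤ) ≡ -1ℤ * (z + z + 1ℤ) + t * (-1ℤ * -1ℤ - -1ℤ)
  ring324 = solve-∀
  ring325 : ∀ s N → 0ℤ ≡ s * (0ℤ - 0ℤ * N) - (0ℤ - (N + N) * 0ℤ + 0ℤ * (N * N))
  ring325 = solve-∀
  ring326 : ∀ s N m S Q x → s * (S - m * N) - (Q - (N + N) * S + m * (N * N)) + (x - N) * (s - (x - N)) ≡ s * (S + x - (1ℤ + m) * N) - (Q + x * x - (N + N) * (S + x) + (1ℤ + m) * (N * N))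
  ring326 = solve-∀
  ring327 : ∀ s → 0ℤ ≡ s * ((0ℤ - 1ℤ) * 0ℤ - (0ℤ + 0ℤ)) - (0ℤ * 0ℤ - 0ℤ * 0ℤ)
  ring327 = solve-∀
  ring328 : ∀ a b → - (a + b) + b ≡ - a
  ring328 = solve-∀
  ring329 : ∀ a b → - (a + b) + a ≡ - b
  ring329 = solve-∀
  ring330 : ∀ a b → b - a - 1ℤ ≡ b - (1ℤ + a)
  ring330 = solve-∀
  ring331 : ∀ a b q N → N - a - 1ℤ + b + (q - 1ℤ) * N + (a - b - q * N) ≡ -1ℤ
  ring331 = solve-∀
  ring332 : ∀ a b q N → N - b - 1ℤ + a + (- q - 1ℤ) * N + - (a - b - q * N) ≡ -1ℤ
  ring332 = solve-∀
  ring333 : ∀ q → - (q - 1ℤ) - 1ℤ ≡ - q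
  ring333 = solve-∀
  ring334 : ∀ y a s t → y + a * s + -1ℤ * t + (y + a * s + -1ℤ * t) + 1ℤ ≡ y + y + 1ℤ + (a + a) * s - (t + t)
  ring334 = solve-∀
  ring335 : ∀ s t a → - (s * t - s - t) + (a + a) * s - (t + t) - (s * t - s - t) ≡ - ((t - (1ℤ + a) + (t - (1ℤ + a))) * s)
  ring335 = solve-∀
  ring336 : ∀ x y α β s t a q → x - (y + a * s + ((x - y) * β + q * s) * t) ≡ - ((x - y) * (α * s + β * t - 1ℤ)) + s * ((x - y) * α - (a + q * t))
  ring336 = solve-∀
  ring337 : ∀ y a b s i j t → (a - b) * s - (j - i) * t ≡ y + a * s + i * t - (y + b * s + j * t)
  ring337 = solve-∀
  ring338 : ∀ k j → k + 1ℤ - j - 1ℤ ≡ k - j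
  ring338 = solve-∀
  ring339 : ∀ z k j t → z + k * t ≡ z + j * t + (k - j) * t
  ring339 = solve-∀
  ring340 : ∀ z k j t → z + j * t ≡ z + k * t + t + (j - (k + 1ℤ)) * t
  ring340 = solve-∀
  ring341 : ∀ n j → - (j - n) - 1ℤ ≡ n - j - 1ℤ
  ring341 = solve-∀
  ring342 : ∀ n → n - (n - 1ℤ) - 1ℤ ≡ 0ℤ
  ring342 = solve-∀
  ring343 : ∀ x y → x - (y - 1ℤ) - 1ℤ ≡ x - y
  ring343 = solve-∀
  ring344 : ∀ x y s → y - (x - 1ℤ - s) - 1ℤ ≡ s - (x - y)
  ring344 = solve-∀
  ring345 : ∀ y a b s t n m → y + a * s + (n - 1ℤ) * t - (y + b * s + (n - 1ℤ - s) * t + m * s) ≡ (a - b + t - m) * s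
  ring345 = solve-∀
  ring346 : ∀ a b N → a - b + N - (a + (N - b)) ≡ 0ℤ
  ring346 = solve-∀
  ring347 : ∀ y a b s u → y + b * s + u ≡ y + a * s + u + (b - a) * s
  ring347 = solve-∀
  ring348 : ∀ z j t → z + -1ℤ * t ≡ z + j * t + (- j - 1ℤ) * t
  ring348 = solve-∀
  ring349 : ∀ j → - j - 1ℤ ≡ 0ℤ - j - 1ℤ
  ring349 = solve-∀
  ring350 : ∀ x z → x ≡ z + (x - z)
  ring350 = solve-∀
  ring351 : ∀ a → a + a ≡ a + a + 0ℤ
  ring351 = solve-∀
  ring352 : ∀ t n y a s → n * (y + a * s + (y + a * s) + 1ℤ) + t * (n * n - n) ≡ (y + y + 1ℤ - t) * n + (s + s) * (a * n) + t * (n * n)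
  ring352 = solve-∀
  ring353 : ∀ c s t A Q → c * 0ℤ + (s + s) * A + t * Q ≡ (s + s) * A + t * Q
  ring353 = solve-∀
  ring354 : ∀ s t A Q → - (s * ((t - 1ℤ) * 0ℤ - (A + A)) - (t * Q - 0ℤ * 0ℤ)) ≡ (s + s) * A + t * Q
  ring354 = solve-∀
  ring355 : ∀ x d → (x + x + 1ℤ) * d ≡ x * d + x * d + d
  ring355 = solve-∀
  ring356 : ∀ k m d → (- (k - m) - 1ℤ) + (- (k - m) - 1ℤ) + d + - ((m - k) + (m - k) - (- d)) ≡ -[1+ 1 ]
  ring356 = solve-∀
  ring357 : ∀ s h → 0ℤ + h ≡ 1ℤ * h - s * 0ℤ
  ring357 = solve-∀
  ring358 : ∀ s c m h x → (1ℤ + m) * h - s * c + x - ((1ℤ + (1ℤ + m)) * h - s * c) ≡ - (h - x)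
  ring358 = solve-∀
  ring359 : ∀ m c → m - c + 1ℤ ≡ 1ℤ + m - c
  ring359 = solve-∀
  ring360 : ∀ s c m h x → (1ℤ + m) * h - s * c + x - ((1ℤ + (1ℤ + m)) * h - s * (c + 1ℤ)) ≡ s - (h - x)
  ring360 = solve-∀
  ring361 : ∀ m c → m - c ≡ 1ℤ + m - (c + 1ℤ)
  ring361 = solve-∀
  ring362 : ∀ c → c + - (c + 1ℤ) ≡ -1ℤ
  ring362 = solve-∀
  ring363 : ∀ s t c h → c * s - h * t ≡ - (t * h - s * c)
  ring363 = solve-∀
  ring364 : ∀ N c m t → N - c + (m - 1ℤ) * t + (c - m * t) + (t - (1ℤ + N)) ≡ -1ℤ
  ring364 = solve-∀
  ring365 : ∀ m t → (- (m - 1ℤ) - 1ℤ) * t ≡ - (m * t)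
  ring365 = solve-∀
  ring366 : ∀ t h s → t * h - s * 0ℤ ≡ t * h
  ring366 = solve-∀
  ring367 : ∀ y a s j t T → -[1+ 0 ] - (y + a * s + j * t) - (y + (T - a) * s + (-[1+ 0 ] - j) * t) ≡ - (y + y + 1ℤ - (- (s * t - s - t))) + (t - (1ℤ + T)) * s
  ring367 = solve-∀
  ring368 : ∀ n A T s y a j t → n - (A + T * s) + (A - y) + (T - a) * s + (- j - 1ℤ) * t + (t - 1ℤ) + - (n - (y + a * s + j * t)) ≡ -1ℤ
  ring368 = solve-∀
  ring369 : ∀ y a s u → y + a * s + u + s ≡ y + (1ℤ + a) * s + u
  ring369 = solve-∀
  ring370 : ∀ y a s j t → y + a * s + j * t + s - (y + 0ℤ * s + (j + s) * t) ≡ - ((t - (1ℤ + a)) * s)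
  ring370 = solve-∀
  ring371 : ∀ z j t → z + j * t + t ≡ z + (j + 1ℤ) * t
  ring371 = solve-∀
  ring372 : ∀ l s t k → (l + l - 1ℤ) * s - (k + k + 1ℤ) * t ≡ - t + (l + l) * s - (s + (k + k) * t)
  ring372 = solve-∀
  ring373 : ∀ l s t → - t + (l + l) * s ≡ s - t + (l + l - 1ℤ) * s
  ring373 = solve-∀
  ring374 : ∀ x s t i m W → x - (-[1+ 0 ] - x + s + m * t) ≡ (x + x + 1ℤ - W) + (W - (s - t + (1ℤ + i) * t * s)) + ((1ℤ + i) * s - 1ℤ - m) * t
  ring374 = solve-∀
  ring375 : ∀ x s t i m W → -[1+ 0 ] - x - (x + t + m * s) ≡ - (x + x + 1ℤ - W) + - (W - (s - t + - (1ℤ + i) * t * s)) + ((1ℤ + i) * t - 1ℤ - m) * s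
  ring375 = solve-∀
  ring376 : ∀ n d → n * d + (d - 1ℤ) ≡ (1ℤ + n) * d - 1ℤ
  ring376 = solve-∀
  ring377 : ∀ l → l + l ≡ l + l - 1ℤ + 1ℤ
  ring377 = solve-∀
  ring378 : ∀ s t k → - (- s + (k + k) * t) ≡ s + (- k + - k) * t
  ring378 = solve-∀
  ring379 : ∀ c s t l W → c - (- t + (l - 1ℤ + (l - 1ℤ)) * s) ≡ c + (s + s) - W + (W - (- t + (l + l) * s))
  ring379 = solve-∀
  ring380 : ∀ c s t k W → W - (s + (1ℤ - k + (1ℤ - k)) * t) ≡ W - (c + (t + t)) + (c - (s + (- k + - k) * t))
  ring380 = solve-∀
  ring381 : ∀ c b s t → c + (- (-[1+ 0 ] - b)) * s + (c + (- (-[1+ 0 ] - b)) * s) + 1ℤ - (- (s * t)) ≡ (c + c + 1ℤ - (- s)) + (b + b + 1ℤ - (- t)) * s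
  ring381 = solve-∀
  ring382 : ∀ x s y t → x * s + (- y) * t - 1ℤ ≡ - (1ℤ + y * t - x * s)
  ring382 = solve-∀
  ring383 : ∀ x s y t → (- x) * s + y * t - 1ℤ ≡ - (1ℤ + x * s - y * t)
  ring383 = solve-∀
  ring384 : ∀ a s t α β q → a - (α * q + a * β) * t ≡ - a * (α * s + β * t - 1ℤ) + α * (a * s - q * t)
  ring384 = solve-∀
  ring385 : ∀ a s t α β q → a - (β * q + a * α) * s ≡ - a * (α * s + β * t - 1ℤ) + β * (a * t - q * s)
  ring385 = solve-∀
  ring386 : ∀ x d → -[1+ 0 ] - x ≡ -[1+ 0 ] - (x + d) + d
  ring386 = solve-∀
  ring387 : ∀ z d → -[1+ 0 ] - z ≡ -[1+ 0 ] - (z - d - (- d))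
  ring387 = solve-∀
  ring388 : ∀ z d → -[1+ 0 ] - z - d ≡ -[1+ 0 ] - (z - (- d))
  ring388 = solve-∀
  ring389 : ∀ b q l p → b + b + 1ℤ - (- q + (- l + - l) * p) ≡ - (-[1+ 0 ] - b - b - q - l * (+ 2 * p))
  ring389 = solve-∀
  ring390 : ∀ b q l p → -[1+ 0 ] - b - b - q - (- l) * (+ 2 * p) ≡ - (b + b + 1ℤ - (- q + (l + l) * p))
  ring390 = solve-∀
  ring391 : ∀ k → k + k ≡ k * + 2
  ring391 = solve-∀
  ring392 : ∀ m → - (m * + 2) ≡ - m + - m
  ring392 = solve-∀
  ring393 : ∀ n a b → n ≡ n - a - b + (a + b)
  ring393 = solve-∀
  ring394 : ∀ x a b → x + (a + b) - a - b ≡ x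
  ring394 = solve-∀
  ring395 : ∀ s t k → - (- (- s) + (k + k) * t) ≡ - s + (- k + - k) * t
  ring395 = solve-∀
  ring396 : ∀ c s t → c + (-[1+ 0 ] - c) * t + (c + (-[1+ 0 ] - c) * t) + 1ℤ - (s * t - s - t) ≡ (1ℤ - t) * (c + c + 1ℤ - (- s))
  ring396 = solve-∀

  -- Linear arithmetic over ℤ

  NN : ℤ → Set
  NN a = 0ℤ ≤ a

  nn+ : ∀ {a b} → NN a → NN b → NN (a + b)
  nn+ = ℤP.+-mono-≤

  nn* : ∀ {a b} → NN a → NN b → NN (a * b)
  nn* {+ m} {+ n} _ _ = subst NN (ℤP.pos-* m n) (+≤+ z≤n)

  nn-cast : ∀ {a b} → a ≡ b → NN a → NN b
  nn-cast = subst NN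

  nn≤ : ∀ {a b} → a ≤ b → NN (b - a)
  nn≤ = ℤP.i≤j⇒0≤j-i

  ≤nn : ∀ {a b} → NN (b - a) → a ≤ b
  ≤nn = ℤP.0≤i-j⇒j≤i

  nn≡ : ∀ {a} → a ≡ 0ℤ → NN a
  nn≡ refl = +≤+ z≤n

  nn-pos : ∀ n → NN (+ n)
  nn-pos n = +≤+ z≤n

  nn-neg-absurd : ∀ {a} n → NN a → a ≡ -[1+ n ] → ⊥
  nn-neg-absurd n () refl

  nn-antisym : ∀ {a} → NN a → NN (- a) → a ≡ 0ℤ
  nn-antisym {+ zero} _ _ = refl
  nn-antisym {+ suc n} _ ()

  nn-total : ∀ a → NN a ⊎ NN (- a - 1ℤ)
  nn-total (+ n) = inj₁ (+≤+ z≤n)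
  nn-total -[1+ n ] = inj₂ (+≤+ z≤n)

  zsub : ∀ {a b} → a ≡ b → a - b ≡ 0ℤ
  zsub {a} {b} = ℤP.i≡j⇒i-j≡0 {a} {b}

  subz : ∀ {a b} → a - b ≡ 0ℤ → a ≡ b
  subz {a} {b} = ℤP.i-j≡0⇒i≡j a b

  z+ : ∀ {a b} → a ≡ 0ℤ → b ≡ 0ℤ → a + b ≡ 0ℤ
  z+ refl refl = refl

  z* : ∀ c {a} → a ≡ 0ℤ → c * a ≡ 0ℤ
  z* c refl = ℤP.*-zeroʳ c

  -- Finitely supported functions on ℤ

  -- mag x < N cuts out the window {-N, …, N-1}.
  mag : ℤ → ℕ
  mag (+ n) = n
  mag -[1+ n ] = n

  mag≤abs : ∀ x → mag x ℕ.≤ ∣ x ∣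
  mag≤abs (+ n) = ℕP.≤-refl
  mag≤abs -[1+ n ] = ℕP.n≤1+n n

  abs≤mag : ∀ x → ∣ x ∣ ℕ.≤ suc (mag x)
  abs≤mag (+ n) = ℕP.n≤1+n n
  abs≤mag -[1+ n ] = ℕP.≤-refl

  x≡x-d+d : ∀ (x d : ℤ) → x ≡ (x - d) + d
  x≡x-d+d = solve-∀

  mag-shift : ∀ x d → mag x ℕ.≤ mag (x - d) ℕ.+ suc ∣ d ∣
  mag-shift x d = begin
    mag x ≤⟨ mag≤abs x ⟩
    ∣ x ∣ ≡⟨ cong ∣_∣ (x≡x-d+d x d) ⟩
    ∣ (x - d) + d ∣ ≤⟨ ℤP.∣i+j∣≤∣i∣+∣j∣ (x - d) d ⟩
    ∣ x - d ∣ ℕ.+ ∣ d ∣ ≤⟨ ℕP.+-monoˡ-≤ ∣ d ∣ (abs≤mag (x - d)) ⟩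
    suc (mag (x - d)) ℕ.+ ∣ d ∣ ≡⟨ sym (ℕP.+-suc (mag (x - d)) ∣ d ∣) ⟩
    mag (x - d) ℕ.+ suc ∣ d ∣ ∎
    where open ℕP.≤-Reasoning

  mag-shift′ : ∀ x d N → N ℕ.+ suc ∣ d ∣ ℕ.≤ mag x → N ℕ.≤ mag (x - d)
  mag-shift′ x d N h = ℕP.+-cancelʳ-≤ (suc ∣ d ∣) N (mag (x - d)) (ℕP.≤-trans h (mag-shift x d))

  -- The bound is part of the data, so that the sum over ℤ is a computed finite sum; by `Σ-cong` the
  -- sum does not depend on the bound chosen.
  record FS : Set where
    constructor mkFS
    field
      at : ℤ → ℤ
      bd : ℕ
      van : ∀ x → bd ℕ.≤ mag x → at x ≡ 0ℤ
  open FS public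

  sumTo : ℕ → (ℤ → ℤ) → ℤ
  sumTo zero g = 0ℤ
  sumTo (suc n) g = sumTo n g + (g (+ n) + g -[1+ n ])

  Σℤ : FS → ℤ
  Σℤ F = sumTo (bd F) (at F)

  sumTo-cong : ∀ N {g h : ℤ → ℤ} → (∀ x → g x ≡ h x) → sumTo N g ≡ sumTo N h
  sumTo-cong zero e = refl
  sumTo-cong (suc N) e = cong₂ _+_ (sumTo-cong N e) (cong₂ _+_ (e (+ N)) (e -[1+ N ]))

  sumTo-stable : ∀ (F : FS) k → sumTo (k ℕ.+ bd F) (at F) ≡ Σℤ F
  sumTo-stable F zero = refl
  sumTo-stable F (suc k)
    rewrite van F (+ (k ℕ.+ bd F)) (ℕP.m≤n+m (bd F) k)
          | van F -[1+ (k ℕ.+ bd F) ] (ℕP.m≤n+m (bd F) k)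
    = trans (ℤP.+-identityʳ _) (sumTo-stable F k)

  sumTo-stable′ : ∀ (F : FS) k → sumTo (bd F ℕ.+ k) (at F) ≡ Σℤ F
  sumTo-stable′ F k = trans (cong (λ N → sumTo N (at F)) (ℕP.+-comm (bd F) k)) (sumTo-stable F k)

  Σ-cong : ∀ {F G : FS} → (∀ x → at F x ≡ at G x) → Σℤ F ≡ Σℤ G
  Σ-cong {F} {G} e =
    trans (sym (sumTo-stable F (bd G))) (trans (sumTo-cong (bd G ℕ.+ bd F) e) (sumTo-stable′ G (bd F)))

  addFS subFS : FS → FS → FS
  addFS F G = mkFS (λ x → at F x + at G x) (bd F ℕ.+ bd G)
    (λ x h → cong₂ _+_ (van F x (ℕP.≤-trans (ℕP.m≤m+n (bd F) (bd G)) h)) (van G x (ℕP.≤-trans (ℕP.m≤n+m (bd G) (bd F)) h)))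
  subFS F G = mkFS (λ x → at F x - at G x) (bd F ℕ.+ bd G)
    (λ x h → cong₂ _-_ (van F x (ℕP.≤-trans (ℕP.m≤m+n (bd F) (bd G)) h)) (van G x (ℕP.≤-trans (ℕP.m≤n+m (bd G) (bd F)) h)))

  mulFS : (ℤ → ℤ) → FS → FS
  mulFS c F = mkFS (λ x → c x * at F x) (bd F) (λ x h → trans (cong (c x *_) (van F x h)) (ℤP.*-zeroʳ (c x)))

  zeroFS : FS
  zeroFS = mkFS (λ _ → 0ℤ) 0 (λ _ _ → refl)

  sumTo-+ : ∀ N (g h : ℤ → ℤ) → sumTo N (λ x → g x + h x) ≡ sumTo N g + sumTo N h
  sumTo-+ zero g h = refl
  sumTo-+ (suc N) g h rewrite sumTo-+ N g h = ring1 (sumTo N g) (sumTo N h) (g (+ N)) (h (+ N)) (g -[1+ N ]) (h -[1+ N ])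

  sumTo-* : ∀ N c (g : ℤ → ℤ) → sumTo N (λ x → c * g x) ≡ c * sumTo N g
  sumTo-* zero c g = sym (ℤP.*-zeroʳ c)
  sumTo-* (suc N) c g rewrite sumTo-* N c g = ring2 c (sumTo N g) (g (+ N)) (g -[1+ N ])

  Σ-add : ∀ F G → Σℤ (addFS F G) ≡ Σℤ F + Σℤ G
  Σ-add F G = trans (sumTo-+ (bd F ℕ.+ bd G) (at F) (at G)) (cong₂ _+_ (sumTo-stable′ F (bd G)) (sumTo-stable G (bd F)))

  Σ-scale : ∀ c F → Σℤ (mulFS (λ _ → c) F) ≡ c * Σℤ F
  Σ-scale c F = sumTo-* (bd F) c (at F)

  Σ-sub : ∀ F G → Σℤ (subFS F G) ≡ Σℤ F - Σℤ G
  Σ-sub F G = trans (Σ-cong {subFS F G} {addFS F (mulFS (λ _ → -1ℤ) G)} (λ x → ring3 (at F x) (at G x)))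
    (trans (Σ-add F (mulFS (λ _ → -1ℤ) G)) (trans (cong (λ e → Σℤ F + e) (Σ-scale -1ℤ G)) (sym (ring3 (Σℤ F) (Σℤ G)))))

  shiftFS : ℤ → FS → FS
  shiftFS d F = mkFS (λ x → at F (x - d)) (bd F ℕ.+ suc ∣ d ∣) (λ x h → van F (x - d) (mag-shift′ x d (bd F) h))

  -- A unit shift turns the window of `suc N` into the window of `N` with two further points at its
  -- lower end. Keeping these explicit lets `Σ-shift1` discard them beyond the bound.
  sumTo-pred : ∀ N (g : ℤ → ℤ) → sumTo (suc N) (λ x → g (x - 1ℤ)) ≡ sumTo N g + (g -[1+ N ] + g -[1+ suc N ])
  sumTo-pred zero g = refl
  sumTo-pred (suc N) g rewrite sumTo-pred N g | ℕP.+-identityʳ N =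
    ring4 (sumTo N g) (g (+ N)) (g -[1+ N ]) (g -[1+ suc N ]) (g -[1+ suc (suc N) ])

  Σ-shift1 : ∀ F → Σℤ (shiftFS 1ℤ F) ≡ Σℤ F
  Σ-shift1 F = trans (trans (cong (λ N → sumTo N (λ x → at F (x - 1ℤ))) (ℕP.+-comm (bd F) 2)) (sumTo-pred (suc (bd F)) (at F)))
    (trans (cong₂ (λ a b → sumTo (suc (bd F)) (at F) + (a + b)) (van F -[1+ suc (bd F) ] (ℕP.n≤1+n _)) (van F -[1+ suc (suc (bd F)) ] (ℕP.m≤n+m (bd F) 2)))
    (trans (ℤP.+-identityʳ _) (sumTo-stable F 1)))

  Σ-shift+ : ∀ n F → Σℤ (shiftFS (+ n) F) ≡ Σℤ F
  Σ-shift+ zero F = Σ-cong {shiftFS 0ℤ F} {F} (λ x → cong (at F) (ℤP.+-identityʳ x))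
  Σ-shift+ (suc n) F = trans (Σ-cong {shiftFS (+ suc n) F} {shiftFS 1ℤ (shiftFS (+ n) F)} (λ x → cong (at F) (ring5 x (+ n))))
    (trans (Σ-shift1 (shiftFS (+ n) F)) (Σ-shift+ n F))

  Σ-shift : ∀ d F → Σℤ (shiftFS d F) ≡ Σℤ F
  Σ-shift (+ n) F = Σ-shift+ n F
  Σ-shift -[1+ n ] F = trans (sym (Σ-shift+ (suc n) (shiftFS -[1+ n ] F)))
    (Σ-cong {shiftFS (+ suc n) (shiftFS -[1+ n ] F)} {F} (λ x → cong (at F) (ring6 x (+ suc n))))

  sumTo-nonneg : ∀ N g → (∀ x → NN (g x)) → NN (sumTo N g)
  sumTo-nonneg zero g h = +≤+ z≤n
  sumTo-nonneg (suc N) g h = nn+ (sumTo-nonneg N g h) (nn+ (h (+ N)) (h -[1+ N ]))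

  Σ-nonneg : ∀ F → (∀ x → NN (at F x)) → NN (Σℤ F)
  Σ-nonneg F h = sumTo-nonneg (bd F) (at F) h

  sumTo-term : ∀ N g p → (∀ x → NN (g x)) → mag p ℕ.< N → NN (sumTo N g - g p)
  sumTo-term (suc N) g p h (s≤s lt) with ℕP.m≤n⇒m<n∨m≡n lt
  ... | inj₁ lt′ = nn-cast (ring79 (sumTo N g) (g p) (g (+ N) + g -[1+ N ])) (nn+ (sumTo-term N g p h lt′) (nn+ (h (+ N)) (h -[1+ N ])))
  sumTo-term (suc N) g (+ _) h (s≤s lt) | inj₂ refl = nn-cast (ring7 (sumTo N g) (g (+ N)) (g -[1+ N ])) (nn+ (sumTo-nonneg N g h) (h -[1+ N ]))
  sumTo-term (suc N) g -[1+ _ ] h (s≤s lt) | inj₂ refl = nn-cast (ring8 (sumTo N g) (g (+ N)) (g -[1+ N ])) (nn+ (sumTo-nonneg N g h) (h (+ N)))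

  Σ-term : ∀ F p → (∀ x → NN (at F x)) → NN (Σℤ F - at F p)
  Σ-term F p h = subst (λ e → NN (e - at F p)) (sumTo-stable F (suc (mag p)))
    (sumTo-term (suc (mag p) ℕ.+ bd F) (at F) p h (s≤s (ℕP.m≤m+n (mag p) (bd F))))

  searchℤ : ∀ {P : ℤ → Set} → (∀ y → Dec (P y)) → ∀ N → (Σ[ y ∈ ℤ ] P y) ⊎ (∀ y → mag y ℕ.< N → ¬ P y)
  searchℤ P? zero = inj₂ (λ y ())
  searchℤ P? (suc N) with searchℤ P? N | P? (+ N) | P? -[1+ N ]
  ... | inj₁ r | _ | _ = inj₁ r
  ... | inj₂ f | yes p | _ = inj₁ (_ , p)
  ... | inj₂ f | no _ | yes p = inj₁ (_ , p)
  ... | inj₂ f | no ¬p | no ¬q = inj₂ go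
    where
      go : ∀ y → mag y ℕ.< suc N → _
      go y (s≤s lt) with ℕP.m≤n⇒m<n∨m≡n lt
      ... | inj₁ lt′ = f y lt′
      go (+ _) (s≤s lt) | inj₂ refl = ¬p
      go -[1+ _ ] (s≤s lt) | inj₂ refl = ¬q

  ¬nn : ∀ {a} → ¬ (a < 0ℤ) → NN a
  ¬nn h = ℤP.≮⇒≥ h

  -- Were all values nonnegative, the sum would be at least the value at `p`. A search inside the
  -- bound makes the argument constructive, since all values beyond it are zero.
  Σ-find-neg : ∀ F p → NN (- Σℤ F) → 0ℤ < at F p → Σ[ y ∈ ℤ ] at F y < 0ℤ
  Σ-find-neg F p le pos with searchℤ (λ y → at F y ℤP.<? 0ℤ) (bd F)
  ... | inj₁ r = r
  ... | inj₂ f = ⊥-elim (ℤP.<⇒≱ pos (≤nn (nn-cast (ring9 (Σℤ F) (at F p)) (nn+ (Σ-term F p all) le))))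
    where
      all : ∀ y → NN (at F y)
      all y with mag y ℕP.<? bd F
      ... | yes lt = ¬nn (f y lt)
      ... | no ge = nn≡ (van F y (ℕP.≮⇒≥ ge))

  sumTo-zero : ∀ N g → (∀ x → mag x ℕ.< N → g x ≡ 0ℤ) → sumTo N g ≡ 0ℤ
  sumTo-zero zero g h = refl
  sumTo-zero (suc N) g h rewrite h (+ N) (ℕP.n<1+n N) | h -[1+ N ] (ℕP.n<1+n N) =
    trans (ℤP.+-identityʳ _) (sumTo-zero N g (λ x lt → h x (ℕP.m<n⇒m<1+n lt)))

  ≢-mag : ∀ {x p : ℤ} → mag x ℕ.< mag p → x ≢ p
  ≢-mag lt refl = ℕP.<-irrefl refl lt

  Σ-single : ∀ F p → (∀ x → x ≢ p → at F x ≡ 0ℤ) → Σℤ F ≡ at F p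
  Σ-single F p h = trans (sym (sumTo-stable F (suc (mag p)))) (go p (bd F) h)
    where
      base : ∀ p → (∀ x → x ≢ p → at F x ≡ 0ℤ) → sumTo (suc (mag p)) (at F) ≡ at F p
      base (+ n) h rewrite sumTo-zero n (at F) (λ x lt → h x (≢-mag lt)) | h -[1+ n ] (λ ()) =
        trans (ℤP.+-identityˡ _) (ℤP.+-identityʳ _)
      base -[1+ n ] h rewrite sumTo-zero n (at F) (λ x lt → h x (≢-mag lt)) | h (+ n) (λ ()) =
        trans (ℤP.+-identityˡ _) (ℤP.+-identityˡ _)
      go : ∀ p k → (∀ x → x ≢ p → at F x ≡ 0ℤ) → sumTo (suc (mag p) ℕ.+ k) (at F) ≡ at F p
      go p zero h = trans (cong (λ N → sumTo N (at F)) (ℕP.+-identityʳ (suc (mag p)))) (base p h)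
      go p (suc k) h rewrite ℕP.+-suc (mag p) k
        | h (+ (suc (mag p ℕ.+ k))) (λ e → ℕP.<-irrefl (sym (cong mag e)) (s≤s (ℕP.m≤m+n (mag p) k)))
        | h -[1+ (suc (mag p ℕ.+ k)) ] (λ e → ℕP.<-irrefl (sym (cong mag e)) (s≤s (ℕP.m≤m+n (mag p) k)))
        = trans (ℤP.+-identityʳ _) (go p k h)

  -- Indicators and point masses

  ind : Bool → ℤ
  ind true = 1ℤ
  ind false = 0ℤ

  δ : ℤ → FS
  δ p = mkFS (λ y → ind (does (y ℤP.≟ p))) (suc (mag p)) v
    where
      v : ∀ y → suc (mag p) ℕ.≤ mag y → ind (does (y ℤP.≟ p)) ≡ 0ℤ
      v y lt with y ℤP.≟ p
      ... | yes refl = ⊥-elim (ℕP.<-irrefl refl lt)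
      ... | no _ = refl

  δ-at : ∀ p → at (δ p) p ≡ 1ℤ
  δ-at p with p ℤP.≟ p
  ... | yes _ = refl
  ... | no n = ⊥-elim (n refl)

  δ-off : ∀ p y → y ≢ p → at (δ p) y ≡ 0ℤ
  δ-off p y n with y ℤP.≟ p
  ... | yes e = ⊥-elim (n e)
  ... | no _ = refl

  Σ-δ : ∀ p → Σℤ (δ p) ≡ 1ℤ
  Σ-δ p = trans (Σ-single (δ p) p (δ-off p)) (δ-at p)

  Σ-mulδ : ∀ c p → Σℤ (mulFS c (δ p)) ≡ c p
  Σ-mulδ c p = trans (Σ-single (mulFS c (δ p)) p (λ x n → trans (cong (c x *_) (δ-off p x n)) (ℤP.*-zeroʳ (c x))))
    (trans (cong (c p *_) (δ-at p)) (ℤP.*-identityʳ (c p)))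

  -- The odd coordinate, in which bar is negation.
  w : ℤ → ℤ
  w x = x + x + 1ℤ

  bar-bar : ∀ x → bar (bar x) ≡ x
  bar-bar = ring10

  bar-inj : ∀ {x y} → bar x ≡ bar y → x ≡ y
  bar-inj {x} {y} e = trans (sym (bar-bar x)) (trans (cong bar e) (bar-bar y))

  bar-swap : ∀ {x y} → bar x ≡ y → x ≡ bar y
  bar-swap {x} refl = sym (bar-bar x)

  bar-+ : ∀ x d → bar (x + d) ≡ bar x - d
  bar-+ = ring11

  bar-- : ∀ x d → bar (x - d) ≡ bar x + d
  bar-- = ring12

  w-bar : ∀ x → w (bar x) ≡ - w x
  w-bar = ring13

  w-+ : ∀ x d → w (x + d) ≡ w x + (d + d)
  w-+ = ring14

  bar≡+ : ∀ x → bar x ≡ x - w x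
  bar≡+ = ring15

  double-inj : ∀ {x y : ℤ} → x + x ≡ y + y → x ≡ y
  double-inj {x} {y} e = ℤP.*-cancelˡ-≡ (+ 2) x y (trans (ring16 x) (trans e (sym (ring16 y))))

  w-inj : ∀ {x y} → w x ≡ w y → x ≡ y
  w-inj {x} {y} e = double-inj (trans (ring17 x) (trans (cong (_- 1ℤ) e) (sym (ring17 y))))

  even≢odd : ∀ x y → x + x ≡ y + y + 1ℤ → ⊥
  even≢odd x y e = go (y - x) (trans (ring18 x y) (trans (cong (λ z → z - (x + x)) (sym e)) (ℤP.+-inverseʳ (x + x))))
    where
      go : ∀ z → z + z + 1ℤ ≡ 0ℤ → ⊥
      go (+ zero) ()
      go (+ suc n) ()
      go -[1+ n ] ()

  w≢0 : ∀ x → w x ≢ 0ℤ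
  w≢0 x e = even≢odd 0ℤ x (sym e)

  x≢bar : ∀ x → x ≢ bar x
  x≢bar x e = w≢0 x (trans (ring45 x) (trans (cong (λ z → x - z) (sym e)) (ℤP.+-inverseʳ x)))

  bar-pos : ∀ n → bar (+ n) ≡ -[1+ n ]
  bar-pos zero = refl
  bar-pos (suc n) = refl

  mag-bar : ∀ x → mag (bar x) ≡ mag x
  mag-bar (+ n) = cong mag (bar-pos n)
  mag-bar -[1+ n ] = refl

  true≢false : true ≢ false
  true≢false ()

  contra : ∀ {A : Set} {b : Bool} → b ≡ true → b ≡ false → A
  contra refl ()

  -- Maya diagrams

  record Maya : Set where
    constructor mkMaya
    field
      occ : ℤ → Bool
      lim : ℕ
      hi : ∀ n → lim ℕ.≤ n → occ (+ n) ≡ false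
      lo : ∀ n → lim ℕ.≤ n → occ -[1+ n ] ≡ true
  open Maya public

  infix 4 _≐_
  _≐_ : Maya → Maya → Set
  f ≐ g = ∀ x → occ f x ≡ occ g x

  ≐-sym : ∀ {f g} → f ≐ g → g ≐ f
  ≐-sym e x = sym (e x)

  ≐-trans : ∀ {f g h} → f ≐ g → g ≐ h → f ≐ h
  ≐-trans e e′ x = trans (e x) (e′ x)

  χ : Maya → ℤ → ℤ
  χ f x = ind (occ f x)

  ind-inj : ∀ {a b} → ind a ≡ ind b → a ≡ b
  ind-inj {true} {true} _ = refl
  ind-inj {false} {false} _ = refl

  diff : Maya → Maya → FS
  diff f g = mkFS (λ x → χ f x - χ g x) (lim f ℕ.+ lim g) v
    where
      v : ∀ x → lim f ℕ.+ lim g ℕ.≤ mag x → χ f x - χ g x ≡ 0ℤ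
      v (+ n) h rewrite hi f n (ℕP.≤-trans (ℕP.m≤m+n (lim f) (lim g)) h) | hi g n (ℕP.≤-trans (ℕP.m≤n+m (lim g) (lim f)) h) = refl
      v -[1+ n ] h rewrite lo f n (ℕP.≤-trans (ℕP.m≤m+n (lim f) (lim g)) h) | lo g n (ℕP.≤-trans (ℕP.m≤n+m (lim g) (lim f)) h) = refl

  neg? : ℤ → Bool
  neg? (+ n) = false
  neg? -[1+ n ] = true

  vac : Maya
  vac = mkMaya neg? 0 (λ _ _ → refl) (λ _ _ → refl)

  idℤ : ℤ → ℤ
  idℤ x = x

  -- Both are taken relative to the vacuum, which makes them finite sums. On the beta-set of a
  -- partition the charge is 0 and `E` is the size.
  charge E : Maya → ℤ
  charge f = Σℤ (diff f vac)
  E f = Σℤ (mulFS idℤ (diff f vac))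

  E-cong : ∀ {f g} → f ≐ g → E f ≡ E g
  E-cong {f} {g} e = Σ-cong {mulFS idℤ (diff f vac)} {mulFS idℤ (diff g vac)} (λ x → cong (λ b → x * (ind b - χ vac x)) (e x))

  E-diff : ∀ f g → E f - E g ≡ Σℤ (mulFS idℤ (diff f g))
  E-diff f g = trans (sym (Σ-sub (mulFS idℤ (diff f vac)) (mulFS idℤ (diff g vac))))
    (Σ-cong {subFS (mulFS idℤ (diff f vac)) (mulFS idℤ (diff g vac))} {mulFS idℤ (diff f g)} (λ x → ring19 x (χ f x) (χ g x) (χ vac x)))

  charge-diff : ∀ f g → charge f - charge g ≡ Σℤ (diff f g)
  charge-diff f g = trans (sym (Σ-sub (diff f vac) (diff g vac)))
    (Σ-cong {subFS (diff f vac) (diff g vac)} {diff f g} (λ x → ring20 (χ f x) (χ g x) (χ vac x)))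

  -- Two diagrams whose difference is a d-boundary V(· - d) - V are related by moving beads
  -- along the runners modulo d; V counts the moves.
  Bd : ℤ → (ℤ → ℤ) → Set
  Bd d h = Σ[ V ∈ FS ] (∀ z → h z ≡ at V (z - d) - at V z)

  Bd-cong : ∀ {d h k} → (∀ z → k z ≡ h z) → Bd d h → Bd d k
  Bd-cong e (V , p) = V , λ z → trans (e z) (p z)

  Bd-add : ∀ {d h k} → Bd d h → Bd d k → Bd d (λ z → h z + k z)
  Bd-add {d} (V , p) (W , q) = addFS V W , λ z → trans (cong₂ _+_ (p z) (q z)) (ring21 (at V (z - d)) (at V z) (at W (z - d)) (at W z))

  Bd-scale : ∀ {d h} c → Bd d h → Bd d (λ z → c * h z)
  Bd-scale {d} c (V , p) = mulFS (λ _ → c) V , λ z → trans (cong (c *_) (p z)) (ring22 c (at V (z - d)) (at V z))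

  Bd-zero : ∀ {d} → Bd d (λ _ → 0ℤ)
  Bd-zero = zeroFS , λ _ → refl

  Bd-sub : ∀ {d h k} → Bd d h → Bd d k → Bd d (λ z → h z - k z)
  Bd-sub {d} {h} {k} p q = Bd-cong (λ z → ring3 (h z) (k z)) (Bd-add p (Bd-scale -1ℤ q))

  δ-shift : ∀ x d z → at (δ (x + d)) z ≡ at (δ x) (z - d)
  δ-shift x d z with z ℤP.≟ (x + d) | (z - d) ℤP.≟ x
  ... | yes _ | yes _ = refl
  ... | no _ | no _ = refl
  ... | yes refl | no n = ⊥-elim (n (ring23 x d))
  ... | no n | yes refl = ⊥-elim (n (x≡x-d+d z d))

  Bd-δ+ : ∀ d x (k : ℕ) → Bd d (λ z → at (δ (x + + k * d)) z - at (δ x) z)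
  Bd-δ+ d x zero = Bd-cong (λ z → trans (cong (λ y → at (δ y) z - at (δ x) z) (ring24 x d)) (ℤP.+-inverseʳ (at (δ x) z))) Bd-zero
  Bd-δ+ d x (suc k) = Bd-cong (λ z → trans (cong (λ y → at (δ y) z - at (δ x) z) (ring25 x d (+ k)))
      (ring29 (at (δ (y + d)) z) (at (δ y) z) (at (δ x) z)))
      (Bd-add (δ y , λ z → cong (λ e → e - at (δ y) z) (δ-shift y d z)) (Bd-δ+ d x k))
    where
      y = x + + k * d

  Bd-δ : ∀ d x y k → y ≡ x + k * d → Bd d (λ z → at (δ y) z - at (δ x) z)
  Bd-δ d x y (+ k) refl = Bd-δ+ d x k
  Bd-δ d x y -[1+ k ] e = Bd-cong (λ z → ring26 (at (δ y) z) (at (δ x) z))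
      (Bd-scale -1ℤ (Bd-cong (λ z → cong (λ u → at (δ u) z - at (δ y) z) (trans (ring27 x (+ suc k) d) (cong (λ u → u + + suc k * d) (sym e)))) (Bd-δ+ d y (suc k))))

  Eqv : ℤ → Maya → Maya → Set
  Eqv d f g = Bd d (λ z → χ f z - χ g z)

  Eqv-refl : ∀ {d f g} → f ≐ g → Eqv d f g
  Eqv-refl {d} {f} {g} e = Bd-cong (λ z → trans (cong (λ b → ind b - χ g z) (e z)) (ℤP.+-inverseʳ (χ g z))) Bd-zero

  Eqv-sym : ∀ {d f g} → Eqv d f g → Eqv d g f
  Eqv-sym {d} {f} {g} p = Bd-cong (λ z → ring28 (χ f z) (χ g z)) (Bd-scale -1ℤ p)

  Eqv-trans : ∀ {d f g h} → Eqv d f g → Eqv d g h → Eqv d f h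
  Eqv-trans {d} {f} {g} {h} p q = Bd-cong (λ z → ring29 (χ f z) (χ g z) (χ h z)) (Bd-add p q)

  -- Summation by parts: x (V(x - d) - V(x)) is (x - d) V(x - d) + d V(x - d) - x V(x), and the
  -- first and last terms cancel after summation because sums are invariant under shifts.
  Σ-id-boundary : ∀ d V (F : FS) → (∀ z → at F z ≡ at V (z - d) - at V z) → Σℤ (mulFS idℤ F) ≡ d * Σℤ V
  Σ-id-boundary d V F p = trans (Σ-cong {mulFS idℤ F} {G} (λ x → trans (cong (x *_) (p x)) (ring30 x d (at V (x - d)) (at V x))))
    (trans (Σ-sub G₁ (mulFS idℤ V))
    (trans (cong (_- Σℤ (mulFS idℤ V)) (trans (Σ-add (shiftFS d (mulFS idℤ V)) (mulFS (λ _ → d) (shiftFS d V)))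
       (cong₂ _+_ (Σ-shift d (mulFS idℤ V)) (trans (Σ-scale d (shiftFS d V)) (cong (d *_) (Σ-shift d V))))))
    (ring193 (Σℤ (mulFS idℤ V)) (d * Σℤ V))))
    where
      G₁ = addFS (shiftFS d (mulFS idℤ V)) (mulFS (λ _ → d) (shiftFS d V))
      G = subFS G₁ (mulFS idℤ V)

  E-Eqv : ∀ {d f g} (p : Eqv d f g) → E f - E g ≡ d * Σℤ (proj₁ p)
  E-Eqv {d} {f} {g} (V , p) = trans (E-diff f g) (Σ-id-boundary d V (diff f g) p)

  -- Cores and their minimal energy

  Core : ℤ → Maya → Set
  Core d f = ∀ x → occ f (x + d) ≡ true → occ f x ≡ true

  Core-cong : ∀ {d f g} → f ≐ g → Core d f → Core d g
  Core-cong e c x h = trans (sym (e x)) (c x (trans (e _) h))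

  x+0d : ∀ x d → x + 0ℤ * d ≡ x
  x+0d = solve-∀

  x+sd : ∀ x k d → x + (1ℤ + k) * d ≡ x + k * d + d
  x+sd = solve-∀

  core-down : ∀ {d f} → Core d f → ∀ x (k : ℕ) → occ f (x + + k * d) ≡ true → occ f x ≡ true
  core-down {d} {f} c x zero h = trans (cong (occ f) (sym (x+0d x d))) h
  core-down {d} {f} c x (suc k) h = core-down {d} {f} c x k (c _ (trans (cong (occ f) (sym (x+sd x (+ k) d))) h))

  core-down′ : ∀ {d f} → Core d f → ∀ x y → (k : ℕ) → y ≡ x + + k * d → occ f y ≡ true → occ f x ≡ true
  core-down′ {d} {f} c x _ k refl h = core-down {d} {f} c x k h

  core-up : ∀ {d f} → Core d f → ∀ x y → (k : ℕ) → y ≡ x + + k * d → occ f x ≡ false → occ f y ≡ false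
  core-up {d} {f} c x y k e h with occ f y in eq
  ... | false = refl
  ... | true = contra (core-down′ {d} {f} c x y k e eq) h

  nn≡+ : ∀ {a} → NN a → Σ[ n ∈ ℕ ] a ≡ + n
  nn≡+ {+ n} _ = n , refl

  farUp : ∀ N y d → 0ℤ < d → Σ[ K ∈ ℕ ] Σ[ n ∈ ℕ ] (N ℕ.≤ n × y + + K * d ≡ + n)
  farUp N y (+ suc e) (+<+ (s≤s z≤n)) = K , proj₁ r , le , proj₂ r
    where
      K = N ℕ.+ ∣ y ∣
      d = + suc e
      nny : NN (+ ∣ y ∣ + y)
      nny = go y
        where go : ∀ y → NN (+ ∣ y ∣ + y)
              go (+ n) = +≤+ z≤n
              go -[1+ n ] = nn≡ (ℤP.+-inverseʳ (+ suc n))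
      nnr : NN (y + + K * d - + N)
      nnr = nn-cast (trans (ring31 (+ N) (+ ∣ y ∣) y (+ e)) (cong (λ u → y + u * d - + N) (sym (ℤP.pos-+ N ∣ y ∣))))
        (nn+ nny (nn* (subst NN (ℤP.pos-+ N ∣ y ∣) (+≤+ z≤n)) (nn-pos e)))
      r : Σ[ n ∈ ℕ ] y + + K * d ≡ + n
      r = nn≡+ (nn-cast (ring202 _ (+ N)) (nn+ nnr (nn-pos N)))
      le : N ℕ.≤ proj₁ r
      le = ℤP.drop‿+≤+ (≤nn {+ N} {+ proj₁ r} (subst (λ z → NN (z - + N)) (proj₂ r) nnr))

  farDown : ∀ N y d → 0ℤ < d → Σ[ K ∈ ℕ ] Σ[ n ∈ ℕ ] (N ℕ.≤ n × y - + K * d ≡ -[1+ n ])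
  farDown N y d pos with farUp N (bar y) d pos
  ... | K , n , le , e = K , n , le , trans (ring32 y (+ K) d) (trans (cong bar e) (bar-pos n))

  cross : ∀ (f : ℤ → Bool) z d n → f z ≡ true → f (z + + n * d) ≡ false →
    Σ[ i ∈ ℕ ] (i ℕ.< n × f (z + + i * d) ≡ true × f (z + + i * d + d) ≡ false)
  cross f z d zero h h′ = contra h (trans (cong f (sym (x+0d z d))) h′)
  cross f z d (suc n) h h′ with f (z + + n * d) in eq
  ... | true = n , ℕP.n<1+n n , eq , trans (cong f (sym (x+sd z (+ n) d))) h′
  ... | false with cross f z d n h eq
  ... | i , lt , a , b = i , ℕP.m<n⇒m<1+n lt , a , b

  not-true : ∀ {b} → not b ≡ true → b ≡ false
  not-true {false} _ = refl
  not-false : ∀ {b} → not b ≡ false → b ≡ true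
  not-false {true} _ = refl

  cross-up : ∀ (f : ℤ → Bool) z d n → f z ≡ false → f (z + + n * d) ≡ true →
    Σ[ i ∈ ℕ ] (i ℕ.< n × f (z + + i * d) ≡ false × f (z + + i * d + d) ≡ true)
  cross-up f z d n h h′ with cross (λ x → not (f x)) z d n (cong not h) (cong not h′)
  ... | i , lt , a , b = i , lt , not-true a , not-false b

  occ-hi : ∀ f {x n} → x ≡ + n → lim f ℕ.≤ n → occ f x ≡ false
  occ-hi f refl h = hi f _ h
  occ-lo : ∀ f {x n} → x ≡ -[1+ n ] → lim f ℕ.≤ n → occ f x ≡ true
  occ-lo f refl h = lo f _ h

  topAbove : ∀ f d → 0ℤ < d → ∀ x → occ f x ≡ true →
    Σ[ i ∈ ℕ ] (occ f (x + + i * d) ≡ true × occ f (x + + i * d + d) ≡ false)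
  topAbove f d pos x h with farUp (lim f) x d pos
  ... | K , n , le , e with cross (occ f) x d K h (occ-hi f e le)
  ... | i , _ , a , b = i , a , b

  topBead : ∀ f d → 0ℤ < d → ∀ x → Σ[ k ∈ ℤ ] (occ f (x + k * d) ≡ true × occ f (x + k * d + d) ≡ false)
  topBead f d pos x with farDown (lim f) x d pos
  ... | K , n , le , e with topAbove f d pos (x - + K * d) (occ-lo f e le)
  ... | i , a , b = (+ i - + K) , trans (cong (occ f) (ring33 x (+ i) (+ K) d)) a , trans (cong (λ z → occ f (z + d)) (ring33 x (+ i) (+ K) d)) b

  chainDown : ∀ (V : FS) d → 0ℤ < d → ∀ y → (∀ (k : ℕ) → NN (at V (y - + k * d) - at V (y - + k * d - d))) → NN (at V y)
  chainDown V d pos y h with farDown (bd V) y d pos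
  ... | K , n , le , e = go K (nn≡ (van V _ (subst (λ z → bd V ℕ.≤ mag z) (sym e) le)))
    where
      go : ∀ k → NN (at V (y - + k * d)) → NN (at V y)
      go zero p = subst (λ z → NN (at V z)) (ring149 y d) p
      go (suc k) p = go k (nn-cast (ring202 _ _) (nn+ (h k) (subst (λ z → NN (at V z)) (ring34 y (+ k) d) p)))

  chainUp : ∀ (V : FS) d → 0ℤ < d → ∀ y → (∀ (k : ℕ) → NN (at V (y + + k * d) - at V (y + + k * d + d))) → NN (at V y)
  chainUp V d pos y h with farUp (bd V) y d pos
  ... | K , n , le , e = go K (nn≡ (van V _ (subst (λ z → bd V ℕ.≤ mag z) (sym e) le)))
    where
      go : ∀ k → NN (at V (y + + k * d)) → NN (at V y)
      go zero p = subst (λ z → NN (at V z)) (x+0d y d) p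
      go (suc k) p = go k (nn-cast (ring202 _ _) (nn+ (h k) (subst (λ z → NN (at V z)) (x+sd y (+ k) d) p)))

  nn-1-ind : ∀ b → NN (1ℤ - ind b)
  nn-1-ind true = +≤+ z≤n
  nn-1-ind false = +≤+ z≤n

  nn-ind : ∀ b → NN (ind b)
  nn-ind true = +≤+ z≤n
  nn-ind false = +≤+ z≤n

  y-d+d : ∀ (y d : ℤ) → y + d - d ≡ y
  y-d+d = solve-∀

  -- On each runner a core has beads below and gaps above. Going down from a bead of `g`, or up from
  -- a gap, the values of `V` can only decrease, and in both directions they end at 0.
  weight-nonneg : ∀ {d f g} → 0ℤ < d → Core d g → (p : Eqv d f g) → ∀ y → NN (at (proj₁ p) y)
  weight-nonneg {d} {f} {g} pos c (V , p) y with occ g y in eq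
  ... | true = chainDown V d pos y (λ k → nn-cast (lem (at V (y - + k * d)) (at V (y - + k * d - d)) _ (occ f (y - + k * d)) (p (y - + k * d)) (below k)) (nn-1-ind (occ f (y - + k * d))))
    where
      below : ∀ k → χ g (y - + k * d) ≡ 1ℤ
      below k = cong ind (core-down′ {d} {g} c _ y k (ring35 y (+ k) d) eq)
      lem : ∀ a b g f → ind f - g ≡ b - a → g ≡ 1ℤ → 1ℤ - ind f ≡ a - b
      lem a b g f e refl = trans (ring36 (ind f)) (trans (cong -_ e) (ring182 a b))
  ... | false = chainUp V d pos y (λ k → nn-cast (lem k) (nn-ind (occ f (y + + k * d + d))))
    where
      above : ∀ k → χ g (y + + k * d + d) ≡ 0ℤ
      above k = cong ind (core-up {d} {g} c y _ (suc k) (sym (x+sd y (+ k) d)) eq)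
      lem : ∀ k → χ f (y + + k * d + d) ≡ at V (y + + k * d) - at V (y + + k * d + d)
      lem k = trans (sym (ℤP.+-identityʳ _)) (trans (cong (λ z → χ f (y + + k * d + d) - z) (sym (above k)))
        (trans (p (y + + k * d + d)) (cong (λ z → at V z - at V (y + + k * d + d)) (y-d+d (y + + k * d) d))))

  E-core-min : ∀ {d f g} → 0ℤ < d → Core d g → Eqv d f g → NN (E f - E g)
  E-core-min {d} {f} {g} pos c p = nn-cast (sym (E-Eqv {d} {f} {g} p)) (nn* (ℤP.<⇒≤ pos) (Σ-nonneg (proj₁ p) (weight-nonneg {d} {f} {g} pos c p)))

  Bd-trivial : ∀ {d f g} (p : Eqv d f g) → (∀ y → at (proj₁ p) y ≡ 0ℤ) → f ≐ g
  Bd-trivial {d} {f} {g} (V , p) z x = ind-inj (subz (trans (p x) (cong₂ _-_ (z (x - d)) (z x))))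

  pos-nonzero : ∀ {d} → 0ℤ < d → d ≢ 0ℤ
  pos-nonzero pos refl = ℤP.<-irrefl refl pos

  E-core-unique : ∀ {d f g} → 0ℤ < d → Core d g → Eqv d f g → E f ≡ E g → f ≐ g
  E-core-unique {d} {f} {g} pos c p e = Bd-trivial {d} {f} {g} p zero′
    where
      V = proj₁ p
      nn = weight-nonneg {d} {f} {g} pos c p
      σ0 : Σℤ V ≡ 0ℤ
      σ0 = [ (λ z → ⊥-elim (pos-nonzero pos z)) , (λ z → z) ]′ (ℤP.i*j≡0⇒i≡0∨j≡0 d (trans (sym (E-Eqv {d} {f} {g} p)) (zsub e)))
      zero′ : ∀ y → at V y ≡ 0ℤ
      zero′ y = nn-antisym (nn y) (nn-cast (ring37 (at V y)) (subst (λ u → NN (u - at V y)) σ0 (Σ-term V y nn)))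

  -- Applied in both directions, `weight-nonneg` makes `V` and its negative nonnegative.
  core-unique : ∀ {d f g} → 0ℤ < d → Core d f → Core d g → Eqv d f g → f ≐ g
  core-unique {d} {f} {g} pos cf cg p = Bd-trivial {d} {f} {g} p
    (λ y → nn-antisym (weight-nonneg {d} {f} {g} pos cg p y) (nn-cast (ring38 (at (proj₁ p) y)) (weight-nonneg {d} {g} {f} pos cf (Eqv-sym {d} {f} {g} p) y)))

  -- Self-conjugate diagrams and flips

  SC : Maya → Set
  SC f = ∀ x → occ f (bar x) ≡ not (occ f x)

  SC-cong : ∀ {f g} → f ≐ g → SC f → SC g
  SC-cong e s x = trans (sym (e _)) (trans (s x) (cong not (e x)))

  SC-true : ∀ {f} → SC f → ∀ {x} → occ f x ≡ true → occ f (bar x) ≡ false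
  SC-true s h = trans (s _) (cong not h)

  SC-false : ∀ {f} → SC f → ∀ {x} → occ f x ≡ false → occ f (bar x) ≡ true
  SC-false s h = trans (s _) (cong not h)

  pair? : ∀ x y → Dec (y ≡ x ⊎ y ≡ bar x)
  pair? x y with y ℤP.≟ x | y ℤP.≟ bar x
  ... | yes e | _ = yes (inj₁ e)
  ... | no _ | yes e = yes (inj₂ e)
  ... | no n | no n′ = no λ { (inj₁ e) → n e ; (inj₂ e) → n′ e }

  -- On a self-conjugate diagram negating the values at x and x̄ is the same as exchanging them; as
  -- negations, flips visibly commute and are involutive on every diagram.
  flipOcc : ℤ → (ℤ → Bool) → ℤ → Bool
  flipOcc x f y with pair? x y
  ... | yes _ = not (f y)
  ... | no _ = f y

  flip-on : ∀ x f y → y ≡ x ⊎ y ≡ bar x → flipOcc x f y ≡ not (f y)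
  flip-on x f y h with pair? x y
  ... | yes _ = refl
  ... | no n = ⊥-elim (n h)

  flip-off : ∀ x f y → y ≢ x → y ≢ bar x → flipOcc x f y ≡ f y
  flip-off x f y n n′ with pair? x y
  ... | yes (inj₁ e) = ⊥-elim (n e)
  ... | yes (inj₂ e) = ⊥-elim (n′ e)
  ... | no _ = refl

  pair-mag : ∀ x y → y ≡ x ⊎ y ≡ bar x → mag y ≡ mag x
  pair-mag x y (inj₁ refl) = refl
  pair-mag x y (inj₂ refl) = mag-bar x

  flip : ℤ → Maya → Maya
  flip x f = mkMaya (flipOcc x (occ f)) (lim f ℕ.+ suc (mag x)) h l
    where
      off : ∀ y → lim f ℕ.+ suc (mag x) ℕ.≤ mag y → flipOcc x (occ f) y ≡ occ f y
      off y le with pair? x y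
      ... | no _ = refl
      ... | yes e = ⊥-elim (ℕP.<-irrefl (sym (pair-mag x y e)) (ℕP.≤-trans (ℕP.m≤n+m (suc (mag x)) (lim f)) le))
      h : ∀ n → lim f ℕ.+ suc (mag x) ℕ.≤ n → flipOcc x (occ f) (+ n) ≡ false
      h n le = trans (off (+ n) le) (hi f n (ℕP.≤-trans (ℕP.m≤m+n (lim f) _) le))
      l : ∀ n → lim f ℕ.+ suc (mag x) ℕ.≤ n → flipOcc x (occ f) -[1+ n ] ≡ true
      l n le = trans (off -[1+ n ] le) (lo f n (ℕP.≤-trans (ℕP.m≤m+n (lim f) _) le))

  flip-at : ∀ x f → occ (flip x f) x ≡ not (occ f x)
  flip-at x f = flip-on x (occ f) x (inj₁ refl)

  flip-cong≐ : ∀ {x f g} → f ≐ g → flip x f ≐ flip x g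
  flip-cong≐ {x} e y with pair? x y
  ... | yes _ = cong not (e y)
  ... | no _ = e y

  flip-flip : ∀ x f → flip x (flip x f) ≐ f
  flip-flip x f y with pair? x y
  ... | yes h = trans (cong not (flip-on x (occ f) y h)) (not-involutive (occ f y))
  ... | no n = flip-off x (occ f) y (λ e → n (inj₁ e)) (λ e → n (inj₂ e))

  flip-bar : ∀ x f → flip (bar x) f ≐ flip x f
  flip-bar x f y with pair? (bar x) y | pair? x y
  ... | yes _ | yes _ = refl
  ... | no _ | no _ = refl
  ... | yes (inj₁ e) | no n = ⊥-elim (n (inj₂ e))
  ... | yes (inj₂ e) | no n = ⊥-elim (n (inj₁ (trans e (bar-bar x))))
  ... | no n | yes (inj₁ e) = ⊥-elim (n (inj₂ (trans e (sym (bar-bar x)))))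
  ... | no n | yes (inj₂ e) = ⊥-elim (n (inj₁ e))

  flip-comm : ∀ x y f → flip x (flip y f) ≐ flip y (flip x f)
  flip-comm x y f z = go (pair? x z) (pair? y z)
    where
      go : Dec (z ≡ x ⊎ z ≡ bar x) → Dec (z ≡ y ⊎ z ≡ bar y) → occ (flip x (flip y f)) z ≡ occ (flip y (flip x f)) z
      go (yes p) (yes q) = trans (flip-on x _ z p) (trans (cong not (flip-on y _ z q)) (sym (trans (flip-on y _ z q) (cong not (flip-on x _ z p)))))
      go (yes p) (no q) = trans (flip-on x _ z p) (trans (cong not (flip-off y _ z (λ e → q (inj₁ e)) (λ e → q (inj₂ e))))
        (sym (trans (flip-off y _ z (λ e → q (inj₁ e)) (λ e → q (inj₂ e))) (flip-on x _ z p))))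
      go (no p) (yes q) = trans (flip-off x _ z (λ e → p (inj₁ e)) (λ e → p (inj₂ e))) (trans (flip-on y _ z q)
        (sym (trans (flip-on y _ z q) (cong not (flip-off x _ z (λ e → p (inj₁ e)) (λ e → p (inj₂ e)))))))
      go (no p) (no q) = trans (flip-off x _ z (λ e → p (inj₁ e)) (λ e → p (inj₂ e))) (trans (flip-off y _ z (λ e → q (inj₁ e)) (λ e → q (inj₂ e)))
        (sym (trans (flip-off y _ z (λ e → q (inj₁ e)) (λ e → q (inj₂ e))) (flip-off x _ z (λ e → p (inj₁ e)) (λ e → p (inj₂ e))))))

  pair-bar : ∀ {x y} → y ≡ x ⊎ y ≡ bar x → bar y ≡ x ⊎ bar y ≡ bar x
  pair-bar (inj₁ refl) = inj₂ refl
  pair-bar {x} (inj₂ refl) = inj₁ (bar-bar x)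

  flip-SC : ∀ x {f} → SC f → SC (flip x f)
  flip-SC x {f} s y = go (pair? x y)
    where
      go : Dec (y ≡ x ⊎ y ≡ bar x) → occ (flip x f) (bar y) ≡ not (occ (flip x f) y)
      go (yes p) = trans (flip-on x _ (bar y) (pair-bar p)) (cong not (trans (s y) (sym (flip-on x _ y p))))
      go (no n) = trans (flip-off x _ (bar y) (λ e → n (inj₂ (bar-swap e))) (λ e → n (inj₁ (bar-inj e))))
        (trans (s y) (cong not (sym (flip-off x _ y (λ e → n (inj₁ e)) (λ e → n (inj₂ e))))))

  sgn : Bool → ℤ
  sgn true = 1ℤ
  sgn false = -1ℤ

  flip-diff : ∀ x {f} → SC f → ∀ z → χ (flip x f) z - χ f z ≡ sgn (occ f x) * (at (δ (bar x)) z - at (δ x) z)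
  flip-diff x {f} s z = go (z ℤP.≟ x) (z ℤP.≟ bar x)
    where
      go : Dec (z ≡ x) → Dec (z ≡ bar x) → χ (flip x f) z - χ f z ≡ sgn (occ f x) * (at (δ (bar x)) z - at (δ x) z)
      go (yes refl) _ rewrite flip-at z f | δ-at z | δ-off (bar z) z (x≢bar z) with occ f z
      ... | true = refl
      ... | false = refl
      go (no n) (yes refl) rewrite flip-on x (occ f) (bar x) (inj₂ refl) | δ-at (bar x) | δ-off x (bar x) n | s x with occ f x
      ... | true = refl
      ... | false = refl
      go (no n) (no n′) rewrite flip-off x (occ f) z n n′ | δ-off x z n | δ-off (bar x) z n′ =
        trans (ℤP.+-inverseʳ (χ f z)) (sym (ℤP.*-zeroʳ (sgn (occ f x))))

  E-flip : ∀ x {f} → SC f → E (flip x f) ≡ E f - sgn (occ f x) * w x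
  E-flip x {f} s = subz (trans (ring39 (E (flip x f)) (E f) (sgn (occ f x) * w x)) (trans (cong (λ e → e + sgn (occ f x) * w x) main) (ring40 (sgn (occ f x)) x)))
    where
      D = subFS (δ (bar x)) (δ x)
      a = sgn (occ f x)
      main : E (flip x f) - E f ≡ a * (bar x - x)
      main = trans (E-diff (flip x f) f)
        (trans (Σ-cong {mulFS idℤ (diff (flip x f) f)} {mulFS (λ _ → a) (subFS (mulFS idℤ (δ (bar x))) (mulFS idℤ (δ x)))}
          (λ z → trans (cong (z *_) (flip-diff x {f} s z)) (ring41 z a (at (δ (bar x)) z) (at (δ x) z))))
        (trans (Σ-scale a (subFS (mulFS idℤ (δ (bar x))) (mulFS idℤ (δ x))))
        (cong (a *_) (trans (Σ-sub (mulFS idℤ (δ (bar x))) (mulFS idℤ (δ x))) (cong₂ _-_ (Σ-mulδ idℤ (bar x)) (Σ-mulδ idℤ x))))))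

  E-flip-true : ∀ x {f} → SC f → occ f x ≡ true → E (flip x f) ≡ E f - w x
  E-flip-true x {f} s h = trans (E-flip x {f} s) (trans (cong (λ b → E f - sgn b * w x) h) (cong (λ e → E f - e) (ℤP.*-identityˡ (w x))))

  E-flip-false : ∀ x {f} → SC f → occ f x ≡ false → E (flip x f) ≡ E f + w x
  E-flip-false x {f} s h = trans (E-flip x {f} s) (trans (cong (λ b → E f - sgn b * w x) h) (ring42 (E f) (w x)))

  -- The flips move a bead between x and x̄ in `f` and between y and ȳ in `g`, in the same direction
  -- because the occupancies agree. From x ≡ y follows x̄ ≡ ȳ, so the two moves differ by a
  -- boundary.
  flip-Eqv : ∀ {d f g} x y k → SC f → SC g → Eqv d f g → y ≡ x + k * d → occ f x ≡ occ g y → Eqv d (flip x f) (flip y g)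
  flip-Eqv {d} {f} {g} x y k sf sg p e h = Bd-cong eq (Bd-add p (Bd-scale (sgn (occ f x))
      (Bd-sub (Bd-δ d x y k e) (Bd-δ d (bar x) (bar y) (- k) (trans (cong bar e) (trans (bar-+ x (k * d)) (ring204 (bar x) k d)))))))
    where
      lem₂ : ∀ F G f g a X X′ Y Y′ → F - f ≡ a * (X′ - X) → G - g ≡ a * (Y′ - Y) → F - G ≡ f - g + a * ((Y - X) - (Y′ - X′))
      lem₂ F G f g a X X′ Y Y′ e₁ e₂ = trans (ring169 F G f g) (trans (cong₂ (λ u v → f - g + (u - v)) e₁ e₂) (ring43 f g a X X′ Y Y′))
      eq : ∀ z → χ (flip x f) z - χ (flip y g) z ≡ χ f z - χ g z + sgn (occ f x) * ((at (δ y) z - at (δ x) z) - (at (δ (bar y)) z - at (δ (bar x)) z))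
      eq z = lem₂ (χ (flip x f) z) (χ (flip y g) z) (χ f z) (χ g z) (sgn (occ f x)) (at (δ x) z) (at (δ (bar x)) z) (at (δ y) z) (at (δ (bar y)) z)
        (flip-diff x {f} sf z) (trans (flip-diff y {g} sg z) (cong (λ b → sgn b * _) (sym h)))

  -- The points x and x̄ are w x apart, so the moved bead stays on its runner.
  flip-self : ∀ {d} f x → SC f → d ∣ w x → Eqv d (flip x f) f
  flip-self {d} f x s (divides q e) = Bd-cong (flip-diff x {f} s) (Bd-scale (sgn (occ f x))
    (Bd-δ d x (bar x) (- q) (trans (bar≡+ x) (trans (cong (λ u → x - u) e) (ring204 x q d)))))

  -- The two flips amount to moving the bead x to y and the bead ȳ to x̄, both within a class. The
  -- proof compares with flipping y twice.
  flip-two : ∀ {d} f x y k → SC f → y ≡ x + k * d → occ f x ≡ true → occ f y ≡ false → y ≢ bar x → Eqv d (flip x (flip y f)) f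
  flip-two {d} f x y k s e hx hy n = Eqv-trans {d} {flip x (flip y f)} {flip y (flip y f)} {f}
    (flip-Eqv {d} {flip y f} {flip y f} x y k (flip-SC y {f} s) (flip-SC y {f} s) (Eqv-refl {d} {flip y f} {flip y f} (λ _ → refl)) e
      (trans (flip-off y (occ f) x (λ { refl → contra hx hy }) (λ eb → n (sym (trans (cong bar eb) (bar-bar y))))) (trans hx (sym (trans (flip-at y f) (cong not hy))))))
    (Eqv-refl {d} {flip y (flip y f)} {f} (flip-flip y f))

  x+d≢x : ∀ {d} → 0ℤ < d → ∀ x → x + d ≢ x
  x+d≢x {d} pos x e = pos-nonzero pos (trans (ring44 x d) (trans (cong (_- x) e) (ℤP.+-inverseʳ x)))

  -- The runner of b loses its top bead and the runner of b̄ has its lowest gap filled; the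
  -- condition on `w b` keeps the two runners distinct.
  flip-core : ∀ {d} f b → 0ℤ < d → SC f → Core d f → occ f b ≡ true → occ f (b + d) ≡ false → ¬ (d ∣ w b) → Core d (flip b f)
  flip-core {d} f b pos s c hb hb′ nd x h = go (x ℤP.≟ b) (x ℤP.≟ bar b)
    where
      go : Dec (x ≡ b) → Dec (x ≡ bar b) → occ (flip b f) x ≡ true
      go (yes refl) _ = contra h (trans (flip-off b (occ f) (b + d) (x+d≢x pos b) (λ e → nd (divides -1ℤ (lem b d e)))) hb′)
        where
          lem : ∀ b d → b + d ≡ bar b → w b ≡ -1ℤ * d
          lem b d e = trans (ring45 b) (trans (cong (λ u → b - u) (sym e)) (ring46 b d))
      go (no _) (yes refl) = trans (flip-on b (occ f) (bar b) (inj₂ refl)) (cong not (SC-true {f} s hb))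
      go (no n) (no n′) = trans (flip-off b (occ f) x n n′) (go′ ((x + d) ℤP.≟ b) ((x + d) ℤP.≟ bar b))
        where
          go′ : Dec (x + d ≡ b) → Dec (x + d ≡ bar b) → occ f x ≡ true
          go′ (yes e) _ = contra h (trans (cong (occ (flip b f)) e) (trans (flip-at b f) (cong not hb)))
          go′ (no _) (yes e) = trans (cong (occ f) x≡) (SC-false {f} s hb′)
            where
              x≡ : x ≡ bar (b + d)
              x≡ = trans (sym (y-d+d x d)) (trans (cong (_- d) e) (ring47 b d))
          go′ (no m) (no m′) = c x (trans (sym (flip-off b (occ f) (x + d) m m′)) h)

  -- Beta-sets of partitions

  -- The parts after the first one have row index one less in the tail, hence the shift by 1; the
  -- empty list is the vacuum.
  beta : List ℕ → ℤ → Bool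
  beta [] y = neg? y
  beta (x ∷ xs) y = does (y ℤP.≟ (+ x - 1ℤ)) ∨ beta xs (y + 1ℤ)

  does-no : ∀ {x y : ℤ} → x ≢ y → does (x ℤP.≟ y) ≡ false
  does-no {x} {y} n with x ℤP.≟ y
  ... | yes e = ⊥-elim (n e)
  ... | no _ = refl

  does-yes : ∀ {x y : ℤ} → x ≡ y → does (x ℤP.≟ y) ≡ true
  does-yes {x} {y} e with x ℤP.≟ y
  ... | yes _ = refl
  ... | no n = ⊥-elim (n e)

  does-⇔ : ∀ {x y u v : ℤ} → (x ≡ y → u ≡ v) → (u ≡ v → x ≡ y) → does (x ℤP.≟ y) ≡ does (u ℤP.≟ v)
  does-⇔ {x} {y} {u} {v} p q with x ℤP.≟ y | u ℤP.≟ v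
  ... | yes _ | yes _ = refl
  ... | no _ | no _ = refl
  ... | yes e | no n = ⊥-elim (n (p e))
  ... | no n | yes e = ⊥-elim (n (q e))

  +x-1 : ∀ x n → + n ≡ + x - 1ℤ → suc n ≡ x
  +x-1 (suc x) n e = cong suc (ℤP.+-injective e)

  beta-lim : ∀ xs n → sum xs ℕ.+ length xs ℕ.≤ n → beta xs (+ n) ≡ false
  beta-lim [] n h = refl
  beta-lim (x ∷ xs) n h
    rewrite does-no {+ n} {+ x - 1ℤ} (λ e → ℕP.<-irrefl refl (subst (ℕ._≤ n) (sym (+x-1 x n e)) (ℕP.≤-trans (ℕP.m≤m+n x _) (subst (ℕ._≤ n) (ℕP.+-assoc x (sum xs) _) h))))
    = beta-lim xs (n ℕ.+ 1) (ℕP.≤-trans (ℕP.≤-trans (ℕP.+-monoʳ-≤ (sum xs) (ℕP.n≤1+n (length xs))) (ℕP.≤-trans (ℕP.m≤n+m _ x) (ℕP.≤-reflexive (sym (ℕP.+-assoc x (sum xs) _))))) (ℕP.≤-trans h (ℕP.m≤m+n n 1)))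

  beta-low : ∀ xs n → length xs ℕ.≤ n → beta xs -[1+ n ] ≡ true
  beta-low [] n h = refl
  beta-low (x ∷ xs) (suc n) (s≤s h) rewrite beta-low xs n h = ∨-zeroʳ _

  toMaya : List ℕ → Maya
  toMaya xs = mkMaya (beta xs) (sum xs ℕ.+ length xs) (beta-lim xs) (λ n h → beta-low xs n (ℕP.≤-trans (ℕP.m≤n+m (length xs) (sum xs)) h))

  data Desc : ℕ → List ℕ → Set where
    nil : ∀ {b} → Desc b []
    cons : ∀ {b x xs} → 1 ℕ.≤ x → x ℕ.≤ b → Desc x xs → Desc b (x ∷ xs)

  Desc-head : ∀ {b x xs} → Desc b (x ∷ xs) → Desc x (x ∷ xs)
  Desc-head (cons p q r) = cons p ℕP.≤-refl r

  Desc-weaken : ∀ {b c xs} → b ℕ.≤ c → Desc b xs → Desc c xs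
  Desc-weaken h nil = nil
  Desc-weaken h (cons p q r) = cons p (ℕP.≤-trans q h) r

  toDesc : ∀ xs → T (isPartition xs) → Σ[ b ∈ ℕ ] Desc b xs
  toDesc [] _ = 0 , nil
  toDesc (x ∷ []) v = x , cons (ℕP.≤ᵇ⇒≤ 1 x v) ℕP.≤-refl nil
  toDesc (x ∷ y ∷ xs) v = x , extend (ℕP.≤ᵇ⇒≤ y x (proj₁ (split v))) (proj₂ (toDesc (y ∷ xs) (proj₂ (split v))))
    where
      split : T ((y ℕ.≤ᵇ x) ∧ isPartition (y ∷ xs)) → T (y ℕ.≤ᵇ x) × T (isPartition (y ∷ xs))
      split = Equivalence.to (T-∧ {y ℕ.≤ᵇ x})
      extend : ∀ {b} → y ℕ.≤ x → Desc b (y ∷ xs) → Desc x (x ∷ y ∷ xs)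
      extend h (cons p q r) = cons (ℕP.≤-trans p h) ℕP.≤-refl (cons p h r)

  fromDesc : ∀ {b xs} → Desc b xs → T (isPartition xs)
  fromDesc nil = tt
  fromDesc (cons p q nil) = ℕP.≤⇒≤ᵇ p
  fromDesc (cons p q r@(cons p′ q′ r′)) = Equivalence.from T-∧ (ℕP.≤⇒≤ᵇ q′ , fromDesc r)

  desc : (κ : Partition) → Σ[ b ∈ ℕ ] Desc b (parts κ)
  desc κ = toDesc (parts κ) (valid κ)

  beta-hi : ∀ {b xs} → Desc b xs → ∀ n → b ℕ.≤ n → beta xs (+ n) ≡ false
  beta-hi nil n h = refl
  beta-hi {b} (cons {x = x} {xs = xs} p q r) n h
    rewrite does-no {+ n} {+ x - 1ℤ} (λ e → ℕP.<-irrefl refl (ℕP.≤-trans (ℕP.≤-reflexive (+x-1 x n e)) (ℕP.≤-trans q h)))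
    = beta-hi r (n ℕ.+ 1) (ℕP.≤-trans q (ℕP.≤-trans h (ℕP.m≤m+n n 1)))

  x-1+1 : ∀ x → x - 1ℤ + 1ℤ ≡ x
  x-1+1 = solve-∀

  x+1-1 : ∀ x → x + 1ℤ - 1ℤ ≡ x
  x+1-1 = solve-∀

  χ-cons : ∀ {b x xs} → Desc b (x ∷ xs) → ∀ y → ind (beta (x ∷ xs) y) ≡ at (δ (+ x - 1ℤ)) y + ind (beta xs (y + 1ℤ))
  χ-cons {b} {x} {xs} (cons p q r) y = go (y ℤP.≟ (+ x - 1ℤ))
    where
      go : Dec (y ≡ + x - 1ℤ) → ind (beta (x ∷ xs) y) ≡ at (δ (+ x - 1ℤ)) y + ind (beta xs (y + 1ℤ))
      go (yes e) = trans (cong (λ b → ind (b ∨ beta xs (y + 1ℤ))) (does-yes e)) (sym (cong₂ (λ b c → ind b + ind c) (does-yes e)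
        (trans (cong (λ u → beta xs (u + 1ℤ)) e) (trans (cong (beta xs) (x-1+1 (+ x))) (beta-hi r x ℕP.≤-refl)))))
      go (no n) = trans (cong (λ b → ind (b ∨ beta xs (y + 1ℤ))) (does-no n))
        (trans (sym (ℤP.+-identityˡ _)) (cong (λ b → ind b + ind (beta xs (y + 1ℤ))) (sym (does-no n))))

  vac-step : ∀ y → χ vac (y + 1ℤ) - χ vac y ≡ - at (δ -1ℤ) y
  vac-step (+ n) = refl
  vac-step -[1+ zero ] = refl
  vac-step -[1+ suc n ] = refl

  -- A new first part puts a bead at x - 1 and pushes all others one place to the left; the vacuum
  -- pushed in this way loses the point -1.
  cons-diff : ∀ {b x xs} → Desc b (x ∷ xs) → ∀ y →
    at (diff (toMaya (x ∷ xs)) vac) y ≡ at (subFS (addFS (δ (+ x - 1ℤ)) (shiftFS -1ℤ (diff (toMaya xs) vac))) (δ -1ℤ)) y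
  cons-diff {x = x} {xs = xs} D y = trans (cong (_- χ vac y) (χ-cons D y))
    (trans (ring48 (at (δ (+ x - 1ℤ)) y) (ind (beta xs (y + 1ℤ))) (χ vac (y + 1ℤ)) (χ vac y))
      (cong (λ e → at (δ (+ x - 1ℤ)) y + (ind (beta xs (y + 1ℤ)) - χ vac (y + 1ℤ)) + e) (vac-step y)))

  charge-partition : ∀ {b xs} → Desc b xs → charge (toMaya xs) ≡ 0ℤ
  charge-partition nil = refl
  charge-partition {b} D@(cons {x = x} {xs = xs} p q r) =
    trans (Σ-cong {diff (toMaya (x ∷ xs)) vac} {subFS (addFS (δ (+ x - 1ℤ)) S) (δ -1ℤ)} (cons-diff D))
    (trans (Σ-sub (addFS (δ (+ x - 1ℤ)) S) (δ -1ℤ))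
    (trans (cong₂ _-_ (trans (Σ-add (δ (+ x - 1ℤ)) S) (cong₂ _+_ (Σ-δ (+ x - 1ℤ)) (trans (Σ-shift -1ℤ (diff (toMaya xs) vac)) (charge-partition r)))) (Σ-δ -1ℤ)) refl))
    where S = shiftFS -1ℤ (diff (toMaya xs) vac)

  E-partition : ∀ {b xs} → Desc b xs → E (toMaya xs) ≡ + sum xs
  E-partition nil = refl
  E-partition {b} D@(cons {x = x} {xs = xs} p q r) =
    trans (Σ-cong {mulFS idℤ (diff (toMaya (x ∷ xs)) vac)} {G} (λ y → trans (cong (y *_) (cons-diff D y)) (ring49 y (at (δ (+ x - 1ℤ)) y) (at S₀ (y - -1ℤ)) (at (δ -1ℤ) y))))
    (trans (Σ-sub (addFS A (subFS B C)) Z)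
    (trans (cong₂ _-_ (trans (Σ-add A (subFS B C)) (cong₂ _+_ (Σ-mulδ idℤ (+ x - 1ℤ)) (trans (Σ-sub B C)
        (cong₂ _-_ (trans (Σ-shift -1ℤ (mulFS idℤ S₀)) (E-partition r)) (trans (Σ-shift -1ℤ S₀) (charge-partition r)))))) (Σ-mulδ idℤ -1ℤ))
    (trans (ring50 (+ x) (+ sum xs)) (sym (ℤP.pos-+ x (sum xs))))))
    where
      S₀ = diff (toMaya xs) vac
      A = mulFS idℤ (δ (+ x - 1ℤ))
      B = shiftFS -1ℤ (mulFS idℤ S₀)
      C = shiftFS -1ℤ S₀
      Z = mulFS idℤ (δ -1ℤ)
      G = subFS (addFS A (subFS B C)) Z

  may : Partition → Maya
  may κ = toMaya (parts κ)

  E-size : ∀ κ → E (may κ) ≡ + size κ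
  E-size κ = E-partition (proj₂ (desc κ))

  charge-may : ∀ κ → charge (may κ) ≡ 0ℤ
  charge-may κ = charge-partition (proj₂ (desc κ))

  beta-inj : ∀ {b c xs ys} → Desc b xs → Desc c ys → (∀ z → beta xs z ≡ beta ys z) → xs ≡ ys
  beta-inj nil nil e = refl
  beta-inj nil (cons {x = suc y} {xs = ys} p q r) e with trans (e (+ y)) (cong (_∨ beta ys (+ y + 1ℤ)) (does-yes {+ y} {+ y} refl))
  ... | ()
  beta-inj (cons {x = suc y} {xs = ys} p q r) nil e with trans (sym (e (+ y))) (cong (_∨ beta ys (+ y + 1ℤ)) (does-yes {+ y} {+ y} refl))
  ... | ()
  beta-inj D₁@(cons {x = suc x} {xs = xs} p q r) D₂@(cons {x = suc y} {xs = ys} p′ q′ r′) e = cong₂ _∷_ x≡y (beta-inj r r′ tails)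
    where
      top : ∀ {x xs y ys} → Desc (suc y) (suc y ∷ ys) → (∀ z → beta (suc x ∷ xs) z ≡ beta (suc y ∷ ys) z) → x ℕ.≤ y
      top {x} {xs} {y} {ys} D e with x ℕP.≤? y
      ... | yes le = le
      ... | no gt = ⊥-elim (contra (cong (_∨ beta xs (+ x + 1ℤ)) (does-yes {+ x} {+ x} refl)) (trans (e (+ x)) (beta-hi D x (ℕP.≰⇒> gt))))
      x≡y : suc x ≡ suc y
      x≡y = cong suc (ℕP.≤-antisym (top {x} {xs} {y} {ys} (Desc-head D₂) e) (top {y} {ys} {x} {xs} (Desc-head D₁) (λ z → sym (e z))))
      pt : ∀ x xs z → z ≢ + suc x → beta (suc x ∷ xs) (z - 1ℤ) ≡ beta xs z
      pt x xs z n = trans (cong (_∨ beta xs (z - 1ℤ + 1ℤ)) (does-no {z - 1ℤ} {+ suc x - 1ℤ} (λ e → n (trans (sym (x-1+1 z)) (trans (cong (_+ 1ℤ) e) (x-1+1 (+ suc x)))))))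
        (cong (beta xs) (x-1+1 z))
      tails : ∀ z → beta xs z ≡ beta ys z
      tails z = go (z ℤP.≟ + suc x)
        where
          go : Dec (z ≡ + suc x) → beta xs z ≡ beta ys z
          go (yes refl) = trans (beta-hi r (suc x) ℕP.≤-refl) (sym (beta-hi r′ (suc x) (ℕP.≤-reflexive (sym x≡y))))
          go (no n) = trans (sym (pt x xs z n)) (trans (e (z - 1ℤ)) (pt y ys z (λ h → n (trans h (cong +_ (sym x≡y))))))

  may-inj : ∀ κ μ → may κ ≐ may μ → κ ≡ μ
  may-inj κ@(mkPartition xs v) μ@(mkPartition ys v′) e = go (beta-inj (proj₂ (desc κ)) (proj₂ (desc μ)) e) v′
    where go : ∀ {ys} → xs ≡ ys → (v′ : T (isPartition ys)) → mkPartition xs v ≡ mkPartition ys v′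
          go refl v′ = cong (mkPartition xs) (T-irrelevant v v′)

  -- Partitions from diagrams of charge zero

  shiftMaya : ℤ → Maya → Maya
  shiftMaya k f = mkMaya (λ z → occ f (z - k)) (lim f ℕ.+ suc ∣ k ∣)
    (λ n h → hi′ (+ n - k) (mag-shift′ (+ n) k (lim f) h) (sgn′ n k (ℕP.≤-trans (ℕP.m≤n+m _ (lim f)) h)))
    (λ n h → lo′ (-[1+ n ] - k) (mag-shift′ -[1+ n ] k (lim f) h) (sgn″ n k (ℕP.≤-trans (ℕP.m≤n+m _ (lim f)) h)))
    where
      hi′ : ∀ z → lim f ℕ.≤ mag z → NN z → occ f z ≡ false
      hi′ (+ n) h _ = hi f n h
      lo′ : ∀ z → lim f ℕ.≤ mag z → NN (-1ℤ - z) → occ f z ≡ true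
      lo′ -[1+ n ] h _ = lo f n h
      lo′ (+ n) h p = ⊥-elim (nn-neg-absurd n p (lem n))
        where lem : ∀ n → -1ℤ - + n ≡ -[1+ n ]
              lem zero = refl
              lem (suc n) = refl
      absk : ∀ k → NN (+ ∣ k ∣ - k)
      absk (+ n) = nn≡ (ℤP.+-inverseʳ (+ n))
      absk -[1+ n ] = +≤+ z≤n
      absk′ : ∀ k → NN (+ ∣ k ∣ + k)
      absk′ (+ n) = +≤+ z≤n
      absk′ -[1+ n ] = nn≡ (ℤP.+-inverseʳ (+ suc n))
      sgn′ : ∀ n k → suc ∣ k ∣ ℕ.≤ n → NN (+ n - k)
      sgn′ n k h = nn-cast (ring51 (+ n) (+ ∣ k ∣) k) (nn+ (nn≤ (+≤+ (ℕP.≤-trans (ℕP.n≤1+n _) h))) (absk k))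
      sgn″ : ∀ n k → suc ∣ k ∣ ℕ.≤ n → NN (-1ℤ - (-[1+ n ] - k))
      sgn″ n k h = nn-cast (ring52 (+ n) (+ ∣ k ∣) k) (nn+ (nn≤ (+≤+ (ℕP.≤-trans (ℕP.n≤1+n _) h))) (absk′ k))

  vac-pred : ∀ z → χ vac (z - 1ℤ) - χ vac z ≡ at (δ 0ℤ) z
  vac-pred (+ zero) = refl
  vac-pred (+ suc n) = refl
  vac-pred -[1+ n ] = refl

  charge-shift1 : ∀ f → charge (shiftMaya 1ℤ f) ≡ charge f + 1ℤ
  charge-shift1 f = trans (Σ-cong {diff (shiftMaya 1ℤ f) vac} {addFS (shiftFS 1ℤ (diff f vac)) (δ 0ℤ)}
      (λ z → trans (ring29 (χ f (z - 1ℤ)) (χ vac (z - 1ℤ)) (χ vac z)) (cong (λ e → χ f (z - 1ℤ) - χ vac (z - 1ℤ) + e) (vac-pred z))))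
    (trans (Σ-add (shiftFS 1ℤ (diff f vac)) (δ 0ℤ)) (cong₂ _+_ (Σ-shift 1ℤ (diff f vac)) (Σ-δ 0ℤ)))

  charge-cong : ∀ {f g} → f ≐ g → charge f ≡ charge g
  charge-cong {f} {g} e = Σ-cong {diff f vac} {diff g vac} (λ x → cong (λ b → ind b - χ vac x) (e x))

  charge-shift : ∀ n f → charge (shiftMaya (+ n) f) ≡ charge f + + n
  charge-shift zero f = trans (charge-cong {shiftMaya 0ℤ f} {f} (λ x → cong (occ f) (ℤP.+-identityʳ x))) (sym (ℤP.+-identityʳ _))
  charge-shift (suc n) f = trans (charge-cong {shiftMaya (+ suc n) f} {shiftMaya 1ℤ (shiftMaya (+ n) f)} (λ x → cong (occ f) (ring5 x (+ n))))
    (trans (charge-shift1 (shiftMaya (+ n) f)) (trans (cong (_+ 1ℤ) (charge-shift n f)) (ring53 (charge f) (+ n))))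

  -- The charge fixes the origin, since a shift to the right by k adds k to it. For negative k the
  -- relation is read as a shift of `f` instead of `g`.
  shift-charge0 : ∀ f g k → charge f ≡ 0ℤ → charge g ≡ 0ℤ → (∀ z → occ f z ≡ occ g (z - k)) → k ≡ 0ℤ
  shift-charge0 f g (+ n) cf cg e = trans (sym (trans (cong (_+ + n) cg) (ℤP.+-identityˡ (+ n)))) (trans (sym (charge-shift n g)) (trans (sym (charge-cong {f} {shiftMaya (+ n) g} e)) cf))
  shift-charge0 f g -[1+ n ] cf cg e = ⊥-elim (lem₀ (trans (sym (trans (cong (_+ + suc n) cf) (ℤP.+-identityˡ (+ suc n)))) (trans (sym (charge-shift (suc n) f))
      (trans (charge-cong {shiftMaya (+ suc n) f} {g} (λ z → trans (e _) (cong (occ g) (ring6 z (+ suc n))))) cg))))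
    where
      lem₀ : + suc n ≢ 0ℤ
      lem₀ ()

  -- A bead met before any gap would give a part 0; it belongs to the vacuum already and must not be
  -- listed.
  consPos : ℕ → List ℕ → List ℕ
  consPos zero xs = xs
  consPos (suc c) xs = suc c ∷ xs

  consPos-Desc : ∀ {c xs} → Desc c xs → Desc c (consPos c xs)
  consPos-Desc {zero} D = D
  consPos-Desc {suc c} D = cons (s≤s z≤n) ℕP.≤-refl D

  consPos-beta : ∀ {c xs} → Desc c xs → ∀ y → beta (consPos c xs) y ≡ does (y ℤP.≟ (+ c - 1ℤ)) ∨ beta xs (y + 1ℤ)
  consPos-beta {suc c} D y = refl
  consPos-beta {zero} nil (+ n) = sym (cong (_∨ false) (does-no {+ n} { -1ℤ} (λ ())))
  consPos-beta {zero} nil -[1+ zero ] = refl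
  consPos-beta {zero} nil -[1+ suc n ] = sym (∨-zeroʳ (does (-[1+ suc n ] ℤP.≟ -1ℤ)))
  consPos-beta {zero} (cons p q r) y = ⊥-elim (ℕP.<-irrefl refl (ℕP.≤-trans p q))

  p<p+1 : ∀ p → p < p + 1ℤ
  p<p+1 p = subst (_< p + 1ℤ) (ℤP.+-identityʳ p) (ℤP.+-monoʳ-< p (+<+ (s≤s z≤n)))

  -- Reading a partition off a Maya diagram from left to right: each bead contributes a part
  -- equal to the number c of gaps met so far.
  record Scan (f : Maya) (p : ℤ) : Set where
    field
      c : ℕ
      acc : List ℕ
      dsc : Desc c acc
      below : ∀ z → z < p → beta acc (z - p + + c) ≡ occ f z
      above : ∀ z → p ≤ z → beta acc (z - p + + c) ≡ false

  scan-step : ∀ f p → Scan f p → Scan f (p + 1ℤ)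
  scan-step f p S with occ f p in eq
  ... | false = record
    { c = suc c ; acc = acc ; dsc = Desc-weaken (ℕP.n≤1+n c) dsc
    ; below = λ z h → trans (cong (beta acc) (ring54 z p (+ c))) (bel z h (z ℤP.≟ p))
    ; above = λ z h → trans (cong (beta acc) (ring54 z p (+ c))) (above z (ℤP.≤-trans (ℤP.i≤i+j p 1ℤ) h)) }
    where
      open Scan S
      bel : ∀ z → z < p + 1ℤ → Dec (z ≡ p) → beta acc (z - p + + c) ≡ occ f z
      bel z h (yes refl) = trans (above z ℤP.≤-refl) (sym eq)
      bel z h (no n) = below z (ℤP.≤∧≢⇒< (subst (z ≤_) (ring55 p) (ℤP.i<j⇒i≤pred[j] h)) n)
  ... | true = record
    { c = c ; acc = consPos c acc ; dsc = consPos-Desc dsc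
    ; below = λ z h → trans (consPos-beta dsc _) (trans (cong₂ _∨_ (does-⇔ (to z p (+ c)) (fro z p (+ c))) (cong (beta acc) (ring56 z p (+ c)))) (bel z h (z ℤP.≟ p)))
    ; above = λ z h → trans (consPos-beta dsc _) (trans (cong₂ _∨_ (does-no (λ e → ℤP.<-irrefl refl (ℤP.<-≤-trans (p<p+1 p) (subst (p + 1ℤ ≤_) (to z p (+ c) e) h)))) (cong (beta acc) (ring56 z p (+ c))))
                 (above z (ℤP.≤-trans (ℤP.i≤i+j p 1ℤ) h))) }
    where
      open Scan S
      to : ∀ z p c → z - (p + 1ℤ) + c ≡ c - 1ℤ → z ≡ p
      to z p c e = subz (trans (ring57 z p c) (zsub e))
      fro : ∀ z p c → z ≡ p → z - (p + 1ℤ) + c ≡ c - 1ℤ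
      fro z _ c refl = ring58 z c
      bel : ∀ z → z < p + 1ℤ → (D : Dec (z ≡ p)) → does (z ℤP.≟ p) ∨ beta acc (z - p + + c) ≡ occ f z
      bel z h (yes refl) = trans (cong (_∨ beta acc (z - z + + c)) (does-yes {z} {z} refl)) (sym eq)
      bel z h (no n) = trans (cong (_∨ beta acc (z - p + + c)) (does-no n)) (below z (ℤP.≤∧≢⇒< (subst (z ≤_) (ring55 p) (ℤP.i<j⇒i≤pred[j] h)) n))

  scan : ∀ f n → Scan f (- + lim f + + n)
  scan f zero = record { c = 0 ; acc = [] ; dsc = nil ; below = bel ; above = abv }
    where
      N = lim f
      p = - + N + 0ℤ
      neg-true : ∀ z → z < 0ℤ → neg? z ≡ true
      neg-true -[1+ n ] _ = refl
      neg-true (+ n) (+<+ ())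
      neg-false : ∀ z → NN z → neg? z ≡ false
      neg-false (+ n) _ = refl
      occ-true : ∀ z → z < - + N → occ f z ≡ true
      occ-true -[1+ n ] h = lo f n (lem n N h)
        where lem : ∀ n N → -[1+ n ] < - + N → N ℕ.≤ n
              lem n zero h = z≤n
              lem n (suc N) (Data.Integer.-<- h) = h
      occ-true (+ n) h = ⊥-elim (lem n N h)
        where lem : ∀ n N → + n < - + N → ⊥
              lem n zero (+<+ ())
              lem n (suc N) ()
      bel : ∀ z → z < p → beta [] (z - p + 0ℤ) ≡ occ f z
      bel z h = trans (neg-true _ (subst (_< 0ℤ) (ring59 z p) (subst (z + - p <_) (ℤP.+-inverseʳ p) (ℤP.+-monoˡ-< (- p) h)))) (sym (occ-true z (subst (z <_) (ℤP.+-identityʳ _) h)))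
      abv : ∀ z → p ≤ z → beta [] (z - p + 0ℤ) ≡ false
      abv z h = neg-false _ (nn-cast (ring59 z p) (nn≤ h))
  scan f (suc n) = subst (Scan f) (ring60 (+ lim f) (+ n)) (scan-step f _ (scan f n))

  fromMaya : ∀ f → charge f ≡ 0ℤ → Σ[ κ ∈ Partition ] may κ ≐ f
  fromMaya f cf = mkPartition acc (fromDesc dsc) , λ z → sym (trans (sym (full z)) (cong (beta acc) (trans (ring94 z p (+ c)) (trans (cong (λ e → z - e) k0) (ℤP.+-identityʳ z)))))
    where
      N = lim f
      p = - + N + + (N ℕ.+ N)
      p≡N : p ≡ + N
      p≡N = trans (cong (λ e → - + N + e) (ℤP.pos-+ N N)) (ring61 (+ N))
      open Scan (scan f (N ℕ.+ N))
      full : ∀ z → beta acc (z - p + + c) ≡ occ f z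
      full z = [ below z , (λ h → trans (above z h) (sym (hi″ z (subst (_≤ z) p≡N h)))) ]′ (cmp z p)
        where
          cmp : ∀ z p → z < p ⊎ p ≤ z
          cmp z p with z ℤP.<? p
          ... | yes h = inj₁ h
          ... | no h = inj₂ (ℤP.≮⇒≥ h)
          hi″ : ∀ z → + N ≤ z → occ f z ≡ false
          hi″ (+ n) (+≤+ h) = hi f n h
      -- The scan reproduces `f` only up to this shift; both diagrams have charge 0, so there is
      -- none.
      k0 : p - + c ≡ 0ℤ
      k0 = shift-charge0 f (toMaya acc) (p - + c) cf (charge-partition dsc) (λ z → trans (sym (full z)) (cong (beta acc) (ring94 z p (+ c))))

  Σ-antisym : ∀ F → (∀ n → at F -[1+ n ] ≡ - at F (+ n)) → Σℤ F ≡ 0ℤ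
  Σ-antisym F h = go (bd F)
    where go : ∀ N → sumTo N (at F) ≡ 0ℤ
          go zero = refl
          go (suc N) rewrite h N | go N = trans (ℤP.+-identityˡ _) (ℤP.+-inverseʳ (at F (+ N)))

  SC-charge : ∀ {f} → SC f → charge f ≡ 0ℤ
  SC-charge {f} s = Σ-antisym (diff f vac) (λ n → lem (occ f (+ n)) (occ f -[1+ n ]) (trans (cong (occ f) (sym (bar-pos n))) (s (+ n))))
    where lem : ∀ a b → b ≡ not a → ind b - 1ℤ ≡ - (ind a - 0ℤ)
          lem true _ refl = refl
          lem false _ refl = refl

  -- Beta-sets, conjugate parts and self-conjugacy

  ∈B⇒ : ∀ xs {b} r → 1 ℕ.≤ r → b ≡ + nthPart xs r - + r → beta xs b ≡ true
  ∈B⇒ [] (suc r) _ refl = refl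
  ∈B⇒ (x ∷ xs) (suc zero) _ refl = cong (_∨ beta xs (+ x - 1ℤ + 1ℤ)) (does-yes {+ x - 1ℤ} refl)
  ∈B⇒ (x ∷ xs) {b} (suc (suc r)) _ e = trans (cong (does (b ℤP.≟ (+ x - 1ℤ)) ∨_) (∈B⇒ xs (suc r) (s≤s z≤n) (trans (cong (_+ 1ℤ) e) (ring62 (+ nthPart xs (suc r)) (+ suc r))))) (∨-zeroʳ _)

  ⇒∈B : ∀ xs {b} → beta xs b ≡ true → Σ[ r ∈ ℕ ] (1 ℕ.≤ r × b ≡ + nthPart xs r - + r)
  ⇒∈B [] { -[1+ n ]} h = suc n , s≤s z≤n , refl
  ⇒∈B (x ∷ xs) {b} h = go (b ℤP.≟ (+ x - 1ℤ)) h
    where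
      shift : (Σ[ r ∈ ℕ ] (1 ℕ.≤ r × b + 1ℤ ≡ + nthPart xs r - + r)) → Σ[ r ∈ ℕ ] (1 ℕ.≤ r × b ≡ + nthPart (x ∷ xs) r - + r)
      shift (suc r , p , e) = suc (suc r) , s≤s z≤n , trans (sym (x+1-1 b)) (trans (cong (_- 1ℤ) e) (ring63 (+ nthPart xs (suc r)) (+ suc r)))
      go : (D : Dec (b ≡ + x - 1ℤ)) → does D ∨ beta xs (b + 1ℤ) ≡ true → Σ[ r ∈ ℕ ] (1 ℕ.≤ r × b ≡ + nthPart (x ∷ xs) r - + r)
      go (yes e) _ = 1 , s≤s z≤n , e
      go (no _) h = shift (⇒∈B xs h)

  ∈B→ : ∀ {κ b} → b ∈B κ → occ (may κ) b ≡ true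
  ∈B→ {κ} (r , p , e) = ∈B⇒ (parts κ) r p e

  →∈B : ∀ {κ b} → occ (may κ) b ≡ true → b ∈B κ
  →∈B {κ} h = ⇒∈B (parts κ) h

  ¬∈B→ : ∀ {κ b} → ¬ (b ∈B κ) → occ (may κ) b ≡ false
  ¬∈B→ {κ} {b} n with occ (may κ) b in eq
  ... | false = refl
  ... | true = ⊥-elim (n (→∈B {κ} eq))

  conj# : List ℕ → ℕ → ℕ
  conj# xs r = length (filter (λ x → r ℕP.≤? x) xs)

  conj-≤ : ∀ x xs r → r ℕ.≤ x → conj# (x ∷ xs) r ≡ suc (conj# xs r)
  conj-≤ x xs r h = cong length (filter-accept (λ x → r ℕP.≤? x) {x} {xs} h)

  conj-≰ : ∀ x xs r → ¬ (r ℕ.≤ x) → conj# (x ∷ xs) r ≡ conj# xs r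
  conj-≰ x xs r h = cong length (filter-reject (λ x → r ℕP.≤? x) {x} {xs} h)

  conj-> : ∀ {b xs} r → Desc b xs → b ℕ.< r → conj# xs r ≡ 0
  conj-> r nil h = refl
  conj-> r (cons {x = x} {xs = xs} p q d) h = trans (conj-≰ x xs r (λ le → ℕP.<-irrefl refl (ℕP.<-≤-trans h (ℕP.≤-trans le q)))) (conj-> r d (ℕP.≤-<-trans q h))

  -- Along the boundary of the Young diagram beads are the steps that end rows and gaps the steps
  -- that end columns; column j + 1 ends at j minus its length.
  gap-intro : ∀ {b xs} → Desc b xs → ∀ j → beta xs (+ j - + conj# xs (suc j)) ≡ false
  gap-intro nil zero = refl
  gap-intro nil (suc j) = refl
  gap-intro D@(cons {x = x} {xs = xs} p q d) j = go (suc j ℕP.≤? x)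
    where
      ne : suc j ℕ.≤ x → + j - + suc (conj# xs (suc j)) ≢ + x - 1ℤ
      ne le e = nn-neg-absurd 0 (nn+ (nn+ (nn≤ (+≤+ le)) (nn-pos (conj# xs (suc j)))) (nn≡ (zsub e)))
        (ring64 (+ j) (+ conj# xs (suc j)) (+ x))
      go : Dec (suc j ℕ.≤ x) → beta (x ∷ xs) (+ j - + conj# (x ∷ xs) (suc j)) ≡ false
      go (yes le) = trans (cong (λ c → beta (x ∷ xs) (+ j - + c)) (conj-≤ x xs (suc j) le))
        (cong₂ _∨_ (does-no (ne le)) (trans (cong (beta xs) (ring62 (+ j) (+ conj# xs (suc j)))) (gap-intro d j)))
      go (no gt) = trans (cong (λ c → beta (x ∷ xs) (+ j - + c)) (trans (conj-≰ x xs (suc j) gt) (conj-> (suc j) d (ℕP.≰⇒> gt))))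
        (trans (cong (beta (x ∷ xs)) (ℤP.+-identityʳ (+ j))) (beta-hi (Desc-head D) j (ℕP.≤-pred (ℕP.≰⇒> gt))))

  gap-elim : ∀ {b xs} → Desc b xs → ∀ y → beta xs y ≡ false → Σ[ j ∈ ℕ ] y ≡ + j - + conj# xs (suc j)
  gap-elim nil (+ n) h = n , sym (ℤP.+-identityʳ (+ n))
  gap-elim (cons {x = x} {xs = xs} p q d) y h = go (y ℤP.≟ (+ x - 1ℤ)) h
    where
      fin : y ≢ + x - 1ℤ → (j : ℕ) → y + 1ℤ ≡ + j - + conj# xs (suc j) → Σ[ j ∈ ℕ ] y ≡ + j - + conj# (x ∷ xs) (suc j)
      fin n j e with suc j ℕP.≤? x
      ... | yes le = j , trans (sym (x+1-1 y)) (trans (cong (_- 1ℤ) e) (trans (ring63 (+ j) (+ conj# xs (suc j))) (cong (λ c → + j - + c) (sym (conj-≤ x xs (suc j) le)))))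
      ... | no gt = go′ j e gt
        where
          go′ : ∀ j → y + 1ℤ ≡ + j - + conj# xs (suc j) → ¬ (suc j ℕ.≤ x) → Σ[ j ∈ ℕ ] y ≡ + j - + conj# (x ∷ xs) (suc j)
          go′ zero e gt = ⊥-elim (gt p)
          go′ (suc j) e gt = j , trans y≡ (trans (sym (ℤP.+-identityʳ (+ j))) (cong (λ c → + j - + c) (sym (conj-> (suc j) (cons p ℕP.≤-refl d) (ℕP.≤∧≢⇒< x≤j x≢j))))) 
            where
              y≡ : y ≡ + j
              y≡ = trans (sym (x+1-1 y)) (trans (cong (_- 1ℤ) (trans e (trans (cong (λ c → + suc j - + c) (conj-> (suc (suc j)) d (ℕP.≰⇒> gt))) (ℤP.+-identityʳ (+ suc j))))) refl)
              x≤j : x ℕ.≤ suc j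
              x≤j = ℕP.≤-pred (ℕP.≰⇒> gt)
              x≢j : x ≢ suc j
              x≢j refl = n y≡
      go : (D : Dec (y ≡ + x - 1ℤ)) → does D ∨ beta xs (y + 1ℤ) ≡ false → Σ[ j ∈ ℕ ] y ≡ + j - + conj# (x ∷ xs) (suc j)
      go (no n) h with gap-elim d (y + 1ℤ) h
      ... | j , e = fin n j e

  -- Strong induction: at a first difference the larger of the two entries would be missing from the
  -- other sequence.
  enum-unique : ∀ (e e′ : ℕ → ℤ) → (∀ r → e (suc r) < e r) → (∀ r → e′ (suc r) < e′ r) →
    (∀ r → Σ[ j ∈ ℕ ] e r ≡ e′ j) → (∀ r → Σ[ j ∈ ℕ ] e′ r ≡ e j) → ∀ r → e r ≡ e′ r
  enum-unique e e′ de de′ to fro r = strong (suc r) r ℕP.≤-refl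
    where
      anti : ∀ (e : ℕ → ℤ) → (∀ r → e (suc r) < e r) → ∀ {i j} → i ℕ.≤ j → e j ≤ e i
      anti e de {i} {j} h = go (ℕP.≤⇒≤′ h)
        where go : ∀ {j} → i ℕ.≤′ j → e j ≤ e i
              go ℕ.≤′-refl = ℤP.≤-refl
              go (ℕ.≤′-step h) = ℤP.≤-trans (ℤP.<⇒≤ (de _)) (go h)
      santi : ∀ (e : ℕ → ℤ) → (∀ r → e (suc r) < e r) → ∀ {i j} → i ℕ.< j → e j < e i
      santi e de {i} {suc j} (s≤s h) = ℤP.<-≤-trans (de j) (anti e de h)
      half : ∀ (e e′ : ℕ → ℤ) → (∀ r → e (suc r) < e r) → (∀ r → e′ (suc r) < e′ r) → (∀ r → Σ[ j ∈ ℕ ] e′ r ≡ e j) →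
        ∀ r → (∀ i → i ℕ.< r → e i ≡ e′ i) → e′ r ≤ e r
      half e e′ de de′ fro r ih with fro r
      ... | j , eq with j ℕP.<? r
      ... | yes lt = ⊥-elim (ℤP.<-irrefl (trans eq (ih j lt)) (santi e′ de′ lt))
      ... | no ge = subst (_≤ e r) (sym eq) (anti e de (ℕP.≮⇒≥ ge))
      strong : ∀ n r → r ℕ.< n → e r ≡ e′ r
      strong (suc n) r (s≤s h) = ℤP.≤-antisym
        (half e′ e de′ de to r (λ i lt → sym (strong n i (ℕP.<-≤-trans lt h))))
        (half e e′ de de′ fro r (λ i lt → strong n i (ℕP.<-≤-trans lt h)))

  nth-≤ : ∀ {b xs} → Desc b xs → ∀ r → nthPart xs (suc r) ℕ.≤ b
  nth-≤ nil r = z≤n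
  nth-≤ (cons p q d) zero = q
  nth-≤ (cons p q d) (suc r) = ℕP.≤-trans (nth-≤ d r) q

  nth-anti : ∀ {b xs} → Desc b xs → ∀ r → nthPart xs (suc (suc r)) ℕ.≤ nthPart xs (suc r)
  nth-anti nil r = z≤n
  nth-anti (cons p q d) zero = nth-≤ d 0
  nth-anti (cons p q d) (suc r) = nth-anti d r

  conj-anti : ∀ xs r → conj# xs (suc r) ℕ.≤ conj# xs r
  conj-anti [] r = z≤n
  conj-anti (x ∷ xs) r = go (suc r ℕP.≤? x) (r ℕP.≤? x)
    where
      go : Dec (suc r ℕ.≤ x) → Dec (r ℕ.≤ x) → conj# (x ∷ xs) (suc r) ℕ.≤ conj# (x ∷ xs) r
      go (yes h) (yes h′) rewrite conj-≤ x xs (suc r) h | conj-≤ x xs r h′ = s≤s (conj-anti xs r)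
      go (yes h) (no n) = ⊥-elim (n (ℕP.≤-trans (ℕP.n≤1+n r) h))
      go (no n) (yes h′) rewrite conj-≰ x xs (suc r) n | conj-≤ x xs r h′ = ℕP.m≤n⇒m≤1+n (conj-anti xs r)
      go (no n) (no n′) rewrite conj-≰ x xs (suc r) n | conj-≰ x xs r n′ = conj-anti xs r

  dec-< : ∀ a b r → a ℕ.≤ b → + a - + suc r < + b - + r
  dec-< a b r h = ℤP.≤-<-trans (ℤP.+-monoˡ-≤ (- + suc r) (+≤+ h)) (ℤP.+-monoʳ-< (+ b) (ℤP.neg-mono-< (+<+ (ℕP.n<1+n r))))

  -- Bar carries the bead of row r to the gap of column r as soon as the row and the column have
  -- equal length.
  SelfConjugate⇒SC : ∀ κ → SelfConjugate κ → SC (may κ)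
  SelfConjugate⇒SC κ sc y with occ (may κ) y in eq
  ... | true with →∈B {κ} eq
  ... | suc r , p , e = trans (cong (beta xs) (trans (cong bar (trans e (cong (λ c → + c - + suc r) (sc (suc r) p)))) (ring65 (+ conj# xs (suc r)) (+ r)))) (gap-intro (proj₂ (desc κ)) r)
    where
      xs = parts κ
  SelfConjugate⇒SC κ sc y | false with gap-elim (proj₂ (desc κ)) y eq
  ... | j , e = ∈B→ {κ} (suc j , s≤s z≤n , trans (cong bar (trans e (cong (λ c → + j - + c) (sym (sc (suc j) (s≤s z≤n)))))) (ring66 (+ part κ (suc j)) (+ j)))

  -- Applying bar to the gaps listed by columns gives a second decreasing enumeration of the beads,
  -- which must agree with the enumeration by rows.
  SC⇒SelfConjugate : ∀ κ → SC (may κ) → SelfConjugate κ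
  SC⇒SelfConjugate κ s (suc r) _ = ℤP.+-injective (trans (ring317 (+ part κ (suc r)) (+ suc r)) (trans (cong (_+ + suc r) main) (sym (ring317 (+ conjPart κ (suc r)) (+ suc r)))))
    where
      xs = parts κ
      D = proj₂ (desc κ)
      e e′ : ℕ → ℤ
      e r = + nthPart xs (suc r) - + suc r
      e′ r = + conj# xs (suc r) - + suc r
      to : ∀ r → Σ[ j ∈ ℕ ] e r ≡ e′ j
      to r with gap-elim D (bar (e r)) (SC-true {may κ} s {e r} (∈B⇒ xs (suc r) (s≤s z≤n) refl))
      ... | j , q = j , trans (sym (bar-bar (e r))) (trans (cong bar q) (ring66 (+ conj# xs (suc j)) (+ j)))
      fro : ∀ r → Σ[ j ∈ ℕ ] e′ r ≡ e j
      fro r with ⇒∈B xs {bar (+ r - + conj# xs (suc r))} (SC-false {may κ} s (gap-intro D r))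
      ... | suc j , _ , q = j , trans (ring67 (+ conj# xs (suc r)) (+ r)) q
      main : e r ≡ e′ r
      main = enum-unique e e′ (λ r → dec-< _ _ (suc r) (nth-anti D r)) (λ r → dec-< _ _ (suc r) (conj-anti xs (suc r))) to fro r

  -- Rim hooks as bead moves

  setOcc : ℤ → Bool → Maya → Maya
  setOcc x b f = mkMaya (λ z → if does (z ℤP.≟ x) then b else occ f z) (lim f ℕ.+ suc (mag x))
    (λ n h → trans (off (+ n) h) (hi f n (ℕP.≤-trans (ℕP.m≤m+n (lim f) _) h)))
    (λ n h → trans (off -[1+ n ] h) (lo f n (ℕP.≤-trans (ℕP.m≤m+n (lim f) _) h)))
    where
      off : ∀ z → lim f ℕ.+ suc (mag x) ℕ.≤ mag z → (if does (z ℤP.≟ x) then b else occ f z) ≡ occ f z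
      off z h = cong (λ c → if c then b else occ f z) (does-no {z} {x} (λ { refl → ℕP.<-irrefl refl (ℕP.≤-trans (ℕP.m≤n+m (suc (mag x)) (lim f)) h) }))

  set-at : ∀ x b f → occ (setOcc x b f) x ≡ b
  set-at x b f = cong (λ c → if c then b else occ f x) (does-yes {x} refl)

  set-off : ∀ x b f z → z ≢ x → occ (setOcc x b f) z ≡ occ f z
  set-off x b f z n = cong (λ c → if c then b else occ f z) (does-no n)

  record Move (d : ℤ) (f g : Maya) (x : ℤ) : Set where
    field
      f-hi : occ f (x + d) ≡ true
      f-lo : occ f x ≡ false
      g-hi : occ g (x + d) ≡ false
      g-lo : occ g x ≡ true
      rest : ∀ z → z ≢ x → z ≢ x + d → occ g z ≡ occ f z

  χ-two : ∀ {f g p q} → occ f p ≡ true → occ f q ≡ false → occ g p ≡ false → occ g q ≡ true →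
    (∀ z → z ≢ q → z ≢ p → occ g z ≡ occ f z) → ∀ z → χ f z - χ g z ≡ at (δ p) z - at (δ q) z
  χ-two {f} {g} {p} {q} fp fq gp gq r z = go (z ℤP.≟ p) (z ℤP.≟ q)
    where
      p≢q : p ≢ q
      p≢q refl = contra fp fq
      go : Dec (z ≡ p) → Dec (z ≡ q) → χ f z - χ g z ≡ at (δ p) z - at (δ q) z
      go (yes refl) _ rewrite fp | gp | δ-at z | δ-off q z p≢q = refl
      go (no n) (yes refl) rewrite fq | gq | δ-at z | δ-off p z n = refl
      go (no n) (no n′) rewrite r z n′ n | δ-off p z n | δ-off q z n′ = ℤP.+-inverseʳ (χ f z)

  Move-Eqv : ∀ {d f g x} → Move d f g x → Eqv d f g
  Move-Eqv {d} {f} {g} {x} m = δ x , λ z → trans (χ-two {f} {g} {x + d} {x} (Move.f-hi m) (Move.f-lo m) (Move.g-hi m) (Move.g-lo m) (Move.rest m) z)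
    (cong (λ e → e - at (δ x) z) (δ-shift x d z))

  E-two : ∀ {f g p q} → (∀ z → χ f z - χ g z ≡ at (δ p) z - at (δ q) z) → E f - E g ≡ p - q
  E-two {f} {g} {p} {q} h = trans (E-diff f g)
    (trans (Σ-cong {mulFS idℤ (diff f g)} {subFS (mulFS idℤ (δ p)) (mulFS idℤ (δ q))} (λ z → trans (cong (z *_) (h z)) (ring22 z (at (δ p) z) (at (δ q) z))))
    (trans (Σ-sub (mulFS idℤ (δ p)) (mulFS idℤ (δ q))) (cong₂ _-_ (Σ-mulδ idℤ p) (Σ-mulδ idℤ q))))

  charge-Eqv : ∀ {d f g} → Eqv d f g → charge f ≡ charge g
  charge-Eqv {d} {f} {g} (V , p) = subz (trans (charge-diff f g) (trans (Σ-cong {diff f g} {subFS (shiftFS d V) V} p)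
    (trans (Σ-sub (shiftFS d V) V) (trans (cong (_- Σℤ V) (Σ-shift d V)) (ℤP.+-inverseʳ (Σℤ V))))))

  moveMaya : ℤ → Maya → ℤ → Maya
  moveMaya d f x = setOcc x true (setOcc (x + d) false f)

  moveMaya-Move : ∀ {d} f x → 0ℤ < d → occ f (x + d) ≡ true → occ f x ≡ false → Move d f (moveMaya d f x) x
  moveMaya-Move {d} f x pos h h′ = record
    { f-hi = h ; f-lo = h′
    ; g-hi = trans (set-off x true (setOcc (x + d) false f) (x + d) (x+d≢x pos x)) (set-at (x + d) false f)
    ; g-lo = set-at x true (setOcc (x + d) false f)
    ; rest = λ z n n′ → trans (set-off x true (setOcc (x + d) false f) z n) (set-off (x + d) false f z n′) }

  least : ∀ {P : ℕ → Set} → (∀ n → Dec (P n)) → ∀ n → P n → Σ[ i ∈ ℕ ] (P i × (∀ r → r ℕ.< i → ¬ P r))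
  least {P} P? n p = [ (λ r → r) , (λ h → n , p , h) ]′ (below n)
    where
      below : ∀ n → (Σ[ i ∈ ℕ ] (P i × (∀ r → r ℕ.< i → ¬ P r))) ⊎ (∀ r → r ℕ.< n → ¬ P r)
      below zero = inj₂ (λ r ())
      below (suc n) with below n
      ... | inj₁ r = inj₁ r
      ... | inj₂ h with P? n
      ... | yes p = inj₁ (n , p , h)
      ... | no np = inj₂ λ r lt → [ h r , (λ { refl → np }) ]′ (ℕP.m≤n⇒m<n∨m≡n (ℕP.≤-pred lt))

  greatest : ∀ {P : ℕ → Set} → (∀ n → Dec (P n)) → ∀ i → P i → ∀ R → (∀ r → R ℕ.≤ r → ¬ P r) →
    Σ[ j ∈ ℕ ] (P j × i ℕ.≤ j × (∀ r → j ℕ.< r → ¬ P r))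
  greatest P? i p zero h = ⊥-elim (h i z≤n p)
  greatest P? i p (suc R) h with P? R
  ... | yes pR = R , pR , ℕP.≮⇒≥ (λ lt → h i lt p) , h
  ... | no np = greatest P? i p R (λ r le → [ h r , (λ { refl → np }) ]′ (ℕP.m≤n⇒m<n∨m≡n le))

  bead : Partition → ℕ → ℤ
  bead κ r = + part κ r - + r

  part-anti : ∀ κ r → 1 ℕ.≤ r → part κ (suc r) ℕ.≤ part κ r
  part-anti κ (suc r) _ = nth-anti (proj₂ (desc κ)) r

  bead-step : ∀ κ r → 1 ℕ.≤ r → bead κ (suc r) < bead κ r
  bead-step κ r p = dec-< _ _ r (part-anti κ r p)

  bead-anti : ∀ κ {r r′} → 1 ℕ.≤ r → r ℕ.≤ r′ → bead κ r′ ≤ bead κ r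
  bead-anti κ {r} {r′} p h = go (ℕP.≤⇒≤′ h)
    where go : ∀ {r′} → r ℕ.≤′ r′ → bead κ r′ ≤ bead κ r
          go ℕ.≤′-refl = ℤP.≤-refl
          go (ℕ.≤′-step h) = ℤP.≤-trans (ℤP.<⇒≤ (bead-step κ _ (ℕP.≤-trans p (ℕP.≤′⇒≤ h)))) (go h)

  bead-strict : ∀ κ {r r′} → 1 ℕ.≤ r → r ℕ.< r′ → bead κ r′ < bead κ r
  bead-strict κ {r} {suc r′} p (s≤s h) = ℤP.<-≤-trans (bead-step κ r′ (ℕP.≤-trans p h)) (bead-anti κ p h)

  occ-bead : ∀ κ r → 1 ℕ.≤ r → occ (may κ) (bead κ r) ≡ true
  occ-bead κ r p = ∈B→ {κ} (r , p , refl)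

  nth-beyond : ∀ xs r → length xs ℕ.< r → nthPart xs r ≡ 0
  nth-beyond [] r h = refl
  nth-beyond (x ∷ xs) (suc zero) (s≤s ())
  nth-beyond (x ∷ xs) (suc (suc r)) (s≤s h) = nth-beyond xs (suc r) h

  bead-< : ∀ {a b} r → a ℕ.< b → + a - + r < + b - + r
  bead-< r h = ℤP.+-monoˡ-< (- + r) (+<+ h)

  bead-<⁻¹ : ∀ {a b} r → + a - + r < + b - + r → a ℕ.< b
  bead-<⁻¹ r h = ℕP.≰⇒> (λ le → ℤP.<⇒≱ h (ℤP.+-monoˡ-≤ (- + r) (+≤+ le)))

  path-trans : ∀ {D r c r′ c′ r″ c″} → PathIn D r c r′ c′ → PathIn D r′ c′ r″ c″ → PathIn D r c r″ c″
  path-trans here q = q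
  path-trans (step a d p) q = step a d (path-trans p q)

  adj-sym : ∀ {r c r′ c′} → Adjacent r c r′ c′ → Adjacent r′ c′ r c
  adj-sym (inj₁ (e , inj₁ h)) = inj₁ (sym e , inj₂ h)
  adj-sym (inj₁ (e , inj₂ h)) = inj₁ (sym e , inj₁ h)
  adj-sym (inj₂ (e , inj₁ h)) = inj₂ (sym e , inj₂ h)
  adj-sym (inj₂ (e , inj₂ h)) = inj₂ (sym e , inj₁ h)

  path-sym : ∀ {D : ℕ → ℕ → Set} {r c r′ c′} → D r c → PathIn D r c r′ c′ → PathIn D r′ c′ r c
  path-sym d here = here
  path-sym d (step a d′ p) = path-trans (path-sym d′ p) (step (adj-sym a) d here)

  path-crossing : ∀ {D : ℕ → ℕ → Set} {r₁ c₁ r₂ c₂} r → D r₁ c₁ → r₁ ℕ.≤ r → r ℕ.< r₂ → PathIn D r₁ c₁ r₂ c₂ →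
    Σ[ c ∈ ℕ ] (D r c × D (suc r) c)
  path-crossing r d le lt here = ⊥-elim (ℕP.<-irrefl refl (ℕP.<-≤-trans lt le))
  path-crossing r d le lt (step {r′ = r′} a d′ p) with r′ ℕP.≤? r
  ... | yes le′ = path-crossing r d′ le′ lt p
  path-crossing r d le lt (step (inj₁ (refl , _)) d′ p) | no gt = ⊥-elim (gt le)
  path-crossing r d le lt (step (inj₂ (refl , inj₂ refl)) d′ p) | no gt = ⊥-elim (gt (ℕP.≤-trans (ℕP.n≤1+n _) le))
  path-crossing r d le lt (step (inj₂ (refl , inj₁ refl)) d′ p) | no gt with ℕP.≤-antisym le (ℕP.≤-pred (ℕP.≰⇒> gt))
  ... | refl = _ , d , d′

  -- The skew diagram ν \ μ is a rim hook occupying rows i, …, j.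
  record HookRows (ν μ : Partition) : Set where
    field
      i j : ℕ
      i≥1 : 1 ℕ.≤ i
      i≤j : i ℕ.≤ j
      act-i : part μ i ℕ.< part ν i
      act-j : part μ j ℕ.< part ν j
      before : ∀ r → 1 ℕ.≤ r → r ℕ.< i → part ν r ≡ part μ r
      after : ∀ r → j ℕ.< r → part ν r ≡ part μ r
      between : ∀ r → i ℕ.≤ r → r ℕ.< j → part ν (suc r) ≡ suc (part μ r)
    j≥1 : 1 ℕ.≤ j
    j≥1 = ℕP.≤-trans i≥1 i≤j

  module HookToRows (s : ℕ) (s>0 : 0 ℕ.< s) (ν μ : Partition) (rh : RemovesRimHook s ν μ) where
    private
      a b : ℕ → ℕ
      a = part ν
      b = part μ
      f g : Maya
      f = may ν
      g = may μ
    sub-rows : ∀ r → 1 ℕ.≤ r → b r ℕ.≤ a r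
    sub-rows r p with b r in eq
    ... | zero = z≤n
    ... | suc c = proj₂ (proj₂ (proj₁ rh r (suc c) (p , s≤s z≤n , ℕP.≤-reflexive (sym eq))))

    skew : ∀ r c → 1 ℕ.≤ r → b r ℕ.< c → c ℕ.≤ a r → Skew ν μ r c
    skew r c p h h′ = (p , ℕP.≤-trans (s≤s z≤n) h , h′) , λ n → ℕP.<⇒≱ h (proj₂ (proj₂ n))

    unskew : ∀ r c → Skew ν μ r c → 1 ℕ.≤ r × b r ℕ.< c × c ℕ.≤ a r
    unskew r c ((p , q , h) , n) = p , ℕP.≰⇒> (λ le → n (p , q , le)) , h

    Act : ℕ → Set
    Act r = 1 ℕ.≤ r × b r ℕ.< a r

    Act? : ∀ r → Dec (Act r)
    Act? r with 1 ℕP.≤? r | b r ℕP.<? a r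
    ... | yes p | yes q = yes (p , q)
    ... | no p | _ = no (p ∘ proj₁)
    ... | yes _ | no q = no (q ∘ proj₂)

    inactive : ∀ r → 1 ℕ.≤ r → ¬ Act r → a r ≡ b r
    inactive r p n = ℕP.≤-antisym (ℕP.≮⇒≥ (λ h → n (p , h))) (sub-rows r p)

    R : ℕ
    R = suc (length (parts ν))

    beyond : ∀ r → R ℕ.≤ r → ¬ Act r
    beyond r h (_ , lt) = ℕP.<⇒≱ lt (subst (ℕ._≤ b r) (sym (nth-beyond (parts ν) r h)) z≤n)

    none⇒≐ : (∀ r → ¬ Act r) → f ≐ g
    none⇒≐ none z = go (occ f z) (occ g z) refl refl
      where
        go : ∀ u v → occ f z ≡ u → occ g z ≡ v → occ f z ≡ occ g z
        go true true e e′ = trans e (sym e′)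
        go false false e e′ = trans e (sym e′)
        go true false e e′ = ⊥-elim (contra (push (→∈B {ν} e)) e′)
          where push : z ∈B ν → occ g z ≡ true
                push (r , p , q) = ∈B→ {μ} (r , p , trans q (cong (λ c → + c - + r) (inactive r p (none r))))
        go false true e e′ = ⊥-elim (contra (push (→∈B {μ} e′)) e)
          where push : z ∈B μ → occ f z ≡ true
                push (r , p , q) = ∈B→ {ν} (r , p , trans q (cong (λ c → + c - + r) (sym (inactive r p (none r)))))

    some : Σ[ r ∈ ℕ ] Act r
    some = go (ℕP.anyUpTo? Act? R)
      where
        go : Dec (Σ[ r ∈ ℕ ] (r ℕ.< R × Act r)) → Σ[ r ∈ ℕ ] Act r
        go (yes (r , _ , h)) = r , h
        go (no n) = ⊥-elim (ℕP.<-irrefl (sym same) (subst (size μ ℕ.<_) (sym (proj₁ (proj₂ rh))) (ℕP.m<m+n (size μ) s>0)))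
          where
            none : ∀ r → ¬ Act r
            none r h = [ (λ lt → n (r , lt , h)) , (λ ge → beyond r ge h) ]′ (ℕP.<-≤-connex r R)
            same : size ν ≡ size μ
            same = ℤP.+-injective (trans (sym (E-size ν)) (trans (E-cong {f} {g} (none⇒≐ none)) (E-size μ)))

    -- A path in the skew diagram from row i to row j steps from row r to row r + 1 in some column,
    -- so the upper row of μ ends before that column, which row r + 1 of ν reaches. The opposite
    -- inequality is the rim condition at the first node of row r outside μ.
    between′ : ∀ i j → Act i → Act j → ∀ r → i ℕ.≤ r → r ℕ.< j → a (suc r) ≡ suc (b r)
    between′ i j (i≥1 , act-i) (j≥1 , act-j) r h h′ =
      go (path-crossing r si h h′ (proj₂ (proj₂ (proj₂ rh)) i (a i) j (a j) si (skew j (a j) j≥1 act-j ℕP.≤-refl)))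
      where
        si = skew i (a i) i≥1 act-i ℕP.≤-refl
        go : Σ[ c ∈ ℕ ] (Skew ν μ r c × Skew ν μ (suc r) c) → a (suc r) ≡ suc (b r)
        go (c , d , d′) = fin (unskew r c d) (unskew (suc r) c d′)
          where
            fin : 1 ℕ.≤ r × b r ℕ.< c × c ℕ.≤ a r → 1 ℕ.≤ suc r × b (suc r) ℕ.< c × c ℕ.≤ a (suc r) → a (suc r) ≡ suc (b r)
            fin (p , q , q′) (_ , _ , q″) = ℕP.≤-antisym
              (ℕP.≮⇒≥ (λ lt → proj₂ (proj₁ (proj₂ (proj₂ rh)) r (suc (b r)) (skew r (suc (b r)) p ℕP.≤-refl (ℕP.≤-trans q q′))) (s≤s z≤n , s≤s z≤n , lt)))
              (ℕP.≤-trans q q″)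

    rows : HookRows ν μ
    rows = pick (least Act? (proj₁ some) (proj₂ some))
      where
        pick : Σ[ i ∈ ℕ ] (Act i × (∀ r → r ℕ.< i → ¬ Act r)) → HookRows ν μ
        pick (i , act-i , mn) = pick′ (greatest Act? i act-i R beyond)
          where
            pick′ : Σ[ j ∈ ℕ ] (Act j × i ℕ.≤ j × (∀ r → j ℕ.< r → ¬ Act r)) → HookRows ν μ
            pick′ (j , act-j , i≤j , mx) = record
              { i = i ; j = j ; i≥1 = proj₁ act-i ; i≤j = i≤j ; act-i = proj₂ act-i ; act-j = proj₂ act-j
              ; before = λ r p lt → inactive r p (mn r lt)
              ; after = λ r lt → inactive r (ℕP.≤-trans (proj₁ act-j) (ℕP.<⇒≤ lt)) (mx r lt)
              ; between = between′ i j act-i act-j }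

  module RowsToMove (ν μ : Partition) (H : HookRows ν μ) where
    open HookRows H
    private
      b : ℕ → ℕ
      b = part μ
      f g : Maya
      f = may ν
      g = may μ

    P Q : ℤ
    P = bead ν i
    Q = bead μ j

    gQ : occ g Q ≡ true
    gQ = occ-bead μ j j≥1
    fP : occ f P ≡ true
    fP = occ-bead ν i i≥1

    fQ : occ f Q ≡ false
    fQ with occ f Q in eq
    ... | false = refl
    ... | true with →∈B {ν} eq
    ... | r , p , e with r ℕP.≤? j
    ... | yes le = ⊥-elim (ℤP.<-irrefl e (ℤP.<-≤-trans (bead-< j act-j) (bead-anti ν p le)))
    ... | no gt = ⊥-elim (ℤP.<-irrefl (sym (trans e (cong (λ c → + c - + r) (after r (ℕP.≰⇒> gt))))) (bead-strict μ j≥1 (ℕP.≰⇒> gt)))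

    gP : occ g P ≡ false
    gP with occ g P in eq
    ... | false = refl
    ... | true with →∈B {μ} eq
    ... | r , p , e with i ℕP.≤? r
    ... | yes le = ⊥-elim (ℤP.<-irrefl (sym e) (ℤP.≤-<-trans (bead-anti μ i≥1 le) (bead-< i act-i)))
    ... | no gt = ⊥-elim (ℤP.<-irrefl (trans e (cong (λ c → + c - + r) (sym (before r p (ℕP.≰⇒> gt))))) (bead-strict ν p (ℕP.≰⇒> gt)))

    -- By `between` the bead of row r + 1 of ν is the bead of row r of μ inside the hook, and
    -- outside it the rows agree; only row i of ν and row j of μ remain unmatched.
    f⇒g : ∀ z → z ≢ P → occ f z ≡ true → occ g z ≡ true
    f⇒g z n h with →∈B {ν} h
    ... | r , p , e with ℕP.<-cmp r i
    ... | tri< lt _ _ = ∈B→ {μ} (r , p , trans e (cong (λ c → + c - + r) (before r p lt)))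
    ... | tri≈ _ refl _ = ⊥-elim (n e)
    ... | tri> _ _ gt with r ℕP.≤? j
    ... | no gt′ = ∈B→ {μ} (r , p , trans e (cong (λ c → + c - + r) (after r (ℕP.≰⇒> gt′))))
    f⇒g z n h | suc r , p , e | tri> _ _ gt | yes le =
      ∈B→ {μ} (r , ℕP.≤-trans i≥1 (ℕP.≤-pred gt) , trans e (trans (cong (λ c → + c - + suc r) (between r (ℕP.≤-pred gt) le)) (ring71 (+ b r) (+ r))))

    g⇒f : ∀ z → z ≢ Q → occ g z ≡ true → occ f z ≡ true
    g⇒f z n h with →∈B {μ} h
    ... | r , p , e with ℕP.<-cmp r j
    ... | tri> _ _ gt = ∈B→ {ν} (r , p , trans e (cong (λ c → + c - + r) (sym (after r gt))))
    ... | tri≈ _ refl _ = ⊥-elim (n e)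
    ... | tri< lt _ _ with i ℕP.≤? r
    ... | no gt′ = ∈B→ {ν} (r , p , trans e (cong (λ c → + c - + r) (sym (before r p (ℕP.≰⇒> gt′)))))
    ... | yes le = ∈B→ {ν} (suc r , s≤s z≤n , trans e (trans (sym (ring71 (+ b r) (+ r))) (cong (λ c → + c - + suc r) (sym (between r le lt)))))

    rest′ : ∀ z → z ≢ Q → z ≢ P → occ g z ≡ occ f z
    rest′ z n n′ with occ f z in ef | occ g z in eg
    ... | true | true = refl
    ... | false | false = refl
    ... | true | false = ⊥-elim (contra (f⇒g z n′ ef) eg)
    ... | false | true = ⊥-elim (contra (g⇒f z n eg) ef)

    move : ∀ s → size ν ≡ size μ ℕ.+ s → Move (+ s) f g Q
    move s sz = record { f-hi = trans (cong (occ f) (sym P≡)) fP ; f-lo = fQ ; g-hi = trans (cong (occ g) (sym P≡)) gP ; g-lo = gQ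
                  ; rest = λ z n n′ → rest′ z n (λ e → n′ (trans e P≡)) }
      where
        -- The length of the move is read off from the energies: they are the sizes, and they differ
        -- by P - Q.
        P≡ : P ≡ Q + + s
        P≡ = subz (trans (ring68 P Q (+ s)) (trans (cong (λ e → e - + s) (sym (E-two {f} {g} {P} {Q} (χ-two {f} {g} {P} {Q} fP fQ gP gQ rest′))))
          (trans (cong₂ (λ x y → x - y - + s) (trans (E-size ν) (trans (cong +_ sz) (ℤP.pos-+ (size μ) s))) (E-size μ)) (ring69 (+ size μ) (+ s)))))

  module RowsToHook (ν μ : Partition) (H : HookRows ν μ) where
    open HookRows H
    private
      a b : ℕ → ℕ
      a = part ν
      b = part μ
      D : ℕ → ℕ → Set
      D = Skew ν μ

    active : ∀ r → i ℕ.≤ r → r ℕ.≤ j → b r ℕ.< a r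
    active r h h′ with ℕP.m≤n⇒m<n∨m≡n h′
    ... | inj₁ lt = subst (ℕ._≤ a r) (between r h lt) (part-anti ν r (ℕP.≤-trans i≥1 h))
    ... | inj₂ refl = act-j

    sub-rows : ∀ r → 1 ℕ.≤ r → b r ℕ.≤ a r
    sub-rows r p with i ℕP.≤? r | r ℕP.≤? j
    ... | yes h | yes h′ = ℕP.<⇒≤ (active r h h′)
    ... | no h | _ = ℕP.≤-reflexive (sym (before r p (ℕP.≰⇒> h)))
    ... | yes _ | no h = ℕP.≤-reflexive (sym (after r (ℕP.≰⇒> h)))

    skew : ∀ r c → 1 ℕ.≤ r → b r ℕ.< c → c ℕ.≤ a r → D r c
    skew r c p h h′ = (p , ℕP.≤-trans (s≤s z≤n) h , h′) , λ n → ℕP.<⇒≱ h (proj₂ (proj₂ n))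

    unskew : ∀ r c → D r c → 1 ℕ.≤ r × b r ℕ.< c × c ℕ.≤ a r
    unskew r c ((p , q , h) , n) = p , ℕP.≰⇒> (λ le → n (p , q , le)) , h

    range : ∀ r c → D r c → i ℕ.≤ r × r ℕ.≤ j
    range r c d with unskew r c d
    ... | p , h , h′ = ℕP.≮⇒≥ (λ lt → ℕP.<⇒≱ (ℕP.<-≤-trans h h′) (ℕP.≤-reflexive (before r p lt)))
                     , ℕP.≮⇒≥ (λ lt → ℕP.<⇒≱ (ℕP.<-≤-trans h h′) (ℕP.≤-reflexive (after r lt)))

    rim : ∀ r c → D r c → Rim ν r c
    rim r c d = proj₁ d , λ n → no-node (proj₂ (proj₂ n))
      where
        no-node : ¬ (suc c ℕ.≤ a (suc r))
        no-node h with ℕP.m≤n⇒m<n∨m≡n (proj₂ (range r c d))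
        ... | inj₁ lt = ℕP.<⇒≱ h (subst (ℕ._≤ c) (sym (between r (proj₁ (range r c d)) lt)) (proj₁ (proj₂ (unskew r c d))))
        ... | inj₂ refl = ℕP.<⇒≱ h (ℕP.≤-trans (ℕP.≤-reflexive (after (suc j) ℕP.≤-refl)) (ℕP.≤-trans (part-anti μ j j≥1) (ℕP.<⇒≤ (proj₁ (proj₂ (unskew r c d))))))

    to-right : ∀ r c k → 1 ℕ.≤ r → b r ℕ.< c → k ℕ.+ c ℕ.≤ a r → PathIn D r c r (k ℕ.+ c)
    to-right r c zero p h h′ = here
    to-right r c (suc k) p h h′ = path-trans (to-right r c k p h (ℕP.≤-trans (ℕP.n≤1+n _) h′))
      (step (inj₁ (refl , inj₁ refl)) (skew r (suc k ℕ.+ c) p (ℕP.<-≤-trans h (ℕP.m≤n+m c (suc k))) h′) here)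

    to-end : ∀ r c → D r c → PathIn D r c r (a r)
    to-end r c d = subst (PathIn D r c r) (ℕP.m∸n+n≡m (proj₂ (proj₂ (unskew r c d))))
      (to-right r c (a r ℕ.∸ c) (proj₁ (unskew r c d)) (proj₁ (proj₂ (unskew r c d))) (ℕP.≤-reflexive (ℕP.m∸n+n≡m (proj₂ (proj₂ (unskew r c d))))))

    end : ∀ r → i ℕ.≤ r → r ℕ.≤ j → D r (a r)
    end r h h′ = skew r (a r) (ℕP.≤-trans i≥1 h) (active r h h′) ℕP.≤-refl

    -- The end of row r + 1 lies directly below the first node of row r outside μ, because
    -- `a (suc r)` is `suc (b r)`; so the path runs left along row r and then one step down.
    down1 : ∀ r → i ℕ.≤ r → r ℕ.< j → PathIn D r (a r) (suc r) (a (suc r))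
    down1 r h h′ = path-trans (path-sym corner (to-end r (a (suc r)) corner))
      (step (inj₂ (refl , inj₁ refl)) (end (suc r) (ℕP.m≤n⇒m≤1+n h) h′) here)
      where
        corner : D r (a (suc r))
        corner = skew r (a (suc r)) (ℕP.≤-trans i≥1 h) (ℕP.≤-reflexive (sym (between r h h′))) (part-anti ν r (ℕP.≤-trans i≥1 h))

    down : ∀ r k → i ℕ.≤ r → k ℕ.+ r ℕ.≤ j → PathIn D r (a r) (k ℕ.+ r) (a (k ℕ.+ r))
    down r zero h h′ = here
    down r (suc k) h h′ = path-trans (down r k h (ℕP.≤-trans (ℕP.n≤1+n _) h′)) (down1 (k ℕ.+ r) (ℕP.≤-trans h (ℕP.m≤n+m r k)) h′)

    ordered : ∀ r c r′ c′ → r ℕ.≤ r′ → D r c → D r′ c′ → PathIn D r c r′ c′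
    ordered r c r′ c′ le d d′ = path-trans (to-end r c d) (path-trans
      (subst (λ u → PathIn D r (a r) u (a u)) (ℕP.m∸n+n≡m le) (down r (r′ ℕ.∸ r) (proj₁ (range r c d)) (subst (ℕ._≤ j) (sym (ℕP.m∸n+n≡m le)) (proj₂ (range r′ c′ d′)))))
      (path-sym d′ (to-end r′ c′ d′)))

    connected : Connected D
    connected r c r′ c′ d d′ = [ (λ le → ordered r c r′ c′ le d d′) , (λ le → path-sym d′ (ordered r′ c′ r c le d′ d)) ]′ (ℕP.≤-total r r′)

    hook : ∀ s → size ν ≡ size μ ℕ.+ s → RemovesRimHook s ν μ
    hook s sz = (λ { r c (p , q , h) → p , q , ℕP.≤-trans h (sub-rows r p) }) , sz , rim , connected

  module MoveToRows (ν μ : Partition) (d x : ℤ) (d>0 : 0ℤ < d) (M : Move d (may ν) (may μ) x) where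
    open Move M
    private
      f g : Maya
      f = may ν
      g = may μ

    module Index (i : ℕ) (i≥1 : 1 ℕ.≤ i) (ei : x + d ≡ bead ν i) (j : ℕ) (xj : x < bead ν j) (i≤j : i ℕ.≤ j)
                 (maxj : ∀ r → j ℕ.< r → bead ν r ≤ x) where
      j≥1 : 1 ℕ.≤ j
      j≥1 = ℕP.≤-trans i≥1 i≤j

      -- The beads of ν in decreasing order after x + d, the bead of row i, has been replaced by x:
      -- the beads of rows i + 1 to j move up one place and x takes place j.
      row : ℕ → ℤ
      row r with r ℕP.<? i
      ... | yes _ = bead ν r
      ... | no _ with ℕP.<-cmp r j
      ... | tri< _ _ _ = bead ν (suc r)
      ... | tri≈ _ _ _ = x
      ... | tri> _ _ _ = bead ν r

      row-before : ∀ r → r ℕ.< i → row r ≡ bead ν r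
      row-before r h with r ℕP.<? i
      ... | yes _ = refl
      ... | no n = ⊥-elim (n h)

      row-between : ∀ r → i ℕ.≤ r → r ℕ.< j → row r ≡ bead ν (suc r)
      row-between r h h′ with r ℕP.<? i
      ... | yes lt = ⊥-elim (ℕP.<⇒≱ lt h)
      ... | no _ with ℕP.<-cmp r j
      ... | tri< _ _ _ = refl
      ... | tri≈ n _ _ = ⊥-elim (n h′)
      ... | tri> n _ _ = ⊥-elim (n h′)

      row-j : row j ≡ x
      row-j with j ℕP.<? i
      ... | yes lt = ⊥-elim (ℕP.<⇒≱ lt i≤j)
      ... | no _ with ℕP.<-cmp j j
      ... | tri< _ n _ = ⊥-elim (n refl)
      ... | tri≈ _ _ _ = refl
      ... | tri> _ n _ = ⊥-elim (n refl)

      row-after : ∀ r → j ℕ.< r → row r ≡ bead ν r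
      row-after r h with r ℕP.<? i
      ... | yes _ = refl
      ... | no _ with ℕP.<-cmp r j
      ... | tri< _ _ n = ⊥-elim (n h)
      ... | tri≈ _ _ n = ⊥-elim (n h)
      ... | tri> _ _ _ = refl

      data Pos (r : ℕ) : Set where
        bef : r ℕ.< i → Pos r
        btw : i ℕ.≤ r → r ℕ.< j → Pos r
        atj : r ≡ j → Pos r
        aft : j ℕ.< r → Pos r

      pos : ∀ r → Pos r
      pos r with r ℕP.<? i
      ... | yes h = bef h
      ... | no h with ℕP.<-cmp r j
      ... | tri< h′ _ _ = btw (ℕP.≮⇒≥ h) h′
      ... | tri≈ _ e _ = atj e
      ... | tri> _ _ h′ = aft h′

      row-≤ : ∀ r → 1 ℕ.≤ r → row r ≤ bead ν r
      row-≤ r p = go (pos r)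
        where
          go : Pos r → row r ≤ bead ν r
          go (bef h) = ℤP.≤-reflexive (row-before r h)
          go (btw h h′) = subst (_≤ bead ν r) (sym (row-between r h h′)) (ℤP.<⇒≤ (bead-step ν r p))
          go (atj refl) = subst (_≤ bead ν r) (sym row-j) (ℤP.<⇒≤ xj)
          go (aft h) = ℤP.≤-reflexive (row-after r h)

      row-< : ∀ r → i ℕ.≤ r → r ℕ.≤ j → row r < bead ν r
      row-< r h h′ = go (ℕP.m≤n⇒m<n∨m≡n h′)
        where
          go : r ℕ.< j ⊎ r ≡ j → row r < bead ν r
          go (inj₁ lt) = subst (_< bead ν r) (sym (row-between r h lt)) (bead-step ν r (ℕP.≤-trans i≥1 h))
          go (inj₂ refl) = subst (_< bead ν r) (sym row-j) xj

      row-dec : ∀ r → 1 ℕ.≤ r → row (suc r) < row r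
      row-dec r p = go (pos r)
        where
          go : Pos r → row (suc r) < row r
          go (bef h) = subst (row (suc r) <_) (sym (row-before r h)) (ℤP.≤-<-trans (row-≤ (suc r) (s≤s z≤n)) (bead-step ν r p))
          go (btw h h′) = subst (row (suc r) <_) (sym (row-between r h h′)) (row-< (suc r) (ℕP.m≤n⇒m≤1+n h) h′)
          go (atj refl) = subst (row (suc r) <_) (sym row-j) (ℤP.≤∧≢⇒< (ℤP.≤-trans (row-≤ (suc r) (s≤s z≤n)) (maxj (suc r) ℕP.≤-refl))
            (λ e → contra (occ-bead ν (suc r) (s≤s z≤n)) (trans (cong (occ f) (trans (sym (row-after (suc r) ℕP.≤-refl)) e)) f-lo)))
          go (aft h) = subst (row (suc r) <_) (sym (row-after r h)) (ℤP.≤-<-trans (row-≤ (suc r) (s≤s z≤n)) (bead-step ν r p))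

      bead-inj : ∀ {r r′} → 1 ℕ.≤ r → 1 ℕ.≤ r′ → bead ν r ≡ bead ν r′ → r ≡ r′
      bead-inj {r} {r′} p p′ e with ℕP.<-cmp r r′
      ... | tri< h _ _ = ⊥-elim (ℤP.<-irrefl (sym e) (bead-strict ν p h))
      ... | tri≈ _ h _ = h
      ... | tri> _ _ h = ⊥-elim (ℤP.<-irrefl e (bead-strict ν p′ h))

      kept : ∀ r → 1 ℕ.≤ r → r ≢ i → occ g (bead ν r) ≡ true
      kept r p n = trans (rest (bead ν r) (λ e → contra (occ-bead ν r p) (trans (cong (occ f) e) f-lo)) (λ e → n (bead-inj p i≥1 (trans e ei)))) (occ-bead ν r p)

      row-bead : ∀ r → 1 ℕ.≤ r → occ g (row r) ≡ true
      row-bead r p = go (pos r)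
        where
          go : Pos r → occ g (row r) ≡ true
          go (bef h) = trans (cong (occ g) (row-before r h)) (kept r p (ℕP.<⇒≢ h))
          go (btw h h′) = trans (cong (occ g) (row-between r h h′)) (kept (suc r) (s≤s z≤n) (λ e → ℕP.<⇒≢ (s≤s h) (sym e)))
          go (atj refl) = trans (cong (occ g) row-j) g-lo
          go (aft h) = trans (cong (occ g) (row-after r h)) (kept r p (λ e → ℕP.<⇒≢ (ℕP.≤-<-trans i≤j h) (sym e)))

      index : ∀ z → occ g z ≡ true → Σ[ r ∈ ℕ ] z ≡ row (suc r)
      index z h = go (z ℤP.≟ x)
        where
          prd : ∀ {r} → 1 ℕ.≤ r → z ≡ row r → Σ[ r ∈ ℕ ] z ≡ row (suc r)
          prd {suc r} _ e = r , e
          go′ : Σ[ r ∈ ℕ ] (1 ℕ.≤ r × z ≡ bead ν r) → z ≢ x + d → Σ[ r ∈ ℕ ] z ≡ row (suc r)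
          go′ (r , p , e) n with ℕP.<-cmp r i
          ... | tri< lt _ _ = prd p (trans e (sym (row-before r lt)))
          ... | tri≈ _ refl _ = ⊥-elim (n (trans e (sym ei)))
          ... | tri> _ _ gt with r ℕP.≤? j
          ... | no gt′ = prd p (trans e (sym (row-after r (ℕP.≰⇒> gt′))))
          go′ (suc r , p , e) n | tri> _ _ gt | yes le = prd (ℕP.≤-trans i≥1 (ℕP.≤-pred gt)) (trans e (sym (row-between r (ℕP.≤-pred gt) le)))
          go : Dec (z ≡ x) → Σ[ r ∈ ℕ ] z ≡ row (suc r)
          go (yes refl) = prd j≥1 (sym row-j)
          go (no n) = go′ (→∈B {ν} (trans (sym (rest z n n′)) h)) n′
            where n′ : z ≢ x + d
                  n′ refl = contra h g-hi

      main : ∀ r → 1 ℕ.≤ r → bead μ r ≡ row r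
      main (suc r) _ = enum-unique (λ r → bead μ (suc r)) (λ r → row (suc r)) (λ r → bead-step μ (suc r) (s≤s z≤n)) (λ r → row-dec (suc r) (s≤s z≤n))
        (λ r → index _ (occ-bead μ (suc r) (s≤s z≤n))) fro r
        where
          fro : ∀ r → Σ[ k ∈ ℕ ] row (suc r) ≡ bead μ (suc k)
          fro r with →∈B {μ} (row-bead (suc r) (s≤s z≤n))
          ... | suc k , _ , e = k , e

      cancel : ∀ {a b} r → + a - + r ≡ + b - + r → a ≡ b
      cancel {a} {b} r e = ℤP.+-injective (subz (trans (ring70 (+ a) (+ b) (+ r)) (zsub e)))

      rows : HookRows ν μ
      rows = record
        { i = i ; j = j ; i≥1 = i≥1 ; i≤j = i≤j
        ; act-i = bead-<⁻¹ i (subst (_< bead ν i) (sym (main i i≥1)) (row-< i ℕP.≤-refl i≤j))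
        ; act-j = bead-<⁻¹ j (subst (_< bead ν j) (sym (main j j≥1)) (row-< j i≤j ℕP.≤-refl))
        ; before = λ r p h → cancel r (sym (trans (main r p) (row-before r h)))
        ; after = λ r h → cancel r (sym (trans (main r (ℕP.≤-trans j≥1 (ℕP.<⇒≤ h))) (row-after r h)))
        ; between = λ r h h′ → cancel (suc r) (trans (sym (trans (main r (ℕP.≤-trans i≥1 h)) (row-between r h h′))) (sym (ring71 (+ part μ r) (+ r)))) }

    rows : HookRows ν μ
    rows = pick (→∈B {ν} f-hi)
      where
        x<x+d : x < x + d
        x<x+d = subst (_< x + d) (ℤP.+-identityʳ x) (ℤP.+-monoʳ-< x d>0)
        R : ℕ
        R = suc (length (parts ν)) ℕ.+ ∣ x ∣
        neg-abs : ∀ x → - + ∣ x ∣ ≤ x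
        neg-abs (+ zero) = ℤP.≤-refl
        neg-abs (+ suc n) = -≤+
        neg-abs -[1+ n ] = ℤP.≤-refl
        beyond : ∀ r → R ℕ.≤ r → ¬ (x < bead ν r)
        beyond r h lt = ℤP.<⇒≱ lt (ℤP.≤-trans (ℤP.≤-reflexive (trans (cong (λ c → + c - + r) (nth-beyond (parts ν) r (ℕP.≤-trans (ℕP.m≤m+n _ ∣ x ∣) h))) (ℤP.+-identityˡ (- + r))))
          (ℤP.≤-trans (ℤP.neg-mono-≤ (+≤+ (ℕP.≤-trans (ℕP.m≤n+m ∣ x ∣ (suc (length (parts ν)))) h))) (neg-abs x)))
        pick : (x + d) ∈B ν → HookRows ν μ
        pick (i , i≥1 , ei) = pick′ (greatest (λ r → x ℤP.<? bead ν r) i (subst (x <_) ei x<x+d) R beyond)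
          where
            pick′ : Σ[ j ∈ ℕ ] (x < bead ν j × i ℕ.≤ j × (∀ r → j ℕ.< r → ¬ (x < bead ν r))) → HookRows ν μ
            pick′ (j , xj , i≤j , mx) = Index.rows i i≥1 ei j xj i≤j (λ r h → ℤP.≮⇒≥ (mx r h))

  -- Hooks, cores and weights on diagrams

  hook⇒move : ∀ s → 0 ℕ.< s → ∀ ν μ → RemovesRimHook s ν μ → Σ[ x ∈ ℤ ] Move (+ s) (may ν) (may μ) x
  hook⇒move s s>0 ν μ rh = _ , RowsToMove.move ν μ (HookToRows.rows s s>0 ν μ rh) s (proj₁ (proj₂ rh))

  Move-cong : ∀ {d f g g′ x} → g′ ≐ g → Move d f g x → Move d f g′ x
  Move-cong e m = record { f-hi = Move.f-hi m ; f-lo = Move.f-lo m ; g-hi = trans (e _) (Move.g-hi m) ; g-lo = trans (e _) (Move.g-lo m)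
                         ; rest = λ z n n′ → trans (e z) (Move.rest m z n n′) }

  Move-size : ∀ s ν μ x → Move (+ s) (may ν) (may μ) x → size ν ≡ size μ ℕ.+ s
  Move-size s ν μ x M = ℤP.+-injective (trans (sym (E-size ν)) (trans (subz (trans (ring68 (E (may ν)) (E (may μ)) (+ s)) (trans (cong (_- + s)
      (E-two {may ν} {may μ} {x + + s} {x} (χ-two {may ν} {may μ} (Move.f-hi M) (Move.f-lo M) (Move.g-hi M) (Move.g-lo M) (Move.rest M)))) (ring69 x (+ s)))))
      (trans (cong (_+ + s) (E-size μ)) (sym (ℤP.pos-+ (size μ) s)))))

  pos-ℕ : ∀ {s} → 0 ℕ.< s → 0ℤ < + s
  pos-ℕ h = +<+ h

  -- A bead move keeps the charge, so the moved diagram is again the beta-set of a partition, and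
  -- the row description of the move is that of a hook.
  remove-hook : ∀ s → 0 ℕ.< s → ∀ ν x → occ (may ν) (x + + s) ≡ true → occ (may ν) x ≡ false →
    Σ[ μ ∈ Partition ] (RemovesRimHook s ν μ × Move (+ s) (may ν) (may μ) x)
  remove-hook s s>0 ν x h h′ = μ , RowsToHook.hook ν μ (MoveToRows.rows ν μ (+ s) x (pos-ℕ s>0) M) s (Move-size s ν μ x M) , M
    where
      g = moveMaya (+ s) (may ν) x
      M₀ : Move (+ s) (may ν) g x
      M₀ = moveMaya-Move (may ν) x (pos-ℕ s>0) h h′
      built = fromMaya g (trans (sym (charge-Eqv {+ s} {may ν} {g} (Move-Eqv M₀))) (charge-may ν))
      μ = proj₁ built
      M : Move (+ s) (may ν) (may μ) x
      M = Move-cong (proj₂ built) M₀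

  IsCore⇒Core : ∀ s → 0 ℕ.< s → ∀ κ → IsCore s κ → Core (+ s) (may κ)
  IsCore⇒Core s s>0 κ c x h with occ (may κ) x in eq
  ... | true = refl
  ... | false = go (remove-hook s s>0 κ x h eq)
    where go : Σ[ μ ∈ Partition ] (RemovesRimHook s κ μ × Move (+ s) (may κ) (may μ) x) → false ≡ true
          go (μ , rh , _) = ⊥-elim (c μ rh)

  Core⇒IsCore : ∀ s → 0 ℕ.< s → ∀ κ → Core (+ s) (may κ) → IsCore s κ
  Core⇒IsCore s s>0 κ c μ rh = go (hook⇒move s s>0 κ μ rh)
    where go : Σ[ x ∈ ℤ ] Move (+ s) (may κ) (may μ) x → ⊥
          go (x , M) = contra (c x (Move.f-hi M)) (Move.f-lo M)

  Reduces⇒Eqv : ∀ s → 0 ℕ.< s → ∀ {ν κ k} → Reduces s ν κ k → Eqv (+ s) (may ν) (may κ)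
  Reduces⇒Eqv s s>0 {ν} done = Eqv-refl {+ s} {may ν} {may ν} (λ _ → refl)
  Reduces⇒Eqv s s>0 {ν} {κ} (next {ν = ν′} rh rs) = Eqv-trans {+ s} {may ν} {may ν′} {may κ}
    (Move-Eqv (proj₂ (hook⇒move s s>0 ν ν′ rh))) (Reduces⇒Eqv s s>0 rs)

  Reduces-size : ∀ s {ν κ k} → Reduces s ν κ k → size ν ≡ size κ ℕ.+ s ℕ.* k
  Reduces-size s {ν} done = sym (trans (cong (size ν ℕ.+_) (ℕP.*-zeroʳ s)) (ℕP.+-identityʳ _))
  Reduces-size s {ν} {κ} (next {w = k} rh rs) = trans (proj₁ (proj₂ rh)) (trans (cong (ℕ._+ s) (Reduces-size s rs))
    (trans (ℕP.+-assoc (size κ) _ s) (cong (size κ ℕ.+_) (trans (ℕP.+-comm (s ℕ.* k) s) (sym (ℕP.*-suc s k))))))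

  Up? : ∀ (f : Maya) d x → Dec (occ f (x + d) ≡ true × occ f x ≡ false)
  Up? f d x with occ f (x + d) | occ f x
  ... | true | false = yes (refl , refl)
  ... | false | _ = no (λ ())
  ... | true | true = no (λ ())

  -- Beyond the limit of `f` the core condition cannot fail, so a bounded search decides it.
  core? : ∀ f s → (Σ[ x ∈ ℤ ] (occ f (x + + s) ≡ true × occ f x ≡ false)) ⊎ Core (+ s) f
  core? f s = [ inj₁ , (λ h → inj₂ (core h)) ]′ (searchℤ (Up? f (+ s)) (lim f))
    where
      core : (∀ y → mag y ℕ.< lim f → ¬ (occ f (y + + s) ≡ true × occ f y ≡ false)) → Core (+ s) f
      core h x p with occ f x in eq
      ... | true = refl
      core h (+ n) p | false with n ℕP.<? lim f
      ... | yes lt = ⊥-elim (h (+ n) lt (p , eq))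
      ... | no ge = contra p (hi f (n ℕ.+ s) (ℕP.≤-trans (ℕP.≮⇒≥ ge) (ℕP.m≤m+n n s)))
      core h -[1+ n ] p | false with n ℕP.<? lim f
      ... | yes lt = ⊥-elim (h -[1+ n ] lt (p , eq))
      ... | no ge = contra (lo f n (ℕP.≮⇒≥ ge)) eq

  -- Hooks are removed as long as there are any, the size being the measure. The core reached is
  -- equivalent to κ, and an equivalence class contains only one core.
  Eqv⇒HasCore : ∀ s → 0 ℕ.< s → ∀ ν κ → IsCore s κ → Eqv (+ s) (may ν) (may κ) → HasCore s ν κ
  Eqv⇒HasCore s s>0 ν κ c p = k , red , c
    where
      go : ∀ n ν → size ν ℕ.< n → Eqv (+ s) (may ν) (may κ) → Σ[ k ∈ ℕ ] Reduces s ν κ k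
      go (suc n) ν (s≤s h) p = [ up , stop ]′ (core? (may ν) s)
        where
          stop : Core (+ s) (may ν) → Σ[ k ∈ ℕ ] Reduces s ν κ k
          stop cν = 0 , subst (λ u → Reduces s ν u 0) (may-inj ν κ (core-unique {+ s} {may ν} {may κ} (pos-ℕ s>0) cν (IsCore⇒Core s s>0 κ c) p)) done
          up : (Σ[ x ∈ ℤ ] (occ (may ν) (x + + s) ≡ true × occ (may ν) x ≡ false)) → Σ[ k ∈ ℕ ] Reduces s ν κ k
          up (x , a , b) = again (remove-hook s s>0 ν x a b)
            where
              wrap : ∀ {μ} → RemovesRimHook s ν μ → Σ[ k ∈ ℕ ] Reduces s μ κ k → Σ[ k ∈ ℕ ] Reduces s ν κ k
              wrap rh (k , rs) = suc k , next rh rs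
              again : Σ[ μ ∈ Partition ] (RemovesRimHook s ν μ × Move (+ s) (may ν) (may μ) x) → Σ[ k ∈ ℕ ] Reduces s ν κ k
              again (μ , rh , M) = wrap rh (go n μ (ℕP.<-≤-trans (subst (size μ ℕ.<_) (sym (proj₁ (proj₂ rh))) (ℕP.m<m+n (size μ) s>0)) h)
                (Eqv-trans {+ s} {may μ} {may ν} {may κ} (Eqv-sym {+ s} {may ν} {may μ} (Move-Eqv M)) p))
      r = go (suc (size ν)) ν ℕP.≤-refl p
      k = proj₁ r
      red = proj₂ r

  HasCore⇒Eqv : ∀ s → 0 ℕ.< s → ∀ {ν κ} → HasCore s ν κ → Eqv (+ s) (may ν) (may κ)
  HasCore⇒Eqv s s>0 (k , rs , _) = Reduces⇒Eqv s s>0 rs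

  -- Reduction to the case of two (s,t)-cores

  -- Coprimality is kept as Euclid's lemma in both directions, so that exchanging s and t (`swapS`)
  -- is a mere renaming of fields and every argument serves for both moduli.
  record Setup : Set where
    field
      s t : ℤ
      s>1 : 1ℤ < s
      t>1 : 1ℤ < t
      gauss-t : ∀ a → t ∣ a * s → t ∣ a
      gauss-s : ∀ a → s ∣ a * t → s ∣ a

  swapS : Setup → Setup
  swapS S = record { s = t ; t = s ; s>1 = t>1 ; t>1 = s>1 ; gauss-t = gauss-s ; gauss-s = gauss-t }
    where open Setup S

  ∣-cast : ∀ {t a b} → a ≡ b → t ∣ a → t ∣ b
  ∣-cast refl h = h

  >1⇒>0 : ∀ {a} → 1ℤ < a → 0ℤ < a
  >1⇒>0 h = ℤP.<-trans (+<+ (s≤s z≤n)) h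

  ∤1 : ∀ {t} → 1ℤ < t → ¬ (t ∣ 1ℤ)
  ∤1 {+ suc (suc n)} h (divides (+ zero) ())
  ∤1 {+ suc (suc n)} h (divides (+ suc m) ())
  ∤1 {+ suc (suc n)} h (divides -[1+ m ] ())
  ∤1 {+ suc zero} (+<+ (s≤s ())) _
  ∤1 {+ zero} (+<+ ()) _

  dec-in : ∀ {P : Set} (D : Dec P) → P → does D ≡ true
  dec-in (yes _) h = refl
  dec-in (no n) h = ⊥-elim (n h)

  dec-out : ∀ {P : Set} (D : Dec P) → ¬ P → does D ≡ false
  dec-out (yes h) n = ⊥-elim (n h)
  dec-out (no _) n = refl

  -- A divisor of the odd number w x is odd, so 2 can be cancelled modulo t.
  odd-half : ∀ {t} x a → t ∣ w x → t ∣ a + a → t ∣ a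
  odd-half x a h h′ = ∣-cast (ring72 x a) (∣m∣n⇒∣m-n (∣n⇒∣m*n a h) (∣n⇒∣m*n x h′))

  module SetupFacts (S : Setup) where
    open Setup S public
    s>0 : 0ℤ < s
    s>0 = >1⇒>0 s>1
    t>0 : 0ℤ < t
    t>0 = >1⇒>0 t>1
    t∤s : ¬ (t ∣ s)
    t∤s h = ∤1 t>1 (gauss-t 1ℤ (∣-cast (sym (ℤP.*-identityˡ s)) h))
    s∤t : ¬ (s ∣ t)
    s∤t h = ∤1 s>1 (gauss-s 1ℤ (∣-cast (sym (ℤP.*-identityˡ t)) h))

  Bd-shift : ∀ {d h} e → Bd d h → Bd d (λ z → h (z - e))
  Bd-shift {d} e (V , p) = shiftFS e V , λ z → trans (p (z - e)) (cong (λ u → at V u - at V (z - e)) (ring73 z e d))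

  -- Telescoping: one step by k d is k steps by d.
  Bd-multiple : ∀ {d h} (k : ℕ) → Bd (+ k * d) h → Bd d h
  Bd-multiple {d} k (V , p) = Bd-cong p (go k)
    where
      go : ∀ k → Bd d (λ z → at V (z - + k * d) - at V z)
      go zero = Bd-cong (λ z → trans (cong (λ u → at V u - at V z) (ring149 z d)) (ℤP.+-inverseʳ (at V z))) Bd-zero
      go (suc k) = Bd-cong (λ z → trans (cong (λ u → at V u - at V z) (ring74 z (+ k) d)) (ring75 (at V (z - d - + k * d)) (at V (z - d)) (at V z)))
        (Bd-add (Bd-shift d (go k)) (V , λ z → refl))

  classInd : ℤ → ℤ → ℤ → ℤ
  classInd t x z = ind (does (t ∣? (z - x)))

  classInd-in : ∀ {t x z} → t ∣ z - x → classInd t x z ≡ 1ℤ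
  classInd-in {t} {x} {z} h = cong ind (dec-in (t ∣? (z - x)) h)

  classInd-out : ∀ {t x z} → ¬ (t ∣ z - x) → classInd t x z ≡ 0ℤ
  classInd-out {t} {x} {z} h = cong ind (dec-out (t ∣? (z - x)) h)

  -- π exchanges the residue classes of c and c + δ modulo t.
  module Swap (t c δ : ℤ) (t∤δ : ¬ (t ∣ δ)) where
    data Cls (z : ℤ) : Set where
      inC : t ∣ z - c → Cls z
      inC′ : t ∣ z - (c + δ) → Cls z
      out : ¬ (t ∣ z - c) → ¬ (t ∣ z - (c + δ)) → Cls z

    cls : ∀ z → Cls z
    cls z with t ∣? (z - c) | t ∣? (z - (c + δ))
    ... | yes h | _ = inC h
    ... | no _ | yes h = inC′ h
    ... | no n | no n′ = out n n′

    disjoint : ∀ {z} → t ∣ z - c → ¬ (t ∣ z - (c + δ))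
    disjoint {z} h h′ = t∤δ (∣-cast (ring76 z c δ) (∣m∣n⇒∣m-n h h′))

    move : ∀ z → Cls z → ℤ
    move z (inC _) = z + δ
    move z (inC′ _) = z - δ
    move z (out _ _) = z

    π : ℤ → ℤ
    π z = move z (cls z)

    π-C : ∀ {z} → t ∣ z - c → π z ≡ z + δ
    π-C {z} h = go (cls z)
      where go : (k : Cls z) → move z k ≡ z + δ
            go (inC _) = refl
            go (inC′ h′) = ⊥-elim (disjoint {z} h h′)
            go (out n _) = ⊥-elim (n h)

    π-C′ : ∀ {z} → t ∣ z - (c + δ) → π z ≡ z - δ
    π-C′ {z} h = go (cls z)
      where go : (k : Cls z) → move z k ≡ z - δ
            go (inC h′) = ⊥-elim (disjoint {z} h′ h)
            go (inC′ _) = refl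
            go (out _ n) = ⊥-elim (n h)

    π-out : ∀ {z} → ¬ (t ∣ z - c) → ¬ (t ∣ z - (c + δ)) → π z ≡ z
    π-out {z} n n′ = go (cls z)
      where go : (k : Cls z) → move z k ≡ z
            go (inC h) = ⊥-elim (n h)
            go (inC′ h) = ⊥-elim (n′ h)
            go (out _ _) = refl

    inC+ : ∀ {z} → t ∣ z - c → t ∣ z + δ - (c + δ)
    inC+ {z} h = ∣-cast (ring77 z c δ) h
    inC- : ∀ {z} → t ∣ z - (c + δ) → t ∣ z - δ - c
    inC- {z} h = ∣-cast (ring78 z c δ) h

    π-inv : ∀ z → π (π z) ≡ z
    π-inv z = go (cls z)
      where
        go : (k : Cls z) → π (move z k) ≡ z
        go (inC h) = trans (π-C′ (inC+ {z} h)) (y-d+d z δ)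
        go (inC′ h) = trans (π-C (inC- {z} h)) (ring202 z δ)
        go (out n n′) = π-out n n′

    ∣+t : ∀ {a z} → t ∣ z - a → t ∣ z + t - a
    ∣+t {a} {z} h = ∣-cast (ring79 z a t) (∣m∣n⇒∣m+n h (divides 1ℤ (sym (ℤP.*-identityˡ t))))
    ∣-t : ∀ {a z} → t ∣ z + t - a → t ∣ z - a
    ∣-t {a} {z} h = ∣-cast (ring80 z a t) (∣m∣n⇒∣m-n h (divides 1ℤ (sym (ℤP.*-identityˡ t))))

    π-t : ∀ z → π (z + t) ≡ π z + t
    π-t z = go (cls z)
      where
        go : (k : Cls z) → π (z + t) ≡ move z k + t
        go (inC h) = trans (π-C (∣+t {c} {z} h)) (ring153 z t δ)
        go (inC′ h) = trans (π-C′ (∣+t {c + δ} {z} h)) (ring81 z t δ)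
        go (out n n′) = π-out (λ h → n (∣-t {c} {z} h)) (λ h → n′ (∣-t {c + δ} {z} h))

    π--t : ∀ z → π (z - t) ≡ π z - t
    π--t z = trans (sym (y-d+d (π (z - t)) t)) (cong (_- t) (trans (sym (π-t (z - t))) (cong π (ring202 z t))))

    swapFS : FS → FS
    swapFS D = mulFS (classInd t c) D

    not-C : ∀ {z} → ¬ (t ∣ z - (c + δ)) → ¬ (t ∣ z - δ - c)
    not-C {z} n h = n (∣-cast (ring82 z c δ) h)

    -- Only the values at z and z + δ with z ≡ c are exchanged, so the change is a δ-boundary
    -- carried by the class of c. The function `g` is arbitrary because the lemma serves both for
    -- indicators and for the boundary function of a t-equivalence.
    πBd : ∀ (g : ℤ → ℤ) D → (∀ z → at D z ≡ g z - g (z + δ)) → ∀ z → g (π z) - g z ≡ at (swapFS D) (z - δ) - at (swapFS D) z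
    πBd g D h z = go (cls z)
      where
        go : (k : Cls z) → g (move z k) - g z ≡ at (swapFS D) (z - δ) - at (swapFS D) z
        go (inC p) = trans (ring83 (g (z + δ)) (g z) (at D (z - δ))) (sym (cong₂ _-_ (cong (_* at D (z - δ)) (classInd-out {t} {c} {z - δ} (not-C {z} (disjoint {z} p)))) (cong₂ _*_ (classInd-in {t} {c} {z} p) (h z))))
        go (inC′ p) = trans (ring84 (g (z - δ)) (g z) (at D z)) (sym (cong₂ _-_ (cong₂ _*_ (classInd-in {t} {c} {z - δ} (inC- {z} p)) (trans (h (z - δ)) (cong (λ u → g (z - δ) - g u) (ring202 z δ))))
          (cong (_* at D z) (classInd-out {t} {c} {z} (λ q → disjoint {z} q p)))))
        go (out n n′) = trans (ring85 (g z) (at D (z - δ)) (at D z)) (sym (cong₂ _-_ (cong (_* at D (z - δ)) (classInd-out {t} {c} {z - δ} (not-C {z} n′))) (cong (_* at D z) (classInd-out {t} {c} {z} n))))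

    φ : Maya → Maya
    φ f = mkMaya (λ z → occ f (π z)) (lim f ℕ.+ (lim A ℕ.+ lim B))
      (λ n h → top n h (cls (+ n))) (λ n h → bot n h (cls -[1+ n ]))
      where
        A = shiftMaya (- δ) f
        B = shiftMaya δ f
        le₁ : ∀ {n} → lim f ℕ.+ (lim A ℕ.+ lim B) ℕ.≤ n → lim f ℕ.≤ n
        le₁ h = ℕP.≤-trans (ℕP.m≤m+n (lim f) _) h
        le₂ : ∀ {n} → lim f ℕ.+ (lim A ℕ.+ lim B) ℕ.≤ n → lim A ℕ.≤ n
        le₂ h = ℕP.≤-trans (ℕP.m≤m+n (lim A) (lim B)) (ℕP.≤-trans (ℕP.m≤n+m _ (lim f)) h)
        le₃ : ∀ {n} → lim f ℕ.+ (lim A ℕ.+ lim B) ℕ.≤ n → lim B ℕ.≤ n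
        le₃ h = ℕP.≤-trans (ℕP.m≤n+m (lim B) (lim A)) (ℕP.≤-trans (ℕP.m≤n+m _ (lim f)) h)
        top : ∀ n → lim f ℕ.+ (lim A ℕ.+ lim B) ℕ.≤ n → (k : Cls (+ n)) → occ f (move (+ n) k) ≡ false
        top n h (inC _) = trans (cong (occ f) (ring86 (+ n) δ)) (hi A n (le₂ h))
        top n h (inC′ _) = hi B n (le₃ h)
        top n h (out _ _) = hi f n (le₁ h)
        bot : ∀ n → lim f ℕ.+ (lim A ℕ.+ lim B) ℕ.≤ n → (k : Cls -[1+ n ]) → occ f (move -[1+ n ] k) ≡ true
        bot n h (inC _) = trans (cong (occ f) (ring86 -[1+ n ] δ)) (lo A n (le₂ h))
        bot n h (inC′ _) = lo B n (le₃ h)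
        bot n h (out _ _) = lo f n (le₁ h)

    z--δ : ∀ z → z - (- δ) ≡ z + δ
    z--δ z = ring167 z δ

    φ-δ : ∀ f → Eqv δ (φ f) f
    φ-δ f = swapFS D , πBd (χ f) D (λ z → cong (λ u → χ f z - χ f u) (z--δ z))
      where D = diff f (shiftMaya (- δ) f)

    -- Since π commutes with the shift by t, the new boundary function is V composed with π. Writing
    -- it as V plus a δ-boundary shows both that its support is finite and that its sum is that of
    -- V.
    φ-t : ∀ {f g} → Eqv t f g → Eqv t (φ f) (φ g)
    φ-t {f} {g} (V , p) = W , λ z → trans (p (π z)) (cong₂ _-_ (trans (cong (at V) (sym (π--t z))) (W≡ (z - t))) (W≡ z))
      where
        D = subFS V (shiftFS (- δ) V)
        X = swapFS D
        W = addFS V (subFS (shiftFS δ X) X)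
        W≡ : ∀ z → at V (π z) ≡ at W z
        W≡ z = trans (ring350 (at V (π z)) (at V z)) (cong (λ u → at V z + u) (πBd (at V) D (λ z → cong (λ u → at V z - at V u) (z--δ z)) z))

    φ-t-Σ : ∀ {f g} (p : Eqv t f g) → Σℤ (proj₁ (φ-t {f} {g} p)) ≡ Σℤ (proj₁ p)
    φ-t-Σ (V , p) = trans (Σ-add V (subFS (shiftFS δ X) X)) (trans (cong (λ u → Σℤ V + u) (trans (Σ-sub (shiftFS δ X) X) (trans (cong (_- Σℤ X) (Σ-shift δ X)) (ℤP.+-inverseʳ (Σℤ X))))) (ℤP.+-identityʳ _))
      where X = swapFS (subFS V (shiftFS (- δ) V))

    φ-E : ∀ {f g} → Eqv t f g → E (φ f) - E (φ g) ≡ E f - E g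
    φ-E {f} {g} p = trans (E-Eqv {t} {φ f} {φ g} (φ-t {f} {g} p)) (trans (cong (t *_) (φ-t-Σ {f} {g} p)) (sym (E-Eqv {t} {f} {g} p)))

    φ-core : ∀ {f} → Core t f → Core t (φ f)
    φ-core {f} c z h = c (π z) (trans (cong (occ f) (sym (π-t z))) h)

    -- When the column of c is contained, after the shift by δ, in the column of c + δ, the exchange
    -- moves beads only downwards, each by δ; a single proper move makes the drop strict.
    module Drop (f : Maya) (mono : ∀ z → t ∣ z - c → occ f z ≡ true → occ f (z + δ) ≡ true) (pos : 0ℤ < δ) where
      private
        V : FS
        V = proj₁ (φ-δ f)

      nonpos : ∀ z → NN (-1ℤ * at V z)
      nonpos z = go (t ∣? (z - c))
        where
          bool : ∀ a b → (a ≡ true → b ≡ true) → NN (-1ℤ * (1ℤ * (ind a - ind b)))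
          bool true true h = +≤+ z≤n
          bool true false h = ⊥-elim (true≢false (sym (h refl)))
          bool false true h = +≤+ z≤n
          bool false false h = +≤+ z≤n
          go : Dec (t ∣ z - c) → NN (-1ℤ * at V z)
          go (yes h) = subst (λ u → NN (-1ℤ * (u * (χ f z - χ f (z - (- δ)))))) (sym (classInd-in {t} {c} {z} h)) (bool (occ f z) _ (λ q → trans (cong (occ f) (z--δ z)) (mono z h q)))
          go (no n) = subst (λ u → NN (-1ℤ * (u * (χ f z - χ f (z - (- δ)))))) (sym (classInd-out {t} {c} {z} n)) (nn≡ refl)

      E-drop : E f - E (φ f) ≡ δ * (- Σℤ V)
      E-drop = trans (ring87 (E f) (E (φ f))) (trans (cong -_ (E-Eqv {δ} {φ f} {f} (φ-δ f))) (ring88 δ (Σℤ V)))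

      weak : NN (E f - E (φ f))
      weak = nn-cast (sym E-drop) (nn* (ℤP.<⇒≤ pos) (nn-cast (ring38 (Σℤ V)) (subst NN (Σ-scale -1ℤ V) (Σ-nonneg (mulFS (λ _ → -1ℤ) V) nonpos))))

      strict : ∀ x → t ∣ x - c → occ f x ≡ false → occ f (x + δ) ≡ true → NN (E f - E (φ f) - 1ℤ)
      strict x hx fx fx′ = nn-cast (trans (ring89 δ (Σℤ V)) (cong (_- 1ℤ) (sym E-drop))) (nn+ (nn* (ℤP.<⇒≤ pos) Σneg) (nn≤ (ℤP.i<j⇒suc[i]≤j pos)))
        where
          Vx : -1ℤ * at V x ≡ 1ℤ
          Vx = cong (-1ℤ *_) (cong₂ _*_ (classInd-in {t} {c} {x} hx) (cong₂ (λ a b → ind a - ind b) fx (trans (cong (occ f) (z--δ x)) fx′)))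
          Σneg : NN (- Σℤ V - 1ℤ)
          Σneg = nn-cast (cong₂ _-_ (trans (Σ-scale -1ℤ V) (ring38 (Σℤ V))) Vx) (Σ-term (mulFS (λ _ → -1ℤ) V) x nonpos)

    φ-inv : ∀ f → φ (φ f) ≐ f
    φ-inv f z = cong (occ f) (π-inv z)

    φ-s : ∀ {s} (k : ℕ) → δ ≡ + k * s → ∀ f → Eqv s (φ f) f
    φ-s k e f = Bd-multiple k (subst (λ d → Bd d (λ z → χ (φ f) z - χ f z)) e (φ-δ f))

    -- The condition says that the conjugate of c + δ is congruent to c: the two classes are
    -- exchanged by bar, hence π commutes with bar.
    φ-SC : t ∣ w c + δ → ∀ f → SC f → SC (φ f)
    φ-SC h f sc z = trans (cong (occ f) (bar-π z)) (sc (π z))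
      where
        bar-π : ∀ z → π (bar z) ≡ bar (π z)
        bar-π z = go (cls z)
          where
            go : (k : Cls z) → π (bar z) ≡ bar (move z k)
            go (inC p) = trans (π-C′ (∣-cast (ring90 z c δ) (∣m∣n⇒∣m-n (∣m⇒∣-m p) h))) (sym (bar-+ z δ))
            go (inC′ p) = trans (π-C (∣-cast (ring91 z c δ) (∣m∣n⇒∣m-n (∣m⇒∣-m p) h))) (sym (bar-- z δ))
            go (out n n′) = π-out (λ q → n′ (∣-cast (ring93 z c δ) (∣m∣n⇒∣m-n (∣m⇒∣-m q) h))) (λ q → n (∣-cast (ring92 z c δ) (∣m∣n⇒∣m-n (∣m⇒∣-m q) h)))

  -- The roles of s and t differ: every diagram keeps its own s-core, whereas t-equivalence is only
  -- carried along. So σ stays in place while τ is replaced by `φ τ`.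
  record Inv (S : Setup) : Set where
    open Setup S
    field
      φ : Maya → Maya
      φ-cong : ∀ {f g} → f ≐ g → φ f ≐ φ g
      φ-inv : ∀ f → φ (φ f) ≐ f
      φ-SC : ∀ f → SC f → SC (φ f)
      φ-s : ∀ f → Eqv s (φ f) f
      φ-t : ∀ {f g} → Eqv t f g → Eqv t (φ f) (φ g)
      φ-E : ∀ {f g} → Eqv t f g → E (φ f) - E (φ g) ≡ E f - E g
      φ-core : ∀ {f} → Core t f → Core t (φ f)

  E-nonneg : ∀ f → SC f → NN (E f)
  E-nonneg f sc = go (fromMaya f (SC-charge {f} sc))
    where go : Σ[ κ ∈ Partition ] may κ ≐ f → NN (E f)
          go (κ , e) = nn-cast (trans (sym (E-size κ)) (E-cong {may κ} {f} e)) (nn-pos (size κ))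

  -- f is self-conjugate of energy n, with the same s-core as σ and the same t-core as τ.
  record Sol (S : Setup) (σ τ : Maya) (n : ℤ) (f : Maya) : Set where
    open Setup S
    field
      sc : SC f
      eqs : Eqv s f σ
      eqt : Eqv t f τ
      en : E f ≡ n

  Unique : Setup → Maya → Maya → ℤ → Set
  Unique S σ τ n = Σ[ f ∈ Maya ] (Sol S σ τ n f × (∀ g → Sol S σ τ n g → g ≐ f))

  Unique-swap : ∀ {S σ τ n} → Unique S σ τ n → Unique (swapS S) τ σ n
  Unique-swap {S} (f , p , u) = f , sw p , λ g q → u g (ws q)
    where
      sw : ∀ {S σ τ n f} → Sol S σ τ n f → Sol (swapS S) τ σ n f
      sw p = record { sc = Sol.sc p ; eqs = Sol.eqt p ; eqt = Sol.eqs p ; en = Sol.en p }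
      ws : ∀ {S σ τ n f} → Sol (swapS S) τ σ n f → Sol S σ τ n f
      ws p = record { sc = Sol.sc p ; eqs = Sol.eqt p ; eqt = Sol.eqs p ; en = Sol.en p }

  Unique-cong : ∀ {S σ τ τ′ n n′} → τ ≐ τ′ → n ≡ n′ → Unique S σ τ n → Unique S σ τ′ n′
  Unique-cong {S} {σ} {τ} {τ′} {n} e refl (f , p , u) = f , to p , λ g q → u g (fro q)
    where
      open Setup S
      to : ∀ {f} → Sol S σ τ n f → Sol S σ τ′ n f
      to {f} p = record { sc = Sol.sc p ; eqs = Sol.eqs p ; eqt = Eqv-trans {t} {f} {τ} {τ′} (Sol.eqt p) (Eqv-refl {t} {τ} {τ′} e) ; en = Sol.en p }
      fro : ∀ {f} → Sol S σ τ′ n f → Sol S σ τ n f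
      fro {f} p = record { sc = Sol.sc p ; eqs = Sol.eqs p ; eqt = Eqv-trans {t} {f} {τ′} {τ} (Sol.eqt p) (Eqv-refl {t} {τ′} {τ} (≐-sym {τ} {τ′} e)) ; en = Sol.en p }

  module Transport (S : Setup) (I : Inv S) where
    open Setup S
    open Inv I

    -- The energy above the t-core is preserved, so n changes by exactly what τ loses.
    push : ∀ {σ τ n f} → Sol S σ τ n f → Sol S σ (φ τ) (n - (E τ - E (φ τ))) (φ f)
    push {σ} {τ} {n} {f} p = record
      { sc = φ-SC f (Sol.sc p)
      ; eqs = Eqv-trans {s} {φ f} {f} {σ} (φ-s f) (Sol.eqs p)
      ; eqt = φ-t {f} {τ} (Sol.eqt p)
      ; en = trans (ring317 (E (φ f)) (E (φ τ))) (trans (cong (λ u → u + E (φ τ)) (φ-E {f} {τ} (Sol.eqt p))) (trans (cong (λ u → u - E τ + E (φ τ)) (Sol.en p)) (ring94 n (E τ) (E (φ τ))))) }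

    Sol-cong : ∀ {σ τ τ′ n n′ f} → τ ≐ τ′ → n ≡ n′ → Sol S σ τ n f → Sol S σ τ′ n′ f
    Sol-cong {σ} {τ} {τ′} {f = f} e refl p = record { sc = Sol.sc p ; eqs = Sol.eqs p ; eqt = Eqv-trans {t} {f} {τ} {τ′} (Sol.eqt p) (Eqv-refl {t} {τ} {τ′} e) ; en = Sol.en p }

    pull : ∀ {σ τ n f} → Sol S σ (φ τ) (n - (E τ - E (φ τ))) f → Sol S σ τ n (φ f)
    pull {σ} {τ} {n} {f} p = Sol-cong {σ} {φ (φ τ)} {τ} {f = φ f} (φ-inv τ) (trans (cong (λ u → n - (E τ - E (φ τ)) - (E (φ τ) - u)) (E-cong {φ (φ τ)} {τ} (φ-inv τ))) (ring95 n (E τ) (E (φ τ)))) (push p)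

    to : ∀ {σ τ n} → Unique S σ τ n → Unique S σ (φ τ) (n - (E τ - E (φ τ)))
    to {σ} {τ} {n} (f , p , u) = φ f , push p , λ g q → ≐-trans {g} {φ (φ g)} {φ f} (≐-sym {φ (φ g)} {g} (φ-inv g)) (φ-cong {φ g} {f} (u (φ g) (pull q)))

    fro : ∀ {σ τ n} → Unique S σ (φ τ) (n - (E τ - E (φ τ))) → Unique S σ τ n
    fro {σ} {τ} {n} (f , p , u) = φ f , pull p , λ g q → ≐-trans {g} {φ (φ g)} {φ f} (≐-sym {φ (φ g)} {g} (φ-inv g)) (φ-cong {φ g} {f} (u (φ g) (push q)))

  -- Columns of a t-core are half-lines, hence nested after any shift; the one pair at x decides the
  -- direction.
  core-col : ∀ {t} τ x δ → Core t τ → occ τ x ≡ false → occ τ (x + δ) ≡ true → ∀ z → t ∣ z - x → occ τ z ≡ true → occ τ (z + δ) ≡ true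
  core-col {t} τ x δ c h h′ z (divides (+ k) e) hz = contra hz (core-up {t} {τ} c x z k (trans (ring350 z x) (cong (λ u → x + u) e)) h)
  core-col {t} τ x δ c h h′ z (divides -[1+ k ] e) hz = core-down′ {t} {τ} c (z + δ) (x + δ) (suc k) (trans (ring96 z x δ) (trans (cong (λ u → z + δ - u) e) (ring97 (z + δ) (+ suc k) t))) h′

  module ReduceStep (S : Setup) (τ : Maya) (scτ : SC τ) (ct : Core (Setup.t S) τ) where
    open SetupFacts S

    Result : Set
    Result = Σ[ I ∈ Inv S ] NN (E τ - E (Inv.φ I τ) - 1ℤ)

    single : ∀ c δ (k : ℕ) → δ ≡ + k * s → 0ℤ < δ → ¬ (t ∣ δ) → t ∣ w c + δ → occ τ c ≡ false → occ τ (c + δ) ≡ true → Result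
    single c δ k e pos nd h h₀ h₁ = record
        { φ = φ ; φ-cong = λ e x → e (π x) ; φ-inv = φ-inv ; φ-SC = φ-SC h ; φ-s = φ-s k e
        ; φ-t = λ {f} {g} → φ-t {f} {g} ; φ-E = λ {f} {g} → φ-E {f} {g} ; φ-core = λ {f} → φ-core {f} }
      , Drop.strict τ (core-col {t} τ c δ ct h₀ h₁) pos c (divides 0ℤ (ℤP.+-inverseʳ c)) h₀ h₁
      where open Swap t c δ nd

    -- Column x is self-conjugate: exchange its two neighbours.
    middle : ∀ x → occ τ x ≡ false → occ τ (x + s) ≡ true → t ∣ w x → Result
    middle x h₀ h₁ d@(divides q e) = single (x - s) (s + s) 2 (ring261 s) (ℤP.+-mono-< s>0 s>0) (λ h → t∤s (odd-half x s d h))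
        (∣-cast (ring98 x s) d) x-s (trans (cong (occ τ) (ring99 x s)) h₁)
      where
        bx : occ τ (bar x) ≡ true
        bx = SC-false {τ} scτ h₀
        bxs : occ τ (bar x - s) ≡ false
        bxs = trans (cong (occ τ) (sym (bar-+ x s))) (SC-true {τ} scτ h₁)
        -- The bead x̄ lies in the column of the gap x, so it cannot lie above x. It lies below, and
        -- then the gap x̄ - s forces the gap x - s.
        go : ∀ q → w x ≡ q * t → occ τ (x - s) ≡ false
        go (+ k) e = core-up {t} {τ} ct (bar x - s) (x - s) k (trans (ring100 x s (w x)) (trans (cong (λ u → u - s + w x) (sym (bar≡+ x))) (cong (λ u → bar x - s + u) e))) bxs
        go -[1+ k ] e = contra (core-down′ {t} {τ} ct x (bar x) (suc k) (trans (bar≡+ x) (trans (cong (λ u → x - u) e) (ring97 x (+ suc k) t))) bx) h₀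
        x-s : occ τ (x - s) ≡ false
        x-s = go q e

    -- In the generic case the classes of x and x + s are exchanged and at the same time their
    -- conjugates. The three conditions, with `t∤s`, keep the four classes distinct, so the
    -- exchanges commute and bar turns one into the other.
    double : ∀ x → occ τ x ≡ false → occ τ (x + s) ≡ true → ¬ (t ∣ w x + s) → ¬ (t ∣ w x) → ¬ (t ∣ w x + (s + s)) → Result
    double x h₀ h₁ n₁ n₂ n₃ = record
        { φ = λ f → B.φ (A.φ f)
        ; φ-cong = λ e z → e (A.π (B.π z))
        ; φ-inv = λ f z → cong (occ f) (trans (cong (λ u → A.π (B.π u)) (comm z)) (trans (cong A.π (B.π-inv (A.π z))) (A.π-inv z)))
        ; φ-SC = λ f sc z → trans (cong (occ f) (trans (cong A.π (barB z)) (trans (barA (A.π z)) (cong bar (sym (comm z)))))) (sc (A.π (B.π z)))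
        ; φ-s = λ f → Eqv-trans {s} {B.φ (A.φ f)} {A.φ f} {f} (B.φ-s 1 (sym (ℤP.*-identityˡ s)) (A.φ f)) (A.φ-s 1 (sym (ℤP.*-identityˡ s)) f)
        ; φ-t = λ {f} {g} p → B.φ-t {A.φ f} {A.φ g} (A.φ-t {f} {g} p)
        ; φ-E = λ {f} {g} p → trans (B.φ-E {A.φ f} {A.φ g} (A.φ-t {f} {g} p)) (A.φ-E {f} {g} p)
        ; φ-core = λ {f} c → B.φ-core {A.φ f} (A.φ-core {f} c) }
      , nn-cast (ring101 (E τ) (E (A.φ τ)) (E (B.φ (A.φ τ))))
          (nn+ (A.Drop.strict τ (core-col {t} τ x s ct h₀ h₁) s>0 x (divides 0ℤ (ℤP.+-inverseʳ x)) h₀ h₁) (B.Drop.weak (A.φ τ) monoB s>0))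
      where
        y : ℤ
        y = bar (x + s)
        module A = Swap t x s t∤s
        module B = Swap t y s t∤s
        ys : y + s ≡ bar x
        ys = ring102 x s
        xy₁ : ∀ z → t ∣ z - x → ¬ (t ∣ z - y)
        xy₁ z h h′ = n₁ (∣-cast (ring103 z x s) (∣m∣n⇒∣m-n h′ h))
        xy₂ : ∀ z → t ∣ z - x → ¬ (t ∣ z - (y + s))
        xy₂ z h h′ = n₂ (∣-cast (ring104 z x s) (∣m∣n⇒∣m-n h′ h))
        xy₃ : ∀ z → t ∣ z - (x + s) → ¬ (t ∣ z - y)
        xy₃ z h h′ = n₃ (∣-cast (ring105 z x s) (∣m∣n⇒∣m-n h′ h))
        xy₄ : ∀ z → t ∣ z - (x + s) → ¬ (t ∣ z - (y + s))
        xy₄ z h h′ = n₁ (∣-cast (ring106 z x s) (∣m∣n⇒∣m-n h′ h))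
        comm : ∀ z → A.π (B.π z) ≡ B.π (A.π z)
        comm z = go (A.cls z)
          where
            go : A.Cls z → A.π (B.π z) ≡ B.π (A.π z)
            go (A.inC p) = trans (cong A.π (B.π-out (xy₁ z p) (xy₂ z p))) (trans (A.π-C p) (sym (trans (cong B.π (A.π-C p)) (B.π-out (xy₃ (z + s) (A.inC+ {z} p)) (xy₄ (z + s) (A.inC+ {z} p))))))
            go (A.inC′ p) = trans (cong A.π (B.π-out (xy₃ z p) (xy₄ z p))) (trans (A.π-C′ p) (sym (trans (cong B.π (A.π-C′ p)) (B.π-out (xy₁ (z - s) (A.inC- {z} p)) (xy₂ (z - s) (A.inC- {z} p))))))
            go (A.out n n′) = trans (go′ (B.cls z)) (cong B.π (sym (A.π-out n n′)))
              where
                go′ : B.Cls z → A.π (B.π z) ≡ B.π z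
                go′ (B.inC q) = trans (cong A.π (B.π-C q)) (trans (A.π-out (λ p → xy₂ (z + s) p (B.inC+ {z} q)) (λ p → xy₄ (z + s) p (B.inC+ {z} q))) (sym (B.π-C q)))
                go′ (B.inC′ q) = trans (cong A.π (B.π-C′ q)) (trans (A.π-out (λ p → xy₁ (z - s) p (B.inC- {z} q)) (λ p → xy₃ (z - s) p (B.inC- {z} q))) (sym (B.π-C′ q)))
                go′ (B.out m m′) = trans (cong A.π (B.π-out m m′)) (trans (A.π-out n n′) (sym (B.π-out m m′)))
        neg₁ : ∀ z → t ∣ z - x → t ∣ bar z - (y + s)
        neg₁ z h = ∣-cast (ring107 z x s) (∣m⇒∣-m h)
        neg₂ : ∀ z → t ∣ z - (x + s) → t ∣ bar z - y
        neg₂ z h = ∣-cast (ring108 z x s) (∣m⇒∣-m h)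
        neg₁′ : ∀ z → t ∣ bar z - (y + s) → t ∣ z - x
        neg₁′ z h = ∣-cast (ring109 z x s) (∣m⇒∣-m h)
        neg₂′ : ∀ z → t ∣ bar z - y → t ∣ z - (x + s)
        neg₂′ z h = ∣-cast (ring110 z x s) (∣m⇒∣-m h)
        barB : ∀ z → B.π (bar z) ≡ bar (A.π z)
        barB z = go (A.cls z)
          where
            go : A.Cls z → B.π (bar z) ≡ bar (A.π z)
            go (A.inC p) = trans (B.π-C′ (neg₁ z p)) (trans (sym (bar-+ z s)) (cong bar (sym (A.π-C p))))
            go (A.inC′ p) = trans (B.π-C (neg₂ z p)) (trans (sym (bar-- z s)) (cong bar (sym (A.π-C′ p))))
            go (A.out n n′) = trans (B.π-out (λ q → n′ (neg₂′ z q)) (λ q → n (neg₁′ z q))) (cong bar (sym (A.π-out n n′)))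
        barA : ∀ z → A.π (bar z) ≡ bar (B.π z)
        barA z = trans (sym (bar-bar _)) (cong bar (trans (sym (barB (bar z))) (cong B.π (bar-bar z))))
        Aτ : ∀ {z} → ¬ (t ∣ z - x) → ¬ (t ∣ z - (x + s)) → occ (A.φ τ) z ≡ occ τ z
        Aτ n n′ = cong (occ τ) (A.π-out n n′)
        y₀ : occ τ y ≡ false
        y₀ = SC-true {τ} scτ h₁
        y₁ : occ τ (y + s) ≡ true
        y₁ = trans (cong (occ τ) ys) (SC-false {τ} scτ h₀)
        monoB : ∀ z → t ∣ z - y → occ (A.φ τ) z ≡ true → occ (A.φ τ) (z + s) ≡ true
        monoB z p h = trans (Aτ (λ q → xy₂ (z + s) q (B.inC+ {z} p)) (λ q → xy₄ (z + s) q (B.inC+ {z} p)))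
          (core-col {t} τ y s ct y₀ y₁ z p (trans (sym (Aτ (λ q → xy₁ z q p) (λ q → xy₃ z q p))) h))

    reduce : ∀ x → occ τ (x + s) ≡ true × occ τ x ≡ false → Result
    reduce x (h₁ , h₀) = go (t ∣? (w x + s)) (t ∣? w x) (t ∣? (w x + (s + s)))
      where
        go : Dec (t ∣ w x + s) → Dec (t ∣ w x) → Dec (t ∣ w x + (s + s)) → Result
        go (yes d) _ _ = single x s 1 (sym (ℤP.*-identityˡ s)) s>0 t∤s d h₀ h₁
        go (no _) (yes d) _ = middle x h₀ h₁ d
        -- Here x + s lies in the self-conjugate class, and so does the lower end of the conjugate
        -- ascent at bar (x + s).
        go (no _) (no _) (yes d) = middle (bar (x + s)) (SC-true {τ} scτ h₁) (trans (cong (occ τ) (ring102 x s)) (SC-false {τ} scτ h₀))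
            (∣-cast (trans (cong -_ (sym (w-+ x s))) (sym (w-bar (x + s)))) (∣m⇒∣-m d))
        go (no n₁) (no n₂) (no n₃) = double x h₀ h₁ n₁ n₂ n₃

  -- `κ` is the s-core of τ. The content is that it is a t-core as well and that the uniqueness
  -- problem for τ is equivalent to the one for `κ` at an energy lowered by the same amount.
  record Reduced (S : Setup) (τ : Maya) : Set where
    open Setup S
    field
      κ : Maya
      scκ : SC κ
      core-s : Core s κ
      core-t : Core t κ
      eqv : Eqv s τ κ
      to : ∀ {σ n} → Unique S σ τ n → Unique S σ κ (n - (E τ - E κ))
      fro : ∀ {σ n} → Unique S σ κ (n - (E τ - E κ)) → Unique S σ τ n

  pos-form : ∀ {d} → 0ℤ < d → Σ[ k ∈ ℕ ] d ≡ + k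
  pos-form {+ n} _ = n , refl

  -- Every exchange lowers the energy, which is nonnegative for self-conjugate diagrams; the
  -- argument m bounds it and counts the remaining exchanges.
  reduce-all : ∀ S τ → SC τ → Core (Setup.t S) τ → Reduced S τ
  reduce-all S τ scτ ct = go ∣ E τ ∣ τ scτ ct (nn≡ (zsub (ℤP.0≤i⇒+∣i∣≡i (E-nonneg τ scτ))))
    where
      open SetupFacts S
      k = proj₁ (pos-form s>0)
      sk : s ≡ + k
      sk = proj₂ (pos-form s>0)
      go : ∀ m τ → SC τ → Core t τ → NN (+ m - E τ) → Reduced S τ
      go m τ scτ ct le = [ step′ , stop ]′ (core? τ k)
        where
          stop : Core (+ k) τ → Reduced S τ
          stop c = record { κ = τ ; scκ = scτ ; core-s = subst (λ d → Core d τ) (sym sk) c ; core-t = ct ; eqv = Eqv-refl {s} {τ} {τ} (λ _ → refl)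
            ; to = λ {σ} {n} u → Unique-cong {S} {σ} {τ} {τ} (λ _ → refl) (ring111 n (E τ)) u
            ; fro = λ {σ} {n} u → Unique-cong {S} {σ} {τ} {τ} (λ _ → refl) (sym (ring111 n (E τ))) u }
          step′ : Σ[ x ∈ ℤ ] (occ τ (x + + k) ≡ true × occ τ x ≡ false) → Reduced S τ
          step′ (x , h) = use (ReduceStep.reduce S τ scτ ct x (subst (λ d → occ τ (x + d) ≡ true × occ τ x ≡ false) (sym sk) h))
            where
              use : ReduceStep.Result S τ scτ ct → Reduced S τ
              use (I , drop) = next′ m le
                where
                  open Inv I
                  wrap : Reduced S (φ τ) → Reduced S τ
                  wrap R = record { κ = κ ; scκ = scκ ; core-s = core-s ; core-t = core-t
                    ; eqv = Eqv-trans {s} {τ} {φ τ} {κ} (Eqv-sym {s} {φ τ} {τ} (φ-s τ)) eqv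
                    ; to = λ {σ} {n} u → Unique-cong {S} {σ} {κ} {κ} (λ _ → refl) (ring113 n (E τ) (E (φ τ)) (E κ)) (to (Transport.to S I u))
                    ; fro = λ {σ} {n} u → Transport.fro S I {σ} {τ} {n} (fro (Unique-cong {S} {σ} {κ} {κ} (λ _ → refl) (sym (ring113 n (E τ) (E (φ τ)) (E κ))) u)) }
                    where
                      open Reduced R
                  next′ : ∀ m → NN (+ m - E τ) → Reduced S τ
                  next′ zero le = ⊥-elim (nn-neg-absurd 0 (nn+ (nn+ le drop) (E-nonneg (φ τ) (φ-SC τ scτ))) (ring114 (E τ) (E (φ τ))))
                  next′ (suc m) le = wrap (go m (φ τ) (φ-SC τ scτ) (φ-core {τ} ct) (nn-cast (ring112 (+ m) (E τ) (E (φ τ))) (nn+ le drop)))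

  -- The five cases give a unique solution

  cancel-pos : ∀ {d a b} → 0ℤ < d → d * a ≡ d * b → a ≡ b
  cancel-pos {d} {a} {b} pos e = [ (λ z → ⊥-elim (pos-nonzero pos z)) , subz ]′ (ℤP.i*j≡0⇒i≡0∨j≡0 d (trans (ring22 d a b) (zsub e)))

  nn-pred : ∀ {a} → 0ℤ < a → NN (a - 1ℤ)
  nn-pred h = nn≤ (ℤP.i<j⇒suc[i]≤j h)

  core-center : ∀ {d g} → SC g → Core d g → ∀ c (k : ℕ) → w c ≡ - (+ k * d) → occ g c ≡ true
  core-center {d} {g} sc co c k e with occ g c in eq
  ... | true = refl
  ... | false = ⊥-elim (contra (core-down′ {d} {g} co c (bar c) k (trans (bar≡+ c) (trans (cong (λ u → c - u) e) (ring167 c (+ k * d)))) (SC-false {g} sc eq)) eq)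

  reflectFS : FS → FS
  reflectFS F = mkFS (λ x → at F (bar x)) (bd F) (λ x h → van F (bar x) (subst (bd F ℕ.≤_) (sym (mag-bar x)) h))

  periodic-zero : ∀ (X : FS) d → 0ℤ < d → (∀ y → at X (y - d) ≡ at X y) → ∀ y → at X y ≡ 0ℤ
  periodic-zero X d pos h y = go (farDown (bd X) y d pos)
    where
      iter : ∀ k → at X (y - + k * d) ≡ at X y
      iter zero = cong (at X) (ring149 y d)
      iter (suc k) = trans (cong (at X) (ring34 y (+ k) d)) (trans (h _) (iter k))
      go : Σ[ K ∈ ℕ ] Σ[ n ∈ ℕ ] (bd X ℕ.≤ n × y - + K * d ≡ -[1+ n ]) → at X y ≡ 0ℤ
      go (K , n , le , e) = trans (sym (iter K)) (van X _ (subst (λ z → bd X ℕ.≤ mag z) (sym e) le))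

  -- The windows are symmetric under bar, V under negation; so a partial sum carries the unpaired
  -- end term V(N), which vanishes at the bound.
  even-sum : ∀ (V : FS) → (∀ n → at V -[1+ n ] ≡ at V (+ suc n)) → Σ[ Y ∈ ℤ ] Σℤ V ≡ at V 0ℤ + (Y + Y)
  even-sum V h = proj₁ (go (bd V)) , trans (proj₂ (go (bd V))) (trans (cong (λ u → at V 0ℤ + u + (proj₁ (go (bd V)) + proj₁ (go (bd V)))) (van V (+ bd V) ℕP.≤-refl)) (ring115 (at V 0ℤ) (proj₁ (go (bd V)))))
    where
      go : ∀ N → Σ[ Y ∈ ℤ ] sumTo N (at V) ≡ at V 0ℤ + at V (+ N) + (Y + Y)
      go zero = - at V 0ℤ , ring116 (at V 0ℤ)
      go (suc N) = proj₁ (go N) + at V (+ N) , trans (cong₂ (λ u v → u + (at V (+ N) + v)) (proj₂ (go N)) (h N)) (ring117 (at V 0ℤ) (at V (+ N)) (at V (+ suc N)) (proj₁ (go N)))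

  ind-not : ∀ a b → ind (not a) - ind (not b) ≡ - (ind a - ind b)
  ind-not true true = refl
  ind-not true false = refl
  ind-not false true = refl
  ind-not false false = refl

  -- The boundary function of a self-conjugate pair is symmetric about c, so an odd
  -- weight forces it to be nonzero at c.
  parity : ∀ {d f g} → 0ℤ < d → SC f → SC g → Core d g → (p : Eqv d f g) → ∀ m → Σℤ (proj₁ p) ≡ m + m + 1ℤ →
    ∀ c → w c ≡ - d → Σ[ j ∈ ℕ ] occ f (c - + j * d) ≡ false
  parity {d} {f} {g} pos sf sg cg (U , p) m odd c wc = found (farDown (bd U) c d pos)
    where
      X = subFS (shiftFS (- d) (reflectFS U)) U
      combine : ∀ F a b x y → F ≡ a - b → - F ≡ x - y → y - a ≡ x - b
      combine F a b x y e e′ = subz (trans (ring118 a b x y) (trans (cong₂ (λ u v → - (u + v)) (sym e′) (sym e)) (ring119 F)))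
      -- Reflecting U gives another boundary function for the same difference. Two such functions
      -- differ by a d-periodic one, which is zero by finite support.
      X-per : ∀ y → at X (y - d) ≡ at X y
      X-per y = trans (cong (λ u → at U (bar u) - at U (y - d)) (trans (ring167 (y - d) d) (ring202 y d)))
        (trans (combine (χ f y - χ g y) (at U (y - d)) (at U y) (at U (bar y - d)) (at U (bar y)) (p y) (trans (sym (trans (cong₂ (λ a b → ind a - ind b) (sf y) (sg y)) (ind-not (occ f y) (occ g y)))) (p (bar y))))
          (cong (λ u → at U u - at U y) (trans (sym (bar-+ y d)) (cong bar (sym (ring167 y d))))))
      sym-U : ∀ y → at U (bar (y + d)) ≡ at U y
      sym-U y = subz (trans (cong (λ u → at U (bar u) - at U y) (sym (ring167 y d))) (periodic-zero X d pos X-per y))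
      V = shiftFS (- c) U
      V-even : ∀ n → at V -[1+ n ] ≡ at V (+ suc n)
      V-even n = trans (cong (at U) (subz { -[1+ n ] - (- c)} {bar (+ suc n + c + d)} (trans (ring120 c (+ n) d) (trans (cong (_+ d) wc) (ℤP.+-inverseˡ d)))))
        (trans (sym-U (+ suc n + c)) (cong (at U) (sym (ring167 (+ suc n) c))))
      V0 : at V 0ℤ ≡ at U c
      V0 = cong (at U) (trans (ring167 0ℤ c) (ℤP.+-identityˡ c))
      U≢0 : at U c ≢ 0ℤ
      U≢0 z = even≢odd Y m (trans (sym (ℤP.+-identityˡ _)) (trans (cong (λ u → u + (Y + Y)) (sym (trans V0 z))) (trans (sym (proj₂ ev)) (trans (Σ-shift (- c) U) odd))))
        where ev = even-sum V V-even
              Y = proj₁ ev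
      gc : occ g c ≡ true
      gc = core-center {d} {g} sg cg c 1 (trans wc (cong -_ (sym (ℤP.*-identityˡ d))))
      -- From c downwards `g` has only beads. As long as `f` has beads there too, U stays constant,
      -- but U is nonzero at c and zero far below.
      scan′ : ∀ K → (Σ[ j ∈ ℕ ] occ f (c - + j * d) ≡ false) ⊎ (at U (c - + K * d) ≡ at U c)
      scan′ zero = inj₂ (cong (at U) (ring149 c d))
      scan′ (suc K) with occ f (c - + K * d) in eq
      ... | false = inj₁ (K , eq)
      ... | true = [ inj₁ , (λ e → inj₂ (trans (cong (at U) (ring34 c (+ K) d)) (trans (subz (trans (sym (p (c - + K * d))) (cong₂ (λ a b → ind a - ind b) eq (core-down′ {d} {g} cg (c - + K * d) c K (ring317 c (+ K * d)) gc)))) e))) ]′ (scan′ K)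
      found : Σ[ K ∈ ℕ ] Σ[ n ∈ ℕ ] (bd U ℕ.≤ n × c - + K * d ≡ -[1+ n ]) → Σ[ j ∈ ℕ ] occ f (c - + j * d) ≡ false
      found (K , n , le , e) = [ (λ r → r) , (λ q → ⊥-elim (U≢0 (trans (sym q) (van U _ (subst (λ z → bd U ℕ.≤ mag z) (sym e) le))))) ]′ (scan′ K)

  w-- : ∀ x d → w (x - d) ≡ w x - (d + d)
  w-- = ring121

  w-step : ∀ {x y k d} → w x ≡ w y + (k + k) * d → x ≡ y + k * d
  w-step {x} {y} {k} {d} e = w-inj {x} {y + k * d} (trans e (trans (cong (λ u → w y + u) (ring122 k d)) (sym (w-+ y (k * d)))))

  -- Cases with at most one flip

  case1 : ∀ S σ τ → SC σ → Core (Setup.s S) σ → σ ≐ τ → Unique S σ τ (E σ)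
  case1 S σ τ sc co e = σ , record { sc = sc ; eqs = Eqv-refl {s} {σ} {σ} (λ _ → refl) ; eqt = Eqv-refl {t} {σ} {τ} e ; en = refl }
    , λ g q → E-core-unique {s} {g} {σ} s>0 co (Sol.eqs q) (Sol.en q)
    where open SetupFacts S

  -- The weight over τ is 1, so `parity` gives a solution a gap at b₀ - j t. Flipping it preserves
  -- the t-core and leaves energy E τ - 2 j t; minimality of the core gives j = 0, and the flipped
  -- diagram is τ.
  case2 : ∀ S σ τ → SC τ → Core (Setup.t S) τ → ∀ b₀ → w b₀ ≡ - Setup.t S → ∀ b l → w b ≡ - Setup.t S + (l + l) * Setup.s S →
    occ τ b ≡ true → σ ≐ flip b τ → Unique S σ τ (E τ + Setup.t S)
  case2 S σ τ sc ct b₀ wb₀ b l wb hb e = f₀ , record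
      { sc = flip-SC b₀ {τ} sc
      ; eqs = Eqv-trans {s} {f₀} {flip b τ} {σ} (flip-Eqv {s} {τ} {τ} b₀ b l sc sc (Eqv-refl {s} {τ} {τ} (λ _ → refl))
          (w-step {b} {b₀} {l} {s} (trans wb (cong (λ u → u + (l + l) * s) (sym wb₀)))) (trans τb₀ (sym hb))) (Eqv-refl {s} {flip b τ} {σ} (≐-sym {σ} {flip b τ} e))
      ; eqt = flip-self {t} τ b₀ sc (divides -1ℤ (trans wb₀ (ring224 t)))
      ; en = trans (E-flip-true b₀ {τ} sc τb₀) (trans (cong (λ u → E τ - u) wb₀) (ring167 (E τ) t)) }
    , uniq
    where
      open SetupFacts S
      f₀ = flip b₀ τ
      τb₀ : occ τ b₀ ≡ true
      τb₀ = core-center {t} {τ} sc ct b₀ 1 (trans wb₀ (cong -_ (sym (ℤP.*-identityˡ t))))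
      uniq : ∀ g → Sol S σ τ (E τ + t) g → g ≐ f₀
      uniq g q = use (parity {t} {g} {τ} t>0 (Sol.sc q) sc ct (Sol.eqt q) 0ℤ
          (cancel-pos t>0 (trans (sym (E-Eqv {t} {g} {τ} (Sol.eqt q))) (trans (cong (λ u → u - E τ) (Sol.en q)) (ring123 (E τ) t)))) b₀ wb₀)
        where
          use : Σ[ j ∈ ℕ ] occ g (b₀ - + j * t) ≡ false → g ≐ f₀
          use (j , gx) = fin (j=0 (E-core-min {t} {h} {τ} t>0 ct eq))
            where
              x = b₀ - + j * t
              wx : w x ≡ - t - (+ j * t + + j * t)
              wx = trans (w-- b₀ (+ j * t)) (cong (λ u → u - (+ j * t + + j * t)) wb₀)
              h = flip x g
              eq : Eqv t h τ
              eq = Eqv-trans {t} {h} {g} {τ} (flip-self {t} g x (Sol.sc q) (divides (-1ℤ - (+ j + + j)) (trans wx (ring124 (+ j) t)))) (Sol.eqt q)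
              Eh : E h ≡ E τ - (+ j * t + + j * t)
              Eh = trans (E-flip-false x {g} (Sol.sc q) gx) (trans (cong₂ _+_ (Sol.en q) wx) (ring125 (E τ) t (+ j * t)))
              j=0 : NN (E h - E τ) → + j * t ≡ 0ℤ
              j=0 nn = nn-antisym jt (nn-cast (ring127 (+ j * t)) (nn+ jt (nn-cast (trans (cong (λ u → u - E τ) Eh) (ring126 (E τ) (+ j * t + + j * t))) nn)))
                where jt = nn* (nn-pos j) (ℤP.<⇒≤ t>0)
              fin : + j * t ≡ 0ℤ → g ≐ f₀
              fin z = ≐-trans {g} {flip x h} {f₀} (≐-sym {flip x h} {g} (flip-flip x g)) (subst (λ u → flip u h ≐ f₀) (sym x≡) (flip-cong≐ {b₀} {h} {τ}
                  (E-core-unique {t} {h} {τ} t>0 ct eq (trans Eh (trans (cong (λ u → E τ - (u + u)) z) (ℤP.+-identityʳ (E τ)))))))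
                where x≡ : x ≡ b₀
                      x≡ = trans (cong (λ u → b₀ - u) z) (ℤP.+-identityʳ b₀)

  ∣-mod : ∀ {t} x y k → y ≡ x + k * t → t ∣ w y → t ∣ w x
  ∣-mod {t} x y k e h = ∣m+n∣n⇒∣m {t} {w x} {(k + k) * t} (subst (t ∣_) w≡ h) (divides (k + k) refl)
    where
      w≡ : w y ≡ w x + (k + k) * t
      w≡ = trans (cong w e) (trans (w-+ x (k * t)) (cong (λ u → w x + u) (ring128 k t)))

  -- If a solution-like f has a gap x, flipping it there must not fall below the
  -- energy of the resulting t-core; z is any gap of the t-core τ in the class of x̄.
  flip-bound : ∀ {t} f τ x z k → 0ℤ < t → SC f → SC τ → Core t τ → Eqv t f τ → occ f x ≡ false → ¬ (t ∣ w x) →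
    bar x ≡ z + k * t → occ τ z ≡ false → NN (E f + w x - E τ + w z - (t + t))
  flip-bound {t} f τ x z k pos sf sτ ct eq fx nd e zg = use (topBead τ t pos (bar x))
    where
      use : Σ[ k′ ∈ ℤ ] (occ τ (bar x + k′ * t) ≡ true × occ τ (bar x + k′ * t + t) ≡ false) → NN (E f + w x - E τ + w z - (t + t))
      use (k′ , hy , hy′) = fin (k + k′) refl
        where
          y = bar x + k′ * t
          g = flip x f
          τ′ = flip y τ
          nd′ : ¬ (t ∣ w y)
          nd′ h = nd (∣-cast (trans (cong -_ (w-bar x)) (ℤP.neg-involutive (w x))) (∣m⇒∣-m (∣-mod (bar x) y k′ refl h)))
          eq′ : Eqv t g τ′
          eq′ = Eqv-trans {t} {g} {flip (bar x) f} {τ′} (Eqv-refl {t} {g} {flip (bar x) f} (≐-sym {flip (bar x) f} {g} (flip-bar x f)))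
            (flip-Eqv {t} {f} {τ} (bar x) y k′ sf sτ eq refl (trans (SC-false {f} sf fx) (sym hy)))
          bound : NN (E f + w x - (E τ - w y))
          bound = nn-cast (cong₂ _-_ (E-flip-false x {f} sf fx) (E-flip-true y {τ} sτ hy)) (E-core-min {t} {g} {τ′} pos (flip-core {t} τ y pos sτ ct hy hy′ nd′) eq′)
          y≡ : ∀ n → k + k′ ≡ n → y ≡ z + n * t
          y≡ n q = trans (cong (λ u → u + k′ * t) e) (trans (ring129 z k k′ t) (cong (λ u → z + u * t) q))
          fin : ∀ n → k + k′ ≡ n → NN (E f + w x - E τ + w z - (t + t))
          -- `y` is a bead and `z` a gap of one column of a core, so y ≤ z - t; this is the source
          -- of the term 2 t in the bound.
          fin (+ n) q = contra (core-down′ {t} {τ} ct z y n (y≡ (+ n) q) hy) zg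
          fin -[1+ n ] q = nn-cast (trans (cong (λ u → E f + w x - (E τ - u) + (+ n + + n) * t) (trans (cong w (y≡ -[1+ n ] q)) (ring130 z (+ n) t))) (ring131 (E f + w x) (E τ) (w z) (+ n) t))
              (nn+ bound (nn* (nn+ (nn-pos n) (nn-pos n)) (ℤP.<⇒≤ pos)))

  -- `γ` is the partition α ⋆ β of the double harpoon and `d` is c̄, a bead of `γ`. Seen from `γ`,
  -- both σ and τ arise by flipping a bead, which makes the situation symmetric in s and t.
  record Data4 (S : Setup) : Set where
    open Setup S
    field
      γ : Maya
      b d c₀ b₀ l k : ℤ
      scγ : SC γ
      γs : Core s γ
      γt : Core t γ
      γb : occ γ b ≡ true
      γd : occ γ d ≡ true
      b≢d : b ≢ d
      wc₀ : w c₀ ≡ - s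
      wb₀ : w b₀ ≡ - t
      wb : w b ≡ - t + (l + l) * s
      wd : w d ≡ - s + (k + k) * t
      σs : Core s (flip b γ)
      σt : Core t (flip b γ)
      τs : Core s (flip d γ)
      τt : Core t (flip d γ)

  swap4 : ∀ {S} → Data4 S → Data4 (swapS S)
  swap4 D = record { γ = γ ; b = d ; d = b ; c₀ = b₀ ; b₀ = c₀ ; l = k ; k = l ; scγ = scγ ; γs = γt ; γt = γs ; γb = γd ; γd = γb
    ; b≢d = λ e → b≢d (sym e) ; wc₀ = wb₀ ; wb₀ = wc₀ ; wb = wd ; wd = wb ; σs = τt ; σt = τs ; τs = σt ; τt = σs }
    where open Data4 D

  pos-suc : ∀ {a} → 0ℤ < a → Σ[ n ∈ ℕ ] a ≡ + suc n
  pos-suc {+ suc n} _ = n , refl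
  pos-suc {+ zero} (+<+ ())

  -- The points x + s and x̄ lie on one t-runner, (s - 1) t apart, so a bead at x + s would make x̄
  -- a bead.
  xm-gap : ∀ {s t} γ → 0ℤ < s → SC γ → Core t γ → ∀ x → w x ≡ s * t - s - t → occ γ x ≡ true → occ γ (x + s) ≡ false
  xm-gap {s} {t} γ pos sc co x e h = go (pos-suc pos) (occ γ (x + s)) refl
    where
      go : Σ[ n ∈ ℕ ] s ≡ + suc n → ∀ v → occ γ (x + s) ≡ v → occ γ (x + s) ≡ false
      go _ false eq = eq
      go (n , en) true eq = contra (core-down′ {t} {γ} co (bar x) (x + s) n
        (subz (trans (ring132 x s t (+ n)) (z+ (zsub e) (cong (_* t) (trans (cong (λ u → u - 1ℤ - + n) en) (ring133 (+ n))))))) eq) (SC-true {γ} sc h)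

  flip-false : ∀ b γ → occ γ b ≡ true → occ (flip b γ) b ≡ false
  flip-false b γ h = trans (flip-at b γ) (cong not h)

  half-of : ∀ {s c} → w c ≡ - s → w (bar c) ≡ s
  half-of {s} {c} e = trans (w-bar c) (trans (cong -_ e) (ℤP.neg-involutive s))

  module Case4 (S : Setup) (D : Data4 S) where
    open SetupFacts S
    open Data4 D
    σ τ : Maya
    σ = flip b γ
    τ = flip d γ
    scσ : SC σ
    scσ = flip-SC b {γ} scγ
    scτ : SC τ
    scτ = flip-SC d {γ} scγ

    d≡ : d ≡ c₀ + k * t
    d≡ = w-step {d} {c₀} {k} {t} (trans wd (cong (λ u → u + (k + k) * t) (sym wc₀)))

    h h′ xm : ℤ
    h = bar c₀
    h′ = bar b₀
    xm = c₀ + h * t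
    wh : w h ≡ s
    wh = half-of {s} {c₀} wc₀
    wh′ : w h′ ≡ t
    wh′ = half-of {t} {b₀} wb₀

    wxm : w xm ≡ s * t - s - t
    wxm = trans (w-+ c₀ (h * t)) (trans (cong (λ u → u + (h * t + h * t)) wc₀) (subz (trans (ring134 s t h) (z* t (zsub wh)))))

    b≡ : b ≡ xm + (l - h′) * s
    b≡ = w-step {b} {xm} {l - h′} {s} (trans wb (subz (trans (cong (λ u → - t + (l + l) * s - (u + (l - h′ + (l - h′)) * s)) wxm) (trans (ring135 s t l h′) (z* s (zsub wh′))))))

    d≡′ : d ≡ xm + (k - h) * t
    d≡′ = trans d≡ (ring136 c₀ h k t)

    s∤wb : ¬ (s ∣ w b)
    s∤wb (divides q e) = s∤t (divides ((l + l) - q) (subz (trans (ring137 s t l q) (zsub (trans (sym e) wb)))))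

    -- σ is an s-core with a gap at b, so b was the top bead of its s-runner in `γ`.
    σ-step : occ γ (b + s) ≡ true → ⊥
    σ-step hs = contra (σs b (trans (flip-off b (occ γ) (b + s) (x+d≢x s>0 b) ne) hs)) (flip-false b γ γb)
      where ne : b + s ≢ bar b
            ne e = s∤wb (divides -1ℤ (subz (trans (ring138 b s) (zsub e))))

    -- Otherwise γ would be the maximal core and b = d its top bead.
    small : NN (s - (k + k) - 1ℤ - 1ℤ)
    small = [ (λ n → ⊥-elim (absurd (nn≡+ n))) , (λ n → nn-cast (trans (ring139 k h) (cong (λ u → u - (k + k) - 1ℤ - 1ℤ) wh)) (nn+ (nn+ n n) (nn-pos 1))) ]′ (nn-total (k - h))
      where
        absurd : Σ[ n ∈ ℕ ] k - h ≡ + n → ⊥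
        absurd (n , e) = b≢d (trans (b-xm (l - h′) refl) (sym (d-xm n e)))
          where
            γxm : occ γ xm ≡ true
            γxm = core-down′ {t} {γ} γt xm d n (trans d≡′ (cong (λ u → xm + u * t) e)) γd
            d-xm : ∀ n → k - h ≡ + n → d ≡ xm
            d-xm zero e = trans d≡′ (trans (cong (λ u → xm + u * t) e) (x+0d xm t))
            d-xm (suc n) e = contra (core-down′ {t} {γ} γt (xm + t) d n (trans d≡′ (trans (cong (λ u → xm + u * t) e) (ring140 xm (+ n) t))) γd)
                (xm-gap {t} {s} γ t>0 scγ γs xm (trans wxm (ring141 s t)) γxm)
            b-xm : ∀ n → l - h′ ≡ n → b ≡ xm
            b-xm (+ zero) e = trans b≡ (trans (cong (λ u → xm + u * s) e) (x+0d xm s))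
            b-xm (+ suc n) e = contra (core-down′ {s} {γ} γs (xm + s) b n (trans b≡ (trans (cong (λ u → xm + u * s) e) (ring140 xm (+ n) s))) γb)
                (xm-gap {s} {t} γ s>0 scγ γt xm wxm γxm)
            b-xm -[1+ n ] e = ⊥-elim (σ-step (core-down′ {s} {γ} γs (b + s) xm n (subz (trans (ring142 xm b s (+ n)) (trans (cong -_ (zsub (trans b≡ (cong (λ u → xm + u * s) e)))) refl))) γxm))

  by-cases : ∀ {P A : Set} → Dec P → (P → A) → (¬ P → A) → A
  by-cases (yes p) f g = f p
  by-cases (no n) f g = g n

  module Case4Uniq (S : Setup) (D : Data4 S) where
    open SetupFacts S
    open Data4 D
    open Case4 S D

    n₀ : ℤ
    n₀ = E γ + s + t

    Eσ : E σ ≡ E γ - w b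
    Eσ = E-flip-true b {γ} scγ γb
    Eτ : E τ ≡ E γ - w d
    Eτ = E-flip-true d {γ} scγ γd

    module Far (f : Maya) (q : Sol S σ τ n₀ f) (I : ℤ) (n : ℕ) (I≡ : I ≡ + n) (I≥1 : NN (I - 1ℤ)) (fx : occ f (c₀ - I * s) ≡ false) where
      x : ℤ
      x = c₀ - I * s
      wx : w x ≡ - s - (I * s + I * s)
      wx = trans (w-- c₀ (I * s)) (cong (λ u → u - (I * s + I * s)) wc₀)
      ntI : NN I
      ntI = subst NN (sym I≡) (nn-pos n)
      nt : NN t
      nt = ℤP.<⇒≤ t>0
      ns : NN s
      ns = ℤP.<⇒≤ s>0

      -- Here w x = - m s t with m ≥ 1. The flip at x keeps the t-core τ, but by `small` its energy
      -- is less than that of τ.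
      inline : t ∣ w x → ⊥
      inline d′ = self (gauss-t (I + I + 1ℤ) (subst (t ∣_) (trans (cong -_ wx) (ring143 s I)) (∣m⇒∣-m d′)))
        where
          eq : Eqv t (flip x f) τ
          eq = Eqv-trans {t} {flip x f} {f} {τ} (flip-self {t} f x (Sol.sc q) d′) (Sol.eqt q)
          nn : NN (E γ + s + t + (- s - (I * s + I * s)) - (E γ - (- s + (k + k) * t)))
          nn = nn-cast (cong₂ _-_ (trans (E-flip-false x {f} (Sol.sc q) fx) (cong₂ _+_ (Sol.en q) wx)) (trans Eτ (cong (λ u → E γ - u) wd))) (E-core-min {t} {flip x f} {τ} t>0 τt eq)
          self : t ∣ I + I + 1ℤ → ⊥
          self (divides m e) = [ (λ m≥1 → nn-neg-absurd 0
                (nn+ (nn+ (nn+ (nn+ nn (nn* ns (nn≡ (zsub e)))) (nn* nt small)) (nn* ns (nn* m≥1 nt))) (nn-pred t>0)) (ring145 (E γ) s t I k m))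
            , (λ m≤0 → nn-neg-absurd 0 (nn+ (nn+ (nn+ ntI ntI) (nn* m≤0 nt)) (nn≡ (cong -_ (zsub e)))) (ring144 I m t)) ]′ (nn-total (m - 1ℤ))

      outline : ¬ (t ∣ w x) → ⊥
      outline nd = nn-neg-absurd 0 (nn+ (nn-cast (cong (λ u → u - (t + t)) (cong₂ _+_ (cong₂ _-_ (cong₂ _+_ (Sol.en q) wx) Eτ) wz)) bound) (nn-pred t>0)) (ring147 (E γ) s t I (w d))
        where
          z : ℤ
          z = bar d + I * s
          wz : w z ≡ - w d + (I * s + I * s)
          wz = trans (w-+ (bar d) (I * s)) (cong (λ u → u + (I * s + I * s)) (w-bar d))
          γz : occ γ z ≡ false
          γz = core-up {s} {γ} γs (bar d) z n (cong (λ u → bar d + u * s) I≡) (SC-true {γ} scγ {d} γd)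
          -- The flip at d fills the gap d̄ of `γ`; as I ≥ 1, the gap z above it on the s-runner
          -- remains a gap of τ.
          z≢ : z ≢ bar d
          z≢ e = [ (λ i0 → nn-neg-absurd 0 (subst (λ u → NN (u - 1ℤ)) i0 I≥1) refl) , pos-nonzero s>0 ]′ (ℤP.i*j≡0⇒i≡0∨j≡0 I (trans (ring44 (bar d) (I * s)) (zsub e)))
          τz : occ τ z ≡ false
          τz = trans (flip-off d (occ γ) z (λ e → contra γd (trans (cong (occ γ) (sym e)) γz)) z≢) γz
          bound : NN (E f + w x - E τ + w z - (t + t))
          bound = flip-bound {t} f τ x z k t>0 (Sol.sc q) scτ τt (Sol.eqt q) fx nd (trans (ring146 c₀ I s k t) (cong (λ u → bar u + I * s + k * t) (sym d≡))) τz

      absurd : ⊥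
      absurd = by-cases (t ∣? w x) inline outline

    -- The weight over σ is (s + t + w b) / s = 2 l + 1, hence odd, and `Far` excludes all gaps on
    -- the runner except c₀ itself.
    c₀-gap : ∀ f → Sol S σ τ n₀ f → occ f c₀ ≡ false
    c₀-gap f q = use (parity {s} {f} {σ} s>0 (Sol.sc q) scσ σs (Sol.eqs q) l
        (cancel-pos s>0 (trans (sym (E-Eqv {s} {f} {σ} (Sol.eqs q))) (trans (cong₂ _-_ (Sol.en q) (trans Eσ (cong (λ u → E γ - u) wb))) (ring148 (E γ) s t l)))) c₀ wc₀)
      where
        use : Σ[ j ∈ ℕ ] occ f (c₀ - + j * s) ≡ false → occ f c₀ ≡ false
        use (zero , fx) = trans (cong (occ f) (sym (ring149 c₀ s))) fx
        use (suc i , fx) = ⊥-elim (Far.absurd f q (+ suc i) (suc i) refl (nn-pos i) fx)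

  case4 : ∀ S (D : Data4 S) → Unique S (flip (Data4.b D) (Data4.γ D)) (flip (Data4.d D) (Data4.γ D)) (E (Data4.γ D) + Setup.s S + Setup.t S)
  case4 S D = f₀ , sol , uniq
    where
      open SetupFacts S
      open Data4 D
      σ τ f₁ f₀ : Maya
      σ = flip b γ
      τ = flip d γ
      f₁ = flip c₀ γ
      f₀ = flip b₀ f₁
      sc₁ : SC f₁
      sc₁ = flip-SC c₀ {γ} scγ
      γc₀ : occ γ c₀ ≡ true
      γc₀ = core-center {s} {γ} scγ γs c₀ 1 (trans wc₀ (cong -_ (sym (ℤP.*-identityˡ s))))
      γb₀ : occ γ b₀ ≡ true
      γb₀ = core-center {t} {γ} scγ γt b₀ 1 (trans wb₀ (cong -_ (sym (ℤP.*-identityˡ t))))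
      c≢b : c₀ ≢ b₀
      c≢b e = t∤s (divides 1ℤ (subz (trans (ring150 s t) (cong -_ (zsub (trans (sym wc₀) (trans (cong w e) wb₀)))))))
      c≢b̄ : c₀ ≢ bar b₀
      c≢b̄ e = nn-neg-absurd 0 (nn+ (nn+ (nn-pred s>0) (ℤP.<⇒≤ t>0)) (nn≡ (zsub (trans (sym wc₀) (trans (cong w e) (half-of {t} {b₀} wb₀)))))) (ring151 s t)
      b≢c : b₀ ≢ c₀
      b≢c e = c≢b (sym e)
      b≢c̄ : b₀ ≢ bar c₀
      b≢c̄ e = c≢b̄ (bar-swap (sym e))
      sc₂ : SC (flip b₀ γ)
      sc₂ = flip-SC b₀ {γ} scγ
      f₁b₀ : occ f₁ b₀ ≡ true
      f₁b₀ = trans (flip-off c₀ (occ γ) b₀ b≢c b≢c̄) γb₀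
      s∣wc₀ : s ∣ w c₀
      s∣wc₀ = divides -1ℤ (trans wc₀ (ring224 s))
      t∣wb₀ : t ∣ w b₀
      t∣wb₀ = divides -1ℤ (trans wb₀ (ring224 t))
      b≡ : b ≡ b₀ + l * s
      b≡ = w-step {b} {b₀} {l} {s} (trans wb (cong (λ u → u + (l + l) * s) (sym wb₀)))
      d≡ : d ≡ c₀ + k * t
      d≡ = w-step {d} {c₀} {k} {t} (trans wd (cong (λ u → u + (k + k) * t) (sym wc₀)))
      sol : Sol S σ τ (E γ + s + t) f₀
      sol = record
        { sc = flip-SC b₀ {f₁} sc₁
        ; eqs = flip-Eqv {s} {f₁} {γ} b₀ b l sc₁ scγ (flip-self {s} γ c₀ scγ s∣wc₀) b≡ (trans f₁b₀ (sym γb))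
        ; eqt = Eqv-trans {t} {f₀} {flip c₀ (flip b₀ γ)} {τ} (Eqv-refl {t} {f₀} {flip c₀ (flip b₀ γ)} (flip-comm b₀ c₀ γ))
            (flip-Eqv {t} {flip b₀ γ} {γ} c₀ d k sc₂ scγ (flip-self {t} γ b₀ scγ t∣wb₀) d≡ (trans (trans (flip-off b₀ (occ γ) c₀ c≢b c≢b̄) γc₀) (sym γd)))
        ; en = trans (E-flip-true b₀ {f₁} sc₁ f₁b₀) (trans (cong₂ _-_ (trans (E-flip-true c₀ {γ} scγ γc₀) (cong (λ u → E γ - u) wc₀)) wb₀) (ring152 (E γ) s t)) }
      uniq : ∀ g → Sol S σ τ (E γ + s + t) g → g ≐ f₀
      -- Both c₀ and b₀ are gaps of `g`. Undoing both flips gives a diagram in the s-class of `γ`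
      -- with the energy of `γ`, hence `γ`.
      uniq g q = ≐-trans {g} {flip c₀ h₁} {f₀} (≐-sym {flip c₀ h₁} {g} (flip-flip c₀ g))
          (≐-trans {flip c₀ h₁} {flip c₀ (flip b₀ h)} {f₀} (flip-cong≐ {c₀} {h₁} {flip b₀ h} (≐-sym {flip b₀ h} {h₁} (flip-flip b₀ h₁)))
          (≐-trans {flip c₀ (flip b₀ h)} {flip c₀ (flip b₀ γ)} {f₀} (flip-cong≐ {c₀} {flip b₀ h} {flip b₀ γ} (flip-cong≐ {b₀} {h} {γ} h≐γ)) (flip-comm c₀ b₀ γ)))
        where
          h₁ h : Maya
          h₁ = flip c₀ g
          h = flip b₀ h₁
          scg : SC g
          scg = Sol.sc q
          sch₁ : SC h₁
          sch₁ = flip-SC c₀ {g} scg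
          gc₀ : occ g c₀ ≡ false
          gc₀ = Case4Uniq.c₀-gap S D g q
          gb₀ : occ g b₀ ≡ false
          gb₀ = Case4Uniq.c₀-gap (swapS S) (swap4 D) g (record { sc = scg ; eqs = Sol.eqt q ; eqt = Sol.eqs q ; en = trans (Sol.en q) (ring153 (E γ) s t) })
          h₁b₀ : occ h₁ b₀ ≡ false
          h₁b₀ = trans (flip-off c₀ (occ g) b₀ b≢c b≢c̄) gb₀
          eqh : Eqv s h γ
          eqh = Eqv-trans {s} {h} {flip b σ} {γ} (flip-Eqv {s} {h₁} {σ} b₀ b l sch₁ (flip-SC b {γ} scγ)
              (Eqv-trans {s} {h₁} {g} {σ} (flip-self {s} g c₀ scg s∣wc₀) (Sol.eqs q)) b≡ (trans h₁b₀ (sym (flip-false b γ γb))))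
            (Eqv-refl {s} {flip b σ} {γ} (flip-flip b γ))
          Eh : E h ≡ E γ
          Eh = trans (E-flip-false b₀ {h₁} sch₁ h₁b₀) (trans (cong₂ _+_ (trans (E-flip-false c₀ {g} scg gc₀) (cong₂ _+_ (Sol.en q) wc₀)) wb₀) (ring154 (E γ) s t))
          h≐γ : h ≐ γ
          h≐γ = E-core-unique {s} {h} {γ} s>0 γs eqh Eh

  -- The case of the largest core

  module Case5 (S : Setup) (κ : Maya) (sc : SC κ) (κs : Core (Setup.s S) κ) (κt : Core (Setup.t S) κ)
      (c₀ b₀ e₀ xm : ℤ) (wc₀ : w c₀ ≡ - Setup.s S) (wb₀ : w b₀ ≡ - Setup.t S) (we₀ : w e₀ ≡ - (Setup.s S * Setup.t S))
      (wxm : w xm ≡ Setup.s S * Setup.t S - Setup.s S - Setup.t S) (κxm : occ κ xm ≡ true) where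
    open SetupFacts S

    n₀ : ℤ
    n₀ = E κ + s * t

    nt : NN t
    nt = ℤP.<⇒≤ t>0
    ns : NN s
    ns = ℤP.<⇒≤ s>0

    module At (f : Maya) (q : Sol S κ κ n₀ f) (I : ℤ) (n : ℕ) (I≡ : I ≡ + n) (fx : occ f (c₀ - I * s) ≡ false) where
      x : ℤ
      x = c₀ - I * s
      wx : w x ≡ - s - (I * s + I * s)
      wx = trans (w-- c₀ (I * s)) (cong (λ u → u - (I * s + I * s)) wc₀)
      ntI : NN I
      ntI = subst NN (sym I≡) (nn-pos n)

      -- Here w x = - m s t with m ≥ 1, and the flip at x keeps the t-core κ. Minimality of κ leaves
      -- only m = 1, so x is `e₀` and the flipped diagram is κ.
      inline : t ∣ w x → f ≐ flip e₀ κ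
      inline d′ = self (gauss-t (I + I + 1ℤ) (subst (t ∣_) (trans (cong -_ wx) (ring143 s I)) (∣m⇒∣-m d′)))
        where
          g : Maya
          g = flip x f
          eq : Eqv t g κ
          eq = Eqv-trans {t} {g} {f} {κ} (flip-self {t} f x (Sol.sc q) d′) (Sol.eqt q)
          Eg : E g ≡ E κ + s * t + (- s - (I * s + I * s))
          Eg = trans (E-flip-false x {f} (Sol.sc q) fx) (cong₂ _+_ (Sol.en q) wx)
          nn : NN (E κ + s * t + (- s - (I * s + I * s)) - E κ)
          nn = nn-cast (cong (λ u → u - E κ) Eg) (E-core-min {t} {g} {κ} t>0 κt eq)
          fin : ∀ m → I + I + 1ℤ - m * t ≡ 0ℤ → s * ((m - 1ℤ) * t) ≡ 0ℤ → f ≐ flip e₀ κ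
          fin m e z = ≐-trans {f} {flip x g} {flip e₀ κ} (≐-sym {flip x g} {f} (flip-flip x f)) (subst (λ u → flip x g ≐ flip u κ) x≡ (flip-cong≐ {x} {g} {κ}
              (E-core-unique {t} {g} {κ} t>0 κt eq (trans Eg (trans (ring156 (E κ) s t I m) (trans (cong₂ (λ u v → E κ - u - s * v) z e) (ring159 (E κ) s)))))))
            where x≡ : x ≡ e₀
                  x≡ = w-inj {x} {e₀} (trans wx (trans (subz (trans (ring157 s t I m) (trans (cong₂ (λ u v → - u - s * v) z e) (ring158 s)))) (sym we₀)))
          self : t ∣ I + I + 1ℤ → f ≐ flip e₀ κ
          self (divides m e) = [ (λ m≥1 → fin m (zsub e) (nn-antisym (nn* ns (nn* m≥1 nt)) (nn-cast (ring155 (E κ) s t I m) (nn+ nn (nn* ns (nn≡ (zsub e)))))))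
            , (λ m≤0 → ⊥-elim (nn-neg-absurd 0 (nn+ (nn+ (nn+ ntI ntI) (nn* m≤0 nt)) (nn≡ (cong -_ (zsub e)))) (ring144 I m t))) ]′ (nn-total (m - 1ℤ))

      -- This is where the bead `xm` is used: its conjugate is a gap of κ, so low that `flip-bound`
      -- evaluates to - t ≥ 0.
      outline : ¬ (t ∣ w x) → ⊥
      outline nd = nn-neg-absurd 0 (nn+ (nn-cast (cong (λ u → u - (t + t)) (cong₂ _+_ (cong (λ u → u - E κ) (cong₂ _+_ (Sol.en q) wx)) wz)) bound) (nn-pred t>0)) (ring162 (E κ) s t I)
        where
          h z : ℤ
          h = bar c₀
          z = bar xm + I * s
          wz : w z ≡ - (s * t - s - t) + (I * s + I * s)
          wz = trans (w-+ (bar xm) (I * s)) (cong (λ u → u + (I * s + I * s)) (trans (w-bar xm) (cong -_ wxm)))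
          κz : occ κ z ≡ false
          κz = core-up {s} {κ} κs (bar xm) z n (cong (λ u → bar xm + u * s) I≡) (SC-true {κ} sc {xm} κxm)
          x≡ : bar x ≡ z + h * t
          x≡ = w-step {bar x} {z} {h} {t} (trans (w-bar x) (trans (cong -_ wx) (trans (ring161 s I) (trans (subz (trans (ring160 s t I h) (cong -_ (z* t (zsub (half-of {s} {c₀} wc₀)))))) (cong (λ u → u + (h + h) * t) (sym wz))))))
          bound : NN (E f + w x - E κ + w z - (t + t))
          bound = flip-bound {t} f κ x z h t>0 (Sol.sc q) sc κt (Sol.eqt q) fx nd x≡ κz

      result : f ≐ flip e₀ κ
      result = by-cases (t ∣? w x) inline (λ nd → ⊥-elim (outline nd))

    κe₀ : occ κ e₀ ≡ true
    κe₀ = core-center {s} {κ} sc κs e₀ (proj₁ (pos-form t>0)) (trans we₀ (cong -_ (trans (ℤP.*-comm s t) (cong (_* s) (proj₂ (pos-form t>0))))))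

    s∣we₀ : s ∣ w e₀
    s∣we₀ = divides (- t) (trans we₀ (ring163 s t))
    t∣we₀ : t ∣ w e₀
    t∣we₀ = divides (- s) (trans we₀ (ring164 s t))

    case5 : Unique S κ κ n₀
    case5 = flip e₀ κ , record
        { sc = flip-SC e₀ {κ} sc
        ; eqs = flip-self {s} κ e₀ sc s∣we₀
        ; eqt = flip-self {t} κ e₀ sc t∣we₀
        ; en = trans (E-flip-true e₀ {κ} sc κe₀) (trans (cong (λ u → E κ - u) we₀) (ring167 (E κ) (s * t))) }
      , uniq
      where
        uniq : ∀ g → Sol S κ κ n₀ g → g ≐ flip e₀ κ
        uniq g q = use (parity {s} {g} {κ} s>0 (Sol.sc q) sc κs (Sol.eqs q) (bar b₀)
            (trans (cancel-pos s>0 (trans (sym (E-Eqv {s} {g} {κ} (Sol.eqs q))) (trans (cong (λ u → u - E κ) (Sol.en q)) (ring165 (E κ) s t)))) (sym (half-of {t} {b₀} wb₀))) c₀ wc₀)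
          where
            use : Σ[ j ∈ ℕ ] occ g (c₀ - + j * s) ≡ false → g ≐ flip e₀ κ
            use (j , fx) = At.result g q (+ j) j refl fx

  -- Uniqueness forces one of the five cases

  classInd-shift : ∀ t x z → classInd t x z ≡ classInd t x (z - t)
  classInd-shift t x z = by-cases (t ∣? (z - x))
    (λ h → trans (classInd-in {t} {x} {z} h) (sym (classInd-in {t} {x} {z - t} (∣-cast (ring73 z x t) (∣m∣n⇒∣m-n h (divides 1ℤ (sym (ℤP.*-identityˡ t))))))))
    (λ n → trans (classInd-out {t} {x} {z} n) (sym (classInd-out {t} {x} {z - t} (λ h → n (∣-cast (ring166 z x t) (∣m∣n⇒∣m+n h (divides 1ℤ (sym (ℤP.*-identityˡ t)))))))))

  -- The sum of `colFS` compares the beads z + s with the beads z for z in one class modulo t. Moves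
  -- by t respect both classes and keep the comparison; for an s-core it is at most 0.
  module Cols (s t : ℤ) (f τ : Maya) (eqt : Eqv t f τ) (τs : Core s τ) (x : ℤ) where
    private
      V = proj₁ eqt
      ind-x : ℤ → ℤ
      ind-x = classInd t x
      z--s : ∀ z → z - (- s) ≡ z + s
      z--s z = ring167 z s

    colFS : Maya → FS
    colFS g = mulFS ind-x (diff (shiftMaya (- s) g) g)

    col-at : ∀ g z → at (colFS g) z ≡ ind-x z * (χ g (z + s) - χ g z)
    col-at g z = cong (λ u → ind-x z * (χ g u - χ g z)) (z--s z)

    private
      Y : FS
      Y = mulFS ind-x (subFS (shiftFS (- s) V) V)

      pointwise : ∀ z → at (colFS f) z ≡ at (addFS (colFS τ) (subFS (shiftFS t Y) Y)) z
      pointwise z = trans (col-at f z) (trans (cong (ind-x z *_) split) (trans (ring168 (ind-x z) (χ τ (z + s)) (χ τ z) (at V (z + s - t)) (at V (z + s)) (at V (z - t)) (at V z))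
        (cong₂ _+_ (sym (col-at τ z)) (cong₂ _-_ (trans (cong (_* (at V (z + s - t) - at V (z - t))) (classInd-shift t x z)) (cong (λ u → ind-x (z - t) * (at V u - at V (z - t))) (ring170 z s t)))
          (cong (λ u → ind-x z * (at V u - at V z)) (sym (z--s z)))))))
        where
          lem₁ : ∀ F G a b X Y → F - a ≡ X → G - b ≡ Y → F - G ≡ a - b + (X - Y)
          lem₁ F G a b _ _ refl refl = ring169 F G a b
          split : χ f (z + s) - χ f z ≡ χ τ (z + s) - χ τ z + ((at V (z + s - t) - at V (z + s)) - (at V (z - t) - at V z))
          split = lem₁ (χ f (z + s)) (χ f z) (χ τ (z + s)) (χ τ z) _ _ (proj₂ eqt (z + s)) (proj₂ eqt z)

    Σ≤0 : NN (- Σℤ (colFS f))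
    Σ≤0 = nn-cast (cong -_ (sym total)) (nn-cast (ring38 (Σℤ (colFS τ))) (subst NN (Σ-scale -1ℤ (colFS τ)) (Σ-nonneg (mulFS (λ _ → -1ℤ) (colFS τ)) nonpos)))
      where
        total : Σℤ (colFS f) ≡ Σℤ (colFS τ)
        total = trans (Σ-cong {colFS f} {addFS (colFS τ) (subFS (shiftFS t Y) Y)} pointwise) (trans (Σ-add (colFS τ) (subFS (shiftFS t Y) Y))
          (trans (cong (λ u → Σℤ (colFS τ) + u) (trans (Σ-sub (shiftFS t Y) Y) (trans (cong (_- Σℤ Y) (Σ-shift t Y)) (ℤP.+-inverseʳ (Σℤ Y))))) (ℤP.+-identityʳ _)))
        bool : ∀ o a b → (a ≡ true → b ≡ true) → NN (-1ℤ * (ind o * (ind a - ind b)))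
        bool false a b h = +≤+ z≤n
        bool true true true h = +≤+ z≤n
        bool true true false h = ⊥-elim (true≢false (sym (h refl)))
        bool true false true h = +≤+ z≤n
        bool true false false h = +≤+ z≤n
        nonpos : ∀ z → NN (-1ℤ * at (colFS τ) z)
        nonpos z = subst (λ u → NN (-1ℤ * u)) (sym (col-at τ z)) (bool (does (t ∣? (z - x))) (occ τ (z + s)) (occ τ z) (τs z))

    private
      bool-neg : ∀ a b → 1ℤ * (ind a - ind b) < 0ℤ → b ≡ true × a ≡ false
      bool-neg false true _ = refl , refl
      bool-neg true true (+<+ ())
      bool-neg true false (+<+ ())
      bool-neg false false (+<+ ())

    neg-elim : ∀ y → at (colFS f) y < 0ℤ → t ∣ y - x × occ f y ≡ true × occ f (y + s) ≡ false
    neg-elim y h = by-cases (t ∣? (y - x))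
      (λ d → d , bool-neg (occ f (y + s)) (occ f y) (subst (_< 0ℤ) (trans (col-at f y) (cong (_* (χ f (y + s) - χ f y)) (classInd-in {t} {x} {y} d))) h))
      (λ n → ⊥-elim (ℤP.<-irrefl (trans (col-at f y) (trans (cong (_* (χ f (y + s) - χ f y)) (classInd-out {t} {x} {y} n)) (ℤP.*-zeroˡ (χ f (y + s) - χ f y)))) h))

    col-up : ∀ z → t ∣ z - x → occ f z ≡ false → occ f (z + s) ≡ true → at (colFS f) z ≡ 1ℤ
    col-up z d h h′ = trans (col-at f z) (cong₂ _*_ (classInd-in {t} {x} {z} d) (cong₂ (λ a b → ind a - ind b) h′ h))

    col-dn : ∀ z → t ∣ z - x → occ f z ≡ true → occ f (z + s) ≡ false → at (colFS f) z ≡ -1ℤ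
    col-dn z d h h′ = trans (col-at f z) (cong₂ _*_ (classInd-in {t} {x} {z} d) (cong₂ (λ a b → ind a - ind b) h′ h))

    private
      x-x : t ∣ x - x
      x-x = divides 0ℤ (ℤP.+-inverseʳ x)

    -- An ascent, that is a gap x below a bead x + s, contributes 1 to a total which is at most 0,
    -- so the class also contains a descent.
    partner : occ f x ≡ false → occ f (x + s) ≡ true → Σ[ y ∈ ℤ ] (t ∣ y - x × occ f y ≡ true × occ f (y + s) ≡ false)
    partner h h′ = go (Σ-find-neg (colFS f) x Σ≤0 (subst (0ℤ <_) (sym (col-up x x-x h h′)) (+<+ (s≤s z≤n))))
      where go : Σ[ y ∈ ℤ ] at (colFS f) y < 0ℤ → Σ[ y ∈ ℤ ] (t ∣ y - x × occ f y ≡ true × occ f (y + s) ≡ false)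
            go (y , lt) = y , neg-elim y lt

    -- Two ups need two downs.
    partner₂ : occ f x ≡ false → occ f (x + s) ≡ true → ∀ x₂ → t ∣ x₂ - x → x₂ ≢ x → occ f x₂ ≡ false → occ f (x₂ + s) ≡ true →
      ∀ y₀ → t ∣ y₀ - x → occ f y₀ ≡ true → occ f (y₀ + s) ≡ false →
      Σ[ y ∈ ℤ ] (t ∣ y - x × occ f y ≡ true × occ f (y + s) ≡ false × y ≢ y₀)
    partner₂ h h′ x₂ d₂ ne h₂ h₂′ y₀ d₀ g g′ = go (Σ-find-neg F x le pos)
      where
        F : FS
        -- The correction cancels the descent at y₀ and the ascent at x₂ without changing the total,
        -- so the remaining ascent at x calls for another descent.
        F = addFS (colFS f) (subFS (δ y₀) (δ x₂))
        le : NN (- Σℤ F)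
        le = nn-cast (trans (ring171 (Σℤ (colFS f))) (cong -_ (sym (trans (Σ-add (colFS f) (subFS (δ y₀) (δ x₂))) (cong (λ u → Σℤ (colFS f) + u) (trans (Σ-sub (δ y₀) (δ x₂)) (cong₂ _-_ (Σ-δ y₀) (Σ-δ x₂)))))))) Σ≤0
        y₀≢x₂ : y₀ ≢ x₂
        y₀≢x₂ e = contra g (trans (cong (occ f) e) h₂)
        x≢y₀ : x ≢ y₀
        x≢y₀ e = contra g (trans (cong (occ f) (sym e)) h)
        pos : 0ℤ < at F x
        pos = subst (0ℤ <_) (sym (cong₂ _+_ (col-up x x-x h h′) (cong₂ _-_ (δ-off y₀ x x≢y₀) (δ-off x₂ x (λ e → ne (sym e)))))) (+<+ (s≤s z≤n))
        go : Σ[ y ∈ ℤ ] at F y < 0ℤ → Σ[ y ∈ ℤ ] (t ∣ y - x × occ f y ≡ true × occ f (y + s) ≡ false × y ≢ y₀)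
        go (y , lt) = by-cases (y ℤP.≟ y₀)
          (λ { refl → ⊥-elim (ℤP.<-irrefl (cong₂ _+_ (col-dn y d₀ g g′) (cong₂ _-_ (δ-at y) (δ-off x₂ y y₀≢x₂))) lt) })
          (λ n → by-cases (y ℤP.≟ x₂)
            (λ { refl → ⊥-elim (ℤP.<-irrefl (cong₂ _+_ (col-up y d₂ h₂ h₂′) (cong₂ _-_ (δ-off y₀ y n) (δ-at y))) lt) })
            (λ n′ → fin (neg-elim y (subst (_< 0ℤ) (trans (cong (λ u → at (colFS f) y + u) (cong₂ _-_ (δ-off y₀ y n) (δ-off x₂ y n′))) (ℤP.+-identityʳ _)) lt)) n))
          where fin : t ∣ y - x × occ f y ≡ true × occ f (y + s) ≡ false → y ≢ y₀ → Σ[ y ∈ ℤ ] (t ∣ y - x × occ f y ≡ true × occ f (y + s) ≡ false × y ≢ y₀)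
                fin (a , b , c) n = y , a , b , c , n

  -- Modulo s the beads p, q pass to r, u, modulo t to u, r. The conclusion lists the conjugacies
  -- under which the exchange cannot be made together with its conjugate.
  Quad : Setup → Maya → Set
  Quad S f = ∀ p q r u → occ f p ≡ true → occ f q ≡ true → occ f r ≡ false → occ f u ≡ false → p + q ≡ r + u → p ≢ q → r ≢ u →
      Setup.s S ∣ r - p → Setup.t S ∣ u - p → (r ≡ bar p ⊎ u ≡ bar p) ⊎ (r ≡ bar q ⊎ u ≡ bar q)

  Quad-swap : ∀ S f → Quad S f → Quad (swapS S) f
  Quad-swap S f Q p q r u a b c d e n n′ h h′ = [ (λ z → inj₁ (sw z)) , (λ z → inj₂ (sw z)) ]′ (Q p q u r a b d c (trans e (ℤP.+-comm r u)) n (λ z → n′ (sym z)) h′ h)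
    where sw : ∀ {A B : Set} → A ⊎ B → B ⊎ A
          sw (inj₁ x) = inj₂ x
          sw (inj₂ x) = inj₁ x

  -- These hypotheses suffice for the analysis of ascents and are symmetric in s and t. Uniqueness
  -- is not among them, so that the analysis applies also to a solution from which the excitation at
  -- st has been removed.
  record Ctx (S : Setup) (f : Maya) : Set where
    open Setup S
    field
      scf : SC f
      quad : Quad S f
      stc : Core (s * t) f
      σ τ : Maya
      eqs : Eqv s f σ
      eqt : Eqv t f τ
      σt : Core t σ
      τs : Core s τ

  swap-Ctx : ∀ {S f} → Ctx S f → Ctx (swapS S) f
  swap-Ctx {S} {f} C = record { scf = scf ; quad = Quad-swap S f quad ; stc = subst (λ d → Core d f) (ℤP.*-comm s t) stc
    ; σ = τ ; τ = σ ; eqs = eqt ; eqt = eqs ; σt = τs ; τs = σt }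
    where open Ctx C
          open Setup S

  -- The ascents that the exchange condition allows

  Up : ℤ → Maya → ℤ → Set
  Up s f x = occ f x ≡ false × occ f (x + s) ≡ true

  w-cong : ∀ {t x y} → t ∣ y - x → t ∣ w x → t ∣ w y
  w-cong {t} {x} {y} h h′ = subst (t ∣_) (ring172 x y) (∣m∣n⇒∣m+n h′ (∣m∣n⇒∣m+n h h))

  w-half : ∀ {t x y} → t ∣ w x → t ∣ w y → t ∣ y - x
  w-half {t} {x} {y} h h′ = odd-half x (y - x) h (subst (t ∣_) (ring173 x y) (∣m∣n⇒∣m-n h′ h))

  module Classify (S : Setup) (f : Maya) (C : Ctx S f) where
    open SetupFacts S
    open Ctx C

    t∤-s : ∀ {v} → w v ≡ - s → ¬ (t ∣ w v)
    t∤-s e h = t∤s (subst (t ∣_) (ℤP.neg-involutive s) (∣m⇒∣-m (subst (t ∣_) e h)))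

    t∤s-mid : ∀ {x} → t ∣ w x → ¬ (t ∣ w x + (s + s))
    t∤s-mid {x} h h′ = t∤s (odd-half x s h (subst (t ∣_) (ring193 (w x) (s + s)) (∣m∣n⇒∣m-n h′ h)))

    -- An ascent x and a descent y in one class modulo t allow y, x + s to be exchanged for y + s,
    -- x. The constructors are the four conjugacies that can block this.
    data Bad (x y : ℤ) : Set where
      isA : w y ≡ - s → Bad x y
      isB : y ≡ bar x → Bad x y
      isC : y + s ≡ bar (x + s) → Bad x y
      isD : w x ≡ - s → Bad x y

    bad : ∀ x y → Up s f x → occ f y ≡ true → occ f (y + s) ≡ false → t ∣ y - x → Bad x y
    bad x y (h , h′) g g′ d = [ [ (λ e → isA (subz (trans (ring174 y s) (zsub e)))) , (λ e → isB (bar-swap (sym e))) ]′ , [ (λ e → isC e) , (λ e → isD (subz (trans (ring183 x s) (zsub e)))) ]′ ]′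
      (quad y (x + s) (y + s) x g h′ g′ h (ring254 y x s) ne₁ ne₂ (divides 1ℤ (ring192 y s)) (subst (t ∣_) (ring175 y x) (∣m⇒∣-m d)))
      where
        ne₁ : y ≢ x + s
        ne₁ e = t∤s (subst (t ∣_) (trans (cong (_- x) e) (ring193 x s)) d)
        ne₂ : y + s ≢ x
        ne₂ e = t∤s (subst (t ∣_) (trans (cong (λ u → - (y - u)) (sym e)) (ring176 y s)) (∣m⇒∣-m d))

    isB⇒ : ∀ {x y} → t ∣ y - x → y ≡ bar x → t ∣ w x
    isB⇒ {x} {y} d e = subst (t ∣_) (trans (cong (λ u → - (u - x)) e) (ring177 x)) (∣m⇒∣-m d)

    isC⇒ : ∀ {x y} → t ∣ y - x → y + s ≡ bar (x + s) → t ∣ w x + (s + s)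
    isC⇒ {x} {y} d e = subst (t ∣_) (trans (ring178 x y s) (trans (cong (λ u → - (u - s - x)) e) (ring179 x s))) (∣m⇒∣-m d)

    no-B : ∀ {x v} → t ∣ v - x → w v ≡ - s → ¬ (t ∣ w x)
    no-B {x} {v} d e h = t∤-s {v} e (w-cong {t} {x} {v} d h)

    no-C : ∀ {x v} → t ∣ v - x → w v ≡ - s → ¬ (t ∣ w x + (s + s))
    no-C {x} {v} d e h = t∤s (subst (t ∣_) (trans (ring180 x v s) (trans (cong (λ u → u + (s + s)) e) (ring61 s))) (∣m∣n⇒∣m+n h (∣m∣n⇒∣m+n d d)))

    ∣-minus : ∀ {a b c} → t ∣ a - b → t ∣ c - b → t ∣ a - c
    ∣-minus {a} {b} {c} h h′ = subst (t ∣_) (ring181 a b c) (∣m∣n⇒∣m-n h h′)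

    -- Two ascents force two descents in the class. Three of the resulting pairs are considered; any
    -- combination of blocking conjugacies either identifies two distinct points or contradicts
    -- `t∤s`.
    one-up : ∀ x₁ x₂ → Up s f x₁ → Up s f x₂ → t ∣ x₂ - x₁ → x₁ ≡ x₂
    one-up x₁ x₂ u₁ u₂ d = by-cases (x₁ ℤP.≟ x₂) (λ e → e) (λ n → ⊥-elim (go n (partner (proj₁ u₁) (proj₂ u₁))))
      where
        open Cols s t f τ eqt τs x₁
        go : x₁ ≢ x₂ → Σ[ y ∈ ℤ ] (t ∣ y - x₁ × occ f y ≡ true × occ f (y + s) ≡ false) → ⊥
        go n (y₁ , d₁ , g₁ , g₁′) = go₂ (partner₂ (proj₁ u₁) (proj₂ u₁) x₂ d (λ e → n (sym e)) (proj₁ u₂) (proj₂ u₂) y₁ d₁ g₁ g₁′)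
          where
            go₂ : Σ[ y ∈ ℤ ] (t ∣ y - x₁ × occ f y ≡ true × occ f (y + s) ≡ false × y ≢ y₁) → ⊥
            go₂ (y₂ , d₂ , g₂ , g₂′ , ny) = final (bad x₁ y₁ u₁ g₁ g₁′ d₁) (bad x₁ y₂ u₁ g₂ g₂′ d₂) (bad x₂ y₁ u₂ g₁ g₁′ (∣-minus {y₁} {x₁} {x₂} d₁ d))
              where
                d₁₂ = ∣-minus {y₁} {x₁} {x₂} d₁ d
                clash : ∀ {x y} → occ f x ≡ false → occ f y ≡ true → w x ≡ - s → w y ≡ - s → ⊥
                clash {x} {y} a b e e′ = contra b (trans (cong (occ f) (w-inj {y} {x} (trans e′ (sym e)))) a)
                zero-d : t ∣ x₁ - x₁
                zero-d = divides 0ℤ (ℤP.+-inverseʳ x₁)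
                final : Bad x₁ y₁ → Bad x₁ y₂ → Bad x₂ y₁ → ⊥
                final (isA a) (isA a′) _ = ny (w-inj {y₂} {y₁} (trans a′ (sym a)))
                final (isA a) (isB b) _ = no-B {x₁} {y₁} d₁ a (isB⇒ {x₁} {y₂} d₂ b)
                final (isA a) (isC c) _ = no-C {x₁} {y₁} d₁ a (isC⇒ {x₁} {y₂} d₂ c)
                final (isA a) (isD e) _ = clash (proj₁ u₁) g₁ e a
                final (isD a) _ (isA a′) = clash (proj₁ u₁) g₁ a a′
                final (isD a) _ (isD a′) = n (w-inj {x₁} {x₂} (trans a (sym a′)))
                final (isD a) _ (isB b) = no-B {x₂} {x₁} (subst (t ∣_) (ring182 x₁ x₂) (∣m⇒∣-m d)) a (isB⇒ {x₂} {y₁} d₁₂ b)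
                final (isD a) _ (isC c) = no-C {x₂} {x₁} (subst (t ∣_) (ring182 x₁ x₂) (∣m⇒∣-m d)) a (isC⇒ {x₂} {y₁} d₁₂ c)
                final (isB b) (isA a) _ = no-B {x₁} {y₂} d₂ a (isB⇒ {x₁} {y₁} d₁ b)
                final (isB b) (isB b′) _ = ny (trans b′ (sym b))
                final (isB b) (isC c) _ = t∤s-mid {x₁} (isB⇒ {x₁} {y₁} d₁ b) (isC⇒ {x₁} {y₂} d₂ c)
                final (isB b) (isD a) _ = no-B {x₁} {x₁} zero-d a (isB⇒ {x₁} {y₁} d₁ b)
                final (isC c) (isA a) _ = no-C {x₁} {y₂} d₂ a (isC⇒ {x₁} {y₁} d₁ c)
                final (isC c) (isB b) _ = t∤s-mid {x₁} (isB⇒ {x₁} {y₂} d₂ b) (isC⇒ {x₁} {y₁} d₁ c)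
                final (isC c) (isC c′) _ = ny (trans (sym (y-d+d y₂ s)) (trans (cong (_- s) (trans c′ (sym c))) (y-d+d y₁ s)))
                final (isC c) (isD a) _ = no-C {x₁} {x₁} zero-d a (isC⇒ {x₁} {y₁} d₁ c)

    bar-s : ∀ x → bar (x + s) + s ≡ bar x
    bar-s x = ring102 x s

    Up-bar : ∀ x → Up s f x → Up s f (bar (x + s))
    Up-bar x (h , h′) = SC-true {f} scf {x + s} h′ , trans (cong (occ f) (bar-s x)) (SC-false {f} scf {x} h)

    -- `kT′` is the image of the self-conjugate case `kT` under x ↦ bar (x + s), which permutes the
    -- ascents.
    data Kind (x : ℤ) : Set where
      kS : w x ≡ - s → Kind x
      kT : t ∣ w x → occ f (bar x + s) ≡ false → Kind x
      kT′ : t ∣ w x + (s + s) → Kind x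

    kind : ∀ x → Up s f x → Kind x
    kind x u = go (Cols.partner s t f τ eqt τs x (proj₁ u) (proj₂ u))
      where
        go : Σ[ y ∈ ℤ ] (t ∣ y - x × occ f y ≡ true × occ f (y + s) ≡ false) → Kind x
        go (y , d , g , g′) = sort (bad x y u g g′ d)
          where
            sort : Bad x y → Kind x
            sort (isD e) = kS e
            sort (isB e) = kT (isB⇒ {x} {y} d e) (trans (cong (λ u → occ f (u + s)) (sym e)) g′)
            sort (isC e) = kT′ (isC⇒ {x} {y} d e)
            -- From y ≡ x and w y = - s it follows that the conjugate ascent bar (x + s) lies in the
            -- class of x; by `one-up` it is x.
            sort (isA e) = kS (subz (trans (ring183 x s) (zsub same)))
              where
                dd : t ∣ bar (x + s) - x
                dd = subst (t ∣_) (ℤP.neg-involutive _) (∣m⇒∣-m (subst (t ∣_) (ring184 x y s) (∣m∣n⇒∣m-n (divides 0ℤ (trans (zsub e) refl)) (∣m∣n⇒∣m+n d d))))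
                same : x ≡ bar (x + s)
                same = one-up x (bar (x + s)) u (Up-bar x u) dd

    kind-T : ∀ x → Up s f x → t ∣ w x → occ f (bar x + s) ≡ false
    kind-T x u d = go (kind x u)
      where go : Kind x → occ f (bar x + s) ≡ false
            go (kS e) = ⊥-elim (t∤-s {x} e d)
            go (kT _ h) = h
            go (kT′ d′) = ⊥-elim (t∤s-mid {x} d d′)

    -- A second ascent in the class contradicts `one-up`; a descent can only be blocked against x by
    -- being x̄.
    flat : ∀ x → Up s f x → t ∣ w x → ∀ z → t ∣ w z → z ≢ x → z ≢ bar x → occ f z ≡ occ f (z + s)
    flat x u d z dz n n′ = go (occ f z) (occ f (z + s)) refl refl
      where
        dzx : t ∣ z - x
        dzx = w-half {t} {x} {z} d dz
        no-bad : Bad x z → ⊥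
        no-bad (isA e) = t∤-s {z} e dz
        no-bad (isB e) = n′ e
        no-bad (isC e) = t∤s-mid {x} d (isC⇒ {x} {z} dzx e)
        no-bad (isD e) = t∤-s {x} e d
        go : ∀ a b → occ f z ≡ a → occ f (z + s) ≡ b → occ f z ≡ occ f (z + s)
        go true true e e′ = trans e (sym e′)
        go false false e e′ = trans e (sym e′)
        go false true e e′ = ⊥-elim (n (sym (one-up x z u (e , e′) dzx)))
        go true false e e′ = ⊥-elim (no-bad (bad x z u e e′ dzx))

    w-bar-∣ : ∀ {z} → t ∣ w z → t ∣ w (bar z)
    w-bar-∣ {z} h = subst (t ∣_) (sym (w-bar z)) (∣m⇒∣-m h)

    flat-left : ∀ x → Up s f x → t ∣ w x → ∀ z → t ∣ w z → z ≢ x → z ≢ bar x → occ f (z - s) ≡ occ f z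
    flat-left x u d z dz n n′ = trans (cong (occ f) (ring187 z s)) (trans (scf (bar z + s)) (trans (cong not (sym (flat x u d (bar z) (w-bar-∣ {z} dz) (λ e → n′ (bar-swap e)) (λ e → n (bar-inj e))))) (trans (cong not (scf z)) (not-involutive (occ f z)))))

  step-inj : ∀ {t} → 0ℤ < t → ∀ x a b → x + a * t ≡ x + b * t → a - b ≡ 0ℤ
  step-inj {t} pos x a b e = [ (λ z → z) , (λ z → ⊥-elim (pos-nonzero pos z)) ]′ (ℤP.i*j≡0⇒i≡0∨j≡0 (a - b) (trans (ring185 x a b t) (zsub e)))

  nn-lt : ∀ {i m : ℕ} → i ℕ.< m → NN (+ m - + i - 1ℤ)
  nn-lt {i} {m} h = nn-cast (ring186 (+ m) (+ i)) (nn≤ (+≤+ h))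

  -- With w x = o t, the values of o are treated by sign. The method throughout is to find ascents
  -- along t near the column of x: `flat` copies them to the neighbouring columns, where `one-up`
  -- with s and t exchanged forbids the copy.
  module SelfConjugateUp (S : Setup) (f : Maya) (C : Ctx S f) (x : ℤ) (u : Up (Setup.s S) f x) (d : Setup.t S ∣ w x) where
    open SetupFacts S
    open Ctx C
    private
      fx = proj₁ u
      fxs = proj₂ u
      o : ℤ
      o = _∣_.quotient d
      e : w x ≡ o * t
      e = _∣_.equality d
      X : ℤ
      X = bar x
      X≡ : X ≡ x - o * t
      X≡ = trans (bar≡+ x) (cong (λ u → x - u) e)
      x≡ : x ≡ X + o * t
      x≡ = trans (ring317 x (o * t)) (cong (λ u → u + o * t) (sym X≡))
      fX : occ f X ≡ true
      fX = SC-false {f} scf {x} fx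
      fXs : occ f (X + s) ≡ false
      fXs = Classify.kind-T S f C x u d
      fX-s : occ f (X - s) ≡ false
      fX-s = trans (cong (occ f) (sym (bar-+ x s))) (SC-true {f} scf {x + s} fxs)
      fx-s : occ f (x - s) ≡ true
      fx-s = trans (cong (occ f) (ring187 x s)) (SC-false {f} scf {X + s} fXs)

      -- Since x - s and x + s are beads, both gaps would be ascents along t in one class modulo s,
      -- 2 s apart.
      not-both : occ f (x - t + s) ≡ false → occ f (x - t - s) ≡ false → ⊥
      not-both h h′ = pos-nonzero s>0 (double-inj {s} {0ℤ} (trans (ring190 x t s) (zsub (sym (Classify.one-up (swapS S) f (swap-Ctx C) (x - t - s) (x - t + s)
          (h′ , trans (cong (occ f) (ring188 x t s)) fx-s) (h , trans (cong (occ f) (ring189 x t s)) fxs) (divides (+ 2) (ring191 x t s)))))))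

      -- `flat` copies the ascent along t from z to z + s, in the same class modulo s.
      between : ∀ z → t ∣ w z → Up t f z → z ≢ x → z ≢ X → z + t ≢ x → z + t ≢ X → ⊥
      between z dz (h , h′) n₁ n₂ n₃ n₄ = x+d≢x s>0 z (sym (Classify.one-up (swapS S) f (swap-Ctx C) z (z + s) (h , h′)
          (trans (sym (Classify.flat S f C x u d z dz n₁ n₂)) h , trans (cong (occ f) (ring153 z s t)) (trans (sym (Classify.flat S f C x u d (z + t) dzt n₃ n₄)) h′)) (divides 1ℤ (ring192 z s))))
        where
          dzt : t ∣ w (z + t)
          dzt = w-cong {t} {z} {z + t} (divides 1ℤ (ring192 z t)) dz

      on-line : ∀ X a → t ∣ w X → t ∣ w (X + a * t)
      on-line X a h = w-cong {t} {X} {X + a * t} (divides a (ring193 X (a * t))) h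

      -- There is an up strictly between the ends of the segment from Y to Y + N t; these are x and X in some order.
      segment : ∀ Y N (m : ℕ) → N - 1ℤ - 1ℤ ≡ + m → t ∣ w Y → (∀ z → z ≢ Y → z ≢ Y + N * t → z ≢ x × z ≢ X) →
        occ f (Y + 1ℤ * t) ≡ false → occ f (Y + (N - 1ℤ) * t) ≡ true → ⊥
      segment Y N m em dY ends h h′ = go (cross-up (occ f) (Y + 1ℤ * t) t m h (trans (cong (occ f) (trans (cong (λ u → Y + 1ℤ * t + u * t) (sym em)) (ring194 Y N t))) h′))
        where
          go : Σ[ i ∈ ℕ ] (i ℕ.< m × occ f (Y + 1ℤ * t + + i * t) ≡ false × occ f (Y + 1ℤ * t + + i * t + t) ≡ true) → ⊥
          go (i , lt , a , b) = between z (subst (λ v → t ∣ w v) (sym (ring195 Y I t)) (on-line Y (1ℤ + I) dY)) (a , b) (proj₁ e₁) (proj₂ e₁) (proj₁ e₂) (proj₂ e₂)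
            where
              I = + i
              z = Y + 1ℤ * t + I * t
              M : NN (N - 1ℤ - 1ℤ - I - 1ℤ)
              M = subst (λ u → NN (u - I - 1ℤ)) (sym em) (nn-lt lt)
              e₁ : z ≢ x × z ≢ X
              e₁ = ends z (λ q → nn-neg-absurd 0 (nn+ (nn-pos i) (nn≡ (cong -_ (step-inj t>0 Y (1ℤ + I) 0ℤ (trans (sym (ring195 Y I t)) (trans q (ring197 Y t))))))) (ring198 I))
                          (λ q → nn-neg-absurd 1 (nn+ M (nn≡ (step-inj t>0 Y (1ℤ + I) N (trans (sym (ring195 Y I t)) q)))) (ring199 N I))
              e₂ : z + t ≢ x × z + t ≢ X
              e₂ = ends (z + t) (λ q → nn-neg-absurd 1 (nn+ (nn-pos i) (nn≡ (cong -_ (step-inj t>0 Y (1ℤ + 1ℤ + I) 0ℤ (trans (sym (ring196 Y I t)) (trans q (ring197 Y t))))))) (ring200 I))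
                          (λ q → nn-neg-absurd 0 (nn+ M (nn≡ (step-inj t>0 Y (1ℤ + 1ℤ + I) N (trans (sym (ring196 Y I t)) q)))) (ring201 N I))

      -- If x - t is a gap, `flat` makes x - t + s and x - t - s gaps. If it is a bead, X + t is a
      -- gap and the column must ascend somewhere between X and x.
      o≥2 : NN (o - 1ℤ - 1ℤ) → ⊥
      o≥2 nn = go (nn≡+ nn) (occ f (x - t)) refl
        where
          x-t≢x : x - t ≢ x
          x-t≢x q = x+d≢x t>0 (x - t) (trans (ring202 x t) (sym q))
          x-t≢X : x - t ≢ X
          x-t≢X q = nn-neg-absurd 0 (nn+ nn (nn≡ (cong -_ (step-inj t>0 x -1ℤ (- o) (trans (ring203 x t) (trans q (trans X≡ (ring204 x o t)))))))) (ring205 o)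
          dxt : t ∣ w (x - t)
          dxt = w-cong {t} {x} {x - t} (divides -1ℤ (ring206 x t)) d
          go : Σ[ m ∈ ℕ ] o - 1ℤ - 1ℤ ≡ + m → ∀ v → occ f (x - t) ≡ v → ⊥
          go _ false h = not-both (trans (sym (Classify.flat S f C x u d (x - t) dxt x-t≢x x-t≢X)) h) (trans (Classify.flat-left S f C x u d (x - t) dxt x-t≢x x-t≢X) h)
          go (m , em) true h = segment X o m em (Classify.w-bar-∣ S f C {x} d) (λ z n n′ → (λ q → n′ (trans q x≡)) , n)
              (trans (cong (occ f) (trans (ring207 X t) (sym (bar-- x t)))) (SC-true {f} scf {x - t} h))
              (trans (cong (occ f) (trans (ring208 X o t) (cong (_- t) (sym x≡)))) h)

      o=1 : o - 1ℤ ≡ 0ℤ → ⊥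
      o=1 z = not-both (trans (cong (λ v → occ f (v + s)) x-t) fXs) (trans (cong (λ v → occ f (v - s)) x-t) fX-s)
        where
          x-t : x - t ≡ X
          x-t = trans (ring209 x t) (trans (cong (λ v → x - v * t) (sym (subz {o} {1ℤ} z))) (sym X≡))

      N : ℤ
      N = - o
      X≡N : X ≡ x + N * t
      X≡N = trans X≡ (ring204 x o t)

      wx≡N : w x ≡ - (N * t)
      wx≡N = trans e (ring210 o t)

      ns : NN s
      ns = ℤP.<⇒≤ s>0

      -- By Euclid's lemma s divides o, so the bead x̄ lies above the gap x by a multiple of st.
      long-st : NN (N - 1ℤ - 1ℤ) → s ∣ w x → ⊥
      long-st nn h = go (gauss-s o (subst (s ∣_) e h))
        where
          go : s ∣ o → ⊥
          go (divides m em) = [ (λ m≥0 → nn-neg-absurd 1 (nn+ (nn+ nn (nn* m≥0 ns)) (nn≡ (zsub em))) (ring211 o m s))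
              , (λ m<0 → use (nn≡+ m<0)) ]′ (nn-total m)
            where
              use : Σ[ n ∈ ℕ ] - m - 1ℤ ≡ + n → ⊥
              use (n , en) = contra (core-down′ {s * t} {f} stc x X (suc n) (trans X≡N (cong (λ v → x + v) (trans (cong (λ v → - v * t) em) (trans (ring212 m s t) (cong (λ v → (1ℤ + v) * (s * t)) en))))) fX) fx

      -- The conjugate ascent y is in the self-conjugate class modulo s, so `kind-T` provides the
      -- gap ȳ + t; the bead y + t lies a nonnegative multiple of st above it.
      long-st′ : NN (N - 1ℤ - 1ℤ) → occ f (x + t) ≡ true → s ∣ w x + (t + t) → ⊥
      long-st′ nn h h′ = go (gauss-s (N - 1ℤ - 1ℤ) (subst (s ∣_) wy h″))
        where
          y : ℤ
          y = bar (x + t)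
          wy≡ : w y ≡ - (w x + (t + t))
          wy≡ = trans (w-bar (x + t)) (cong -_ (w-+ x t))
          h″ : s ∣ w y
          h″ = subst (s ∣_) (sym wy≡) (∣m⇒∣-m h′)
          wy : w y ≡ (N - 1ℤ - 1ℤ) * t
          wy = trans wy≡ (trans (cong (λ v → - (v + (t + t))) wx≡N) (ring213 N t))
          up-y : Up t f y
          up-y = Classify.Up-bar (swapS S) f (swap-Ctx C) x (fx , h)
          dn : occ f (bar y + t) ≡ false
          dn = Classify.kind-T (swapS S) f (swap-Ctx C) y up-y h″
          go : s ∣ N - 1ℤ - 1ℤ → ⊥
          go (divides m em) = [ (λ m≥0 → use (nn≡+ m≥0)) , (λ m<0 → nn-neg-absurd 0 (nn+ (nn+ (nn+ nn (nn* m<0 ns)) (nn-pred s>0)) (nn≡ (cong -_ (zsub em)))) (ring214 (N - 1ℤ - 1ℤ) m s)) ]′ (nn-total m)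
            where
              use : Σ[ n ∈ ℕ ] m ≡ + n → ⊥
              use (n , en) = contra (core-down′ {s * t} {f} stc (bar y + t) (y + t) n
                (trans (cong (_+ t) (trans (ring215 y) (cong (λ v → bar y + v) (trans wy (cong (_* t) em))))) (trans (ring216 (bar y) m s t) (cong (λ v → bar y + t + v * (s * t)) en))) (proj₂ up-y)) dn

      long : NN (N - 1ℤ - 1ℤ) → w x ≡ - t
      long nn = go (nn≡+ nn) (occ f (x + t)) refl
        where
          pick : occ f (x + t) ≡ true → Classify.Kind (swapS S) f (swap-Ctx C) x → w x ≡ - t
          pick h (Classify.kS q) = q
          pick h (Classify.kT dv _) = ⊥-elim (long-st nn dv)
          pick h (Classify.kT′ dv) = ⊥-elim (long-st′ nn h dv)
          go : Σ[ m ∈ ℕ ] N - 1ℤ - 1ℤ ≡ + m → ∀ v → occ f (x + t) ≡ v → w x ≡ - t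
          go (m , em) false h = ⊥-elim (segment x N m em d (λ z n n′ → n , (λ q → n′ (trans q X≡N))) (trans (cong (occ f) (ring207 x t)) h)
              (trans (cong (occ f) (trans (ring208 x N t) (trans (cong (_- t) (sym X≡N)) (sym (bar-+ x t))))) (SC-false {f} scf {x + t} h)))
          go _ true h = pick h (Classify.kind (swapS S) f (swap-Ctx C) x (fx , h))

      short : ∀ {a} → NN (- (a - 1ℤ - 1ℤ) - 1ℤ) → NN (a - 1ℤ) → a - 1ℤ ≡ 0ℤ
      short {a} p q = nn-antisym q (nn-cast (ring217 a) p)

    result : w x ≡ - t
    result = [ (λ o≥1 → ⊥-elim ([ o≥2 , (λ p → o=1 (short {o} p o≥1)) ]′ (nn-total (o - 1ℤ - 1ℤ))))
             , (λ o≤0 → [ long , (λ p → last o≤0 p) ]′ (nn-total (N - 1ℤ - 1ℤ))) ]′ (nn-total (o - 1ℤ))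
      where
        nonzero : ∀ {a} → NN a → a ≡ 0ℤ ⊎ NN (a - 1ℤ)
        nonzero {+ zero} _ = inj₁ refl
        nonzero {+ suc n} _ = inj₂ (+≤+ z≤n)
        last : NN (- (o - 1ℤ) - 1ℤ) → NN (- (N - 1ℤ - 1ℤ) - 1ℤ) → w x ≡ - t
        last o≤0 p = [ (λ z → ⊥-elim (w≢0 x (trans wx≡N (trans (cong (λ v → - (v * t)) z) refl)))) , (λ N≥1 → trans wx≡N (trans (cong (λ v → - (v * t)) (subz {N} {1ℤ} (short {N} p N≥1))) (ring218 t))) ]′ (nonzero (nn-cast (ring333 o) o≤0))

  up-self-conjugate : ∀ S f (C : Ctx S f) x → Up (Setup.s S) f x → Setup.t S ∣ w x → w x ≡ - Setup.t S
  up-self-conjugate S f C x u d = SelfConjugateUp.result S f C x u d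

  -- The third position is the image of the second under x ↦ bar (x + s).
  up-position : ∀ S f (C : Ctx S f) x → Up (Setup.s S) f x → w x ≡ - Setup.s S ⊎ (w x ≡ - Setup.t S ⊎ w x ≡ Setup.t S - (Setup.s S + Setup.s S))
  up-position S f C x u = go (Classify.kind S f C x u)
    where
      open SetupFacts S
      go : (Classify.Kind S f C) x → w x ≡ - s ⊎ (w x ≡ - t ⊎ w x ≡ t - (s + s))
      go (Classify.kS e) = inj₁ e
      go (Classify.kT d _) = inj₂ (inj₁ (up-self-conjugate S f C x u d))
      go (Classify.kT′ d) = inj₂ (inj₂ (subz (trans (ring219 (w x) s t) (cong -_ (zsub (trans (sym wy) (up-self-conjugate S f C (bar (x + s)) (Classify.Up-bar S f C x u) (subst (t ∣_) (sym wy) (∣m⇒∣-m d)))))))))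
        where wy : w (bar (x + s)) ≡ - (w x + (s + s))
              wy = trans (w-bar (x + s)) (cong -_ (w-+ x s))

  module Edge (S : Setup) (f : Maya) (C : Ctx S f) where
    open SetupFacts S
    open Ctx C
    private
      ns : NN s
      ns = ℤP.<⇒≤ s>0
      nt : NN t
      nt = ℤP.<⇒≤ t>0

    not-up : ∀ x → ¬ (w x ≡ - s) → ¬ (w x ≡ - t) → ¬ (w x ≡ t - (s + s)) → ¬ Up s f x
    not-up x n₁ n₂ n₃ u = [ n₁ , [ n₂ , n₃ ]′ ]′ (up-position S f C x u)

    -- Suppose b + s is a bead. If b is a gap, it is an ascent at a forbidden position. If b is a
    -- bead, b̄ is an ascent along t, and b̄ + s either is a second one in its class or makes b̄ an
    -- ascent along s, whose descent is then b.
    t-edge : ∀ b → w b ≡ t → occ f (b + s) ≡ false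
    t-edge b wb = go (occ f (b + s)) refl (occ f b) refl
      where
        b₀ : ℤ
        b₀ = bar b
        wb₀ : w b₀ ≡ - t
        wb₀ = trans (w-bar b) (cong -_ wb)
        b₀+t : b₀ + t ≡ b
        b₀+t = trans (cong (λ u → b₀ + u) (sym wb)) (ring220 b)
        go : ∀ v → occ f (b + s) ≡ v → ∀ v′ → occ f b ≡ v′ → occ f (b + s) ≡ false
        go false h _ _ = h
        go true h false h′ = ⊥-elim (not-up b
          (λ e → nn-neg-absurd 0 (nn+ (nn+ (nn-pred s>0) nt) (nn≡ (cong -_ (zsub (trans (sym wb) e))))) (ring221 s t))
          (λ e → nn-neg-absurd 0 (nn+ (nn+ (nn-pred t>0) nt) (nn≡ (cong -_ (zsub (trans (sym wb) e))))) (ring222 t))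
          (λ e → nn-neg-absurd 0 (nn+ (nn+ (nn-pred s>0) ns) (nn≡ (cong -_ (zsub (trans (sym wb) e))))) (ring223 s t))
          (h′ , h))
        go true h true h′ = ⊥-elim (cont (occ f (b₀ + s)) refl)
          where
            fb₀ : occ f b₀ ≡ false
            fb₀ = SC-true {f} scf {b} h′
            up-t : Up t f b₀
            up-t = fb₀ , trans (cong (occ f) b₀+t) h′
            cont : ∀ v → occ f (b₀ + s) ≡ v → ⊥
            cont false q = x+d≢x s>0 b₀ (sym (Classify.one-up (swapS S) f (swap-Ctx C) b₀ (b₀ + s) up-t (q , trans (cong (occ f) (trans (ring153 b₀ s t) (cong (_+ s) b₀+t))) h) (divides 1ℤ (ring192 b₀ s))))
            cont true q = contra h (trans (cong (λ u → occ f (u + s)) (sym (bar-bar b))) (Classify.kind-T S f C b₀ (fb₀ , q) (divides -1ℤ (trans wb₀ (ring224 t)))))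

    -- If c and c + s are beads, c̄ is an ascent; its descent y and the point bar (y + s) are beads
    -- placed symmetrically about c̄ on its t-column. One of them is not below c̄, so the column
    -- ascends above the gap c̄, which by `up-position` can happen only at c̄.
    s-edge : ∀ c → w c ≡ s → occ f (c + s) ≡ false
    s-edge c wc = go (occ f (c + s)) refl (occ f c) refl
      where
        c₀ : ℤ
        c₀ = bar c
        wc₀ : w c₀ ≡ - s
        wc₀ = trans (w-bar c) (cong -_ wc)
        c₀+s : c₀ + s ≡ c
        c₀+s = trans (cong (λ u → c₀ + u) (sym wc)) (ring220 c)
        s∣wc₀ : s ∣ w c₀
        s∣wc₀ = divides -1ℤ (trans wc₀ (ring224 s))
        module Go (h : occ f (c + s) ≡ true) (h′ : occ f c ≡ true) where
          fc₀ : occ f c₀ ≡ false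
          fc₀ = SC-true {f} scf {c} h′
          up-s : Up s f c₀
          up-s = fc₀ , trans (cong (occ f) c₀+s) h′
          -- Once c₀ also moves up along t, the row of c₀ agrees with the next one and forces an illegal up.
          from-up-t : Up t f c₀ → ⊥
          from-up-t ut = not-up (c + t)
              (λ e → nn-neg-absurd 0 (nn+ (nn+ (nn+ (nn+ (nn-pred s>0) ns) nt) nt) (nn≡ (cong -_ (zsub (trans (sym wct) e))))) (ring228 s t))
              (λ e → nn-neg-absurd 0 (nn+ (nn+ (nn+ (nn+ (nn-pred s>0) nt) nt) nt) (nn≡ (cong -_ (zsub (trans (sym wct) e))))) (ring229 s t))
              (λ e → nn-neg-absurd 0 (nn+ (nn+ (nn+ (nn+ (nn-pred s>0) ns) ns) nt) (nn≡ (cong -_ (zsub (trans (sym wct) e))))) (ring230 s t))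
              (trans (cong (λ u → occ f (u + t)) (sym (bar-bar c))) (Classify.kind-T (swapS S) f (swap-Ctx C) c₀ ut s∣wc₀)
              , trans (cong (occ f) (ring231 c s t)) (trans (sym (Classify.flat (swapS S) f (swap-Ctx C) c₀ ut s∣wc₀ (c + s) s∣wcs n₁ n₂)) h))
            where
              wct : w (c + t) ≡ s + (t + t)
              wct = trans (w-+ c t) (cong (λ u → u + (t + t)) wc)
              wcs : w (c + s) ≡ s + (s + s)
              wcs = trans (w-+ c s) (cong (λ u → u + (s + s)) wc)
              s∣wcs : s ∣ w (c + s)
              s∣wcs = divides (+ 3) (trans wcs (ring226 s))
              n₁ : c + s ≢ c₀
              n₁ e = nn-neg-absurd 0 (nn+ (nn+ (nn+ (nn+ (nn-pred s>0) ns) ns) ns) (nn≡ (cong -_ (zsub (trans (sym wcs) (trans (cong w e) wc₀)))))) (ring227 s)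
              n₂ : c + s ≢ bar c₀
              n₂ e = x+d≢x s>0 c (trans e (bar-bar c))
          from-point : ∀ (K : ℕ) → occ f (c₀ + + K * t) ≡ true → ⊥
          from-point K hK = use (cross-up (occ f) c₀ t K fc₀ hK)
            where
              use : Σ[ i ∈ ℕ ] (i ℕ.< K × occ f (c₀ + + i * t) ≡ false × occ f (c₀ + + i * t + t) ≡ true) → ⊥
              use (i , _ , a , b) = sort (up-position (swapS S) f (swap-Ctx C) z (a , b))
                where
                  I z : ℤ
                  I = + i
                  z = c₀ + I * t
                  wz : w z ≡ - s + (I * t + I * t)
                  wz = trans (w-+ c₀ (I * t)) (cong (λ u → u + (I * t + I * t)) wc₀)
                  sort : w z ≡ - t ⊎ (w z ≡ - s ⊎ w z ≡ s - (t + t)) → ⊥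
                  sort (inj₁ e) = t∤s (divides (1ℤ + (I + I)) (subz (trans (ring232 s t I) (cong -_ (zsub (trans (sym wz) e))))))
                  sort (inj₂ (inj₁ e)) = from-up-t (subst (Up t f) (w-inj {z} {c₀} (trans e (sym wc₀))) (a , b))
                  sort (inj₂ (inj₂ e)) = t∤s (divides (I + 1ℤ) (double-inj (subz (trans (ring233 s t I) (cong -_ (zsub (trans (sym wz) e)))))))
          absurd : ⊥
          absurd = use (Cols.partner s t f τ eqt τs c₀ fc₀ (proj₂ up-s))
            where
              use : Σ[ y ∈ ℤ ] (t ∣ y - c₀ × occ f y ≡ true × occ f (y + s) ≡ false) → ⊥
              use (y , divides k ek , g , g′) = sign k ek
                where
                  y≡ : ∀ k → y - c₀ ≡ k * t → y ≡ c₀ + k * t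
                  y≡ k ek = trans (ring350 y c₀) (cong (λ u → c₀ + u) ek)
                  ρy : ∀ k → y - c₀ ≡ k * t → bar (y + s) ≡ c₀ + (- k) * t
                  ρy k ek = trans (cong (λ u → bar (u + s)) (y≡ k ek)) (trans (ring234 c₀ s k t) (trans (cong (λ u → c₀ + (- k) * t - u) (zsub wc₀)) (ring235 _)))
                  sign : ∀ k → y - c₀ ≡ k * t → ⊥
                  sign (+ n) ek = from-point n (trans (cong (occ f) (sym (y≡ (+ n) ek))) g)
                  sign -[1+ n ] ek = from-point (suc n) (trans (cong (occ f) (sym (ρy -[1+ n ] ek))) (SC-false {f} scf {y + s} g′))
        go : ∀ v → occ f (c + s) ≡ v → ∀ v′ → occ f c ≡ v′ → occ f (c + s) ≡ false
        go false h _ _ = h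
        go true h false h′ = ⊥-elim (not-up c
          (λ e → nn-neg-absurd 0 (nn+ (nn+ (nn-pred s>0) ns) (nn≡ (cong -_ (zsub (trans (sym wc) e))))) (ring222 s))
          (λ e → nn-neg-absurd 0 (nn+ (nn+ (nn-pred s>0) nt) (nn≡ (cong -_ (zsub (trans (sym wc) e))))) (ring267 s t))
          (λ e → s∤t (divides (+ 3) (subz (trans (ring225 s t) (cong -_ (zsub (trans (sym wc) e)))))))
          (h′ , h))
        go true h true h′ = ⊥-elim (Go.absurd h h′)

  -- γ is f with the beads at odd coordinates ± s and ± t put in ground position.
  record Norm (S : Setup) (f γ : Maya) : Set where
    open Setup S
    field
      at-s : ∀ z → w z ≡ s → occ γ z ≡ false
      at-t : ∀ z → w z ≡ t → occ γ z ≡ false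
      at-s′ : ∀ z → w z ≡ - s → occ γ z ≡ true
      at-t′ : ∀ z → w z ≡ - t → occ γ z ≡ true
      off : ∀ z → w z ≢ s → w z ≢ t → w z ≢ - s → w z ≢ - t → occ γ z ≡ occ f z

  swap-Norm : ∀ {S f γ} → Norm S f γ → Norm (swapS S) f γ
  swap-Norm N = record { at-s = at-t ; at-t = at-s ; at-s′ = at-t′ ; at-t′ = at-s′ ; off = λ z a b c d → off z b a d c }
    where open Norm N

  -- Each permitted ascent of f, at - s, - t or t - 2 s, has an end at - s, - t or t and disappears
  -- with the normalisation. That no new ascent arises next to the altered points is the content of
  -- `Edge`.
  norm-core : ∀ S f (C : Ctx S f) γ → Norm S f γ → Core (Setup.s S) γ
  norm-core S f C γ N x h = by-cases (w x ℤP.≟ - s) (at-s′ x) λ n₁ → by-cases (w x ℤP.≟ - t) (at-t′ x) λ n₂ →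
      by-cases (w x ℤP.≟ s) (λ e → ⊥-elim (contra h (gap-above e))) λ n₃ → by-cases (w x ℤP.≟ t) (λ e → ⊥-elim (contra h (gap-above-t e))) λ n₄ →
      trans (off x n₃ n₄ n₁ n₂) (gen n₁ n₂)
    where
      open SetupFacts S
      open Ctx C
      open Norm N
      ns : NN s
      ns = ℤP.<⇒≤ s>0
      nt : NN t
      nt = ℤP.<⇒≤ t>0
      wxs : w (x + s) ≡ w x + (s + s)
      wxs = w-+ x s
      gap-above : w x ≡ s → occ γ (x + s) ≡ false
      gap-above e = trans (off (x + s) m₁ m₂ m₃ m₄) (Edge.s-edge S f C x e)
        where
          wv : w (x + s) ≡ s + (s + s)
          wv = trans wxs (cong (λ u → u + (s + s)) e)
          m₁ : w (x + s) ≢ s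
          m₁ q = nn-neg-absurd 0 (nn+ (nn+ (nn-pred s>0) ns) (nn≡ (cong -_ (zsub (trans (sym wv) q))))) (ring236 s)
          m₂ : w (x + s) ≢ t
          m₂ q = s∤t (divides (+ 3) (trans (sym (trans (sym wv) q)) (ring226 s)))
          m₃ : w (x + s) ≢ - s
          m₃ q = nn-neg-absurd 0 (nn+ (nn+ (nn+ (nn+ (nn-pred s>0) ns) ns) ns) (nn≡ (cong -_ (zsub (trans (sym wv) q))))) (ring227 s)
          m₄ : w (x + s) ≢ - t
          m₄ q = nn-neg-absurd 0 (nn+ (nn+ (nn+ (nn+ (nn-pred s>0) ns) ns) nt) (nn≡ (cong -_ (zsub (trans (sym wv) q))))) (ring237 s t)
      gap-above-t : w x ≡ t → occ γ (x + s) ≡ false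
      gap-above-t e = by-cases (w (x + s) ℤP.≟ s) (at-s (x + s)) λ m₁ → by-cases (w (x + s) ℤP.≟ t) (at-t (x + s)) λ m₂ → trans (off (x + s) m₁ m₂ m₃ m₄) (Edge.t-edge S f C x e)
        where
          wv : w (x + s) ≡ t + (s + s)
          wv = trans wxs (cong (λ u → u + (s + s)) e)
          m₃ : w (x + s) ≢ - s
          m₃ q = nn-neg-absurd 0 (nn+ (nn+ (nn+ (nn+ (nn-pred s>0) ns) ns) nt) (nn≡ (cong -_ (zsub (trans (sym wv) q))))) (ring238 s t)
          m₄ : w (x + s) ≢ - t
          m₄ q = nn-neg-absurd 0 (nn+ (nn+ (nn+ (nn+ (nn-pred s>0) ns) nt) nt) (nn≡ (cong -_ (zsub (trans (sym wv) q))))) (ring239 s t)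
      below-s : w (x + s) ≡ - s → occ f x ≡ true
      below-s e = trans (sym (trans (cong (occ f) (ring240 x s)) refl)) (SC-false {f} scf {bar (x + s) + s} (Edge.s-edge S f C (bar (x + s)) (trans (w-bar (x + s)) (trans (cong -_ e) (ℤP.neg-involutive s)))))
      below-t : w (x + s) ≡ - t → occ f x ≡ true
      below-t e = trans (sym (trans (cong (occ f) (ring240 x s)) refl)) (SC-false {f} scf {bar (x + s) + s} (Edge.t-edge S f C (bar (x + s)) (trans (w-bar (x + s)) (trans (cong -_ e) (ℤP.neg-involutive t)))))
      gen : w x ≢ - s → w x ≢ - t → occ f x ≡ true
      gen n₁ n₂ = by-cases (w (x + s) ℤP.≟ - s) below-s λ m₁ → by-cases (w (x + s) ℤP.≟ - t) below-t λ m₂ →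
          by-cases (w (x + s) ℤP.≟ s) (λ e → contra h (at-s (x + s) e)) λ m₃ → by-cases (w (x + s) ℤP.≟ t) (λ e → contra h (at-t (x + s) e)) λ m₄ →
          fin (trans (sym (off (x + s) m₃ m₄ m₁ m₂)) h) m₄ (occ f x) refl
        where
          fin : occ f (x + s) ≡ true → w (x + s) ≢ t → ∀ v → occ f x ≡ v → occ f x ≡ true
          fin p m₄ true q = q
          fin p m₄ false q = ⊥-elim (Edge.not-up S f C x n₁ n₂ (λ e → m₄ (trans wxs (trans (cong (λ u → u + (s + s)) e) (ring241 t s)))) (q , p))

  -- Exchanging two beads for two gaps

  swapMaya : Maya → ℤ → ℤ → ℤ → ℤ → Maya
  swapMaya f p q r u = flip p (flip r (flip q (flip u f)))

  -- The inequalities keep the four points and their conjugates distinct, so that the four flips act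
  -- independently.
  record Four (f : Maya) (p q r u : ℤ) : Set where
    field
      scf : SC f
      fp : occ f p ≡ true
      fq : occ f q ≡ true
      fr : occ f r ≡ false
      fu : occ f u ≡ false
      p≢q : p ≢ q
      r≢u : r ≢ u
      r≢p̄ : r ≢ bar p
      u≢p̄ : u ≢ bar p
      r≢q̄ : r ≢ bar q
      u≢q̄ : u ≢ bar q

    bead≢gap : ∀ {a b} → occ f a ≡ true → occ f b ≡ false → a ≢ b
    bead≢gap h h′ refl = contra h h′

    p≢q̄ : p ≢ bar q
    p≢q̄ = bead≢gap fp (SC-true {f} scf {q} fq)
    r≢ū : r ≢ bar u
    r≢ū e = contra (SC-false {f} scf {u} fu) (trans (cong (occ f) (sym e)) fr)
    flip-sides : ∀ {a b} → a ≢ bar b → b ≢ bar a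
    flip-sides n e = n (bar-swap (sym e))

    f₁ : Maya
    f₁ = flip q (flip u f)
    f₁p : occ f₁ p ≡ true
    f₁p = trans (flip-off q (occ (flip u f)) p p≢q p≢q̄) (trans (flip-off u (occ f) p (bead≢gap fp fu) (flip-sides u≢p̄)) fp)
    f₁r : occ f₁ r ≡ false
    f₁r = trans (flip-off q (occ (flip u f)) r (λ e → bead≢gap fq fr (sym e)) r≢q̄) (trans (flip-off u (occ f) r r≢u r≢ū) fr)
    sc-u : SC (flip u f)
    sc-u = flip-SC u {f} scf
    sc₁ : SC f₁
    sc₁ = flip-SC q {flip u f} sc-u
    sc-r : SC (flip r f₁)
    sc-r = flip-SC r {f₁} sc₁
    f₂p : occ (flip r f₁) p ≡ true
    f₂p = trans (flip-off r (occ f₁) p (bead≢gap fp fr) (flip-sides r≢p̄)) f₁p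
    u-q : occ (flip u f) q ≡ true
    u-q = trans (flip-off u (occ f) q (bead≢gap fq fu) (flip-sides u≢q̄)) fq

    swap-SC : SC (swapMaya f p q r u)
    swap-SC = flip-SC p {flip r f₁} sc-r

    swap-at-p : occ (swapMaya f p q r u) p ≡ false
    swap-at-p = flip-false p (flip r f₁) f₂p

    swap-E : p + q ≡ r + u → E (swapMaya f p q r u) ≡ E f
    swap-E e = trans (E-flip-true p {flip r f₁} sc-r f₂p) (trans (cong (_- w p) (trans (E-flip-false r {f₁} sc₁ f₁r) (cong (_+ w r)
        (trans (E-flip-true q {flip u f} sc-u u-q) (cong (_- w q) (E-flip-false u {f} scf fu)))))) (subz (trans (ring242 (E f) p q r u) (cong (λ v → - (v + v)) (zsub e)))))

    swap-Eqv : ∀ {d} k k′ → r ≡ p + k * d → u ≡ q + k′ * d → Eqv d (swapMaya f p q r u) f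
    swap-Eqv {d} k k′ e e′ = Eqv-trans {d} {swapMaya f p q r u} {f₁} {f} (flip-two {d} f₁ p r k sc₁ e f₁p f₁r r≢p̄) (flip-two {d} f q u k′ scf e′ fq fu u≢q̄)

  Four-swap : ∀ {f p q r u} → Four f p q r u → Four f p q u r
  Four-swap F = record { scf = scf ; fp = fp ; fq = fq ; fr = fu ; fu = fr ; p≢q = p≢q ; r≢u = λ e → r≢u (sym e) ; r≢p̄ = u≢p̄ ; u≢p̄ = r≢p̄ ; r≢q̄ = u≢q̄ ; u≢q̄ = r≢q̄ }
    where open Four F

  swapMaya-comm : ∀ f p q r u → swapMaya f p q r u ≐ swapMaya f p q u r
  swapMaya-comm f p q r u = flip-cong≐ {p} {flip r (flip q (flip u f))} {flip u (flip q (flip r f))}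
    (≐-trans {flip r (flip q (flip u f))} {flip q (flip r (flip u f))} {flip u (flip q (flip r f))} (flip-comm r q (flip u f))
    (≐-trans {flip q (flip r (flip u f))} {flip q (flip u (flip r f))} {flip u (flip q (flip r f))} (flip-cong≐ {q} {flip r (flip u f)} {flip u (flip r f)} (flip-comm r u f)) (flip-comm q u (flip r f))))

  swap-Eqv₂ : ∀ {d f p q r u} → Four f p q r u → ∀ k k′ → u ≡ p + k * d → r ≡ q + k′ * d → Eqv d (swapMaya f p q r u) f
  swap-Eqv₂ {d} {f} {p} {q} {r} {u} F k k′ e e′ = Eqv-trans {d} {swapMaya f p q r u} {swapMaya f p q u r} {f} (Eqv-refl {d} {swapMaya f p q r u} {swapMaya f p q u r} (swapMaya-comm f p q r u))
    (Four.swap-Eqv (Four-swap F) {d} k k′ e e′)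

  bad? : ∀ f p q r u → SC f → occ f p ≡ true → occ f q ≡ true → occ f r ≡ false → occ f u ≡ false → p ≢ q → r ≢ u →
    ((r ≡ bar p ⊎ u ≡ bar p) ⊎ (r ≡ bar q ⊎ u ≡ bar q)) ⊎ Four f p q r u
  bad? f p q r u sc fp fq fr fu n n′ = by-cases (r ℤP.≟ bar p) (λ e → inj₁ (inj₁ (inj₁ e))) λ a → by-cases (u ℤP.≟ bar p) (λ e → inj₁ (inj₁ (inj₂ e))) λ b →
    by-cases (r ℤP.≟ bar q) (λ e → inj₁ (inj₂ (inj₁ e))) λ c → by-cases (u ℤP.≟ bar q) (λ e → inj₁ (inj₂ (inj₂ e))) λ d →
    inj₂ (record { scf = sc ; fp = fp ; fq = fq ; fr = fr ; fu = fu ; p≢q = n ; r≢u = n′ ; r≢p̄ = a ; u≢p̄ = b ; r≢q̄ = c ; u≢q̄ = d })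

  Sol-Eqv : ∀ {S σ τ n n′ f g} → Sol S σ τ n f → SC g → Eqv (Setup.s S) g f → Eqv (Setup.t S) g f → E g ≡ n′ → Sol S σ τ n′ g
  Sol-Eqv {S} {σ} {τ} {f = f} {g = g} p sc es et e = record { sc = sc ; eqs = Eqv-trans {s} {g} {f} {σ} es (Sol.eqs p) ; eqt = Eqv-trans {t} {g} {f} {τ} et (Sol.eqt p) ; en = e }
    where open Setup S

  quad-steps : ∀ {d p q r u} → p + q ≡ r + u → d ∣ r - p → Σ[ k ∈ ℤ ] Σ[ k′ ∈ ℤ ] (r ≡ p + k * d × u ≡ q + k′ * d)
  quad-steps {d} {p} {q} {r} {u} e (divides k ek) = k , - k , subz (trans (ring243 p r k d) (zsub ek)) , subz (trans (ring244 p q r u k d) (z+ (cong -_ (zsub e)) (cong -_ (zsub ek))))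

  swap-Sol : ∀ {S σ τ n f p q r u} → Sol S σ τ n f → Four f p q r u → p + q ≡ r + u → Setup.s S ∣ r - p → Setup.t S ∣ u - p → Sol S σ τ n (swapMaya f p q r u)
  swap-Sol {S} {σ} {τ} {n} {f} {p} {q} {r} {u} sol F e ds dt = Sol-Eqv {f = f} sol (Four.swap-SC F)
      (go (quad-steps {s} {p} {q} {r} {u} e ds)) (go′ (quad-steps {t} {p} {q} {u} {r} (trans e (ℤP.+-comm r u)) dt)) (trans (Four.swap-E F e) (Sol.en sol))
    where
      open Setup S
      go : Σ[ k ∈ ℤ ] Σ[ k′ ∈ ℤ ] (r ≡ p + k * s × u ≡ q + k′ * s) → Eqv s (swapMaya f p q r u) f
      go (k , k′ , a , b) = Four.swap-Eqv F {s} k k′ a b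
      go′ : Σ[ k ∈ ℤ ] Σ[ k′ ∈ ℤ ] (u ≡ p + k * t × r ≡ q + k′ * t) → Eqv t (swapMaya f p q r u) f
      go′ (k , k′ , a , b) = swap-Eqv₂ {t} F k k′ a b

  swap-Sol′ : ∀ {S σ τ n f p q r u} → Sol S σ τ n f → Four f p q r u → p + q ≡ r + u → Setup.s S ∣ r - p → Setup.t S ∣ r - p → Sol S σ τ n (swapMaya f p q r u)
  swap-Sol′ {S} {σ} {τ} {n} {f} {p} {q} {r} {u} sol F e ds dt = Sol-Eqv {f = f} sol (Four.swap-SC F)
      (go s (quad-steps {s} {p} {q} {r} {u} e ds)) (go t (quad-steps {t} {p} {q} {r} {u} e dt)) (trans (Four.swap-E F e) (Sol.en sol))
    where
      open Setup S
      go : ∀ d → Σ[ k ∈ ℤ ] Σ[ k′ ∈ ℤ ] (r ≡ p + k * d × u ≡ q + k′ * d) → Eqv d (swapMaya f p q r u) f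
      go d (k , k′ , a , b) = Four.swap-Eqv F {d} k k′ a b

  -- Comparison of points that differ by multiples of st

  small-div : ∀ {D} → NN (D - (+ 6)) → ∀ c → NN (c - 1ℤ) → NN ((+ 5) - c) → ¬ (D ∣ c)
  small-div {D} big c lo hi (divides q e) = [ (λ q≥1 → nn-neg-absurd 0 (nn+ (nn+ (nn+ (nn+ hi big) (nn* q≥1 nD)) (nn≡ (zsub e))) (nn-pos 0)) (ring246 D c q))
      , (λ q≤0 → nn-neg-absurd 0 (nn+ (nn+ lo (nn* q≤0 nD)) (nn≡ (cong -_ (zsub e)))) (ring247 D c q)) ]′ (nn-total (q - 1ℤ))
    where
      nD : NN D
      nD = nn-cast (ring245 D) (nn+ big (nn-pos 6))

  -- Coprime numbers greater than 1 cannot both be 2.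
  st≥6 : ∀ S → NN (Setup.s S * Setup.t S - (+ 6))
  st≥6 S = [ (λ s≥3 → nn-cast (ring248 s t) (nn+ (nn* s≥3 (ℤP.<⇒≤ t>0)) (nn* (nn-pos 3) t≥2)))
           , (λ s≤2 → [ (λ t≥3 → nn-cast (ring249 s t) (nn+ (nn* s≥2 (ℤP.<⇒≤ t>0)) (nn* (nn-pos 2) t≥3)))
                      , (λ t≤2 → ⊥-elim (t∤s (divides 1ℤ (trans (two s s≥2 s≤2) (trans (sym (two t t≥2 t≤2)) (sym (ℤP.*-identityˡ t))))))) ]′ (nn-total (t - (+ 3)))) ]′ (nn-total (s - (+ 3)))
    where
      open SetupFacts S
      >1⇒ : ∀ {a} → 1ℤ < a → NN (a - (+ 2))
      >1⇒ h = nn≤ (ℤP.i<j⇒suc[i]≤j h)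
      s≥2 = >1⇒ s>1
      t≥2 = >1⇒ t>1
      two : ∀ a → NN (a - (+ 2)) → NN (- (a - (+ 3)) - 1ℤ) → a ≡ + 2
      two a p q = subz {a} {+ 2} (nn-antisym p (nn-cast (ring250 a) q))

  -- A shift x + i avoiding the class of x̄ and the self-conjugate class modulo D.
  record Avoid (D x : ℤ) : Set where
    field
      i : ℤ
      i≥1 : NN (i - 1ℤ)
      i≤5 : NN ((+ 5) - i)
      av₁ : ¬ (D ∣ w x + i)
      av₂ : ¬ (D ∣ w x + (i + i))

  -- Shifts from 1 to 3 suffice: two forbidden coincidences holding at once would make D, which is
  -- at least 6, divide a number between 1 and 5.
  avoid : ∀ {D} → NN (D - (+ 6)) → ∀ x → Avoid D x
  avoid {D} big x = by-cases (D ∣? (w x + 1ℤ))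
      (λ p₁ → by-cases (D ∣? (w x + (+ 4))) (λ r₂ → mk (+ 3) (+≤+ z≤n) (+≤+ z≤n) (sub 1ℤ (+ 3) p₁ refl 2≥ 2≤) (sub (+ 4) (+ 6) r₂ refl 2≥ 2≤))
                                            (λ n → mk (+ 2) (+≤+ z≤n) (+≤+ z≤n) (sub 1ℤ (+ 2) p₁ refl 1≥ 1≤) n))
      (λ n₁ → by-cases (D ∣? (w x + (+ 2)))
        (λ r₁ → mk (+ 3) (+≤+ z≤n) (+≤+ z≤n) (sub (+ 2) (+ 3) r₁ refl 1≥ 1≤) (sub (+ 2) (+ 6) r₁ refl 4≥ 4≤))
        (λ n → mk 1ℤ (+≤+ z≤n) (+≤+ z≤n) n₁ n))
    where
      1≥ : NN (1ℤ - 1ℤ)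
      1≥ = +≤+ z≤n
      1≤ : NN ((+ 5) - 1ℤ)
      1≤ = +≤+ z≤n
      2≥ : NN ((+ 2) - 1ℤ)
      2≥ = +≤+ z≤n
      2≤ : NN ((+ 5) - (+ 2))
      2≤ = +≤+ z≤n
      4≥ : NN ((+ 4) - 1ℤ)
      4≥ = +≤+ z≤n
      4≤ : NN ((+ 5) - (+ 4))
      4≤ = +≤+ z≤n
      mk : ∀ i → NN (i - 1ℤ) → NN ((+ 5) - i) → ¬ (D ∣ w x + i) → ¬ (D ∣ w x + (i + i)) → Avoid D x
      mk i a b c d = record { i = i ; i≥1 = a ; i≤5 = b ; av₁ = c ; av₂ = d }
      sub : ∀ i j → D ∣ w x + i → ∀ {c} → j - i ≡ c → NN (c - 1ℤ) → NN ((+ 5) - c) → ¬ (D ∣ w x + j)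
      sub i j h {c} refl lo hi h′ = small-div big c lo hi (subst (D ∣_) (ring251 (w x) i j) (∣m∣n⇒∣m-n h′ h))

  -- Uniqueness forbids every swap.
  module Only (S : Setup) (σ τ : Maya) (n : ℤ) (f : Maya) (sol : Sol S σ τ n f) (only : ∀ g → Sol S σ τ n g → g ≐ f) where
    open SetupFacts S

    quad : Quad S f
    quad p q r u fp fq fr fu e n₁ n₂ ds dt = [ (λ b → b) , (λ F → ⊥-elim (contra fp (trans (sym (only (swapMaya f p q r u) (swap-Sol sol F e ds dt) p)) (Four.swap-at-p F)))) ]′
      (bad? f p q r u (Sol.sc sol) fp fq fr fu n₁ n₂)

    quad′ : ∀ p q r u → occ f p ≡ true → occ f q ≡ true → occ f r ≡ false → occ f u ≡ false → p + q ≡ r + u → p ≢ q → r ≢ u →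
      s ∣ r - p → t ∣ r - p → (r ≡ bar p ⊎ u ≡ bar p) ⊎ (r ≡ bar q ⊎ u ≡ bar q)
    quad′ p q r u fp fq fr fu e n₁ n₂ ds dt = [ (λ b → b) , (λ F → ⊥-elim (contra fp (trans (sym (only (swapMaya f p q r u) (swap-Sol′ sol F e ds dt) p)) (Four.swap-at-p F)))) ]′
      (bad? f p q r u (Sol.sc sol) fp fq fr fu n₁ n₂)

    D : ℤ
    D = s * t

    D>0 : 0ℤ < D
    D>0 = ℤP.≰⇒> (λ le → nn-neg-absurd 5 (nn+ (st≥6 S) (nn≤ le)) (ring252 D))

    -- The exchange trades z, x + M for z + M, x, where z is the last bead before a gap, in steps of
    -- M, on the line of x + i. The choice of i rules out three of the blocking conjugacies; the
    -- fourth says w x = - M.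
    module FarST (x M m : ℤ) (M≡ : M ≡ m * D) (M>0 : 0ℤ < M) (fx : occ f x ≡ false) (fxM : occ f (x + M) ≡ true) where
      open Avoid (avoid {D} (st≥6 S) x)

      D∣ : ∀ a → D ∣ a * M
      D∣ a = divides (a * m) (trans (cong (a *_) M≡) (ring253 a m D))

      D∣i : ¬ (D ∣ i)
      D∣i = small-div {D} (st≥6 S) i i≥1 i≤5

      result : w x ≡ - M
      result = go (topBead f M M>0 (x + i))
        where
          go : Σ[ k ∈ ℤ ] (occ f (x + i + k * M) ≡ true × occ f (x + i + k * M + M) ≡ false) → w x ≡ - M
          go (k , fz , fzM) = [ [ (λ e → ⊥-elim (av₂ (off (- (k + k + 1ℤ)) (trans (ring255 x i k M) (zsub e))))) , (λ e → ⊥-elim (av₁ (off (- k) (trans (ring256 x i k M) (zsub e))))) ]′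
                , [ (λ e → ⊥-elim (av₁ (off (- (k + 1ℤ + 1ℤ)) (trans (ring257 x i k M) (zsub e))))) , (λ e → subz (trans (ring183 x M) (zsub e))) ]′ ]′
              (quad′ z (x + M) (z + M) x fz fxM fzM fx (ring254 z x M) n₁ n₂ (divides (m * t) (trans (ring193 z M) (trans M≡ (ring258 m s t)))) (divides (m * s) (trans (ring193 z M) (trans M≡ (ring253 m s t)))))
            where
              z : ℤ
              z = x + i + k * M
              off : ∀ a {v} → v - a * M ≡ 0ℤ → D ∣ v
              off a {v} h = subst (D ∣_) (sym (subz h)) (D∣ a)
              n₁ : z ≢ x + M
              n₁ e = D∣i (off (1ℤ - k) (trans (ring259 x i k M) (zsub e)))
              n₂ : z + M ≢ x
              n₂ e = D∣i (off (- k - 1ℤ) (trans (ring260 x i k M) (zsub e)))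

    far-st : ∀ x → occ f x ≡ false → occ f (x + D) ≡ true → w x ≡ - D
    far-st x h h′ = FarST.result x D 1ℤ (sym (ℤP.*-identityˡ D)) D>0 h h′

    far-2st : ∀ x → occ f x ≡ false → occ f (x + (D + D)) ≡ true → w x ≡ - (D + D)
    far-2st x h h′ = FarST.result x (D + D) (+ 2) (ring261 D) (ℤP.+-mono-< D>0 D>0) h h′

  -- Ground positions and the list of outcomes

  parityℕ : ∀ n → (Σ[ e ∈ ℤ ] w e ≡ - + n) ⊎ (Σ[ k ∈ ℤ ] + n ≡ k + k)
  parityℕ zero = inj₂ (0ℤ , refl)
  parityℕ (suc zero) = inj₁ (-1ℤ , refl)
  parityℕ (suc (suc n)) = [ (λ { (e , q) → inj₁ (e - 1ℤ , trans (ring262 e) (trans (cong (_- (+ 2)) q) (ring263 (+ n)))) }) , (λ { (k , q) → inj₂ (k + 1ℤ , trans (ring264 (+ n)) (trans (cong (_+ (+ 2)) q) (ring265 k))) }) ]′ (parityℕ n)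

  parity? : ∀ D → (Σ[ e ∈ ℤ ] w e ≡ - D) ⊎ (Σ[ k ∈ ℤ ] D ≡ k + k)
  parity? (+ n) = parityℕ n
  parity? -[1+ n ] = [ (λ { (e , q) → inj₁ (bar e , trans (w-bar e) (trans (cong -_ q) (ℤP.neg-involutive (+ suc n)))) }) , (λ { (k , q) → inj₂ (- k , trans (cong -_ q) (ring266 k)) }) ]′ (parityℕ (suc n))

  -- For even d there is no point of odd coordinate ± d and `g` is `f`; in general `rel` records
  -- whether a flip was necessary.
  record Ground (d : ℤ) (f g : Maya) : Set where
    field
      sc : SC g
      at : ∀ z → w z ≡ d → occ g z ≡ false
      at′ : ∀ z → w z ≡ - d → occ g z ≡ true
      off : ∀ z → w z ≢ d → w z ≢ - d → occ g z ≡ occ f z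
      rel : (g ≐ f) ⊎ (Σ[ c ∈ ℤ ] (w c ≡ - d × occ f c ≡ false × g ≐ flip c f))

  w-neg : ∀ {z d} → w z ≡ d → w (bar z) ≡ - d
  w-neg {z} e = trans (w-bar z) (cong -_ e)

  ground : ∀ d f → SC f → Σ[ g ∈ Maya ] Ground d f g
  ground d f sc = [ odd , even ]′ (parity? d)
    where
      keep : (∀ z → w z ≡ - d → occ f z ≡ true) → Σ[ g ∈ Maya ] Ground d f g
      keep h = f , record { sc = sc ; at = λ z e → trans (cong (occ f) (sym (bar-bar z))) (SC-true {f} sc {bar z} (h (bar z) (w-neg {z} e))) ; at′ = h
        ; off = λ _ _ _ → refl ; rel = inj₁ (λ _ → refl) }
      even : Σ[ k ∈ ℤ ] d ≡ k + k → Σ[ g ∈ Maya ] Ground d f g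
      even (k , q) = keep (λ z e → ⊥-elim (even≢odd (- k) z (sym (trans e (trans (cong -_ q) (ring266 k))))))
      odd : Σ[ c ∈ ℤ ] w c ≡ - d → Σ[ g ∈ Maya ] Ground d f g
      odd (c , wc) = go (occ f c) refl
        where
          go : ∀ v → occ f c ≡ v → Σ[ g ∈ Maya ] Ground d f g
          go true h = keep (λ z e → trans (cong (occ f) (w-inj {z} {c} (trans e (sym wc)))) h)
          go false h = flip c f , record
            { sc = flip-SC c {f} sc
            ; at = λ z e → trans (cong (occ (flip c f)) (w-inj {z} {bar c} (trans e (sym (half-of {d} {c} wc))))) (trans (flip-on c (occ f) (bar c) (inj₂ refl)) (cong not (SC-false {f} sc {c} h)))
            ; at′ = λ z e → trans (cong (occ (flip c f)) (w-inj {z} {c} (trans e (sym wc)))) (trans (flip-at c f) (cong not h))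
            ; off = λ z n n′ → flip-off c (occ f) z (λ e → n′ (trans (cong w e) wc)) (λ e → n (trans (cong w e) (half-of {d} {c} wc)))
            ; rel = inj₂ (c , wc , h , λ _ → refl) }

  module Grounded (S : Setup) (f : Maya) (scf : SC f) where
    open SetupFacts S
    G₁ = ground s f scf
    g₁ : Maya
    g₁ = proj₁ G₁
    module G₁ = Ground (proj₂ G₁)
    G₂ = ground t g₁ G₁.sc
    γ : Maya
    γ = proj₁ G₂
    module G₂ = Ground (proj₂ G₂)

    s≢t : s ≢ t
    s≢t e = t∤s (divides 1ℤ (trans e (sym (ℤP.*-identityˡ t))))
    s≢-t : s ≢ - t
    s≢-t e = nn-neg-absurd 0 (nn+ (nn+ (nn-pred s>0) (ℤP.<⇒≤ t>0)) (nn≡ (cong -_ (zsub e)))) (ring267 s t)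
    neg-inj : ∀ {a b : ℤ} → - a ≡ - b → a ≡ b
    neg-inj {a} {b} e = trans (sym (ℤP.neg-involutive a)) (trans (cong -_ e) (ℤP.neg-involutive b))

    norm : Norm S f γ
    norm = record
      { at-s = λ z e → trans (G₂.off z (λ q → s≢t (trans (sym e) q)) (λ q → s≢-t (trans (sym e) q))) (G₁.at z e)
      ; at-t = G₂.at
      ; at-s′ = λ z e → trans (G₂.off z (λ q → s≢-t (neg-inj (trans (sym e) (trans q (sym (ℤP.neg-involutive t)))))) (λ q → s≢t (neg-inj (trans (sym e) q)))) (G₁.at′ z e)
      ; at-t′ = G₂.at′
      ; off = λ z a b c d → trans (G₂.off z b d) (G₁.off z a c) }

  -- The five conditions for a pair of (s,t)-cores in terms of diagrams. Oddness of t is expressed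
  -- by a point of odd coordinate - t, and being the largest core by a bead at st - s - t.
  data Outcome (S : Setup) (σ τ : Maya) (n : ℤ) : Set where
    o₁ : σ ≐ τ → n ≡ E σ → Outcome S σ τ n
    o₂ : ∀ b₀ → w b₀ ≡ - Setup.t S → ∀ b l → w b ≡ - Setup.t S + (l + l) * Setup.s S → occ τ b ≡ true → σ ≐ flip b τ → n ≡ E τ + Setup.t S → Outcome S σ τ n
    o₃ : ∀ c₀ → w c₀ ≡ - Setup.s S → ∀ d k → w d ≡ - Setup.s S + (k + k) * Setup.t S → occ σ d ≡ true → τ ≐ flip d σ → n ≡ E σ + Setup.s S → Outcome S σ τ n
    o₄ : ∀ c₀ b₀ → w c₀ ≡ - Setup.s S → w b₀ ≡ - Setup.t S → ∀ γ b d l k → SC γ → occ γ b ≡ true → occ γ d ≡ true → b ≢ d →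
         w b ≡ - Setup.t S + (l + l) * Setup.s S → w d ≡ - Setup.s S + (k + k) * Setup.t S → σ ≐ flip b γ → τ ≐ flip d γ →
         n ≡ E γ + Setup.s S + Setup.t S → Outcome S σ τ n
    o₅ : ∀ c₀ b₀ xm → w c₀ ≡ - Setup.s S → w b₀ ≡ - Setup.t S → w xm ≡ Setup.s S * Setup.t S - Setup.s S - Setup.t S → σ ≐ τ → occ σ xm ≡ true →
         n ≡ E σ + Setup.s S * Setup.t S → Outcome S σ τ n

  -- For the s-core only the number of beads on each runner counts, so flipping b₀ or the top bead
  -- of its s-runner gives the same s-core, and the latter flip leaves a core at once.
  top-row : ∀ {s t} → 0ℤ < s → ¬ (s ∣ t) → ∀ γ σ b₀ → SC γ → Core s γ → w b₀ ≡ - t → occ γ b₀ ≡ true → Core s σ → Eqv s (flip b₀ γ) σ →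
    Σ[ b ∈ ℤ ] Σ[ l ∈ ℤ ] (w b ≡ - t + (l + l) * s × occ γ b ≡ true × σ ≐ flip b γ)
  top-row {s} {t} pos nd γ σ b₀ sc co wb₀ hb₀ cσ eq = go (topAbove γ s pos b₀ hb₀)
    where
      go : Σ[ i ∈ ℕ ] (occ γ (b₀ + + i * s) ≡ true × occ γ (b₀ + + i * s + s) ≡ false) → Σ[ b ∈ ℤ ] Σ[ l ∈ ℤ ] (w b ≡ - t + (l + l) * s × occ γ b ≡ true × σ ≐ flip b γ)
      go (i , h , h′) = b , I , wb , h , ≐-sym {flip b γ} {σ} (core-unique {s} {flip b γ} {σ} pos (flip-core {s} γ b pos sc co h h′ nd′) cσ
          (Eqv-trans {s} {flip b γ} {flip b₀ γ} {σ} (Eqv-sym {s} {flip b₀ γ} {flip b γ} (flip-Eqv {s} {γ} {γ} b₀ b I sc sc (Eqv-refl {s} {γ} {γ} (λ _ → refl)) refl (trans hb₀ (sym h)))) eq))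
        where
          I b : ℤ
          I = + i
          b = b₀ + I * s
          wb : w b ≡ - t + (I + I) * s
          wb = trans (w-+ b₀ (I * s)) (trans (cong (λ u → u + (I * s + I * s)) wb₀) (ring268 t I s))
          nd′ : ¬ (s ∣ w b)
          nd′ (divides q e) = nd (divides (I + I - q) (subz (trans (ring269 t I s q) (zsub (trans (sym e) wb)))))

  -- Solutions that are st-cores

  module Unexcited (S : Setup) (σ τ : Maya) (scσ : SC σ) (scτ : SC τ) (σs : Core (Setup.s S) σ) (σt : Core (Setup.t S) σ) (τs : Core (Setup.s S) τ) (τt : Core (Setup.t S) τ)
      (n : ℤ) (f : Maya) (sol : Sol S σ τ n f) (only : ∀ g → Sol S σ τ n g → g ≐ f) (stc : Core (Setup.s S * Setup.t S) f) where
    open SetupFacts S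
    quad : Quad S f
    quad = Only.quad S σ τ n f sol only
    scf : SC f
    scf = Sol.sc sol
    ctx : Ctx S f
    ctx = record { scf = scf ; quad = quad ; stc = stc ; σ = σ ; τ = τ ; eqs = Sol.eqs sol ; eqt = Sol.eqt sol ; σt = σt ; τs = τs }
    open Grounded S f scf
    γs : Core s γ
    γs = norm-core S f ctx γ norm
    γt : Core t γ
    γt = norm-core (swapS S) f (swap-Ctx ctx) γ (swap-Norm norm)
    scγ : SC γ
    scγ = G₂.sc

    s∣-s : ∀ {s c} → w c ≡ - s → s ∣ w c
    s∣-s {s} e = divides -1ℤ (trans e (ring224 s))

    plain : f ≐ γ → Outcome S σ τ n
    plain e = o₁ (≐-trans {σ} {γ} {τ} (≐-sym {γ} {σ} γσ) γτ) (trans (sym (Sol.en sol)) (trans (E-cong {f} {γ} e) (E-cong {γ} {σ} γσ)))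
      where
        γσ : γ ≐ σ
        γσ = core-unique {s} {γ} {σ} s>0 γs σs (Eqv-trans {s} {γ} {f} {σ} (Eqv-refl {s} {γ} {f} (≐-sym {f} {γ} e)) (Sol.eqs sol))
        γτ : γ ≐ τ
        γτ = core-unique {t} {γ} {τ} t>0 γt τt (Eqv-trans {t} {γ} {f} {τ} (Eqv-refl {t} {γ} {f} (≐-sym {f} {γ} e)) (Sol.eqt sol))

    lift-t : ∀ b₀ → w b₀ ≡ - t → f ≐ flip b₀ γ → Outcome S σ τ n
    lift-t b₀ wb₀ e = go (top-row {s} {t} s>0 s∤t γ σ b₀ scγ γs wb₀ hb₀ σs (Eqv-trans {s} {flip b₀ γ} {f} {σ} (Eqv-refl {s} {flip b₀ γ} {f} (≐-sym {f} {flip b₀ γ} e)) (Sol.eqs sol)))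
      where
        hb₀ : occ γ b₀ ≡ true
        hb₀ = G₂.at′ b₀ wb₀
        γτ : γ ≐ τ
        γτ = core-unique {t} {γ} {τ} t>0 γt τt (Eqv-trans {t} {γ} {flip b₀ γ} {τ} (Eqv-sym {t} {flip b₀ γ} {γ} (flip-self {t} γ b₀ scγ (s∣-s {t} {b₀} wb₀)))
          (Eqv-trans {t} {flip b₀ γ} {f} {τ} (Eqv-refl {t} {flip b₀ γ} {f} (≐-sym {f} {flip b₀ γ} e)) (Sol.eqt sol)))
        go : Σ[ b ∈ ℤ ] Σ[ l ∈ ℤ ] (w b ≡ - t + (l + l) * s × occ γ b ≡ true × σ ≐ flip b γ) → Outcome S σ τ n
        go (b , l , wb , hb , eσ) = o₂ b₀ wb₀ b l wb (trans (sym (γτ b)) hb) (≐-trans {σ} {flip b γ} {flip b τ} eσ (flip-cong≐ {b} {γ} {τ} γτ))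
          (trans (sym (Sol.en sol)) (trans (E-cong {f} {flip b₀ γ} e) (trans (E-flip-true b₀ {γ} scγ hb₀) (trans (cong₂ _-_ (E-cong {γ} {τ} γτ) wb₀) (ring167 (E τ) t)))))

    lift-s : ∀ c₀ → w c₀ ≡ - s → f ≐ flip c₀ γ → Outcome S σ τ n
    lift-s c₀ wc₀ e = go (top-row {t} {s} t>0 t∤s γ τ c₀ scγ γt wc₀ hc₀ τt (Eqv-trans {t} {flip c₀ γ} {f} {τ} (Eqv-refl {t} {flip c₀ γ} {f} (≐-sym {f} {flip c₀ γ} e)) (Sol.eqt sol)))
      where
        hc₀ : occ γ c₀ ≡ true
        hc₀ = Norm.at-s′ norm c₀ wc₀
        γσ : γ ≐ σ
        γσ = core-unique {s} {γ} {σ} s>0 γs σs (Eqv-trans {s} {γ} {flip c₀ γ} {σ} (Eqv-sym {s} {flip c₀ γ} {γ} (flip-self {s} γ c₀ scγ (s∣-s {s} {c₀} wc₀)))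
          (Eqv-trans {s} {flip c₀ γ} {f} {σ} (Eqv-refl {s} {flip c₀ γ} {f} (≐-sym {f} {flip c₀ γ} e)) (Sol.eqs sol)))
        go : Σ[ b ∈ ℤ ] Σ[ l ∈ ℤ ] (w b ≡ - s + (l + l) * t × occ γ b ≡ true × τ ≐ flip b γ) → Outcome S σ τ n
        go (b , l , wb , hb , eτ) = o₃ c₀ wc₀ b l wb (trans (sym (γσ b)) hb) (≐-trans {τ} {flip b γ} {flip b σ} eτ (flip-cong≐ {b} {γ} {σ} γσ))
          (trans (sym (Sol.en sol)) (trans (E-cong {f} {flip c₀ γ} e) (trans (E-flip-true c₀ {γ} scγ hc₀) (trans (cong₂ _-_ (E-cong {γ} {σ} γσ) wc₀) (ring167 (E σ) s)))))

    module Both (c₀ b₀ : ℤ) (wc₀ : w c₀ ≡ - s) (wb₀ : w b₀ ≡ - t) (e : f ≐ flip c₀ (flip b₀ γ)) where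
      hb₀ : occ γ b₀ ≡ true
      hb₀ = G₂.at′ b₀ wb₀
      hc₀ : occ γ c₀ ≡ true
      hc₀ = Norm.at-s′ norm c₀ wc₀
      c≢b : c₀ ≢ b₀
      c≢b q = s≢t (neg-inj (trans (sym wc₀) (trans (cong w q) wb₀)))
      c≢b̄ : c₀ ≢ bar b₀
      c≢b̄ q = s≢-t (neg-inj (trans (sym wc₀) (trans (cong w q) (trans (half-of {t} {b₀} wb₀) (sym (ℤP.neg-involutive t))))))
      fb fc : Maya
      fb = flip b₀ γ
      fc = flip c₀ γ
      scb : SC fb
      scb = flip-SC b₀ {γ} scγ
      scc : SC fc
      scc = flip-SC c₀ {γ} scγ
      e′ : f ≐ flip b₀ fc
      e′ = ≐-trans {f} {flip c₀ fb} {flip b₀ fc} e (flip-comm c₀ b₀ γ)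
      fbc₀ : occ fb c₀ ≡ true
      fbc₀ = trans (flip-off b₀ (occ γ) c₀ c≢b c≢b̄) hc₀
      eqσ : Eqv s fb σ
      eqσ = Eqv-trans {s} {fb} {flip c₀ fb} {σ} (Eqv-sym {s} {flip c₀ fb} {fb} (flip-self {s} fb c₀ scb (s∣-s {s} {c₀} wc₀)))
        (Eqv-trans {s} {flip c₀ fb} {f} {σ} (Eqv-refl {s} {flip c₀ fb} {f} (≐-sym {f} {flip c₀ fb} e)) (Sol.eqs sol))
      eqτ : Eqv t fc τ
      eqτ = Eqv-trans {t} {fc} {flip b₀ fc} {τ} (Eqv-sym {t} {flip b₀ fc} {fc} (flip-self {t} fc b₀ scc (s∣-s {t} {b₀} wb₀)))
        (Eqv-trans {t} {flip b₀ fc} {f} {τ} (Eqv-refl {t} {flip b₀ fc} {f} (≐-sym {f} {flip b₀ fc} e′)) (Sol.eqt sol))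
      en : n ≡ E γ + s + t
      en = trans (sym (Sol.en sol)) (trans (E-cong {f} {flip c₀ fb} e) (trans (E-flip-true c₀ {fb} scb fbc₀) (trans (cong₂ _-_ (trans (E-flip-true b₀ {γ} scγ hb₀) (cong (λ u → E γ - u) wb₀)) wc₀) (ring270 (E γ) s t))))

      -- Here σ = τ, and moving a single bead along the self-conjugate class modulo st gives a second solution.
      clash : ∀ b l k → occ γ b ≡ true → w b ≡ - t + (l + l) * s → w b ≡ - s + (k + k) * t → σ ≐ flip b γ → τ ≐ flip b γ → ⊥
      clash b l k hb wb wb′ eσ eτ = go (gauss-t (l + l + 1ℤ) (divides (k + k + 1ℤ) (subz (trans (ring271 s t l k) (zsub (trans (sym wb) wb′))))))
        where
          go : t ∣ l + l + 1ℤ → ⊥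
          go (divides o eo) = [ (λ o≥1 → second (nn≡+ (nn-cast (ring275 o t) (nn+ (nn* o≥1 (ℤP.<⇒≤ t>0)) (ℤP.<⇒≤ t>0)))) (nn≡+ (nn-cast (ring276 o) (nn+ o≥1 (nn-pos 1)))))
              , (λ o≤0 → w≢0 x (trans wx (cong -_ (nn-antisym nnD (nn-cast (ring277 s t o) (nn* (nn* o≤0 (ℤP.<⇒≤ s>0)) (ℤP.<⇒≤ t>0))))))) ]′ (nn-total (o - 1ℤ))
            where
              D x : ℤ
              D = o * (s * t)
              -- By 2 l + 1 = o t the sum w c₀ + w b₀ - w b collapses to - o s t.
              x = c₀ + b₀ - b
              wx : w x ≡ - D
              wx = trans (ring272 c₀ b₀ b) (trans (cong₂ _-_ (cong₂ _+_ wc₀ wb₀) wb) (subz (trans (ring273 s t l o) (cong -_ (z* s (zsub eo))))))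
              Eσ : E σ ≡ E γ - (- t + (l + l) * s)
              Eσ = trans (E-cong {σ} {flip b γ} eσ) (trans (E-flip-true b {γ} scγ hb) (cong (λ u → E γ - u) wb))
              nD : n - E σ ≡ D
              nD = trans (cong₂ _-_ en Eσ) (subz (trans (ring274 (E γ) s t l o) (z* s (zsub eo))))
              nnD : NN D
              nnD = nn-cast (trans (cong (_- E σ) (Sol.en sol)) nD) (E-core-min {s} {f} {σ} s>0 σs (Sol.eqs sol))
              second : Σ[ m ∈ ℕ ] o * t ≡ + m → Σ[ m ∈ ℕ ] o ≡ + m → ⊥
              second (m , em) (m′ , em′) = contra (core-down′ {s * t} {f} stc x (bar x) m′ (trans (bar≡+ x) (trans (cong (λ u → x - u) wx) (trans (ring167 x D) (cong (λ u → x + u * (s * t)) em′)))) fx̄) fx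
                where
                  σx : occ σ x ≡ true
                  σx = core-center {s} {σ} scσ σs x m (trans wx (cong -_ (trans (ring278 s t o) (cong (_* s) em))))
                  g : Maya
                  g = flip x σ
                  gs : Sol S σ τ n g
                  gs = record { sc = flip-SC x {σ} scσ ; eqs = flip-self {s} σ x scσ (divides (- (o * t)) (trans wx (ring279 s t o)))
                    ; eqt = Eqv-trans {t} {g} {σ} {τ} (flip-self {t} σ x scσ (divides (- (o * s)) (trans wx (ring280 s t o)))) (Eqv-refl {t} {σ} {τ} (≐-trans {σ} {flip b γ} {τ} eσ (≐-sym {τ} {flip b γ} eτ)))
                    ; en = trans (E-flip-true x {σ} scσ σx) (trans (cong (λ u → E σ - u) wx) (trans (ring167 (E σ) D) (trans (cong (λ u → E σ + u) (sym nD)) (ring281 (E σ) n)))) }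
                  fx : occ f x ≡ false
                  fx = trans (sym (only g gs x)) (flip-false x σ σx)
                  fx̄ : occ f (bar x) ≡ true
                  fx̄ = SC-false {f} scf {x} fx

      result : Outcome S σ τ n
      result = go (top-row {s} {t} s>0 s∤t γ σ b₀ scγ γs wb₀ hb₀ σs eqσ) (top-row {t} {s} t>0 t∤s γ τ c₀ scγ γt wc₀ hc₀ τt eqτ)
        where
          go : Σ[ b ∈ ℤ ] Σ[ l ∈ ℤ ] (w b ≡ - t + (l + l) * s × occ γ b ≡ true × σ ≐ flip b γ) →
               Σ[ d ∈ ℤ ] Σ[ k ∈ ℤ ] (w d ≡ - s + (k + k) * t × occ γ d ≡ true × τ ≐ flip d γ) → Outcome S σ τ n
          go (b , l , wb , hb , eσ) (d , k , wd , hd , eτ) = by-cases (b ℤP.≟ d)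
            (λ q → ⊥-elim (clash b l k hb wb (trans (cong w q) wd) eσ (subst (λ v → τ ≐ flip v γ) (sym q) eτ)))
            (λ nq → o₄ c₀ b₀ wc₀ wb₀ γ b d l k scγ hb hd nq wb wd eσ eτ en)

    outcome : Outcome S σ τ n
    outcome = go G₁.rel G₂.rel
      where
        inv : ∀ b g h → h ≐ flip b g → g ≐ flip b h
        inv b g h e = ≐-trans {g} {flip b (flip b g)} {flip b h} (≐-sym {flip b (flip b g)} {g} (flip-flip b g)) (flip-cong≐ {b} {flip b g} {h} (≐-sym {h} {flip b g} e))
        go : (g₁ ≐ f) ⊎ (Σ[ c ∈ ℤ ] (w c ≡ - s × occ f c ≡ false × g₁ ≐ flip c f)) → (γ ≐ g₁) ⊎ (Σ[ c ∈ ℤ ] (w c ≡ - t × occ g₁ c ≡ false × γ ≐ flip c g₁)) → Outcome S σ τ n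
        go (inj₁ e₁) (inj₁ e₂) = plain (≐-sym {γ} {f} (≐-trans {γ} {g₁} {f} e₂ e₁))
        go (inj₁ e₁) (inj₂ (b₀ , wb₀ , _ , e₂)) = lift-t b₀ wb₀ (≐-trans {f} {g₁} {flip b₀ γ} (≐-sym {g₁} {f} e₁) (inv b₀ g₁ γ e₂))
        go (inj₂ (c₀ , wc₀ , _ , e₁)) (inj₁ e₂) = lift-s c₀ wc₀ (≐-trans {f} {flip c₀ g₁} {flip c₀ γ} (inv c₀ f g₁ e₁) (flip-cong≐ {c₀} {g₁} {γ} (≐-sym {γ} {g₁} e₂)))
        go (inj₂ (c₀ , wc₀ , _ , e₁)) (inj₂ (b₀ , wb₀ , _ , e₂)) = Both.result c₀ b₀ wc₀ wb₀ (≐-trans {f} {flip c₀ g₁} {flip c₀ (flip b₀ γ)} (inv c₀ f g₁ e₁) (flip-cong≐ {c₀} {g₁} {flip b₀ γ} (inv b₀ g₁ γ e₂)))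

  -- Solutions excited at st

  odd-factor : ∀ s t e₀ → w e₀ ≡ - (s * t) → Σ[ b ∈ ℤ ] w b ≡ - t
  odd-factor s t e₀ we₀ = [ (λ r → r) , (λ { (k , q) → ⊥-elim (even≢odd (- (s * k)) e₀ (sym (trans we₀ (trans (cong (λ u → - (s * u)) q) (ring282 s k))))) }) ]′ (parity? t)

  -- st is odd and the innermost pair of the self-conjugate class modulo st is excited in f;
  -- F is f without this excitation.
  module Excited (S : Setup) (f : Maya) (scf : SC f) (quad : Quad S f) (e₀ c₀ b₀ : ℤ) (we₀ : w e₀ ≡ - (Setup.s S * Setup.t S))
      (wc₀ : w c₀ ≡ - Setup.s S) (wb₀ : w b₀ ≡ - Setup.t S) (fe₀ : occ f e₀ ≡ false) where
    open SetupFacts S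
    F : Maya
    F = flip e₀ f
    D : ℤ
    D = s * t
    c̄ h′ : ℤ
    c̄ = bar c₀
    h′ = bar b₀
    wc̄ : w c̄ ≡ s
    wc̄ = half-of {s} {c₀} wc₀
    wh′ : w h′ ≡ t
    wh′ = half-of {t} {b₀} wb₀
    wē₀ : w (bar e₀) ≡ D
    wē₀ = half-of {D} {e₀} we₀
    ns : NN s
    ns = ℤP.<⇒≤ s>0
    nt : NN t
    nt = ℤP.<⇒≤ t>0
    nD : NN D
    nD = nn* ns nt
    s≥2 : NN (s - (+ 2))
    s≥2 = nn≤ (ℤP.i<j⇒suc[i]≤j s>1)
    t≥2 : NN (t - (+ 2))
    t≥2 = nn≤ (ℤP.i<j⇒suc[i]≤j t>1)

    same : ∀ x → w x ≢ - D → w x ≢ D → occ f x ≡ occ F x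
    same x n n′ = sym (flip-off e₀ (occ f) x (λ e → n (trans (cong w e) we₀)) (λ e → n′ (trans (cong w e) wē₀)))

    s≢D : s ≢ D
    s≢D e = nn-neg-absurd 0 (nn+ (nn+ (nn* ns t≥2) (nn-pred s>0)) (nn≡ (zsub e))) (ring283 s t)
    s≢-D : s ≢ - D
    s≢-D e = nn-neg-absurd 0 (nn+ (nn+ nD (nn-pred s>0)) (nn≡ (cong -_ (zsub e)))) (ring307 s (s * t))

    h≥1 : NN (c̄ - 1ℤ)
    h≥1 = [ (λ p → p) , (λ q → ⊥-elim (nn-neg-absurd 0 (nn+ (nn+ (nn+ q q) s≥2) (nn≡ (zsub wc̄))) (ring284 c̄ s))) ]′ (nn-total (c̄ - 1ℤ))

    e₀≡ : e₀ ≡ c̄ + (- (h′ + 1ℤ)) * s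
    e₀≡ = w-step {e₀} {c̄} { - (h′ + 1ℤ)} {s} (trans we₀ (trans (subz (trans (ring285 s t h′) (z* s (zsub wh′)))) (cong (λ u → u + (- (h′ + 1ℤ) + - (h′ + 1ℤ)) * s) (sym wc̄))))

    -- The exchange trades c̄, q for e₀, u: e₀ is on the s-runner of c̄, and u lies j t above c̄ as
    -- q lies j t above e₀. The point u is a gap because c̄ is one in the t-core `γ`, and for 0 < j
    -- < s no conjugacy blocks the exchange.
    module Col (γ : Maya) (N : Norm S F γ) (γt : Core t γ) (Fc : occ F c̄ ≡ true) (q j : ℤ) (q≡ : q ≡ e₀ + j * t) (Fq : occ F q ≡ true)
        (j≥1 : NN (j - 1ℤ)) (j<s : NN (s - j - 1ℤ)) where
      open Norm N
      u : ℤ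
      u = c̄ + j * t
      wu : w u ≡ s + (j + j) * t
      wu = trans (w-+ c̄ (j * t)) (trans (cong (λ v → v + (j * t + j * t)) wc̄) (ring286 s j t))
      wq : w q ≡ - D + (j + j) * t
      wq = trans (cong w q≡) (trans (w-+ e₀ (j * t)) (trans (cong (λ v → v + (j * t + j * t)) we₀) (ring268 D j t)))
      jt : NN (j * t - t)
      jt = nn-cast (ring287 j t) (nn* j≥1 nt)
      u-pos : ∀ {a} → NN a → w u ≢ - a
      u-pos {a} na e = nn-neg-absurd 0 (nn+ (nn+ (nn+ (nn+ (nn+ (nn+ jt jt) nt) nt) (nn-pred s>0)) na) (nn≡ (cong -_ (zsub (trans (sym wu) e))))) (ring288 s j t a)
      u≢s : w u ≢ s
      u≢s e = nn-neg-absurd 0 (nn+ (nn+ (nn+ (nn+ jt jt) (nn-pred t>0)) nt) (nn≡ (cong -_ (zsub (trans (sym wu) e))))) (ring289 s j t)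
      u≢t : w u ≢ t
      u≢t e = t∤s (divides (1ℤ - (j + j)) (subz (trans (ring290 s j t) (zsub (trans (sym wu) e)))))
      u≢D : w u ≢ D
      u≢D e = t∤s (divides (s - (j + j)) (subz (trans (ring291 s j t) (zsub (trans (sym wu) e)))))
      q≢-D : w q ≢ - D
      q≢-D e = nn-neg-absurd 0 (nn+ (nn+ (nn+ (nn+ jt jt) (nn-pred t>0)) nt) (nn≡ (cong -_ (zsub (trans (sym wq) e))))) (ring292 D j t)
      q≢D : w q ≢ D
      q≢D e = nn-neg-absurd 0 (nn+ (nn+ (nn+ (nn+ (nn* nt j<s) (nn* nt j<s)) (nn-pred t>0)) nt) (nn≡ (zsub (trans (sym wq) e)))) (ring293 s j t)
      γu : occ γ u ≡ false
      γu = go (nn≡+ (nn-cast (ring276 j) (nn+ j≥1 (nn-pos 1))))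
        where
          go : Σ[ m ∈ ℕ ] j ≡ + m → occ γ u ≡ false
          go (m , em) = core-up {t} {γ} γt c̄ u m (cong (λ v → c̄ + v * t) em) (at-s c̄ wc̄)
      fu : occ f u ≡ false
      fu = trans (same u (u-pos nD) u≢D) (trans (sym (off u u≢s u≢t (u-pos ns) (u-pos nt))) γu)
      absurd : ⊥
      absurd = [ [ (λ e → s≢D (trans (ring294 s) (trans (cong -_ (trans (sym (trans (w-bar c̄) (cong -_ wc̄))) (sym (cong w e)))) (trans (cong -_ we₀) (ℤP.neg-involutive D)))))
                 , (λ e → u-pos ns (trans (cong w e) (trans (w-bar c̄) (cong -_ wc̄)))) ]′
               , [ (λ e → q≢D (trans (trans (ring294 (w q)) (cong -_ (sym (w-bar q)))) (trans (cong (λ v → - w v) (sym e)) (trans (cong -_ we₀) (ℤP.neg-involutive D)))))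
                 , (λ e → t∤s (divides (s - (j + j) - (j + j)) (subz (trans (ring295 s j t) (zsub (trans (sym wu) (trans (cong w e) (trans (w-bar q) (cong -_ wq))))))))) ]′ ]′
          (quad c̄ q e₀ u (trans (same c̄ (λ e → s≢-D (trans (sym wc̄) e)) (λ e → s≢D (trans (sym wc̄) e))) Fc) (trans (same q q≢-D q≢D) Fq) fe₀ fu
            (trans (cong (λ v → c̄ + v) q≡) (ring296 c̄ e₀ (j * t))) p≢q (λ e → u-pos nD (trans (cong w (sym e)) we₀))
            (divides (- (h′ + 1ℤ)) (trans (cong (_- c̄) e₀≡) (ring193 c̄ (- (h′ + 1ℤ) * s)))) (divides j (ring193 c̄ (j * t))))
        where
          p≢q : c̄ ≢ q
          p≢q e = t∤s (divides (j + j - s) (subz (trans (ring297 s j t) (zsub (trans (sym wc̄) (trans (cong w e) wq))))))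

    b₀≡ : b₀ ≡ e₀ + c̄ * t
    b₀≡ = w-step {b₀} {e₀} {c̄} {t} (trans wb₀ (trans (subz (trans (ring298 s t c̄) (cong -_ (z* t (zsub wc̄))))) (cong (λ v → v + (c̄ + c̄) * t) (sym we₀))))
    b̄₀≡ : bar b₀ ≡ e₀ + (c̄ + 1ℤ) * t
    b̄₀≡ = w-step {bar b₀} {e₀} {c̄ + 1ℤ} {t} (trans wh′ (trans (subz (trans (ring299 s t c̄) (cong -_ (z* t (zsub wc̄))))) (cong (λ v → v + (c̄ + 1ℤ + (c̄ + 1ℤ)) * t) (sym we₀))))

    -- Both b₀ and b̄₀ lie on the t-runner of e₀ within the range of `Col`, and one of them is a
    -- bead.
    no-lift : ∀ γ → Norm S F γ → Core t γ → SC F → occ F c₀ ≡ false → ⊥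
    no-lift γ N γt scF Fc = go (occ F b₀) refl
      where
        Fc̄ : occ F c̄ ≡ true
        Fc̄ = SC-false {F} scF {c₀} Fc
        h≥0 : NN c̄
        h≥0 = nn-cast (ring276 c̄) (nn+ h≥1 (nn-pos 1))
        go : ∀ v → occ F b₀ ≡ v → ⊥
        go true p = Col.absurd γ N γt Fc̄ b₀ c̄ b₀≡ p h≥1 (nn-cast (trans (ring301 c̄) (cong (λ v → v - c̄ - 1ℤ) wc̄)) h≥0)
        go false p = Col.absurd γ N γt Fc̄ (bar b₀) (c̄ + 1ℤ) b̄₀≡ (SC-false {F} scF {b₀} p) (nn-cast (sym (ring300 c̄)) h≥0) (nn-cast (trans (ring302 c̄) (cong (λ v → v - (c̄ + 1ℤ) - 1ℤ) wc̄)) h≥1)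

    xm : ℤ
    xm = c₀ + c̄ * t
    wxm : w xm ≡ s * t - s - t
    wxm = trans (w-+ c₀ (c̄ * t)) (trans (cong (λ u → u + (c̄ * t + c̄ * t)) wc₀) (subz (trans (ring134 s t c̄) (z* t (zsub wc̄)))))

    xm≢-D : w xm ≢ - D
    xm≢-D e = nn-neg-absurd 3 (nn+ (nn+ (nn+ (nn+ (nn* ns t≥2) (nn* nt s≥2)) s≥2) t≥2) (nn≡ (cong -_ (zsub (trans (sym wxm) e))))) (ring303 s t)
    xm≢D : w xm ≢ D
    xm≢D e = nn-neg-absurd 0 (nn+ (nn+ (nn-pred s>0) nt) (nn≡ (zsub (trans (sym wxm) e)))) (ring304 s t)

    e₀≡c₀ : e₀ ≡ c₀ + (- h′) * s
    e₀≡c₀ = w-step {e₀} {c₀} { - h′} {s} (trans we₀ (trans (subz (trans (ring305 s t h′) (z* s (zsub wh′)))) (cong (λ u → u + (- h′ + - h′) * s) (sym wc₀))))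

    -- Otherwise the beads c₀, b₀ could be exchanged for the gaps e₀, xm, which have the same sum.
    top-bead : occ F c₀ ≡ true → occ F b₀ ≡ true → occ F xm ≡ true
    top-bead Fc Fb = go (occ f xm) refl
      where
        -s≢ : w c₀ ≢ - D
        -s≢ e = s≢D (trans (ring294 s) (trans (cong -_ (trans (sym wc₀) e)) (ℤP.neg-involutive D)))
        -s≢′ : w c₀ ≢ D
        -s≢′ e = s≢-D (trans (ring294 s) (cong -_ (trans (sym wc₀) e)))
        t≢D : t ≢ D
        t≢D e = nn-neg-absurd 0 (nn+ (nn+ (nn* nt s≥2) (nn-pred t>0)) (nn≡ (zsub e))) (ring306 s t)
        -t≢ : w b₀ ≢ - D
        -t≢ e = t≢D (trans (ring294 t) (trans (cong -_ (trans (sym wb₀) e)) (ℤP.neg-involutive D)))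
        t≢-D : t ≢ - D
        t≢-D e = nn-neg-absurd 0 (nn+ (nn+ nD (nn-pred t>0)) (nn≡ (cong -_ (zsub e)))) (ring307 t (s * t))
        -t≢′ : w b₀ ≢ D
        -t≢′ e = t≢-D (trans (ring294 t) (cong -_ (trans (sym wb₀) e)))
        go : ∀ v → occ f xm ≡ v → occ F xm ≡ true
        go true p = trans (sym (same xm xm≢-D xm≢D)) p
        go false p = ⊥-elim ([ [ (λ e → s≢-D (trans (sym wc̄) (trans (cong w (sym e)) we₀)))
                 , (λ e → s∤t (divides (t - (+ 2)) (subz (trans (ring308 s t) (cong -_ (zsub (trans (sym wxm) (trans (cong w e) wc̄)))))))) ]′
               , [ (λ e → t≢-D (trans (sym wh′) (trans (cong w (sym e)) we₀)))
                 , (λ e → t∤s (divides (s - (+ 2)) (subz (trans (ring309 s t) (cong -_ (zsub (trans (sym wxm) (trans (cong w e) wh′)))))))) ]′ ]′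
          (quad c₀ b₀ e₀ xm (trans (same c₀ -s≢ -s≢′) Fc) (trans (same b₀ -t≢ -t≢′) Fb) fe₀ p
            (trans (cong (λ v → c₀ + v) b₀≡) (ring296 c₀ e₀ (c̄ * t))) c≢b (λ e → xm≢-D (trans (cong w (sym e)) we₀))
            (divides (- h′) (trans (cong (_- c₀) e₀≡c₀) (ring193 c₀ (- h′ * s)))) (divides c̄ (ring193 c₀ (c̄ * t)))))
          where
            c≢b : c₀ ≢ b₀
            c≢b e = t∤s (divides 1ℤ (trans (ring294 s) (trans (cong -_ (trans (sym wc₀) (trans (cong w e) wb₀))) (ring310 t))))

  module ExcitedSolution (S : Setup) (σ τ : Maya) (scσ : SC σ) (scτ : SC τ) (σs : Core (Setup.s S) σ) (σt : Core (Setup.t S) σ) (τs : Core (Setup.s S) τ) (τt : Core (Setup.t S) τ)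
      (n : ℤ) (f : Maya) (sol : Sol S σ τ n f) (only : ∀ g → Sol S σ τ n g → g ≐ f)
      (e₀ : ℤ) (we₀ : w e₀ ≡ - (Setup.s S * Setup.t S)) (fe₀ : occ f e₀ ≡ false) where
    open SetupFacts S
    quad : Quad S f
    quad = Only.quad S σ τ n f sol only
    D : ℤ
    D = s * t
    D>0 : 0ℤ < D
    D>0 = Only.D>0 S σ τ n f sol only
    far-st : ∀ x → occ f x ≡ false → occ f (x + D) ≡ true → w x ≡ - D
    far-st = Only.far-st S σ τ n f sol only
    far-2st : ∀ x → occ f x ≡ false → occ f (x + (D + D)) ≡ true → w x ≡ - (D + D)
    far-2st = Only.far-2st S σ τ n f sol only
    scf : SC f
    scf = Sol.sc sol
    F : Maya
    F = flip e₀ f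
    scF : SC F
    scF = flip-SC e₀ {f} scf
    s∣we₀ : s ∣ w e₀
    s∣we₀ = divides (- t) (trans we₀ (ring163 s t))
    t∣we₀ : t ∣ w e₀
    t∣we₀ = divides (- s) (trans we₀ (ring164 s t))
    Fe₀ : occ F e₀ ≡ true
    Fe₀ = trans (flip-at e₀ f) (cong not fe₀)
    EF : E F ≡ n - D
    EF = trans (E-flip-false e₀ {f} scf fe₀) (cong₂ _+_ (Sol.en sol) we₀)
    solF : Sol S σ τ (n - D) F
    solF = Sol-Eqv {f = f} sol scF (flip-self {s} f e₀ scf s∣we₀) (flip-self {t} f e₀ scf t∣we₀) EF
    ē≡ : bar e₀ ≡ e₀ + D
    ē≡ = trans (bar≡+ e₀) (trans (cong (λ u → e₀ - u) we₀) (ring167 e₀ D))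

    flip-sol : ∀ {m m′ g} → Sol S σ τ m g → E (flip e₀ g) ≡ m′ → Sol S σ τ m′ (flip e₀ g)
    flip-sol {g = g} p e = Sol-Eqv {f = g} p (flip-SC e₀ {g} (Sol.sc p)) (flip-self {s} g e₀ (Sol.sc p) s∣we₀) (flip-self {t} g e₀ (Sol.sc p) t∣we₀) e

    -- A solution two steps down would leave room for one with e₀ occupied.
    no-deep : ∀ g → Sol S σ τ (n - D - D) g → occ g e₀ ≡ true → ⊥
    no-deep g p ge₀ = go (topBead g D D>0 0ℤ)
      where
        -- On the runner of 0 modulo D one has w z ≡ 1, so it is not self-conjugate and avoids e₀.
        -- Moving a bead up by D there, with its conjugate, adds 2 D to the energy.
        go : Σ[ k ∈ ℤ ] (occ g (0ℤ + k * D) ≡ true × occ g (0ℤ + k * D + D) ≡ false) → ⊥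
        go (k , hz , hz′) = contra (trans (sym (only h hs e₀)) he₀) fe₀
          where
            z y : ℤ
            z = 0ℤ + k * D
            y = z + D
            scg : SC g
            scg = Sol.sc p
            D∤1 : ¬ (D ∣ 1ℤ)
            D∤1 = small-div {D} (st≥6 S) 1ℤ (+≤+ z≤n) (+≤+ z≤n)
            D∤wz : ¬ (D ∣ w z)
            D∤wz d = D∤1 (subst (D ∣_) (ring311 k D) (∣m∣n⇒∣m-n d (divides (k + k) refl)))
            D∤wy : ¬ (D ∣ w y)
            D∤wy d = D∤wz (subst (D ∣_) (ring312 z D) (∣m∣n⇒∣m-n d (divides (+ 2) refl)))
            D∣we₀ : D ∣ w e₀
            D∣we₀ = divides -1ℤ (trans we₀ (ring224 D))
            off₁ : ∀ {v} → ¬ (D ∣ w v) → e₀ ≢ v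
            off₁ nd e = nd (subst (λ u → D ∣ w u) e D∣we₀)
            off₂ : ∀ {v} → ¬ (D ∣ w v) → e₀ ≢ bar v
            off₂ {v} nd e = nd (subst (D ∣_) (trans (cong (λ u → - w u) e) (trans (cong -_ (w-bar v)) (ℤP.neg-involutive (w v)))) (∣m⇒∣-m D∣we₀))
            y≢z̄ : y ≢ bar z
            y≢z̄ e = D∤wz (divides -1ℤ (subz (trans (ring138 z D) (zsub e))))
            h : Maya
            h = flip z (flip y g)
            scy : SC (flip y g)
            scy = flip-SC y {g} scg
            z≢y : z ≢ y
            z≢y e = x+d≢x D>0 z (sym e)
            fz : occ (flip y g) z ≡ true
            fz = trans (flip-off y (occ g) z z≢y (λ e → y≢z̄ (bar-swap (sym e)))) hz
            Eh : E h ≡ n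
            Eh = trans (E-flip-true z {flip y g} scy fz) (trans (cong (_- w z) (trans (E-flip-false y {g} scg hz′) (cong (_+ w y) (Sol.en p)))) (ring313 n z D))
            hs : Sol S σ τ n h
            hs = Sol-Eqv {f = g} p (flip-SC z {flip y g} scy) (flip-two {s} g z y t scg (cong (λ u → z + u) (ℤP.*-comm s t)) hz hz′ y≢z̄) (flip-two {t} g z y s scg refl hz hz′ y≢z̄) Eh
            he₀ : occ h e₀ ≡ true
            he₀ = trans (flip-off z (occ (flip y g)) e₀ (off₁ D∤wz) (off₂ {z} D∤wz)) (trans (flip-off y (occ g) e₀ (off₁ D∤wy) (off₂ {y} D∤wy)) ge₀)

    -- `F` solves the problem at n - st, where uniqueness is not given. An exchanged `F′` with a
    -- bead at e₀ could be excited to a second solution at n; with a gap at e₀ it could be flipped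
    -- down to n - 2 st, against `no-deep`.
    quadF : Quad S F
    quadF p q r u fp fq fr fu e n₁ n₂ ds dt = [ (λ b → b) , (λ X → ⊥-elim (go X (occ (swapMaya F p q r u) e₀) refl)) ]′ (bad? F p q r u scF fp fq fr fu n₁ n₂)
      where
        F′ : Maya
        F′ = swapMaya F p q r u
        go : Four F p q r u → ∀ v → occ F′ e₀ ≡ v → ⊥
        go X true h = contra fp (trans (sym (≐-trans {F′} {flip e₀ (flip e₀ F′)} {F} (≐-sym {flip e₀ (flip e₀ F′)} {F′} (flip-flip e₀ F′)) (flip-cong≐ {e₀} {flip e₀ F′} {f} (only (flip e₀ F′) s′)) p)) (Four.swap-at-p X))
          where
            sol′ = swap-Sol solF X e ds dt
            s′ : Sol S σ τ n (flip e₀ F′)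
            s′ = flip-sol {g = F′} sol′ (trans (E-flip-true e₀ {F′} (Four.swap-SC X) h) (trans (cong₂ _-_ (Sol.en sol′) we₀) (ring6 n D)))
        go X false h = no-deep (flip e₀ F′) (flip-sol {g = F′} sol′ (trans (E-flip-false e₀ {F′} (Four.swap-SC X) h) (cong₂ _+_ (Sol.en sol′) we₀))) (trans (flip-at e₀ F′) (cong not h))
          where sol′ = swap-Sol solF X e ds dt

    -- Otherwise a bead would lie 2 st above the gap e₀, for which `far-2st` requires w e₀ = - 2 st.
    beyond : occ f (bar e₀ + D) ≡ false
    beyond = go (occ f (bar e₀ + D)) refl
      where
        go : ∀ v → occ f (bar e₀ + D) ≡ v → occ f (bar e₀ + D) ≡ false
        go false h = h
        go true h = ⊥-elim (nn-neg-absurd 0 (nn+ (nn-pred D>0) (nn≡ (zsub (trans (sym (far-2st e₀ fe₀ (trans (cong (occ f) (trans (sym (ring314 e₀ D)) (cong (_+ D) (sym ē≡)))) h))) we₀)))) (ring315 D))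

    stcF : Core (s * t) F
    stcF x h = go (occ F x) refl
      where
        go : ∀ v → occ F x ≡ v → occ F x ≡ true
        go true q = q
        go false q = ⊥-elim (by-cases (x ℤP.≟ bar e₀)
            (λ e → contra (trans (cong (λ v → occ f (v + D)) (sym e)) (trans (sym (flip-off e₀ (occ f) (x + D) (nx e) (nx̄ e))) h)) beyond)
            (λ n₁ → by-cases ((x + D) ℤP.≟ e₀)
              (λ e → contra (trans (cong (occ f) (sym (trans (cong bar (xe e)) (bar-- e₀ D)))) (SC-false {f} scf {x} (fxoff e n₁))) beyond)
              (λ n₂ → x≢e₀ (w-inj {x} {e₀} (trans (far-st x (fx n₁) (fxD n₂)) (sym we₀))))))
          where
            x≢e₀ : x ≢ e₀
            x≢e₀ e = contra Fe₀ (trans (cong (occ F) (sym e)) q)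
            fx : x ≢ bar e₀ → occ f x ≡ false
            fx n₁ = trans (sym (flip-off e₀ (occ f) x x≢e₀ n₁)) q
            xD≢ē : x + D ≢ bar e₀
            xD≢ē e = x≢e₀ (trans (sym (ring23 x D)) (trans (cong (_- D) (trans e ē≡)) (ring23 e₀ D)))
            fxD : x + D ≢ e₀ → occ f (x + D) ≡ true
            fxD n₂ = trans (sym (flip-off e₀ (occ f) (x + D) n₂ xD≢ē)) h
            xe : x + D ≡ e₀ → x ≡ e₀ - D
            xe e = trans (sym (ring23 x D)) (cong (_- D) e)
            fxoff : x + D ≡ e₀ → x ≢ bar e₀ → occ f x ≡ false
            fxoff _ n₁ = fx n₁
            nx : x ≡ bar e₀ → x + D ≢ e₀
            nx e e′ = pos-nonzero (ℤP.+-mono-< D>0 D>0) (trans (ring316 e₀ D) (trans (cong (λ v → v + D - e₀) (trans (sym ē≡) (sym e))) (zsub e′)))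
            nx̄ : x ≡ bar e₀ → x + D ≢ bar e₀
            nx̄ e e′ = x+d≢x D>0 x (trans e′ (sym e))

    ctxF : Ctx S F
    ctxF = record { scf = scF ; quad = quadF ; stc = stcF ; σ = σ ; τ = τ ; eqs = Sol.eqs solF ; eqt = Sol.eqt solF ; σt = σt ; τs = τs }
    open Grounded S F scF
    γs : Core s γ
    γs = norm-core S F ctxF γ norm
    γt : Core t γ
    γt = norm-core (swapS S) F (swap-Ctx ctxF) γ (swap-Norm norm)

    outcome : Outcome S σ τ n
    outcome = go (odd-factor t s e₀ (trans we₀ (cong -_ (ℤP.*-comm s t)))) (odd-factor s t e₀ we₀)
      where
        go : Σ[ c₀ ∈ ℤ ] w c₀ ≡ - s → Σ[ b₀ ∈ ℤ ] w b₀ ≡ - t → Outcome S σ τ n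
        go (c₀ , wc₀) (b₀ , wb₀) = fin G₁.rel G₂.rel
          where
            xm : ℤ
            xm = Excited.xm S f scf quad e₀ c₀ b₀ we₀ wc₀ wb₀ fe₀
            fin : (g₁ ≐ F) ⊎ (Σ[ c ∈ ℤ ] (w c ≡ - s × occ F c ≡ false × g₁ ≐ flip c F)) → (γ ≐ g₁) ⊎ (Σ[ c ∈ ℤ ] (w c ≡ - t × occ g₁ c ≡ false × γ ≐ flip c g₁)) → Outcome S σ τ n
            fin (inj₂ (c , wc , Fc , _)) _ = ⊥-elim (Excited.no-lift S f scf quad e₀ c₀ b₀ we₀ wc₀ wb₀ fe₀ γ norm γt scF (trans (cong (occ F) (w-inj {c₀} {c} (trans wc₀ (sym wc)))) Fc))
            fin (inj₁ e₁) (inj₂ (b , wb , gb , _)) = ⊥-elim (Excited.no-lift (swapS S) f scf (Quad-swap S f quad) e₀ b₀ c₀ (trans we₀ (cong -_ (ℤP.*-comm s t))) wb₀ wc₀ fe₀ γ (swap-Norm norm) γs scF (trans (cong (occ F) (w-inj {b₀} {b} (trans wb₀ (sym wb)))) (trans (sym (e₁ b)) gb)))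
            fin (inj₁ e₁) (inj₁ e₂) = o₅ c₀ b₀ xm wc₀ wb₀ (Excited.wxm S f scf quad e₀ c₀ b₀ we₀ wc₀ wb₀ fe₀) (≐-trans {σ} {γ} {τ} (≐-sym {γ} {σ} γσ) γτ)
                (trans (sym (γσ xm)) (trans (γF xm) (Excited.top-bead S f scf quad e₀ c₀ b₀ we₀ wc₀ wb₀ fe₀ (trans (sym (γF c₀)) (Norm.at-s′ norm c₀ wc₀)) (trans (sym (γF b₀)) (Norm.at-t′ norm b₀ wb₀)))))
                (trans (ring317 n D) (cong (_+ D) (trans (sym EF) (trans (E-cong {F} {γ} (≐-sym {γ} {F} γF)) (E-cong {γ} {σ} γσ)))))
              where
                γF : γ ≐ F
                γF = ≐-trans {γ} {g₁} {F} e₂ e₁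
                γσ : γ ≐ σ
                γσ = core-unique {s} {γ} {σ} s>0 γs σs (Eqv-trans {s} {γ} {F} {σ} (Eqv-refl {s} {γ} {F} γF) (Sol.eqs solF))
                γτ : γ ≐ τ
                γτ = core-unique {t} {γ} {τ} t>0 γt τt (Eqv-trans {t} {γ} {F} {τ} (Eqv-refl {t} {γ} {F} γF) (Sol.eqt solF))

  -- By `far-st` the solution can fail to be an st-core only at odd coordinate - st; the occupancy
  -- of that point selects the analysis.
  unique⇒outcome : ∀ S σ τ → SC σ → SC τ → Core (Setup.s S) σ → Core (Setup.t S) σ → Core (Setup.s S) τ → Core (Setup.t S) τ → ∀ n → Unique S σ τ n → Outcome S σ τ n
  unique⇒outcome S σ τ scσ scτ σs σt τs τt n (f , sol , only) = [ odd , even ]′ (parity? (s * t))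
    where
      open SetupFacts S
      normal : (∀ e → w e ≡ - (s * t) → occ f e ≡ true) → Outcome S σ τ n
      normal h = Unexcited.outcome S σ τ scσ scτ σs σt τs τt n f sol only stc
        where
          stc : Core (s * t) f
          stc x q = go (occ f x) refl
            where go : ∀ v → occ f x ≡ v → occ f x ≡ true
                  go true p = p
                  go false p = h x (Only.far-st S σ τ n f sol only x p q)
      even : Σ[ k ∈ ℤ ] s * t ≡ k + k → Outcome S σ τ n
      even (k , q) = normal (λ e we → ⊥-elim (even≢odd (- k) e (sym (trans we (trans (cong -_ q) (ring266 k))))))
      odd : Σ[ e ∈ ℤ ] w e ≡ - (s * t) → Outcome S σ τ n
      odd (e₀ , we₀) = go (occ f e₀) refl
        where
          go : ∀ v → occ f e₀ ≡ v → Outcome S σ τ n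
          go true p = normal (λ e we → trans (cong (occ f) (w-inj {e} {e₀} (trans we (sym we₀)))) p)
          go false p = ExcitedSolution.outcome S σ τ scσ scτ σs σt τs τt n f sol only e₀ we₀ p

  -- The largest (s,t)-core

  sumN : ℕ → (ℕ → ℤ) → ℤ
  sumN zero g = 0ℤ
  sumN (suc m) g = sumN m g + g m

  sumN-cong : ∀ m {g h : ℕ → ℤ} → (∀ a → a ℕ.< m → g a ≡ h a) → sumN m g ≡ sumN m h
  sumN-cong zero e = refl
  sumN-cong (suc m) e = cong₂ _+_ (sumN-cong m (λ a lt → e a (ℕP.m<n⇒m<1+n lt))) (e m (ℕP.n<1+n m))

  sumN-zero : ∀ m {g : ℕ → ℤ} → (∀ a → a ℕ.< m → g a ≡ 0ℤ) → sumN m g ≡ 0ℤ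
  sumN-zero zero e = refl
  sumN-zero (suc m) e = z+ (sumN-zero m (λ a lt → e a (ℕP.m<n⇒m<1+n lt))) (e m (ℕP.n<1+n m))

  sumN-single : ∀ m (g : ℕ → ℤ) a₀ → a₀ ℕ.< m → (∀ a → a ℕ.< m → a ≢ a₀ → g a ≡ 0ℤ) → sumN m g ≡ g a₀
  sumN-single (suc m) g a₀ (s≤s le) e = [ (λ lt → trans (cong₂ _+_ (sumN-single m g a₀ lt (λ a l → e a (ℕP.m<n⇒m<1+n l))) (e m (ℕP.n<1+n m) (λ q → ℕP.<-irrefl (sym q) lt))) (ℤP.+-identityʳ _))
      , (λ { refl → trans (cong (_+ g m) (sumN-zero m (λ a l → e a (ℕP.m<n⇒m<1+n l) (λ q → ℕP.<-irrefl q l)))) (ℤP.+-identityˡ (g m)) }) ]′ (ℕP.m≤n⇒m<n∨m≡n le)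

  sumN-add : ∀ m (g h : ℕ → ℤ) → sumN m (λ a → g a + h a) ≡ sumN m g + sumN m h
  sumN-add zero g h = refl
  sumN-add (suc m) g h = trans (cong (_+ (g m + h m)) (sumN-add m g h)) (ring318 (sumN m g) (sumN m h) (g m) (h m))

  sumN-scale : ∀ m c (g : ℕ → ℤ) → sumN m (λ a → c * g a) ≡ c * sumN m g
  sumN-scale zero c g = sym (ℤP.*-zeroʳ c)
  sumN-scale (suc m) c g = trans (cong (_+ c * g m) (sumN-scale m c g)) (ring319 c (sumN m g) (g m))

  sumFS : ℕ → (ℕ → FS) → FS
  sumFS zero G = zeroFS
  sumFS (suc m) G = addFS (sumFS m G) (G m)

  sumFS-at : ∀ m G x → at (sumFS m G) x ≡ sumN m (λ a → at (G a) x)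
  sumFS-at zero G x = refl
  sumFS-at (suc m) G x = cong (_+ at (G m) x) (sumFS-at m G x)

  Σ-sumFS : ∀ m G (c : ℤ → ℤ) → Σℤ (mulFS c (sumFS m G)) ≡ sumN m (λ a → Σℤ (mulFS c (G a)))
  Σ-sumFS zero G c = Σ-cong {mulFS c zeroFS} {zeroFS} (λ x → ℤP.*-zeroʳ (c x))
  Σ-sumFS (suc m) G c = trans (Σ-cong {mulFS c (addFS (sumFS m G) (G m))} {addFS (mulFS c (sumFS m G)) (mulFS c (G m))} (λ x → ℤP.*-distribˡ-+ (c x) (at (sumFS m G) x) (at (G m) x)))
    (trans (Σ-add (mulFS c (sumFS m G)) (mulFS c (G m))) (cong (_+ Σℤ (mulFS c (G m))) (Σ-sumFS m G c)))

  below? : ℤ → ℤ → ℤ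
  below? j n = ind (does (j ℤP.<? n))

  below-yes : ∀ {j n} → j < n → below? j n ≡ 1ℤ
  below-yes {j} {n} h = cong ind (dec-in (j ℤP.<? n) h)

  below-no : ∀ {j n} → n ≤ j → below? j n ≡ 0ℤ
  below-no {j} {n} h = cong ind (dec-out (j ℤP.<? n) (ℤP.≤⇒≯ h))

  below-suc : ∀ j k → below? j (k + 1ℤ) ≡ below? j k + ind (does (j ℤP.≟ k))
  below-suc j k = by-cases (j ℤP.<? k)
    (λ lt → trans (below-yes (ℤP.<-trans lt (p<p+1 k))) (sym (cong₂ _+_ (below-yes lt) (cong ind (does-no {j} {k} (ℤP.<⇒≢ lt))))))
    (λ ge → by-cases (j ℤP.≟ k)
      (λ { refl → trans (below-yes (p<p+1 k)) (sym (cong₂ _+_ (below-no {k} {k} ℤP.≤-refl) (cong ind (does-yes {k} {k} refl)))) })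
      (λ ne → trans (below-no {j} {k + 1ℤ} (subst (_≤ j) (ℤP.+-comm 1ℤ k) (ℤP.i<j⇒suc[i]≤j (ℤP.≤∧≢⇒< (ℤP.≮⇒≥ ge) (λ q → ne (sym q)))))) (sym (cong₂ _+_ (below-no {j} {k} (ℤP.≮⇒≥ ge)) (cong ind (does-no ne))))))

  -- n beads added to (or, for n negative, removed from) a column filled strictly below z.
  ramp : ℤ → ℤ → ℤ → FS
  ramp t z (+ zero) = zeroFS
  ramp t z (+ suc k) = addFS (ramp t z (+ k)) (δ (z + + k * t))
  ramp t z -[1+ zero ] = subFS zeroFS (δ (z + -1ℤ * t))
  ramp t z -[1+ suc k ] = subFS (ramp t z -[1+ k ]) (δ (z + -[1+ suc k ] * t))

  δ-col : ∀ {t} → 0ℤ < t → ∀ z j k → at (δ (z + k * t)) (z + j * t) ≡ ind (does (j ℤP.≟ k))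
  δ-col {t} pos z j k = cong ind (does-⇔ {z + j * t} {z + k * t} {j} {k} (λ e → subz (step-inj pos z j k e)) (λ e → cong (λ u → z + u * t) e))

  ramp-at : ∀ {t} → 0ℤ < t → ∀ z n j → at (ramp t z n) (z + j * t) ≡ below? j n - below? j 0ℤ
  ramp-at pos z (+ zero) j = sym (ℤP.+-inverseʳ (below? j 0ℤ))
  ramp-at {t} pos z (+ suc k) j = trans (cong₂ _+_ (ramp-at pos z (+ k) j) (δ-col pos z j (+ k))) (trans (ring79 (below? j (+ k)) (below? j 0ℤ) (ind (does (j ℤP.≟ + k)))) (cong (_- below? j 0ℤ) (trans (sym (below-suc j (+ k))) (cong (below? j) (ℤP.+-comm (+ k) 1ℤ)))))
  ramp-at {t} pos z -[1+ zero ] j = trans (cong (λ u → 0ℤ - u) (δ-col pos z j -1ℤ)) (trans (ring320 (below? j -1ℤ) (ind (does (j ℤP.≟ -1ℤ)))) (cong (λ u → below? j -1ℤ - u) (sym (below-suc j -1ℤ))))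
  ramp-at {t} pos z -[1+ suc k ] j = trans (cong₂ _-_ (ramp-at pos z -[1+ k ] j) (δ-col pos z j -[1+ suc k ])) (trans (cong (λ u → u - below? j 0ℤ - ind (does (j ℤP.≟ -[1+ suc k ]))) (below-suc j -[1+ suc k ])) (ring80 (below? j -[1+ suc k ]) (below? j 0ℤ) (ind (does (j ℤP.≟ -[1+ suc k ])))))

  ramp-off : ∀ {t} z n x → ¬ (t ∣ x - z) → at (ramp t z n) x ≡ 0ℤ
  ramp-off z (+ zero) x h = refl
  ramp-off {t} z (+ suc k) x h = cong₂ _+_ (ramp-off z (+ k) x h) (δ-off (z + + k * t) x (λ e → h (divides (+ k) (trans (cong (_- z) e) (ring193 z (+ k * t))))))
  ramp-off {t} z -[1+ zero ] x h = cong (λ u → 0ℤ - u) (δ-off (z + -1ℤ * t) x (λ e → h (divides -1ℤ (trans (cong (_- z) e) (ring193 z (-1ℤ * t))))))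
  ramp-off {t} z -[1+ suc k ] x h = cong₂ _-_ (ramp-off z -[1+ k ] x h) (δ-off (z + -[1+ suc k ] * t) x (λ e → h (divides -[1+ suc k ] (trans (cong (_- z) e) (ring193 z (-[1+ suc k ] * t))))))

  one : ℤ → ℤ
  one _ = 1ℤ

  Σ-mul-add : ∀ c F G → Σℤ (mulFS c (addFS F G)) ≡ Σℤ (mulFS c F) + Σℤ (mulFS c G)
  Σ-mul-add c F G = trans (Σ-cong {mulFS c (addFS F G)} {addFS (mulFS c F) (mulFS c G)} (λ x → ℤP.*-distribˡ-+ (c x) (at F x) (at G x))) (Σ-add (mulFS c F) (mulFS c G))

  Σ-mul-sub : ∀ c F G → Σℤ (mulFS c (subFS F G)) ≡ Σℤ (mulFS c F) - Σℤ (mulFS c G)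
  Σ-mul-sub c F G = trans (Σ-cong {mulFS c (subFS F G)} {subFS (mulFS c F) (mulFS c G)} (λ x → ring22 (c x) (at F x) (at G x))) (Σ-sub (mulFS c F) (mulFS c G))

  ramp-charge : ∀ t z n → Σℤ (mulFS one (ramp t z n)) ≡ n
  ramp-charge t z (+ zero) = refl
  ramp-charge t z (+ suc k) = trans (Σ-mul-add one (ramp t z (+ k)) (δ (z + + k * t))) (trans (cong₂ _+_ (ramp-charge t z (+ k)) (Σ-mulδ one (z + + k * t))) (ℤP.+-comm (+ k) 1ℤ))
  ramp-charge t z -[1+ zero ] = trans (Σ-mul-sub one zeroFS (δ (z + -1ℤ * t))) (cong (λ u → 0ℤ - u) (Σ-mulδ one (z + -1ℤ * t)))
  ramp-charge t z -[1+ suc k ] = trans (Σ-mul-sub one (ramp t z -[1+ k ]) (δ (z + -[1+ suc k ] * t))) (trans (cong₂ _-_ (ramp-charge t z -[1+ k ]) (Σ-mulδ one (z + -[1+ suc k ] * t))) (ring321 (+ k)))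

  -- Weighting by w instead of the position doubles the energy up to the charge and so avoids
  -- halving n (n - 1).
  ramp-energy : ∀ t z n → Σℤ (mulFS w (ramp t z n)) ≡ n * w z + t * (n * n - n)
  ramp-energy t z (+ zero) = ring322 t (w z)
  ramp-energy t z (+ suc k) = trans (Σ-mul-add w (ramp t z (+ k)) (δ (z + + k * t))) (trans (cong₂ _+_ (ramp-energy t z (+ k)) (Σ-mulδ w (z + + k * t))) (ring323 (+ k) t z))
  ramp-energy t z -[1+ zero ] = trans (Σ-mul-sub w zeroFS (δ (z + -1ℤ * t))) (trans (cong (λ u → 0ℤ - u) (Σ-mulδ w (z + -1ℤ * t))) (ring324 t z))
  ramp-energy t z -[1+ suc k ] = trans (Σ-mul-sub w (ramp t z -[1+ k ]) (δ (z + -[1+ suc k ] * t))) (trans (cong₂ _-_ (ramp-energy t z -[1+ k ]) (Σ-mulδ w (z + -[1+ suc k ] * t))) (lem (+ k) t z))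
    where lem : ∀ k t z → - (1ℤ + k) * (z + z + 1ℤ) + t * (- (1ℤ + k) * - (1ℤ + k) - - (1ℤ + k)) - (z + - (1ℤ + (1ℤ + k)) * t + (z + - (1ℤ + (1ℤ + k)) * t) + 1ℤ)
                    ≡ - (1ℤ + (1ℤ + k)) * (z + z + 1ℤ) + t * (- (1ℤ + (1ℤ + k)) * - (1ℤ + (1ℤ + k)) - - (1ℤ + (1ℤ + k)))
          lem = solve-∀

  -- defect m is Σ_{a<b<m} (h a - h b)(s - (h a - h b)), twice the energy by which a core with
  -- column heights h falls short of the largest one.
  module Defect (s : ℤ) (h : ℕ → ℤ) where
    term : ℤ → ℕ → ℤ
    term N a = (h a - N) * (s - (h a - N))
    inner : ℕ → ℤ → ℤ
    inner m N = sumN m (term N)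
    defect : ℕ → ℤ
    defect m = sumN m (λ b → inner b (h b))
    S₁ S₂ S₃ : ℕ → ℤ
    S₁ m = sumN m h
    S₂ m = sumN m (λ a → h a * h a)
    S₃ m = sumN m (λ a → + a * h a)

    inner-eq : ∀ m N → inner m N ≡ s * (S₁ m - + m * N) - (S₂ m - (N + N) * S₁ m + + m * (N * N))
    inner-eq zero N = ring325 s N
    inner-eq (suc m) N = trans (cong (_+ term N m) (inner-eq m N)) (ring326 s N (+ m) (S₁ m) (S₂ m) (h m))

    -- The sum of h a - h b over a < b < m is the sum of (m - 1 - 2 a) h a, and the sum of the
    -- squares (h a - h b)² is m Σ h² - (Σ h)².
    defect-eq : ∀ m → defect m ≡ s * ((+ m - 1ℤ) * S₁ m - (S₃ m + S₃ m)) - (+ m * S₂ m - S₁ m * S₁ m)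
    defect-eq zero = ring327 s
    defect-eq (suc m) = trans (cong₂ _+_ (defect-eq m) (inner-eq m (h m))) (lem s (+ m) (S₁ m) (S₂ m) (S₃ m) (h m))
      where lem : ∀ s m S Q A x → s * ((m - 1ℤ) * S - (A + A)) - (m * Q - S * S) + (s * (S - m * x) - (Q - (x + x) * S + m * (x * x)))
                  ≡ s * ((1ℤ + m - 1ℤ) * (S + x) - (A + m * x + (A + m * x))) - ((1ℤ + m) * (Q + x * x) - (S + x) * (S + x))
            lem = solve-∀

    module Bounded (T : ℕ) (lo : ∀ a b → a ℕ.< b → b ℕ.< T → NN (h a - h b)) (up : ∀ a b → a ℕ.< b → b ℕ.< T → NN (s - (h a - h b))) where
      term-nn : ∀ a b → a ℕ.< b → b ℕ.< T → NN (term (h b) a)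
      term-nn a b l l′ = nn* (lo a b l l′) (up a b l l′)
      inner-nn : ∀ m b → m ℕ.≤ b → b ℕ.< T → NN (inner m (h b))
      inner-nn zero b le lt = +≤+ z≤n
      inner-nn (suc m) b le lt = nn+ (inner-nn m b (ℕP.<⇒≤ le) lt) (term-nn m b le lt)
      defect-nn : ∀ m → m ℕ.≤ T → NN (defect m)
      defect-nn zero le = +≤+ z≤n
      defect-nn (suc m) le = nn+ (defect-nn m (ℕP.<⇒≤ le)) (inner-nn m m ℕP.≤-refl le)

      split0 : ∀ {a b} → NN a → NN b → NN (- (a + b)) → NN (- a) × NN (- b)
      split0 {a} {b} p q r = nn-cast (ring328 a b) (nn+ r q) , nn-cast (ring329 a b) (nn+ r p)

      inner-zero : ∀ m b → m ℕ.≤ b → b ℕ.< T → NN (- inner m (h b)) → ∀ a → a ℕ.< m → term (h b) a ≡ 0ℤ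
      inner-zero (suc m) b le lt z a (s≤s la) = [ (λ l → inner-zero m b (ℕP.<⇒≤ le) lt (proj₁ sp) a l) , (λ { refl → nn-antisym (term-nn m b le lt) (proj₂ sp) }) ]′ (ℕP.m≤n⇒m<n∨m≡n la)
        where sp = split0 (inner-nn m b (ℕP.<⇒≤ le) lt) (term-nn m b le lt) z

      defect-zero : ∀ m → m ℕ.≤ T → NN (- defect m) → ∀ b → b ℕ.< m → NN (- inner b (h b))
      defect-zero (suc m) le z b (s≤s lb) = [ (λ l → defect-zero m (ℕP.<⇒≤ le) (proj₁ sp) b l) , (λ { refl → proj₂ sp }) ]′ (ℕP.m≤n⇒m<n∨m≡n lb)
        where sp = split0 (defect-nn m (ℕP.<⇒≤ le)) (inner-nn m m ℕP.≤-refl le) z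

  nn⇒< : ∀ {a b} → NN (b - a - 1ℤ) → a < b
  nn⇒< {a} {b} h = ℤP.suc[i]≤j⇒i<j (≤nn (nn-cast (ring330 a b) h))

  lt-div : ∀ {N a b} → a ℕ.< N → b ℕ.< N → + N ∣ + a - + b → a ≡ b
  lt-div {N} {a} {b} la lb (divides q e) = [ (λ q≥1 → ⊥-elim (nn-neg-absurd 0 (nn+ (nn+ (nn+ (nn-lt la) (nn-pos b)) (nn* q≥1 (nn-pos N))) (nn≡ (zsub e))) (ring331 (+ a) (+ b) q (+ N))))
      , (λ q≤0 → [ (λ q0 → ℤP.+-injective (subz (trans e (cong (_* + N) (zero-q q≤0 q0))))) , (λ q<0 → ⊥-elim (nn-neg-absurd 0 (nn+ (nn+ (nn+ (nn-lt lb) (nn-pos a)) (nn* q<0 (nn-pos N))) (nn≡ (cong -_ (zsub e)))) (ring332 (+ a) (+ b) q (+ N)))) ]′ (nn-total q)) ]′ (nn-total (q - 1ℤ))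
    where
      zero-q : NN (- (q - 1ℤ) - 1ℤ) → NN q → q ≡ 0ℤ
      zero-q p r = nn-antisym r (nn-cast (ring333 q) p)

  abs-≥ : ∀ k → NN (+ ∣ k ∣ - k)
  abs-≥ (+ n) = nn≡ (ℤP.+-inverseʳ (+ n))
  abs-≥ -[1+ n ] = +≤+ z≤n

  neg?-bar : ∀ j → neg? (bar j) ≡ not (neg? j)
  neg?-bar (+ n) = cong neg? (bar-pos n)
  neg?-bar -[1+ n ] = refl

  neg?-down : ∀ j k → NN k → neg? (j + k) ≡ true → neg? j ≡ true
  neg?-down -[1+ n ] k nn h = refl
  neg?-down (+ m) (+ k) nn ()

  -- Column coordinates and the largest core

  module Kappa (S : Setup) (T′ : ℕ) (t≡ : Setup.t S ≡ + suc T′) (α β : ℤ) (bez : α * Setup.s S + β * Setup.t S ≡ 1ℤ)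
      (xm : ℤ) (wxm : w xm ≡ Setup.s S * Setup.t S - Setup.s S - Setup.t S) where
    open SetupFacts S
    N : ℕ
    N = suc T′
    y₀ : ℤ
    y₀ = bar xm
    ns : NN s
    ns = ℤP.<⇒≤ s>0
    nt : NN t
    nt = ℤP.<⇒≤ t>0
    K : ℕ
    K = proj₁ (nn≡+ ns)
    s≡ : s ≡ + K
    s≡ = proj₂ (nn≡+ ns)
    wy₀ : w y₀ ≡ - (s * t - s - t)
    wy₀ = trans (w-bar xm) (cong -_ wxm)

    z : ℕ → ℤ
    z a = y₀ + + a * s

    xm≡ : xm ≡ z T′ + -1ℤ * t
    xm≡ = w-inj {xm} {z T′ + -1ℤ * t} (trans wxm (sym (trans (ring334 y₀ (+ T′) s t) (trans (cong (λ u → u + (+ T′ + + T′) * s - (t + t)) wy₀) (subz (trans (ring335 s t (+ T′)) (cong (λ v → - ((v + v) * s)) (zsub t≡))))))))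

    -- By Bézout α inverts s modulo t, so the column is the residue of (x - y₀) α.
    decomp : ∀ x → Σ[ a ∈ ℕ ] Σ[ j ∈ ℤ ] (a ℕ.< N × x ≡ z a + j * t)
    decomp x = a , (x - y₀) * β + q * s , n%ℕd<d v N , subz (trans (ring336 x y₀ α β s t (+ a) q) (z+ (cong -_ (z* (x - y₀) (zsub bez))) (trans (cong (λ u → s * (v - (+ a + q * u))) t≡) (z* s (zsub (a≡a%ℕn+[a/ℕn]*n v N))))))
      where
        v q : ℤ
        v = (x - y₀) * α
        q = v /ℕ N
        a : ℕ
        a = v %ℕ N

    col-unique : ∀ {a b} i j → a ℕ.< N → b ℕ.< N → z a + i * t ≡ z b + j * t → a ≡ b
    col-unique {a} {b} i j la lb e = lt-div {N} la lb (subst (_∣ + a - + b) t≡ (gauss-t (+ a - + b) (divides (j - i) (subz (trans (ring337 y₀ (+ a) (+ b) s i j t) (zsub e))))))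

    row-unique : ∀ {a b i j} → a ≡ b → z a + i * t ≡ z b + j * t → i ≡ j
    row-unique {a} {_} {i} {j} refl e = subz (step-inj t>0 (z a) i j e)

    module Heights (μ : Maya) (μs : Core s μ) (μt : Core t μ) where
      top : ∀ a → Σ[ k ∈ ℤ ] (occ μ (z a + k * t) ≡ true × occ μ (z a + k * t + t) ≡ false)
      top a = topBead μ t t>0 (z a)
      ht : ℕ → ℤ
      ht a = proj₁ (top a) + 1ℤ

      ht-true : ∀ a j → NN (ht a - j - 1ℤ) → occ μ (z a + j * t) ≡ true
      ht-true a j nn = go (nn≡+ (nn-cast (ring338 (proj₁ (top a)) j) nn))
        where
          go : Σ[ m ∈ ℕ ] proj₁ (top a) - j ≡ + m → occ μ (z a + j * t) ≡ true
          go (m , e) = core-down′ {t} {μ} μt (z a + j * t) (z a + proj₁ (top a) * t) m (trans (ring339 (z a) (proj₁ (top a)) j t) (cong (λ u → z a + j * t + u * t) e)) (proj₁ (proj₂ (top a)))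

      ht-false : ∀ a j → NN (j - ht a) → occ μ (z a + j * t) ≡ false
      ht-false a j nn = go (nn≡+ nn)
        where
          go : Σ[ m ∈ ℕ ] j - ht a ≡ + m → occ μ (z a + j * t) ≡ false
          go (m , e) = core-up {t} {μ} μt (z a + proj₁ (top a) * t + t) (z a + j * t) m (trans (ring340 (z a) (proj₁ (top a)) j t) (cong (λ u → z a + proj₁ (top a) * t + t + u * t) e)) (proj₂ (proj₂ (top a)))

      ht-inv : ∀ a j → occ μ (z a + j * t) ≡ true → NN (ht a - j - 1ℤ)
      ht-inv a j h = [ (λ nn → contra h (ht-false a j nn)) , (λ nn → nn-cast (ring341 (ht a) j) nn) ]′ (nn-total (j - ht a))

      below-occ : ∀ a j → χ μ (z a + j * t) ≡ below? j (ht a)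
      below-occ a j = [ (λ nn → trans (cong ind (ht-false a j nn)) (sym (below-no {j} {ht a} (≤nn nn)))) , (λ nn → trans (cong ind (ht-true a j (nn-cast (ring341 (ht a) j) nn))) (sym (below-yes {j} {ht a} (nn⇒< (nn-cast (ring341 (ht a) j) nn))))) ]′ (nn-total (j - ht a))

      ht-top : ∀ a → occ μ (z a + (ht a - 1ℤ) * t) ≡ true
      ht-top a = ht-true a (ht a - 1ℤ) (nn≡ (ring342 (ht a)))

      -- Subtracting (b - a) s from the top bead of column b leads to column a at the same level.
      mono : ∀ a b → a ℕ.< b → b ℕ.< N → NN (ht a - ht b)
      mono a b l l′ = nn-cast (ring343 (ht a) (ht b)) (ht-inv a (ht b - 1ℤ) (core-down′ {s} {μ} μs (z a + (ht b - 1ℤ) * t) (z b + (ht b - 1ℤ) * t) (b ℕ.∸ a)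
          (trans (ring347 y₀ (+ a) (+ b) s ((ht b - 1ℤ) * t)) (cong (λ u → z a + (ht b - 1ℤ) * t + u * s) (sub≡ a b (ℕP.<⇒≤ l)))) (ht-top b)))
        where
          sub≡ : ∀ a b → a ℕ.≤ b → + b - + a ≡ + (b ℕ.∸ a)
          sub≡ a b le = trans (ℤP.m-n≡m⊖n b a) (ℤP.⊖-≥ le)

      -- Going down by s from column a past column 0 and round to column b takes a + (t - b) steps
      -- and lowers the level by s.
      spread : ∀ a b → a ℕ.< b → b ℕ.< N → NN (s - (ht a - ht b))
      spread a b l l′ = nn-cast (ring344 (ht a) (ht b) s) (ht-inv b (ht a - 1ℤ - s) (core-down′ {s} {μ} μs (z b + (ht a - 1ℤ - s) * t) (z a + (ht a - 1ℤ) * t) (a ℕ.+ (N ℕ.∸ b))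
          (subz (trans (ring345 y₀ (+ a) (+ b) s t (ht a) (+ (a ℕ.+ (N ℕ.∸ b)))) (cong (_* s) (trans (cong (λ u → + a - + b + t - u) (ℤP.pos-+ a (N ℕ.∸ b))) (trans (cong₂ (λ u v → + a - + b + u - (+ a + v)) t≡ (sym (sub≡ b N (ℕP.<⇒≤ l′)))) (ring346 (+ a) (+ b) (+ N)))))))
          (ht-top a)))
        where
          sub≡ : ∀ a b → a ℕ.≤ b → + b - + a ≡ + (b ℕ.∸ a)
          sub≡ a b le = trans (ℤP.m-n≡m⊖n b a) (ℤP.⊖-≥ le)

    module Compare (κ μ : Maya) (κs : Core s κ) (κt : Core t κ) (scκ : SC κ) (κxm : occ κ xm ≡ true)
        (μs : Core s μ) (μt : Core t μ) (ch : charge μ ≡ charge κ) where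
      open Heights μ μs μt
      open Defect s ht
      open Bounded N mono spread

      -- The bead `xm` is at level -1 in the last column and its conjugate `y₀` is a gap at level 0
      -- in the first. With the s-core condition these two fix κ: every column is filled exactly
      -- below level 0.
      κ-gap : ∀ a → occ κ (z a) ≡ false
      κ-gap a = core-up {s} {κ} κs y₀ (z a) a refl (SC-true {κ} scκ {xm} κxm)

      κ-bead : ∀ a → a ℕ.< N → occ κ (z a + -1ℤ * t) ≡ true
      κ-bead a (s≤s le) = core-down′ {s} {κ} κs (z a + -1ℤ * t) xm (T′ ℕ.∸ a) (trans xm≡ (trans (ring347 y₀ (+ a) (+ T′) s (-1ℤ * t)) (cong (λ u → z a + -1ℤ * t + u * s) (trans (ℤP.m-n≡m⊖n T′ a) (ℤP.⊖-≥ le))))) κxm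

      below-κ : ∀ a j → a ℕ.< N → χ κ (z a + j * t) ≡ below? j 0ℤ
      below-κ a j la = [ (λ nn → pos j (nn≡+ nn)) , (λ nn → neg j (nn≡+ nn)) ]′ (nn-total j)
        where
          pos : ∀ j → Σ[ m ∈ ℕ ] j ≡ + m → χ κ (z a + j * t) ≡ below? j 0ℤ
          pos j (m , e) = trans (cong ind (core-up {t} {κ} κt (z a) (z a + j * t) m (cong (λ u → z a + u * t) e) (κ-gap a))) (sym (below-no {j} {0ℤ} (subst (0ℤ ≤_) (sym e) (nn-pos m))))
          neg : ∀ j → Σ[ m ∈ ℕ ] - j - 1ℤ ≡ + m → χ κ (z a + j * t) ≡ below? j 0ℤ
          neg j (m , e) = trans (cong ind (core-down′ {t} {κ} κt (z a + j * t) (z a + -1ℤ * t) m (trans (ring348 (z a) j t) (cong (λ u → z a + j * t + u * t) e)) (κ-bead a la))) (sym (below-yes {j} {0ℤ} (nn⇒< {j} {0ℤ} (nn-cast (trans (sym e) (ring349 j)) (nn-pos m)))))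

      R : ℕ → FS
      R a = ramp t (z a) (ht a)

      pointwise : ∀ x → at (diff μ κ) x ≡ at (sumFS N R) x
      pointwise x = go (decomp x)
        where
          go : Σ[ a ∈ ℕ ] Σ[ j ∈ ℤ ] (a ℕ.< N × x ≡ z a + j * t) → at (diff μ κ) x ≡ at (sumFS N R) x
          go (a₀ , j , la , e) = trans (trans (cong (at (diff μ κ)) e) (trans (cong₂ _-_ (below-occ a₀ j) (below-κ a₀ j la)) (sym (ramp-at t>0 (z a₀) (ht a₀) j))))
              (sym (trans (cong (at (sumFS N R)) e) (trans (sumFS-at N R (z a₀ + j * t)) (sumN-single N (λ a → at (R a) (z a₀ + j * t)) a₀ la
                (λ a l n → ramp-off (z a) (ht a) (z a₀ + j * t) (λ { (divides q eq) → n (sym (col-unique {a₀} {a} j q la l (trans (ring350 (z a₀ + j * t) (z a)) (cong (λ u → z a + u) eq)))) }))))))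

      S0 : S₁ N ≡ 0ℤ
      S0 = trans (sym (sumN-cong N (λ a _ → ramp-charge t (z a) (ht a)))) (trans (sym (Σ-sumFS N R one)) (trans (Σ-cong {mulFS one (sumFS N R)} {diff μ κ} (λ x → trans (ℤP.*-identityˡ _) (sym (pointwise x)))) (trans (sym (charge-diff μ κ)) (zsub ch))))

      -- The two diagrams differ by one ramp for each column. Equal charge makes the heights sum to
      -- 0, so the linear terms drop out and the rest is minus the defect.
      energy : (E μ - E κ) + (E μ - E κ) ≡ - defect N
      energy = trans (cong (λ u → u + u) (E-diff μ κ)) (trans (ring351 I) (trans (cong (λ u → I + I + u) (sym Σ0)) (trans (sym Σw) (trans wsum (sym dneg)))))
        where
          Σw : Σℤ (mulFS w (diff μ κ)) ≡ Σℤ (mulFS idℤ (diff μ κ)) + Σℤ (mulFS idℤ (diff μ κ)) + Σℤ (diff μ κ)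
          Σw = trans (Σ-cong {mulFS w (diff μ κ)} {addFS (addFS I I) (diff μ κ)} (λ x → ring355 x (at (diff μ κ) x))) (trans (Σ-add (addFS I I) (diff μ κ)) (cong (_+ Σℤ (diff μ κ)) (Σ-add I I)))
            where
              I = mulFS idℤ (diff μ κ)
          I : ℤ
          I = Σℤ (mulFS idℤ (diff μ κ))
          Σ0 : Σℤ (diff μ κ) ≡ 0ℤ
          Σ0 = trans (sym (charge-diff μ κ)) (zsub ch)
          dneg : - defect N ≡ (s + s) * S₃ N + t * S₂ N
          dneg = trans (cong -_ (defect-eq N)) (trans (cong (λ u → - (s * ((+ N - 1ℤ) * u - (S₃ N + S₃ N)) - (+ N * S₂ N - u * u))) S0)
            (trans (cong (λ u → - (s * ((u - 1ℤ) * 0ℤ - (S₃ N + S₃ N)) - (u * S₂ N - 0ℤ * 0ℤ))) (sym t≡)) (ring354 s t (S₃ N) (S₂ N))))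
          split : sumN N (λ a → (w y₀ - t) * ht a + (s + s) * (+ a * ht a) + t * (ht a * ht a)) ≡ (w y₀ - t) * S₁ N + (s + s) * S₃ N + t * S₂ N
          split = trans (sumN-add N (λ a → (w y₀ - t) * ht a + (s + s) * (+ a * ht a)) (λ a → t * (ht a * ht a)))
            (cong₂ _+_ (trans (sumN-add N (λ a → (w y₀ - t) * ht a) (λ a → (s + s) * (+ a * ht a))) (cong₂ _+_ (sumN-scale N (w y₀ - t) ht) (sumN-scale N (s + s) (λ a → + a * ht a)))) (sumN-scale N t (λ a → ht a * ht a)))

          wsum : Σℤ (mulFS w (diff μ κ)) ≡ (s + s) * S₃ N + t * S₂ N
          wsum = trans (Σ-cong {mulFS w (diff μ κ)} {mulFS w (sumFS N R)} (λ x → cong (w x *_) (pointwise x)))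
            (trans (Σ-sumFS N R w) (trans (sumN-cong N (λ a _ → trans (ramp-energy t (z a) (ht a)) (ring352 t (ht a) y₀ (+ a) s)))
            (trans split (trans (cong (λ u → (w y₀ - t) * u + (s + s) * S₃ N + t * S₂ N) S0) (ring353 (w y₀ - t) s t (S₃ N) (S₂ N))))))

      maximal : NN (E κ - E μ)
      maximal = [ (λ nn → nn) , (λ nn → ⊥-elim (nn-neg-absurd 1 (nn+ (nn+ (nn+ nn nn) (defect-nn N ℕP.≤-refl)) (nn≡ (cong -_ (zsub energy)))) (ring356 (E κ) (E μ) (defect N)))) ]′ (nn-total (E κ - E μ))

      -- With no defect all heights are h 0 or h 0 - s; count the latter.
      counts : NN (E μ - E κ) → ∀ m → m ℕ.< N → Σ[ c ∈ ℤ ] (S₁ (suc m) ≡ + suc m * ht 0 - s * c × NN c × NN (+ m - c) × (c ≡ 0ℤ → ht m ≡ ht 0))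
      counts ge zero lt = 0ℤ , ring357 s (ht 0) , +≤+ z≤n , +≤+ z≤n , (λ _ → refl)
      counts ge (suc m) lt = go (counts ge m (ℕP.<⇒≤ lt)) (ℤP.i*j≡0⇒i≡0∨j≡0 (ht 0 - ht (suc m)) zero-term)
        where
          zdef : NN (- defect N)
          zdef = nn-cast energy (nn+ ge ge)
          zero-term : (ht 0 - ht (suc m)) * (s - (ht 0 - ht (suc m))) ≡ 0ℤ
          zero-term = inner-zero (suc m) (suc m) ℕP.≤-refl lt (defect-zero N ℕP.≤-refl zdef (suc m) lt) 0 (s≤s z≤n)
          go : Σ[ c ∈ ℤ ] (S₁ (suc m) ≡ + suc m * ht 0 - s * c × NN c × NN (+ m - c) × (c ≡ 0ℤ → ht m ≡ ht 0)) →
               ht 0 - ht (suc m) ≡ 0ℤ ⊎ s - (ht 0 - ht (suc m)) ≡ 0ℤ →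
               Σ[ c ∈ ℤ ] (S₁ (suc (suc m)) ≡ + suc (suc m) * ht 0 - s * c × NN c × NN (+ suc m - c) × (c ≡ 0ℤ → ht (suc m) ≡ ht 0))
          go (c , e , p , q , _) (inj₁ d) = c , subz (trans (cong (λ u → u + ht (suc m) - (+ suc (suc m) * ht 0 - s * c)) e) (trans (ring358 s c (+ m) (ht 0) (ht (suc m))) (cong -_ d))) , p , nn-cast (ring359 (+ m) c) (nn+ q (nn-pos 1)) , (λ _ → sym (subz d))
          go (c , e , p , q , _) (inj₂ d) = c + 1ℤ , subz (trans (cong (λ u → u + ht (suc m) - (+ suc (suc m) * ht 0 - s * (c + 1ℤ))) e) (trans (ring360 s c (+ m) (ht 0) (ht (suc m))) d)) , nn+ p (nn-pos 1) , nn-cast (ring361 (+ m) c) q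
              , (λ z0 → ⊥-elim (nn-neg-absurd 0 (nn+ p (nn≡ (cong -_ z0))) (ring362 c)))

      -- If c columns have height h 0 - s, vanishing of the sum of heights reads t h 0 = s c. So t
      -- divides c, and 0 ≤ c < t gives c = 0; the last column then has height 0 and ends in `xm`.
      rigid : NN (E μ - E κ) → occ μ xm ≡ true
      rigid ge = go (counts ge T′ ℕP.≤-refl)
        where
          go : Σ[ c ∈ ℤ ] (S₁ N ≡ + N * ht 0 - s * c × NN c × NN (+ T′ - c) × (c ≡ 0ℤ → ht T′ ≡ ht 0)) → occ μ xm ≡ true
          go (c , e , p , q , r) = fin (gauss-t c (divides (ht 0) (subz (trans (ring363 s t c (ht 0)) (cong -_ (trans (cong (λ u → u * ht 0 - s * c) t≡) (trans (sym e) S0)))))))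
            where
              fin : t ∣ c → occ μ xm ≡ true
              fin (divides m em) = use c0
                where
                  c0 : c ≡ 0ℤ
                  c0 = [ (λ m≥1 → ⊥-elim (nn-neg-absurd 0 (nn+ (nn+ (nn+ q (nn* m≥1 nt)) (nn≡ (zsub em))) (nn≡ (zsub t≡))) (ring364 (+ T′) c m t)))
                       , (λ m≤0 → nn-antisym p (nn-cast (trans (ring365 m t) (cong -_ (sym em))) (nn* m≤0 nt))) ]′ (nn-total (m - 1ℤ))
                  use : c ≡ 0ℤ → occ μ xm ≡ true
                  use c0 = trans (cong (occ μ) xm≡) (ht-true T′ -1ℤ (nn≡ (trans (cong (λ u → u - -1ℤ - 1ℤ) (trans (r c0) h0)) refl)))
                    where
                      h0 : ht 0 ≡ 0ℤ
                      h0 = [ (λ z0 → ⊥-elim (pos-nonzero t>0 z0)) , (λ z0 → z0) ]′ (ℤP.i*j≡0⇒i≡0∨j≡0 t (trans (sym (ring366 t (ht 0) s)) (trans (cong₂ (λ u v → u * ht 0 - s * v) t≡ (sym c0)) (trans (sym e) S0))))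

    level : ℤ → ℤ
    level x = proj₁ (proj₂ (decomp x))

    level-unique : ∀ x a j → a ℕ.< N → x ≡ z a + j * t → level x ≡ j
    level-unique x a j la e = go (decomp x)
      where
        go : (d : Σ[ a ∈ ℕ ] Σ[ j ∈ ℤ ] (a ℕ.< N × x ≡ z a + j * t)) → proj₁ (proj₂ d) ≡ j
        go (b , i , lb , e′) = row-unique {b} {a} {i} {j} (col-unique {b} {a} i j lb la (trans (sym e′) e)) (trans (sym e′) e)

    -- The explicit candidate for the largest core: all columns filled strictly below level 0.
    occ₀ : ℤ → Bool
    occ₀ x = neg? (level x)

    sc₀ : ∀ x → occ₀ (bar x) ≡ not (occ₀ x)
    sc₀ x = go (decomp x) refl
      where
        go : (d : Σ[ a ∈ ℕ ] Σ[ j ∈ ℤ ] (a ℕ.< N × x ≡ z a + j * t)) → level x ≡ proj₁ (proj₂ d) → occ₀ (bar x) ≡ not (occ₀ x)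
        go (a , j , s≤s la , e) el = trans (cong neg? (trans (level-unique (bar x) (T′ ℕ.∸ a) (bar j) (s≤s (ℕP.m∸n≤m T′ a)) barx) (cong bar (sym el)))) (neg?-bar (level x))
          where
            barx : bar x ≡ z (T′ ℕ.∸ a) + bar j * t
            barx = trans (cong bar e) (trans (subz (trans (ring367 y₀ (+ a) s j t (+ T′)) (z+ (cong -_ (zsub wy₀)) (cong (_* s) (zsub t≡)))))
              (cong (λ u → y₀ + u * s + bar j * t) (trans (ℤP.m-n≡m⊖n T′ a) (ℤP.⊖-≥ la))))

    L : ℕ
    L = ∣ y₀ ∣ ℕ.+ T′ ℕ.* K

    far : ∀ n → L ℕ.≤ n → occ₀ (+ n) ≡ false
    far n h = go (decomp (+ n)) refl
      where
        go : (d : Σ[ a ∈ ℕ ] Σ[ j ∈ ℤ ] (a ℕ.< N × + n ≡ z a + j * t)) → level (+ n) ≡ proj₁ (proj₂ d) → occ₀ (+ n) ≡ false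
        go (a , j , s≤s la , e) el = trans (cong neg? el) ([ nonneg , (λ nn → ⊥-elim (nn-neg-absurd 0
            (nn+ (nn+ (nn+ (nn+ (nn+ bound (abs-≥ y₀)) (nn* (nn≤ (+≤+ la)) ns)) (nn* nn nt)) (nn-pred t>0)) (nn≡ (cong -_ (zsub e)))) (ring368 (+ n) (+ ∣ y₀ ∣) (+ T′) s y₀ (+ a) j t))) ]′ (nn-total j))
          where
            nonneg : NN j → neg? j ≡ false
            nonneg nn = cong neg? (proj₂ (nn≡+ nn))
            bound : NN (+ n - (+ ∣ y₀ ∣ + + T′ * s))
            bound = nn-cast (cong (λ u → + n - u) (trans (ℤP.pos-+ ∣ y₀ ∣ (T′ ℕ.* K)) (cong (λ u → + ∣ y₀ ∣ + u) (trans (ℤP.pos-* T′ K) (cong (+ T′ *_) (sym s≡)))))) (nn≤ (+≤+ h))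

    K₀ : Maya
    K₀ = mkMaya occ₀ L far (λ n h → trans (cong occ₀ (sym (bar-pos n))) (trans (sc₀ (+ n)) (cong not (far n h))))

    -- A step up by s leads to the next column at the same level, or from the last column to the
    -- first at a level higher by s; it never lowers the level.
    K₀s : Core s K₀
    K₀s x h = go (decomp x) refl
      where
        go : (d : Σ[ a ∈ ℕ ] Σ[ j ∈ ℤ ] (a ℕ.< N × x ≡ z a + j * t)) → level x ≡ proj₁ (proj₂ d) → occ₀ x ≡ true
        go (a , j , la , e) el = [ (λ lt → trans (cong neg? (trans el (sym (level-unique (x + s) (suc a) j lt (trans (cong (_+ s) e) (ring369 y₀ (+ a) s (j * t))))))) h)
            , (λ eq → neg?-down (level x) s ns (trans (cong neg? (trans (cong (_+ s) el) (sym (level-unique (x + s) 0 (j + s) (s≤s z≤n) (trans (cong (_+ s) e) (wrap eq)))))) h)) ]′ (ℕP.m≤n⇒m<n∨m≡n la)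
          where
            wrap : suc a ≡ N → z a + j * t + s ≡ z 0 + (j + s) * t
            wrap eq = subz (trans (ring370 y₀ (+ a) s j t) (cong (λ u → - (u * s)) (zsub (trans t≡ (cong +_ (sym eq))))))

    K₀t : Core t K₀
    K₀t x h = go (decomp x) refl
      where
        go : (d : Σ[ a ∈ ℕ ] Σ[ j ∈ ℤ ] (a ℕ.< N × x ≡ z a + j * t)) → level x ≡ proj₁ (proj₂ d) → occ₀ x ≡ true
        go (a , j , la , e) el = neg?-down (level x) 1ℤ (nn-pos 1) (trans (cong neg? (trans (cong (_+ 1ℤ) el) (sym (level-unique (x + t) a (j + 1ℤ) la (trans (cong (_+ t) e) (ring371 (z a) j t)))))) h)

    K₀xm : occ K₀ xm ≡ true
    K₀xm = cong neg? (level-unique xm T′ -1ℤ ℕP.≤-refl xm≡)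

  -- From diagrams back to partitions

  flip-gain : ∀ {γ b x} → occ γ b ≡ true → occ γ x ≡ false → occ (flip b γ) x ≡ true → x ≡ bar b
  flip-gain {γ} {b} {x} hb hx h = by-cases (pair? b x) [ (λ e → contra hb (trans (cong (occ γ) (sym e)) hx)) , (λ e → e) ]′
    (λ n → contra h (trans (flip-off b (occ γ) x (n ∘ inj₁) (n ∘ inj₂)) hx))

  flip-loss : ∀ {γ b x} → SC γ → occ γ b ≡ true → occ γ x ≡ true → occ (flip b γ) x ≡ false → x ≡ b
  flip-loss {γ} {b} {x} sc hb hx h = by-cases (pair? b x) [ (λ e → e) , (λ e → contra hx (trans (cong (occ γ) e) (SC-true {γ} sc {b} hb))) ]′
    (λ n → contra (trans (flip-off b (occ γ) x (n ∘ inj₁) (n ∘ inj₂)) hx) h)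

  flip-repairs : ∀ {d γ b x} → SC γ → occ γ b ≡ true → Core d (flip b γ) → occ γ x ≡ false → occ γ (x + d) ≡ true → x ≡ bar b ⊎ x + d ≡ b
  flip-repairs {d} {γ} {b} {x} sc hb co h h′ = go (occ (flip b γ) x) refl (occ (flip b γ) (x + d)) refl
    where
      go : ∀ u → occ (flip b γ) x ≡ u → ∀ v → occ (flip b γ) (x + d) ≡ v → x ≡ bar b ⊎ x + d ≡ b
      go true p _ _ = inj₁ (flip-gain {γ} {b} {x} hb h p)
      go false p true q = contra (co x q) p
      go false p false q = inj₂ (flip-loss {γ} {b} {x + d} sc hb h′ q)

  -- Each flip has to repair the violation at x, by filling x or by emptying x + d. Distinct beads b
  -- and e cannot do this in the same way, and both distributions of the two tasks give the same
  -- equation.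
  flips-repair : ∀ {d γ b e x} → SC γ → occ γ b ≡ true → occ γ e ≡ true → b ≢ e → Core d (flip b γ) → Core d (flip e γ) →
    occ γ x ≡ false → occ γ (x + d) ≡ true → b ≡ bar e + d
  flips-repair {d} {γ} {b} {e} {x} sc hb he b≢e cb ce h h′ =
    [ (λ p → [ (λ q → ⊥-elim (b≢e (bar-inj (trans (sym p) q)))) , (λ q → trans (sym (bar-bar b)) (trans (cong bar (trans (sym p) (trans (sym (y-d+d x d)) (cong (_- d) q)))) (bar-- e d))) ]′ E′)
    , (λ p → [ (λ q → trans (sym p) (cong (_+ d) q)) , (λ q → ⊥-elim (b≢e (trans (sym p) q))) ]′ E′) ]′ B′
    where
      B′ = flip-repairs {d} {γ} {b} {x} sc hb cb h h′
      E′ = flip-repairs {d} {γ} {e} {x} sc he ce h h′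

  -- Otherwise w x = s - t + o s t with o odd; for o > 0 the bead x of τ lies above its mirror
  -- image by s plus a multiple of t, and for o < 0 the gap x of σ lies below it by t plus a multiple of s.
  no-exchange : ∀ S σ τ → SC σ → SC τ → Core (Setup.s S) σ → Core (Setup.t S) σ → Core (Setup.s S) τ → Core (Setup.t S) τ →
    ∀ x l k → w x ≡ - Setup.t S + (l + l) * Setup.s S → w x ≡ Setup.s S + (k + k) * Setup.t S → occ τ x ≡ true → occ σ x ≡ false → ⊥
  no-exchange S σ τ scσ scτ σs σt τs τt x l k wl wk τx σx = go (gauss-t (l + l - 1ℤ) (divides (k + k + 1ℤ) lk))
    where
      open SetupFacts S
      lk : (l + l - 1ℤ) * s ≡ (k + k + 1ℤ) * t
      lk = subz (trans (ring372 l s t k) (zsub (trans (sym wl) wk)))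
      wo : ∀ o → l + l - 1ℤ ≡ o * t → w x ≡ s - t + o * t * s
      wo o e = trans wl (trans (ring373 l s t) (cong (λ u → s - t + u * s) e))
      absurd+ : ∀ i m → l + l - 1ℤ ≡ (1ℤ + i) * t → (1ℤ + i) * s - 1ℤ ≡ + m → ⊥
      absurd+ i m e f = contra (τs (bar x) (core-down′ {t} {τ} τt (bar x + s) x m x≡ τx)) (SC-true {τ} scτ {x} τx)
        where
          x≡ : x ≡ bar x + s + + m * t
          x≡ = subz (trans (ring374 x s t i (+ m) (w x)) (z+ (z+ (ℤP.+-inverseʳ (w x)) (zsub (wo (1ℤ + i) e))) (cong (_* t) (zsub f))))
      absurd- : ∀ i m → l + l - 1ℤ ≡ - (1ℤ + i) * t → (1ℤ + i) * t - 1ℤ ≡ + m → ⊥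
      absurd- i m e f = contra (σt x (core-down′ {s} {σ} σs (x + t) (bar x) m x≡ (SC-false {σ} scσ {x} σx))) σx
        where
          x≡ : bar x ≡ x + t + + m * s
          x≡ = subz (trans (ring375 x s t i (+ m) (w x)) (z+ (z+ (cong -_ (ℤP.+-inverseʳ (w x))) (cong -_ (zsub (wo (- (1ℤ + i)) e)))) (cong (_* s) (zsub f))))
      big : ∀ {d} → 0ℤ < d → ∀ n → Σ[ m ∈ ℕ ] (1ℤ + + n) * d - 1ℤ ≡ + m
      big {d} pos n = nn≡+ (nn-cast (ring376 (+ n) d) (nn+ (nn* (nn-pos n) (ℤP.<⇒≤ pos)) (nn-pred pos)))
      go : t ∣ l + l - 1ℤ → ⊥
      go (divides (+ zero) e) = even≢odd l 0ℤ (trans (ring377 l) (cong (_+ 1ℤ) e))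
      go (divides (+ suc n) e) = absurd+ (+ n) (proj₁ (big s>0 n)) e (proj₂ (big s>0 n))
      go (divides -[1+ n ] e) = absurd- (+ n) (proj₁ (big t>0 n)) e (proj₂ (big t>0 n))

  -- That α ⋆ β is an (s,t)-core has to be proved. By `flips-repair` it could fail only for b = d̄ +
  -- s or b = d̄ + t, and `no-exchange` excludes these at the points d̄ and b.
  module StarCore (S : Setup) (σ τ γ : Maya) (scσ : SC σ) (scτ : SC τ) (scγ : SC γ)
      (σs : Core (Setup.s S) σ) (σt : Core (Setup.t S) σ) (τs : Core (Setup.s S) τ) (τt : Core (Setup.t S) τ)
      (b d l k : ℤ) (γb : occ γ b ≡ true) (γd : occ γ d ≡ true) (b≢d : b ≢ d)
      (wb : w b ≡ - Setup.t S + (l + l) * Setup.s S) (wd : w d ≡ - Setup.s S + (k + k) * Setup.t S)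
      (σ≐ : σ ≐ flip b γ) (τ≐ : τ ≐ flip d γ) where
    open SetupFacts S

    b≢bard : b ≢ bar d
    b≢bard e = contra γb (trans (cong (occ γ) e) (SC-true {γ} scγ {d} γd))

    wc : w (bar d) ≡ s + (- k + - k) * t
    wc = trans (w-bar d) (trans (cong -_ wd) (ring378 s t k))

    τc : occ τ (bar d) ≡ true
    τc = trans (τ≐ (bar d)) (trans (flip-on d (occ γ) (bar d) (inj₂ refl)) (cong not (SC-true {γ} scγ {d} γd)))
    σc : occ σ (bar d) ≡ false
    σc = trans (σ≐ (bar d)) (trans (flip-off b (occ γ) (bar d) (λ e → b≢bard (sym e)) (λ e → b≢d (sym (bar-inj e)))) (SC-true {γ} scγ {d} γd))
    τb : occ τ b ≡ true
    τb = trans (τ≐ b) (trans (flip-off d (occ γ) b b≢d b≢bard) γb)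
    σb : occ σ b ≡ false
    σb = trans (σ≐ b) (flip-false b γ γb)

    coreσ : ∀ {e} → Core e σ → Core e (flip b γ)
    coreσ {e} = Core-cong {e} {σ} {flip b γ} σ≐
    coreτ : ∀ {e} → Core e τ → Core e (flip d γ)
    coreτ {e} = Core-cong {e} {τ} {flip d γ} τ≐

    not-s : b ≢ bar d + s
    not-s e = no-exchange S σ τ scσ scτ σs σt τs τt (bar d) (l - 1ℤ) (- k) wl wc τc σc
      where
        wl : w (bar d) ≡ - t + (l - 1ℤ + (l - 1ℤ)) * s
        wl = subz (trans (ring379 (w (bar d)) s t l (w b)) (z+ (zsub (trans (sym (w-+ (bar d) s)) (cong w (sym e)))) (zsub wb)))
    not-t : b ≢ bar d + t
    not-t e = no-exchange S σ τ scσ scτ σs σt τs τt b l (1ℤ - k) wb wk τb σb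
      where
        wk : w b ≡ s + (1ℤ - k + (1ℤ - k)) * t
        wk = subz (trans (ring380 (w (bar d)) s t k (w b)) (z+ (zsub (trans (cong w e) (w-+ (bar d) t))) (zsub wc)))

    core : ∀ {e} → Core e σ → Core e τ → b ≢ bar d + e → Core e γ
    core {e} cσ cτ n x h = go (occ γ x) refl
      where
        go : ∀ v → occ γ x ≡ v → occ γ x ≡ true
        go true p = p
        go false p = ⊥-elim (n (flips-repair {e} {γ} {b} {d} {x} scγ γb γd b≢d (coreσ cσ) (coreτ cτ) p h))

    data4 : ∀ c₀ b₀ → w c₀ ≡ - s → w b₀ ≡ - t → Data4 S
    data4 c₀ b₀ wc₀ wb₀ = record
      { γ = γ ; b = b ; d = d ; c₀ = c₀ ; b₀ = b₀ ; l = l ; k = k ; scγ = scγ ; γs = core σs τs not-s ; γt = core σt τt not-t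
      ; γb = γb ; γd = γd ; b≢d = b≢d ; wc₀ = wc₀ ; wb₀ = wb₀ ; wb = wb ; wd = wd
      ; σs = coreσ σs ; σt = coreσ σt ; τs = coreτ τs ; τt = coreτ τt }

  Unique-cong₂ : ∀ {S σ σ′ τ τ′ n n′} → σ ≐ σ′ → τ ≐ τ′ → n ≡ n′ → Unique S σ τ n → Unique S σ′ τ′ n′
  Unique-cong₂ {S} {σ} {σ′} {τ} {τ′} e e′ q u = Unique-swap {swapS S} {τ′} {σ′} (Unique-cong {swapS S} {τ′} {σ} {σ′} e refl (Unique-swap {S} {σ} {τ′} (Unique-cong {S} {σ} {τ} {τ′} e′ q u)))

  outcome⇒unique : ∀ S σ τ → SC σ → SC τ → Core (Setup.s S) σ → Core (Setup.t S) σ → Core (Setup.s S) τ → Core (Setup.t S) τ → ∀ n → Outcome S σ τ n → Unique S σ τ n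
  outcome⇒unique S σ τ scσ scτ σs σt τs τt n (o₁ e q) = Unique-cong {S} {σ} {τ} {τ} (λ _ → refl) (sym q) (case1 S σ τ scσ σs e)
  outcome⇒unique S σ τ scσ scτ σs σt τs τt n (o₂ b₀ wb₀ b l wb hb e q) = Unique-cong {S} {σ} {τ} {τ} (λ _ → refl) (sym q) (case2 S σ τ scτ τt b₀ wb₀ b l wb hb e)
  outcome⇒unique S σ τ scσ scτ σs σt τs τt n (o₃ c₀ wc₀ d k wd hd e q) =
    Unique-cong {S} {σ} {τ} {τ} (λ _ → refl) (sym q) (Unique-swap {swapS S} {τ} {σ} (case2 (swapS S) τ σ scσ σs c₀ wc₀ d k wd hd e))
  outcome⇒unique S σ τ scσ scτ σs σt τs τt n (o₄ c₀ b₀ wc₀ wb₀ γ b d l k scγ γb γd b≢d wb wd e e′ q) =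
    Unique-cong₂ {S} {flip b γ} {σ} {flip d γ} {τ} (≐-sym {σ} {flip b γ} e) (≐-sym {τ} {flip d γ} e′) (sym q) (case4 S (StarCore.data4 S σ τ γ scσ scτ scγ σs σt τs τt b d l k γb γd b≢d wb wd e e′ c₀ b₀ wc₀ wb₀))
  outcome⇒unique S σ τ scσ scτ σs σt τs τt n (o₅ c₀ b₀ xm wc₀ wb₀ wxm e hx q) =
    Unique-cong₂ {S} {σ} {σ} {σ} {τ} (λ _ → refl) e (sym q) (Case5.case5 S σ scσ σs σt c₀ b₀ e₀ xm wc₀ wb₀ we₀ wxm hx)
    where
      open SetupFacts S
      e₀ = c₀ + (- bar b₀) * s
      we₀ : w e₀ ≡ - (s * t)
      we₀ = subz (trans (ring381 c₀ b₀ s t) (z+ (zsub wc₀) (cong (_* s) (zsub wb₀))))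

  -- Bézout coefficients and conjugates of cores

  bezout : ∀ s t → Coprime s t → Σ[ α ∈ ℤ ] Σ[ β ∈ ℤ ] α * + s + β * + t ≡ 1ℤ
  bezout s t c = go (coprime-Bézout c)
    where
      cast : ∀ a x b y → 1 ℕ.+ y ℕ.* b ≡ x ℕ.* a → 1ℤ + + y * + b ≡ + x * + a
      cast a x b y e = trans (cong (λ u → 1ℤ + u) (sym (ℤP.pos-* y b))) (trans (cong +_ e) (ℤP.pos-* x a))
      go : Bézout.Identity 1 s t → Σ[ α ∈ ℤ ] Σ[ β ∈ ℤ ] α * + s + β * + t ≡ 1ℤ
      go (Bézout.+- x y e) = + x , - + y , subz (trans (ring382 (+ x) (+ s) (+ y) (+ t)) (cong -_ (zsub (cast s x t y e))))
      go (Bézout.-+ x y e) = - + x , + y , subz (trans (ring383 (+ x) (+ s) (+ y) (+ t)) (cong -_ (zsub (cast t y s x e))))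

  setup : ∀ s t → 1ℤ < s → 1ℤ < t → ∀ α β → α * s + β * t ≡ 1ℤ → Setup
  setup s t s>1 t>1 α β bez = record
    { s = s ; t = t ; s>1 = s>1 ; t>1 = t>1
    ; gauss-t = λ { a (divides q e) → divides (α * q + a * β) (subz (trans (ring384 a s t α β q) (z+ (z* (- a) (zsub bez)) (z* α (zsub e))))) }
    ; gauss-s = λ { a (divides q e) → divides (β * q + a * α) (subz (trans (ring385 a s t α β q) (z+ (z* (- a) (zsub bez)) (z* β (zsub e))))) } }

  conjugate : Maya → Maya
  conjugate g = mkMaya (λ x → not (occ g (bar x))) (lim g)
    (λ n h → cong not (trans (cong (occ g) (bar-pos n)) (lo g n h)))
    (λ n h → cong not (hi g n h))

  conjugate-Core : ∀ {d g} → Core d g → Core d (conjugate g)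
  conjugate-Core {d} {g} c x h = go (occ g (bar x)) refl
    where
      go : ∀ v → occ g (bar x) ≡ v → not (occ g (bar x)) ≡ true
      go false p = cong not p
      go true p = contra h (cong not (c (bar (x + d)) (trans (cong (occ g) (sym (ring386 x d))) p)))

  conjugate-Eqv : ∀ {d f g} → SC f → Eqv d f g → Eqv d f (conjugate g)
  conjugate-Eqv {d} {f} {g} sc (U , e) = shiftFS (- d) (reflectFS U) , λ z →
    trans (cong (λ b → ind b - ind (not (occ g (bar z)))) (trans (cong (occ f) (sym (bar-bar z))) (sc (bar z))))
    (trans (ind-not (occ f (bar z)) (occ g (bar z))) (trans (cong -_ (e (bar z))) (trans (ring175 (at U (bar z - d)) (at U (bar z)))
      (cong₂ (λ u v → at U u - at U v) (ring387 z d) (ring388 z d)))))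

  -- The conjugate of the core of a self-conjugate `f` is again a core in the class of `f`, so the
  -- core is its own conjugate.
  core-SC : ∀ {d f g} → 0ℤ < d → SC f → Core d g → Eqv d f g → SC g
  core-SC {d} {f} {g} pos sc c eq x = trans (≐g (bar x)) (cong not (cong (occ g) (bar-bar x)))
    where
      ≐g : g ≐ conjugate g
      ≐g = core-unique {d} {g} {conjugate g} pos c (conjugate-Core {d} {g} c)
        (Eqv-trans {d} {g} {f} {conjugate g} (Eqv-sym {d} {f} {g} eq) (conjugate-Eqv {d} {f} {g} sc eq))

  -- Harpoons as flips

  bool-iff : ∀ {a b : Bool} → (a ≡ true → b ≡ true) → (b ≡ true → a ≡ true) → a ≡ b
  bool-iff {true} {b} p q = sym (p refl)
  bool-iff {false} {true} p q = q refl
  bool-iff {false} {false} p q = refl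

  -- The description of the beta-set in a harpoon has the form of `StarWith`, so this serves for
  -- harpoons and for the star alike.
  star⇒flip : ∀ {α β b} → SC (may β) → b ∈B β → StarWith β b α → may α ≐ flip b (may β)
  star⇒flip {α} {β} {b} sc hb st x = by-cases (pair? b x) [ atb , atb̄ ]′ off
    where
      βb = ∈B→ {β} hb
      atb : x ≡ b → occ (may α) x ≡ occ (flip b (may β)) x
      atb e = trans (¬∈B→ {α} {x} (λ m → [ (λ { (_ , n) → n e }) , (λ q → x≢bar b (trans (sym e) q)) ]′ (proj₁ (st x) m)))
        (sym (trans (flip-on b (occ (may β)) x (inj₁ e)) (cong not (trans (cong (occ (may β)) e) βb))))
      atb̄ : x ≡ bar b → occ (may α) x ≡ occ (flip b (may β)) x
      atb̄ e = trans (∈B→ {α} (proj₂ (st x) (inj₂ e)))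
        (sym (trans (flip-on b (occ (may β)) x (inj₂ e)) (cong not (trans (cong (occ (may β)) e) (SC-true {may β} sc {b} βb)))))
      off : ¬ (x ≡ b ⊎ x ≡ bar b) → occ (may α) x ≡ occ (flip b (may β)) x
      off n = trans (bool-iff (λ h → [ (λ { (m , _) → ∈B→ {β} m }) , (λ q → ⊥-elim (n (inj₂ q))) ]′ (proj₁ (st x) (→∈B {α} h)))
          (λ h → ∈B→ {α} (proj₂ (st x) (inj₁ (→∈B {β} h , n ∘ inj₁)))))
        (sym (flip-off b (occ (may β)) x (n ∘ inj₁) (n ∘ inj₂)))

  flip⇒star : ∀ {α β b} → SC (may β) → b ∈B β → may α ≐ flip b (may β) → StarWith β b α
  flip⇒star {α} {β} {b} sc hb e x = to , from
    where
      βb = ∈B→ {β} hb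
      to : x ∈B α → (x ∈B β × x ≢ b) ⊎ x ≡ bar b
      to m = by-cases (pair? b x)
        [ (λ q → contra (∈B→ {α} m) (trans (e x) (trans (flip-on b (occ (may β)) x (inj₁ q)) (cong not (trans (cong (occ (may β)) q) βb))))) , inj₂ ]′
        (λ n → inj₁ (→∈B {β} (trans (sym (flip-off b (occ (may β)) x (n ∘ inj₁) (n ∘ inj₂))) (trans (sym (e x)) (∈B→ {α} m))) , n ∘ inj₁))
      from : (x ∈B β × x ≢ b) ⊎ x ≡ bar b → x ∈B α
      from (inj₂ q) = →∈B {α} (trans (e x) (trans (flip-on b (occ (may β)) x (inj₂ q)) (cong not (trans (cong (occ (may β)) q) (SC-true {may β} sc {b} βb)))))
      from (inj₁ (m , n)) = →∈B {α} (trans (e x) (by-cases (x ℤP.≟ bar b)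
        (λ q → contra (∈B→ {β} m) (trans (cong (occ (may β)) q) (SC-true {may β} sc {b} βb)))
        (λ n′ → trans (flip-off b (occ (may β)) x n n′) (∈B→ {β} m))))

  -- Since b̄ - b = - w b, a congruence modulo 2 p fixes w b up to even multiples of p.
  cong⇒w : ∀ {b q} p → (bar b - b) ≡ q [mod + (2 ℕ.* p) ] → Σ[ l ∈ ℤ ] w b ≡ - q + (l + l) * + p
  cong⇒w {b} {q} p h = go (∣ᵤ⇒∣ {+ (2 ℕ.* p)} {bar b - b - q} h)
    where
      go : + (2 ℕ.* p) ∣ bar b - b - q → Σ[ l ∈ ℤ ] w b ≡ - q + (l + l) * + p
      go (divides l e) = - l , subz (trans (ring389 b q l (+ p)) (cong -_ (zsub (trans e (cong (l *_) (ℤP.pos-* 2 p))))))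

  w⇒cong : ∀ {b q l} p → w b ≡ - q + (l + l) * + p → (bar b - b) ≡ q [mod + (2 ℕ.* p) ]
  w⇒cong {b} {q} {l} p e = ∣⇒∣ᵤ {+ (2 ℕ.* p)} {bar b - b - q} (divides (- l) (trans (subz (trans (ring390 b q l (+ p)) (cong -_ (zsub e)))) (cong (- l *_) (sym (ℤP.pos-* 2 p)))))

  odd⇒half : ∀ t → Odd t → Σ[ e ∈ ℤ ] w e ≡ - + t
  odd⇒half t o = [ (λ h → h) , (λ { (k , q) → ⊥-elim (o (∣⇒∣ᵤ {+ 2} {+ t} (divides k (trans q (ring391 k))))) }) ]′ (parity? (+ t))

  half⇒odd : ∀ t e → w e ≡ - + t → Odd t
  half⇒odd t e we (ℕD.divides m q) = even≢odd (- + m) e (sym (trans we (trans (cong (λ u → - + u) q) (trans (cong -_ (ℤP.pos-* m 2)) (ring392 (+ m))))))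

  -- Solutions as partitions

  module Bridge (S : Setup) (s t : ℕ) (s>0 : 0 ℕ.< s) (t>0 : 0 ℕ.< t) (s≡ : Setup.s S ≡ + s) (t≡ : Setup.t S ≡ + t)
      (σ τ : Partition) (cσ : IsCore s σ) (cτ : IsCore t τ) (n : ℕ) where

    P : Partition → Set
    P μ = size μ ≡ n × HasCore s μ σ × HasCore t μ τ × SelfConjugate μ

    P⇒Sol : ∀ μ → P μ → Sol S (may σ) (may τ) (+ n) (may μ)
    P⇒Sol μ (e , hs , ht , sc) = record
      { sc = SelfConjugate⇒SC μ sc
      ; eqs = subst (λ d → Eqv d (may μ) (may σ)) (sym s≡) (HasCore⇒Eqv s s>0 hs)
      ; eqt = subst (λ d → Eqv d (may μ) (may τ)) (sym t≡) (HasCore⇒Eqv t t>0 ht)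
      ; en = trans (E-size μ) (cong +_ e) }

    Sol⇒P : ∀ μ → Sol S (may σ) (may τ) (+ n) (may μ) → P μ
    Sol⇒P μ p = ℤP.+-injective (trans (sym (E-size μ)) (Sol.en p))
      , Eqv⇒HasCore s s>0 μ σ cσ (subst (λ d → Eqv d (may μ) (may σ)) s≡ (Sol.eqs p))
      , Eqv⇒HasCore t t>0 μ τ cτ (subst (λ d → Eqv d (may μ) (may τ)) t≡ (Sol.eqt p))
      , SC⇒SelfConjugate μ (Sol.sc p)

    Sol-≐ : ∀ {f g} → f ≐ g → Sol S (may σ) (may τ) (+ n) f → Sol S (may σ) (may τ) (+ n) g
    Sol-≐ {f} {g} e p = Sol-Eqv {f = f} {g = g} p (SC-cong {f} {g} e (Sol.sc p)) (Eqv-refl {Setup.s S} {g} {f} (≐-sym {f} {g} e)) (Eqv-refl {Setup.t S} {g} {f} (≐-sym {f} {g} e))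
      (trans (sym (E-cong {f} {g} e)) (Sol.en p))

    realize : ∀ f → Sol S (may σ) (may τ) (+ n) f → Σ[ μ ∈ Partition ] (may μ ≐ f × P μ)
    realize f p = go (fromMaya f (SC-charge {f} (Sol.sc p)))
      where go : Σ[ μ ∈ Partition ] may μ ≐ f → Σ[ μ ∈ Partition ] (may μ ≐ f × P μ)
            go (μ , e) = μ , e , Sol⇒P μ (Sol-≐ {f} {may μ} (≐-sym {may μ} {f} e) p)

    to : ExactlyOneSelfConjugate s t σ τ n → Unique S (may σ) (may τ) (+ n)
    to (κ , p , u) = may κ , P⇒Sol κ p , λ g q → go g (realize g q)
      where go : ∀ g → Σ[ μ ∈ Partition ] (may μ ≐ g × P μ) → g ≐ may κ
            go g (μ , e , pμ) = ≐-trans {g} {may μ} {may κ} (≐-sym {may μ} {g} e) (λ x → cong (λ ν → occ (may ν) x) (u μ pμ))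

    fro : Unique S (may σ) (may τ) (+ n) → ExactlyOneSelfConjugate s t σ τ n
    fro (f , p , u) = go (realize f p)
      where go : Σ[ μ ∈ Partition ] (may μ ≐ f × P μ) → ExactlyOneSelfConjugate s t σ τ n
            go (κ , e , pκ) = κ , pκ , λ μ pμ → may-inj μ κ (≐-trans {may μ} {f} {may κ} (u (may μ) (P⇒Sol μ pμ)) (≐-sym {may κ} {f} e))

  -- Assembling the equivalence

  module Assembly (s t : ℕ) (s>1 : 1 ℕ.< s) (t>1 : 1 ℕ.< t) (coprime : Coprime s t) (σ τ : Partition) (iσ : IsCore s σ) (iτ : IsCore t τ) (n : ℕ)
      (cσ : Partition) (wσ : ℕ) (cwσ : CoreWeight t σ cσ wσ) (cτ : Partition) (wτ : ℕ) (cwτ : CoreWeight s τ cτ wτ) where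

    s>0 : 0 ℕ.< s
    s>0 = ℕP.<-trans (s≤s z≤n) s>1
    t>0 : 0 ℕ.< t
    t>0 = ℕP.<-trans (s≤s z≤n) t>1

    bz = bezout s t coprime
    α β : ℤ
    α = proj₁ bz
    β = proj₁ (proj₂ bz)
    bez : α * + s + β * + t ≡ 1ℤ
    bez = proj₂ (proj₂ bz)

    S : Setup
    S = setup (+ s) (+ t) (+<+ s>1) (+<+ t>1) α β bez

    open Bridge S s t s>0 t>0 refl refl σ τ iσ iτ n

    Conditions : Set
    Conditions =
      (cσ ≡ cτ × n ≡ size σ ℕ.+ size τ ℕ.∸ size cσ)
      ⊎ (Odd t × Harpoon s t cσ cτ × n ≡ size τ ℕ.+ t ℕ.* (wσ ℕ.+ 1))
      ⊎ (Odd s × Harpoon t s cτ cσ × n ≡ size σ ℕ.+ s ℕ.* (wτ ℕ.+ 1))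
      ⊎ (Odd s × Odd t ×
         Σ[ b ∈ ℤ ] Σ[ c ∈ ℤ ] Σ[ γ ∈ Partition ]
           (HarpoonsWith s t cσ cτ b c × StarWith cτ c γ ×
            n ≡ size γ ℕ.+ s ℕ.* (wτ ℕ.+ 1) ℕ.+ t ℕ.* (wσ ℕ.+ 1)))
      ⊎ (Odd s × Odd t × cσ ≡ cτ × IsKappa s t cσ ×
         n ≡ size σ ℕ.+ size τ ℕ.∸ size cσ ℕ.+ s ℕ.* t)

    size-σ : size σ ≡ size cσ ℕ.+ t ℕ.* wσ
    size-σ = Reduces-size t (proj₁ cwσ)
    size-τ : size τ ≡ size cτ ℕ.+ s ℕ.* wτ
    size-τ = Reduces-size s (proj₁ cwτ)

    fσ fτ cs ct : Maya
    fσ = may σ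
    fτ = may τ
    cs = may cσ
    ct = may cτ

    σ~ : Eqv (+ t) fσ cs
    σ~ = Reduces⇒Eqv t t>0 (proj₁ cwσ)
    τ~ : Eqv (+ s) fτ ct
    τ~ = Reduces⇒Eqv s s>0 (proj₁ cwτ)
    cs-t : Core (+ t) cs
    cs-t = IsCore⇒Core t t>0 cσ (proj₂ cwσ)
    ct-s : Core (+ s) ct
    ct-s = IsCore⇒Core s s>0 cτ (proj₂ cwτ)

    M : ℕ
    M = s ℕ.* wτ ℕ.+ t ℕ.* wσ

    E-drop : ∀ d ν κ k → size ν ≡ size κ ℕ.+ d ℕ.* k → ∀ f → f ≐ may κ → E (may ν) - E f ≡ + (d ℕ.* k)
    E-drop d ν κ k e f q = trans (cong₂ _-_ (trans (E-size ν) (trans (cong +_ e) (ℤP.pos-+ (size κ) (d ℕ.* k)))) (trans (E-cong {f} {may κ} q) (E-size κ))) (ring193 (+ size κ) (+ (d ℕ.* k)))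

    module Cores (scσ : SC fσ) (scτ : SC fτ) where
      Rτ : Reduced S fτ
      Rτ = reduce-all S fτ scτ (IsCore⇒Core t t>0 τ iτ)
      Rσ : Reduced (swapS S) fσ
      Rσ = reduce-all (swapS S) fσ scσ (IsCore⇒Core s s>0 σ iσ)
      module Rτ = Reduced Rτ
      module Rσ = Reduced Rσ

      -- The reduction stays in the s-class of τ and ends at an s-core, so it ends at cor_s(τ),
      -- which is thereby seen to be a self-conjugate t-core.
      κτ : Rτ.κ ≐ ct
      κτ = core-unique {+ s} {Rτ.κ} {ct} (pos-ℕ s>0) Rτ.core-s ct-s (Eqv-trans {+ s} {Rτ.κ} {fτ} {ct} (Eqv-sym {+ s} {fτ} {Rτ.κ} Rτ.eqv) τ~)
      κσ : Rσ.κ ≐ cs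
      κσ = core-unique {+ t} {Rσ.κ} {cs} (pos-ℕ t>0) Rσ.core-s cs-t (Eqv-trans {+ t} {Rσ.κ} {fσ} {cs} (Eqv-sym {+ t} {fσ} {Rσ.κ} Rσ.eqv) σ~)

      scs : SC cs
      scs = SC-cong {Rσ.κ} {cs} κσ Rσ.scκ
      sct : SC ct
      sct = SC-cong {Rτ.κ} {ct} κτ Rτ.scκ
      cs-s : Core (+ s) cs
      cs-s = Core-cong {+ s} {Rσ.κ} {cs} κσ Rσ.core-t
      ct-t : Core (+ t) ct
      ct-t = Core-cong {+ t} {Rτ.κ} {ct} κτ Rτ.core-t

      -- The energy that remains for the pair of (s,t)-cores: the two reductions lower it by s times
      -- the s-weight of τ and t times the t-weight of σ.
      m : ℤ
      m = + n - + (s ℕ.* wτ) - + (t ℕ.* wσ)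

      reduceU : Unique S fσ fτ (+ n) → Unique S cs ct m
      reduceU u = Unique-cong₂ {S} {Rσ.κ} {cs} {ct} {ct} κσ (λ _ → refl) (cong (λ e → n₁ - e) (E-drop t σ cσ wσ size-σ Rσ.κ κσ))
          (Unique-swap {swapS S} {ct} {Rσ.κ} (Rσ.to (Unique-swap {S} {fσ} {ct}
            (Unique-cong {S} {fσ} {Rτ.κ} {ct} κτ (cong (λ e → + n - e) (E-drop s τ cτ wτ size-τ Rτ.κ κτ)) (Rτ.to u)))))
        where n₁ = + n - + (s ℕ.* wτ)

      liftU : Unique S cs ct m → Unique S fσ fτ (+ n)
      liftU u = Rτ.fro (Unique-cong {S} {fσ} {ct} {Rτ.κ} (≐-sym {Rτ.κ} {ct} κτ) (cong (λ e → + n - e) (sym (E-drop s τ cτ wτ size-τ Rτ.κ κτ)))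
          (Unique-swap {swapS S} {ct} {fσ} (Rσ.fro (Unique-swap {S} {Rσ.κ} {ct}
            (Unique-cong₂ {S} {cs} {Rσ.κ} {ct} {ct} (≐-sym {Rσ.κ} {cs} κσ) (λ _ → refl) (cong (λ e → n₁ - e) (sym (E-drop t σ cσ wσ size-σ Rσ.κ κσ))) u)))))
        where n₁ = + n - + (s ℕ.* wτ)

      to-size : ∀ X → m ≡ + X → n ≡ X ℕ.+ M
      to-size X e = ℤP.+-injective (trans (ring393 (+ n) (+ (s ℕ.* wτ)) (+ (t ℕ.* wσ))) (cong (λ u → u + + M) e))
      from-size : ∀ X → n ≡ X ℕ.+ M → m ≡ + X
      from-size X e = trans (cong (λ u → + u - + (s ℕ.* wτ) - + (t ℕ.* wσ)) e) (ring394 (+ X) (+ (s ℕ.* wτ)) (+ (t ℕ.* wσ)))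

      size₁ : cσ ≡ cτ → size σ ℕ.+ size τ ℕ.∸ size cσ ≡ size cσ ℕ.+ M
      size₁ e = trans (cong₂ (λ u v → u ℕ.+ v ℕ.∸ size cσ) size-σ (trans size-τ (cong (λ κ → size κ ℕ.+ s ℕ.* wτ) (sym e))))
          (trans (cong (ℕ._∸ size cσ) (lem (size cσ) (t ℕ.* wσ) (s ℕ.* wτ))) (ℕP.m+n∸m≡n (size cσ) _))
        where lem : ∀ c a b → c ℕ.+ a ℕ.+ (c ℕ.+ b) ≡ c ℕ.+ (c ℕ.+ (b ℕ.+ a))
              lem = solveℕ-∀
      size₂ : size τ ℕ.+ t ℕ.* (wσ ℕ.+ 1) ≡ size cτ ℕ.+ t ℕ.+ M
      size₂ = trans (cong (ℕ._+ t ℕ.* (wσ ℕ.+ 1)) size-τ) (lem (size cτ) s t wσ wτ)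
        where lem : ∀ c s t a b → c ℕ.+ s ℕ.* b ℕ.+ t ℕ.* (a ℕ.+ 1) ≡ c ℕ.+ t ℕ.+ (s ℕ.* b ℕ.+ t ℕ.* a)
              lem = solveℕ-∀
      size₃ : size σ ℕ.+ s ℕ.* (wτ ℕ.+ 1) ≡ size cσ ℕ.+ s ℕ.+ M
      size₃ = trans (cong (ℕ._+ s ℕ.* (wτ ℕ.+ 1)) size-σ) (lem (size cσ) s t wσ wτ)
        where lem : ∀ c s t a b → c ℕ.+ t ℕ.* a ℕ.+ s ℕ.* (b ℕ.+ 1) ≡ c ℕ.+ s ℕ.+ (s ℕ.* b ℕ.+ t ℕ.* a)
              lem = solveℕ-∀
      size₄ : ∀ g → g ℕ.+ s ℕ.* (wτ ℕ.+ 1) ℕ.+ t ℕ.* (wσ ℕ.+ 1) ≡ g ℕ.+ s ℕ.+ t ℕ.+ M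
      size₄ g = lem g s t wσ wτ
        where lem : ∀ g s t a b → g ℕ.+ s ℕ.* (b ℕ.+ 1) ℕ.+ t ℕ.* (a ℕ.+ 1) ≡ g ℕ.+ s ℕ.+ t ℕ.+ (s ℕ.* b ℕ.+ t ℕ.* a)
              lem = solveℕ-∀
      size₅ : cσ ≡ cτ → size σ ℕ.+ size τ ℕ.∸ size cσ ℕ.+ s ℕ.* t ≡ size cσ ℕ.+ s ℕ.* t ℕ.+ M
      size₅ e = trans (cong (ℕ._+ s ℕ.* t) (size₁ e)) (lem (size cσ) M (s ℕ.* t))
        where lem : ∀ c m p → c ℕ.+ m ℕ.+ p ≡ c ℕ.+ p ℕ.+ m
              lem = solveℕ-∀

      t-1 : ℕ
      t-1 = proj₁ (pos-suc (pos-ℕ t>0))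
      t≡ : + t ≡ + suc t-1
      t≡ = proj₂ (pos-suc (pos-ℕ t>0))

      contains⇒kappa : ∀ xm → w xm ≡ + s * + t - + s - + t → occ cs xm ≡ true → IsKappa s t cσ
      contains⇒kappa xm wxm h = Core⇒IsCore s s>0 cσ cs-s , proj₂ cwσ , λ μ μs μt →
        ℤP.drop‿+≤+ (≤nn (nn-cast (cong₂ _-_ (E-size cσ) (E-size μ))
          (Kappa.Compare.maximal S t-1 t≡ α β bez xm wxm cs (may μ) cs-s cs-t scs h (IsCore⇒Core s s>0 μ μs) (IsCore⇒Core t t>0 μ μt) (trans (charge-may μ) (sym (charge-may cσ))))))

      -- The explicit core `K₀` is itself an (s,t)-core, so the given largest one has at least its
      -- energy, and `rigid` transfers the bead.
      kappa⇒contains : ∀ xm → w xm ≡ + s * + t - + s - + t → IsKappa s t cσ → occ cs xm ≡ true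
      kappa⇒contains xm wxm (_ , _ , max) = go (fromMaya (Kappa.K₀ S t-1 t≡ α β bez xm wxm) (SC-charge {Kappa.K₀ S t-1 t≡ α β bez xm wxm} (Kappa.sc₀ S t-1 t≡ α β bez xm wxm)))
        where
          k₀ = Kappa.K₀ S t-1 t≡ α β bez xm wxm
          go : Σ[ κ ∈ Partition ] may κ ≐ k₀ → occ cs xm ≡ true
          go (κ , e) = Kappa.Compare.rigid S t-1 t≡ α β bez xm wxm k₀ cs (Kappa.K₀s S t-1 t≡ α β bez xm wxm) (Kappa.K₀t S t-1 t≡ α β bez xm wxm) (Kappa.sc₀ S t-1 t≡ α β bez xm wxm) (Kappa.K₀xm S t-1 t≡ α β bez xm wxm) cs-s cs-t
              (trans (charge-may cσ) (sym (SC-charge {k₀} (Kappa.sc₀ S t-1 t≡ α β bez xm wxm))))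
              (nn-cast (cong₂ _-_ (sym (E-size cσ)) (trans (sym (E-size κ)) (E-cong {may κ} {k₀} e)))
                (nn≤ (+≤+ (max κ (Core⇒IsCore s s>0 κ (Core-cong {+ s} {k₀} {may κ} (≐-sym {may κ} {k₀} e) (Kappa.K₀s S t-1 t≡ α β bez xm wxm)))
                                 (Core⇒IsCore t t>0 κ (Core-cong {+ t} {k₀} {may κ} (≐-sym {may κ} {k₀} e) (Kappa.K₀t S t-1 t≡ α β bez xm wxm)))))))

      not∈ : ∀ {κ b} → occ (may κ) b ≡ false → ¬ (b ∈B κ)
      not∈ {κ} h p = contra (∈B→ {κ} p) h

      harpoon : ∀ {α β p q b l} → SC (may β) → w b ≡ - + q + (l + l) * + p → occ (may β) b ≡ true → may α ≐ flip b (may β) → Harpoon p q α β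
      harpoon {α} {β} {p} {q} {b} {l} sc wb h e = b , →∈B {β} h , not∈ {α} (trans (e b) (flip-false b (may β) h)) , w⇒cong {b} {+ q} {l} p wb , flip⇒star {α} {β} {b} sc (→∈B {β} h) e

      outcome⇒conditions : Outcome S cs ct m → Conditions
      outcome⇒conditions (o₁ e q) = inj₁ (c≡ , trans (to-size (size cσ) (trans q (E-size cσ))) (sym (size₁ c≡)))
        where c≡ = may-inj cσ cτ e
      outcome⇒conditions (o₂ b₀ wb₀ b l wb hb e q) = inj₂ (inj₁ (half⇒odd t b₀ wb₀ , harpoon {cσ} {cτ} {s} {t} {b} {l} sct wb hb e
        , trans (to-size (size cτ ℕ.+ t) (trans q (cong (_+ + t) (E-size cτ)))) (sym size₂)))
      outcome⇒conditions (o₃ c₀ wc₀ d k wd hd e q) = inj₂ (inj₂ (inj₁ (half⇒odd s c₀ wc₀ , harpoon {cτ} {cσ} {t} {s} {d} {k} scs wd hd e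
        , trans (to-size (size cσ ℕ.+ s) (trans q (cong (_+ + s) (E-size cσ)))) (sym size₃))))
      outcome⇒conditions (o₄ c₀ b₀ wc₀ wb₀ γ b d l k scγ γb γd b≢d wb wd e e′ q) = inj₂ (inj₂ (inj₂ (inj₁ (half⇒odd s c₀ wc₀ , half⇒odd t b₀ wb₀ , go (fromMaya γ (SC-charge {γ} scγ))))))
        where
          open StarCore S cs ct γ scs sct scγ cs-s cs-t ct-s ct-t b d l k γb γd b≢d wb wd e e′
          go : Σ[ κ ∈ Partition ] may κ ≐ γ → Σ[ b ∈ ℤ ] Σ[ c ∈ ℤ ] Σ[ γ ∈ Partition ]
            (HarpoonsWith s t cσ cτ b c × StarWith cτ c γ × n ≡ size γ ℕ.+ s ℕ.* (wτ ℕ.+ 1) ℕ.+ t ℕ.* (wσ ℕ.+ 1))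
          go (κ , eκ) = b , bar d , κ
            , (b≢bard , →∈B {cτ} τb , not∈ {cσ} σb , →∈B {cτ} τc , not∈ {cσ} σc , w⇒cong {b} {+ t} {l} s wb
              , w⇒cong {bar d} { - + s} { - k} t (trans wc (cong (λ u → u + (- k + - k) * + t) (sym (ℤP.neg-involutive (+ s))))) , two)
            , starτ
            , trans (to-size (size κ ℕ.+ s ℕ.+ t) (trans q (cong (λ u → u + + s + + t) (trans (sym (E-cong {may κ} {γ} eκ)) (E-size κ))))) (sym (size₄ (size κ)))
            where
              scκ : SC (may κ)
              scκ = SC-cong {γ} {may κ} (≐-sym {may κ} {γ} eκ) scγ
              starτ : StarWith cτ (bar d) κ
              starτ = flip⇒star {κ} {cτ} {bar d} sct (→∈B {cτ} τc) (λ x → trans (eκ x) (trans (sym (flip-flip d γ x)) (trans (flip-cong≐ {d} {flip d γ} {ct} (≐-sym {ct} {flip d γ} e′) x) (sym (flip-bar d ct x)))))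
              starσ : StarWith κ b cσ
              starσ = flip⇒star {cσ} {κ} {b} scκ (→∈B {κ} (trans (eκ b) γb)) (λ x → trans (e x) (flip-cong≐ {b} {γ} {may κ} (≐-sym {may κ} {γ} eκ) x))
              two : ∀ x → (x ∈B cσ → (x ∈B cτ × x ≢ b × x ≢ bar d) ⊎ (x ≡ bar b ⊎ x ≡ bar (bar d))) ×
                          ((x ∈B cτ × x ≢ b × x ≢ bar d) ⊎ (x ≡ bar b ⊎ x ≡ bar (bar d)) → x ∈B cσ)
              two x = (λ p → [ (λ { (pκ , x≢b) → [ (λ { (pτ , x≢d) → inj₁ (pτ , x≢b , x≢d) }) , (λ z → inj₂ (inj₂ z)) ]′ (proj₁ (starτ x) pκ) }) , (λ z → inj₂ (inj₁ z)) ]′ (proj₁ (starσ x) p))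
                , λ { (inj₁ (pτ , x≢b , x≢d)) → proj₂ (starσ x) (inj₁ (proj₂ (starτ x) (inj₁ (pτ , x≢d)) , x≢b))
                    ; (inj₂ (inj₁ z)) → proj₂ (starσ x) (inj₂ z)
                    ; (inj₂ (inj₂ z)) → proj₂ (starσ x) (inj₁ (proj₂ (starτ x) (inj₂ z) , λ z′ → b≢d (trans (sym z′) (trans z (bar-bar d))))) }
      outcome⇒conditions (o₅ c₀ b₀ xm wc₀ wb₀ wxm e hx q) = inj₂ (inj₂ (inj₂ (inj₂ (half⇒odd s c₀ wc₀ , half⇒odd t b₀ wb₀ , c≡ , contains⇒kappa xm wxm hx
          , trans (to-size (size cσ ℕ.+ s ℕ.* t) (trans q (cong₂ _+_ (E-size cσ) (sym (ℤP.pos-* s t))))) (sym (size₅ c≡))))))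
        where c≡ = may-inj cσ cτ e

      conditions⇒outcome : Conditions → Outcome S cs ct m
      conditions⇒outcome (inj₁ (c≡ , q)) = o₁ (λ x → cong (λ κ → occ (may κ) x) c≡) (trans (from-size (size cσ) (trans q (size₁ c≡))) (sym (E-size cσ)))
      conditions⇒outcome (inj₂ (inj₁ (odd , (b , hb , _ , mod , spec) , q))) = go (odd⇒half t odd) (cong⇒w {b} {+ t} s mod)
        where
          go : Σ[ e ∈ ℤ ] w e ≡ - + t → Σ[ l ∈ ℤ ] w b ≡ - + t + (l + l) * + s → Outcome S cs ct m
          go (b₀ , wb₀) (l , wb) = o₂ b₀ wb₀ b l wb (∈B→ {cτ} hb) (star⇒flip {cσ} {cτ} {b} sct hb spec) (trans (from-size (size cτ ℕ.+ t) (trans q size₂)) (cong (_+ + t) (sym (E-size cτ))))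
      conditions⇒outcome (inj₂ (inj₂ (inj₁ (odd , (d , hd , _ , mod , spec) , q)))) = go (odd⇒half s odd) (cong⇒w {d} {+ s} t mod)
        where
          go : Σ[ e ∈ ℤ ] w e ≡ - + s → Σ[ l ∈ ℤ ] w d ≡ - + s + (l + l) * + t → Outcome S cs ct m
          go (c₀ , wc₀) (k , wd) = o₃ c₀ wc₀ d k wd (∈B→ {cσ} hd) (star⇒flip {cτ} {cσ} {d} scs hd spec) (trans (from-size (size cσ ℕ.+ s) (trans q size₃)) (cong (_+ + s) (sym (E-size cσ))))
      conditions⇒outcome (inj₂ (inj₂ (inj₂ (inj₁ (odds , oddt , b , c , κ , (b≢c , hb , nb , hc , nc , modb , modc , spec) , star , q))))) =
          go (odd⇒half s odds) (odd⇒half t oddt) (cong⇒w {b} {+ t} s modb) (cong⇒w {c} { - + s} t modc)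
        where
          τb : occ ct b ≡ true
          τb = ∈B→ {cτ} hb
          τc : occ ct c ≡ true
          τc = ∈B→ {cτ} hc
          b≢barc : b ≢ bar c
          b≢barc e = contra τb (trans (cong (occ ct) e) (SC-true {ct} sct {c} τc))
          γ≐ : may κ ≐ flip c ct
          γ≐ = star⇒flip {κ} {cτ} {c} sct hc star
          scκ : SC (may κ)
          scκ = SC-cong {flip c ct} {may κ} (≐-sym {may κ} {flip c ct} γ≐) (flip-SC c {ct} sct)
          κb : occ (may κ) b ≡ true
          κb = trans (γ≐ b) (trans (flip-off c (occ ct) b b≢c b≢barc) τb)
          κd : occ (may κ) (bar c) ≡ true
          κd = trans (γ≐ (bar c)) (trans (flip-on c (occ ct) (bar c) (inj₂ refl)) (cong not (SC-true {ct} sct {c} τc)))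
          τ≐ : ct ≐ flip (bar c) (may κ)
          τ≐ x = sym (trans (flip-bar c (may κ) x) (trans (flip-cong≐ {c} {may κ} {flip c ct} γ≐ x) (flip-flip c ct x)))
          starσ : StarWith κ b cσ
          starσ x = (λ p → [ (λ { (pτ , x≢b , x≢c) → inj₁ (proj₂ (star x) (inj₁ (pτ , x≢c)) , x≢b) })
                           , [ inj₂ , (λ z → inj₁ (proj₂ (star x) (inj₂ z) , λ z′ → b≢barc (trans (sym z′) z))) ]′ ]′ (proj₁ (spec x) p))
            , λ { (inj₁ (pκ , x≢b)) → proj₂ (spec x) ([ (λ { (pτ , x≢c) → inj₁ (pτ , x≢b , x≢c) }) , (λ z → inj₂ (inj₂ z)) ]′ (proj₁ (star x) pκ))
                ; (inj₂ z) → proj₂ (spec x) (inj₂ (inj₁ z)) }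
          go : Σ[ e ∈ ℤ ] w e ≡ - + s → Σ[ e ∈ ℤ ] w e ≡ - + t → Σ[ l ∈ ℤ ] w b ≡ - + t + (l + l) * + s → Σ[ k ∈ ℤ ] w c ≡ - (- + s) + (k + k) * + t → Outcome S cs ct m
          -- The bead d of the star is c̄, and w c̄ = - w c turns the congruence for - s into the
          -- one for s.
          go (c₀ , wc₀) (b₀ , wb₀) (l , wb) (k , wc) = o₄ c₀ b₀ wc₀ wb₀ (may κ) b (bar c) l (- k) scκ κb κd b≢barc wb (trans (w-bar c) (trans (cong -_ wc) (ring395 (+ s) (+ t) k)))
              (star⇒flip {cσ} {κ} {b} scκ (→∈B {κ} κb) starσ) τ≐
              (trans (from-size (size κ ℕ.+ s ℕ.+ t) (trans q (size₄ (size κ)))) (cong (λ u → u + + s + + t) (sym (E-size κ))))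
      conditions⇒outcome (inj₂ (inj₂ (inj₂ (inj₂ (odds , oddt , c≡ , kap , q))))) = go (odd⇒half s odds) (odd⇒half t oddt)
        where
          go : Σ[ e ∈ ℤ ] w e ≡ - + s → Σ[ e ∈ ℤ ] w e ≡ - + t → Outcome S cs ct m
          go (c₀ , wc₀) (b₀ , wb₀) = o₅ c₀ b₀ xm wc₀ wb₀ wxm (λ x → cong (λ κ → occ (may κ) x) c≡) (kappa⇒contains xm wxm kap)
              (trans (from-size (size cσ ℕ.+ s ℕ.* t) (trans q (size₅ c≡))) (cong₂ _+_ (sym (E-size cσ)) (ℤP.pos-* s t)))
            where
              xm = c₀ + bar c₀ * + t
              wxm : w xm ≡ + s * + t - + s - + t
              wxm = subz (trans (ring396 c₀ (+ s) (+ t)) (z* (1ℤ - + t) (zsub wc₀)))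

      exactly⇒conditions : ExactlyOneSelfConjugate s t σ τ n → Conditions
      exactly⇒conditions x = outcome⇒conditions (unique⇒outcome S cs ct scs sct cs-s cs-t ct-s ct-t m (reduceU (to x)))

      conditions⇒exactly : Conditions → ExactlyOneSelfConjugate s t σ τ n
      conditions⇒exactly c = fro (liftU (outcome⇒unique S cs ct scs sct cs-s cs-t ct-s ct-t m (conditions⇒outcome c)))

    forward : ExactlyOneSelfConjugate s t σ τ n → SelfConjugate σ × SelfConjugate τ × Conditions
    forward x@(κ , (_ , hs , ht , sc) , _) = SC⇒SelfConjugate σ scσ , SC⇒SelfConjugate τ scτ , Cores.exactly⇒conditions scσ scτ x
      where
        scκ = SelfConjugate⇒SC κ sc
        scσ : SC fσ
        scσ = core-SC {+ s} {may κ} {fσ} (pos-ℕ s>0) scκ (IsCore⇒Core s s>0 σ iσ) (HasCore⇒Eqv s s>0 hs)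
        scτ : SC fτ
        scτ = core-SC {+ t} {may κ} {fτ} (pos-ℕ t>0) scκ (IsCore⇒Core t t>0 τ iτ) (HasCore⇒Eqv t t>0 ht)

    backward : SelfConjugate σ × SelfConjugate τ × Conditions → ExactlyOneSelfConjugate s t σ τ n
    backward (a , b , c) = Cores.conditions⇒exactly (SelfConjugate⇒SC σ a) (SelfConjugate⇒SC τ b) c

open import Defs
open import Data.Nat using (ℕ; _+_; _*_; _∸_; _<_)
open import Data.Nat.Coprimality using (Coprime)
open import Data.Integer using (ℤ)
open import Data.Product using (Σ-syntax; _×_)
open import Data.Sum using (_⊎_)
open import Function.Bundles using (_⇔_; mk⇔)
open import Relation.Binary.PropositionalEquality using (_≡_)

theorem5p15 :
  (s t : ℕ) → 1 < s → 1 < t → Coprime s t →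
  (σ τ : Partition) → IsCore s σ → IsCore t τ → (n : ℕ) →
  -- cσ = cor_t(σ), wσ = wei_t(σ), cτ = cor_s(τ), wτ = wei_s(τ)
  (cσ : Partition) (wσ : ℕ) → CoreWeight t σ cσ wσ →
  (cτ : Partition) (wτ : ℕ) → CoreWeight s τ cτ wτ →
  (ExactlyOneSelfConjugate s t σ τ n
    ⇔
   (SelfConjugate σ × SelfConjugate τ ×
    ((cσ ≡ cτ × n ≡ size σ + size τ ∸ size cσ)
     ⊎ (Odd t × Harpoon s t cσ cτ × n ≡ size τ + t * (wσ + 1))
     ⊎ (Odd s × Harpoon t s cτ cσ × n ≡ size σ + s * (wτ + 1))
     ⊎ (Odd s × Odd t ×
        Σ[ b ∈ ℤ ] Σ[ c ∈ ℤ ] Σ[ γ ∈ Partition ]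
          (HarpoonsWith s t cσ cτ b c × StarWith cτ c γ ×
           n ≡ size γ + s * (wτ + 1) + t * (wσ + 1)))
     ⊎ (Odd s × Odd t × cσ ≡ cτ × IsKappa s t cσ ×
        n ≡ size σ + size τ ∸ size cσ + s * t))))
theorem5p15 s t s>1 t>1 coprime σ τ iσ iτ n cσ wσ cwσ cτ wτ cwτ = mk⇔ A.forward A.backward
  where module A = Proof.Assembly s t s>1 t>1 coprime σ τ iσ iτ n cσ wσ cwσ cτ wτ cwτ
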